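{- There is an absolute constant $C>0$ such that the following holds. Let $\mathcal{F}_1,\dots,\mathcal{F}_t$ be set systems with $m_i=|\mathcal{F}_i|>1$ for all $i$, let $\mathcal{F}=\mathcal{F}_1\times\cdots\times\mathcal{F}_t$, and let $D=\prod_{i=1}^t\operatorname{herdisc}\mathcal{F}_i$. Then \[ \frac{D}{C^t\log|\mathcal{F}|\prod_{i=1}^t\sqrt{\log m_i}}\le\operatorname{herdisc}\mathcal{F}\le D\cdot C^t\sqrt{\log|\mathcal{F}|}\prod_{i=1}^t\log m_i . \]
   Context: For set systems $\mathcal{F}$ on $V$ and $\mathcal{G}$ on $W$, the product $\mathcal{F}\times\mathcal{G}=\{F\times G: F\in\mathcal{F},G\in\mathcal{G}\}$ is a set system on $V\times W$; iterated products are defined analogously. For a set system $\mathcal{F}$ on ground set $V$, $\operatorname{disc}\mathcal{F}=\min_{x\in\{ -1,1\}^V}\max_{F\in\mathcal{F}}\bigl|\sum_{v\in F}x_v\bigr|$, and $\operatorname{herdisc}\mathcal{F}=\max_{J\subseteq V}\operatorname{disc}(\mathcal{F}|_J)$, where $\mathcal{F}|_J=\{F\cap J:F\in\mathcal{F}\}$. -}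

module Defs where

open import Data.Bool.Base using (_∧_)
import Data.Bool.Properties as Bool
open import Data.Fin.Base using (Fin; zero; suc; quotient; remainder)
open import Data.Fin.Subset using (Subset; inside; outside; _∩_)
open import Data.Integer.Base as ℤ using (ℤ; +_; ∣_∣; _◃_)
open import Data.List.Base using (List; []; _∷_; length; map; deduplicate; cartesianProductWith)
open import Data.List.Extrema.Nat using (min; max)
open import Data.List.Relation.Unary.Unique.Propositional using (Unique)
open import Data.Nat.Base as ℕ using (ℕ; zero; suc)
open import Data.Product.Base using (_×_; ∃-syntax)
open import Data.Rational.Base as ℚ using (ℚ; 0ℚ; 1ℚ; ↥_; ↧ₙ_)
open import Data.Sign.Base as Sign using (Sign)
open import Data.Sum.Base using (_⊎_)
open import Data.Vec.Base using (Vec; []; _∷_; lookup; tabulate; replicate)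
import Data.Vec.Functional as Vector
open import Data.Vec.Properties using (≡-dec)
open import Relation.Binary.Definitions using (DecidableEquality)
open import Relation.Nullary.Negation.Core using (¬_)

import Data.List.Relation.Unary.Unique.DecPropositional.Properties as UniqueDec

------------------------------------------------------------------------
-- Set systems

-- The ground set is Fin n.  Uniqueness makes the length of the list the
-- number of distinct members.
record SetSystem (n : ℕ) : Set where
  constructor mkSystem
  field
    members : List (Subset n)
    unique  : Unique members

open SetSystem public

card : ∀ {n} → SetSystem n → ℕ
card 𝓕 = length (members 𝓕)

_≟ˢ_ : ∀ {n} → DecidableEquality (Subset n)
_≟ˢ_ = ≡-dec Bool._≟_

fromList : ∀ {n} → List (Subset n) → SetSystem n
fromList xs = mkSystem (deduplicate _≟ˢ_ xs) (UniqueDec.deduplicate-! _≟ˢ_ xs)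

-- Fin (m * n) stands for Fin m × Fin n through (quotient , remainder).
_×ˢ_ : ∀ {m n} → Subset m → Subset n → Subset (m ℕ.* n)
_×ˢ_ {m} {n} A B =
  tabulate λ k → lookup A (quotient n k) ∧ lookup B (remainder {m} n k)

-- Pairs (A , B) with A or B empty all give the empty set, so card (𝓕 ⊗ 𝓖)
-- can be smaller than card 𝓕 * card 𝓖.
_⊗_ : ∀ {m n} → SetSystem m → SetSystem n → SetSystem (m ℕ.* n)
𝓕 ⊗ 𝓖 = fromList (cartesianProductWith _×ˢ_ (members 𝓕) (members 𝓖))

∏-size : ∀ {k} → (Fin (suc k) → ℕ) → ℕ
∏-size {zero}  n = n zero
∏-size {suc k} n = n zero ℕ.* ∏-size (λ i → n (suc i))

⨂ : ∀ {k} {n : Fin (suc k) → ℕ} → (∀ i → SetSystem (n i)) → SetSystem (∏-size n)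
⨂ {zero}  𝓕 = 𝓕 zero
⨂ {suc k} 𝓕 = 𝓕 zero ⊗ ⨂ (λ i → 𝓕 (suc i))

------------------------------------------------------------------------
-- Discrepancy

vectors : ∀ {A : Set} → List A → ∀ n → List (Vec A n)
vectors xs zero    = [] ∷ []
vectors xs (suc n) = cartesianProductWith _∷_ xs (vectors xs n)

colourings : ∀ n → List (Vec Sign n)
colourings = vectors (Sign.+ ∷ Sign.- ∷ [])

subsets : ∀ n → List (Subset n)
subsets = vectors (outside ∷ inside ∷ [])

∑ : ∀ {n} → Subset n → Vec Sign n → ℤ
∑ []            []      = + 0
∑ (inside  ∷ F) (s ∷ x) = (s ◃ 1) ℤ.+ ∑ F x
∑ (outside ∷ F) (s ∷ x) = ∑ F x

imbalance : ∀ {n} → SetSystem n → Vec Sign n → ℕ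
imbalance 𝓕 x = max 0 (map (λ F → ∣ ∑ F x ∣) (members 𝓕))

-- The seed of min is the value at a colouring, so it does not affect the result.
disc : ∀ {n} → SetSystem n → ℕ
disc {n} 𝓕 = min (imbalance 𝓕 (replicate n Sign.+)) (map (imbalance 𝓕) (colourings n))

-- The trace is kept on the ground set Fin n: the colours outside J do not
-- enter any sum over a set F ∩ J, so its discrepancy is the one on J.
_∣ˢ_ : ∀ {n} → SetSystem n → Subset n → SetSystem n
𝓕 ∣ˢ J = fromList (map (_∩ J) (members 𝓕))

herdisc : ∀ {n} → SetSystem n → ℕ
herdisc {n} 𝓕 = max 0 (map (λ J → disc (𝓕 ∣ˢ J)) (subsets n))

∏ : ∀ {t} → (Fin t → ℕ) → ℕ
∏ = Vector.foldr ℕ._*_ 1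

------------------------------------------------------------------------
-- Real numbers as Dedekind cuts

-- Lower x q means q < x and Upper x q means x < q.
record Cut : Set₁ where
  field
    Lower : ℚ → Set
    Upper : ℚ → Set

open Cut public

infix 4 _<ᴿ_ _≤ᴿ_

_<ᴿ_ : Cut → Cut → Set
x <ᴿ y = ∃[ q ] Upper x q × Lower y q

_≤ᴿ_ : Cut → Cut → Set
x ≤ᴿ y = ¬ (y <ᴿ x)

fromℚ : ℚ → Cut
fromℚ r = record { Lower = λ q → q ℚ.< r ; Upper = λ q → r ℚ.< q }

fromℕ : ℕ → Cut
fromℕ n = fromℚ (+ n ℚ./ 1)

infixl 7 _*ᴿ_ _/ᴿ_
infixr 8 _^ᴿ_

-- Product of nonnegative reals.
_*ᴿ_ : Cut → Cut → Cut
x *ᴿ y = record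
  { Lower = λ q → q ℚ.< 0ℚ ⊎
      (∃[ a ] ∃[ b ] 0ℚ ℚ.≤ a × 0ℚ ℚ.≤ b × Lower x a × Lower y b × q ℚ.≤ a ℚ.* b)
  ; Upper = λ q → ∃[ a ] ∃[ b ] Upper x a × Upper y b × a ℚ.* b ℚ.≤ q
  }

-- Reciprocal of a positive real.
recip : Cut → Cut
recip x = record
  { Lower = λ q → ∃[ u ] Upper x u × q ℚ.* u ℚ.< 1ℚ
  ; Upper = λ q → ∃[ l ] 0ℚ ℚ.< l × Lower x l × 1ℚ ℚ.< q ℚ.* l
  }

_/ᴿ_ : Cut → Cut → Cut
x /ᴿ y = x *ᴿ recip y

_^ᴿ_ : Cut → ℕ → Cut
x ^ᴿ zero  = fromℕ 1
x ^ᴿ suc n = x *ᴿ (x ^ᴿ n)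

∏ᴿ : ∀ {t} → (Fin t → Cut) → Cut
∏ᴿ = Vector.foldr _*ᴿ_ (fromℕ 1)

-- Square root of a nonnegative real.
√ : Cut → Cut
√ x = record
  { Lower = λ q → q ℚ.< 0ℚ ⊎ Lower x (q ℚ.* q)
  ; Upper = λ q → 0ℚ ℚ.< q × Upper x (q ℚ.* q)
  }

-- The binary logarithm of n ≥ 1: for a ≥ 0 and b > 0, a / b < log n if and only
-- if 2 ^ a < n ^ b, and likewise with > in place of <.
log : ℕ → Cut
log n = record
  { Lower = λ q → q ℚ.< 0ℚ ⊎ 2 ℕ.^ ∣ ↥ q ∣ ℕ.< n ℕ.^ (↧ₙ q)
  ; Upper = λ q → 0ℚ ℚ.≤ q × n ℕ.^ (↧ₙ q) ℕ.< 2 ℕ.^ ∣ ↥ q ∣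
  }

{-# OPTIONS --safe #-}

-- The intermediary between herdisc 𝓕 and herdisc 𝓕ᵢ is the factorization norm
-- γ₂ of the incidence matrices: the least γ such that A = B C with the rows of
-- B and the columns of C of squared length at most γ.  It is multiplicative
-- under Kronecker products, because factorizations tensor, and so do the
-- feasible points of the dual program.
--
-- From γ₂ to herdisc: the Gram–Schmidt walk, derandomised by the potential
-- Σ_F E[(discrepancy of F)^(2q)] with q ≈ log m, produces a colouring with
-- disc² ≤ 32 q γ².
--
-- Duality, up to constants: row and column weights are increased greedily.
-- The resolvents (1 + 4^l S P)⁻¹ at the scales l ≤ log m measure the gain.
-- When no increase gains much, telescoping the resolvents over the scales
-- gives a factorization; otherwise the trace grows until it is a dual witness.
--
-- From herdisc to γ₂ ≤ O(log m) herdisc: a large trace at one scale yields many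
-- columns, each far from the span of its predecessors.  By Lovász, Spencer and
-- Vesztergombi every point of {0, …, 31}^r can be rounded to a vertex of [0, 32]^r
-- with error O(herdisc) by repeated halving, and counting grid points against
-- the volume spanned by these columns contradicts a small herdisc.

module Submission where

open import Defs
open import Data.Bool.Base using (Bool; true; false; _∧_)
open import Data.Empty using (⊥-elim)
open import Data.Fin.Base using (Fin; zero; suc; quotient; remainder; combine)
import Data.Fin.Properties as Fin
open import Data.Fin.Subset using (Subset; inside; outside; _∩_)
open import Data.Integer.Base as ℤ using (ℤ; -[1+_]; _◃_)
import Data.Integer.Properties as ℤₚ
import Data.Integer.Tactic.RingSolver as ℤ-Solver
open import Data.List.Base as List using (List; []; _∷_; _++_; map; length; allFin; upTo; cartesianProductWith)
open import Data.List.Extrema.Nat using (max; argmax-sel; argmin-sel; xs≤max; min≤xs)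
open import Data.List.Membership.Propositional using (_∈_; _∉_)
open import Data.List.Membership.Propositional.Properties using (∈-map⁺; ∈-map⁻; ∈-deduplicate⁺; ∈-deduplicate⁻; ∈-cartesianProductWith⁺; ∈-cartesianProductWith⁻; ∈-upTo⁻; ∈-lookup; ∈-allFin)
import Data.List.Properties as Listₚ
open import Data.List.Relation.Unary.All as All using (All; []; _∷_)
open import Data.List.Relation.Unary.AllPairs using ([]; _∷_)
open import Data.List.Relation.Unary.Any as Any using (here; there)
open import Data.List.Relation.Unary.Any.Properties using (lookup-index)
open import Data.List.Relation.Unary.Unique.Propositional using (Unique)
open import Data.List.Relation.Unary.Unique.Propositional.Properties using (allFin⁺)
open import Data.Maybe.Base using (Maybe; nothing; just)
open import Data.Nat.Base as ℕ using (ℕ; zero; suc)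
import Data.Nat.Properties as ℕₚ
import Data.Nat.Tactic.RingSolver as ℕ-Solver
open import Data.Product.Base using (_×_; _,_; proj₁; proj₂; ∃-syntax)
open import Data.Rational.Base as ℚ using (ℚ; mkℚ; 0ℚ; 1ℚ; ½; _+_; _-_; -_; _*_; 1/_; ∣_∣; _≤_; _<_; ↥_; ↧ₙ_; toℚᵘ; positive; nonNegative; ≢-nonZero; *≤*)
open import Data.Rational.Properties
open import Data.Rational.Unnormalised.Base as ℚᵘ using (mkℚᵘ; *≡*)
import Data.Rational.Unnormalised.Properties as ℚᵘₚ
open import Data.Sign.Base as Sign using (Sign)
open import Data.Sum.Base using (_⊎_; inj₁; inj₂)
open import Data.Vec.Base as Vec using (Vec; []; _∷_; lookup; tabulate)
open import Data.Vec.Properties using (lookup∘tabulate; lookup-zipWith)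
open import Level using (0ℓ)
open import Relation.Binary.Definitions using (tri<; tri≈; tri>)
open import Relation.Binary.PropositionalEquality using (_≡_; _≢_; refl; sym; trans; cong; cong₂; subst; subst₂)
open import Relation.Nullary using (¬_; Dec; yes; no; does)
open import Tactic.RingSolver using (solve-∀)
open import Tactic.RingSolver.Core.AlmostCommutativeRing using (AlmostCommutativeRing; fromCommutativeRing)

-- All vectors and weights are rational, so minima, roots and eigenvectors are not at hand. Hence γ₂
-- is never formed: a `Factorization` bounds it from above, a `Witness` from below, and the two only
-- have to meet up to a constant factor, which C^t absorbs. The dual of γ₂ maximises, over weights p
-- on the rows and q on the columns, the trace norm of the weighted matrix. This is tr X^½ for X =
-- P^½ S P^½ with P = diag p and S = Σ_j q_j a_j a_jᵀ, where a_j is a column. The rational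
-- substitute for the root is that Σ_l 2^l x / (1 + 4^l x) is of order x^½; this is why the scales
-- are powers of 4 and carry the weight 2^l. The two logarithms have different origins. From γ₂ to
-- herdisc, √(log m) is the price of a moment high enough that one of m sets cannot dominate the
-- sum. From herdisc to γ₂, log m is the number of scales, since a small herdisc bounds the trace at
-- each scale separately.

0≟ : ∀ x → Maybe (0ℚ ≡ x)
0≟ x with 0ℚ ≟ x
... | yes p = just p
... | no  _ = nothing

ℚ-ring : AlmostCommutativeRing 0ℓ 0ℓ
ℚ-ring = fromCommutativeRing +-*-commutativeRing 0≟

-- Order on ℚ

<⇒≱ : ∀ {p q : ℚ} → p < q → ¬ (q ≤ p)
<⇒≱ p<q q≤p = <-irrefl refl (<-≤-trans p<q q≤p)

≤∧≢⇒< : ∀ {p q : ℚ} → p ≤ q → p ≢ q → p < q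
≤∧≢⇒< {p} {q} p≤q p≢q with <-cmp p q
... | tri< lt _ _ = lt
... | tri≈ _ eq _ = ⊥-elim (p≢q eq)
... | tri> _ _ gt = ⊥-elim (<⇒≱ gt p≤q)

≤-by : ∀ {p q} r → 0ℚ ≤ r → q ≡ p + r → p ≤ q
≤-by {p} r 0≤r refl = subst (_≤ p + r) (+-identityʳ p) (+-monoʳ-≤ p 0≤r)

<-by : ∀ {p q} r → 0ℚ < r → q ≡ p + r → p < q
<-by {p} r 0<r refl = subst (_< p + r) (+-identityʳ p) (+-monoʳ-< p 0<r)

0≤- : ∀ {p q} → p ≤ q → 0ℚ ≤ q - p
0≤- {p} {q} p≤q = subst (_≤ q - p) (+-inverseʳ p) (+-monoˡ-≤ (- p) p≤q)

0<- : ∀ {p q} → p < q → 0ℚ < q - p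
0<- {p} {q} p<q = subst (_< q - p) (+-inverseʳ p) (+-monoˡ-< (- p) p<q)

0≤+ : ∀ {p q} → 0ℚ ≤ p → 0ℚ ≤ q → 0ℚ ≤ p + q
0≤+ = +-mono-≤

0≤* : ∀ {p q} → 0ℚ ≤ p → 0ℚ ≤ q → 0ℚ ≤ p * q
0≤* {p} {q} 0≤p 0≤q = subst (_≤ p * q) (*-zeroˡ q) (*-monoʳ-≤-nonNeg q {{nonNegative 0≤q}} 0≤p)

0<* : ∀ {p q} → 0ℚ < p → 0ℚ < q → 0ℚ < p * q
0<* {p} {q} 0<p 0<q = subst (_< p * q) (*-zeroˡ q) (*-monoˡ-<-pos q {{positive 0<q}} 0<p)

*-monoˡ : ∀ {p q} r → 0ℚ ≤ r → p ≤ q → r * p ≤ r * q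
*-monoˡ r 0≤r = *-monoˡ-≤-nonNeg r {{nonNegative 0≤r}}

*-monoʳ : ∀ {p q} r → 0ℚ ≤ r → p ≤ q → p * r ≤ q * r
*-monoʳ r 0≤r = *-monoʳ-≤-nonNeg r {{nonNegative 0≤r}}

*-mono : ∀ {p q r s} → 0ℚ ≤ p → 0ℚ ≤ r → p ≤ q → r ≤ s → p * r ≤ q * s
*-mono {p} {q} {r} {s} 0≤p 0≤r p≤q r≤s = ≤-trans (*-monoʳ r 0≤r p≤q) (*-monoˡ q (≤-trans 0≤p p≤q) r≤s)

*-cancelˡ : ∀ {p q} r → 0ℚ < r → r * p ≤ r * q → p ≤ q
*-cancelˡ r 0<r = *-cancelˡ-≤-pos r {{positive 0<r}}

0≤neg : ∀ {p} → p ≤ 0ℚ → 0ℚ ≤ - p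
0≤neg = neg-antimono-≤

0≤sq : ∀ p → 0ℚ ≤ p * p
0≤sq p with ≤-total 0ℚ p
... | inj₁ 0≤p = 0≤* 0≤p 0≤p
... | inj₂ p≤0 = subst (0ℚ ≤_) (lemma p) (0≤* (0≤neg p≤0) (0≤neg p≤0))
  where
  lemma : ∀ p → (- p) * (- p) ≡ p * p
  lemma = solve-∀ ℚ-ring

sq≡0⇒≡0 : ∀ p → p * p ≤ 0ℚ → p ≡ 0ℚ
sq≡0⇒≡0 p p²≤0 with <-cmp 0ℚ p
... | tri< 0<p _ _ = ⊥-elim (<⇒≱ (0<* 0<p 0<p) p²≤0)
... | tri≈ _ eq _ = sym eq
... | tri> _ _ p<0 = ⊥-elim (<⇒≱ (subst (0ℚ <_) (lemma p) (0<* (neg-antimono-< p<0) (neg-antimono-< p<0))) p²≤0)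
  where
  lemma : ∀ p → (- p) * (- p) ≡ p * p
  lemma = solve-∀ ℚ-ring

0<1 : 0ℚ < 1ℚ
0<1 = positive⁻¹ 1ℚ

0≤1 : 0ℚ ≤ 1ℚ
0≤1 = <⇒≤ 0<1

≤-≡-trans : ∀ {p q r : ℚ} → p ≤ q → q ≡ r → p ≤ r
≤-≡-trans p≤q refl = p≤q

≡-≤-trans : ∀ {p q r : ℚ} → p ≡ q → q ≤ r → p ≤ r
≡-≤-trans refl q≤r = q≤r

*-mono-< : ∀ {p q r s} → 0ℚ ≤ p → 0ℚ ≤ r → p < q → r < s → p * r < q * s
*-mono-< {p} {q} {r} {s} 0≤p 0≤r p<q r<s =
  ≤-<-trans (*-monoʳ r 0≤r (<⇒≤ p<q)) (*-monoʳ-<-pos q {{positive (≤-<-trans 0≤p p<q)}} r<s)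

sq-cancel-≤ : ∀ {p q} → 0ℚ ≤ q → p * p ≤ q * q → p ≤ q
sq-cancel-≤ {p} {q} 0≤q p²≤q² with p ≤? q
... | yes p≤q = p≤q
... | no  p≰q = ⊥-elim (<⇒≱ (*-mono-< 0≤q 0≤q (≰⇒> p≰q) (≰⇒> p≰q)) p²≤q²)

-- Total inverse, with inv 0 = 0.
inv : ℚ → ℚ
inv p with p ≟ 0ℚ
... | yes _ = 0ℚ
... | no p≢0 = (1/ p) {{≢-nonZero p≢0}}

inv-r : ∀ {p} → 0ℚ < p → p * inv p ≡ 1ℚ
inv-r {p} 0<p with p ≟ 0ℚ
... | yes refl = ⊥-elim (<-irrefl refl 0<p)
... | no p≢0 = *-inverseʳ p {{≢-nonZero p≢0}}

inv-r≢ : ∀ {p} → p ≢ 0ℚ → p * inv p ≡ 1ℚ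
inv-r≢ {p} p≢ with p ≟ 0ℚ
... | yes eq = ⊥-elim (p≢ eq)
... | no p≢0 = *-inverseʳ p {{≢-nonZero p≢0}}

inv-pos : ∀ {p} → 0ℚ < p → 0ℚ < inv p
inv-pos {p} 0<p with p ≟ 0ℚ
... | yes refl = ⊥-elim (<-irrefl refl 0<p)
... | no p≢0 = positive⁻¹ _ {{1/pos⇒pos p {{positive 0<p}}}}

inv-nonNeg : ∀ {p} → 0ℚ ≤ p → 0ℚ ≤ inv p
inv-nonNeg {p} 0≤p with p ≟ 0ℚ
... | yes _ = ≤-refl
... | no p≢0 = <⇒≤ (positive⁻¹ _ {{1/pos⇒pos p {{positive (≤∧≢⇒< 0≤p (λ e → p≢0 (sym e)))}}}})

inv-≤1 : ∀ {p} → 1ℚ ≤ p → inv p ≤ 1ℚ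
inv-≤1 {p} 1≤p = *-cancelˡ p (<-≤-trans 0<1 1≤p)
  (≡-≤-trans (inv-r (<-≤-trans 0<1 1≤p)) (≤-≡-trans 1≤p (sym (*-identityʳ p))))

-- By recursion, so that numerals such as `ι 16` unfold to sums of `1ℚ` and `ι (suc r)` to
-- `1ℚ + ι r` inside the ring identities. The agreement with fractions of denominator 1 is `ι≡/1`.
ι : ℕ → ℚ
ι zero    = 0ℚ
ι (suc n) = 1ℚ + ι n

ι-+ : ∀ m n → ι (m ℕ.+ n) ≡ ι m + ι n
ι-+ zero n = sym (+-identityˡ _)
ι-+ (suc m) n = trans (cong (1ℚ +_) (ι-+ m n)) (sym (+-assoc 1ℚ (ι m) (ι n)))

ι-* : ∀ m n → ι (m ℕ.* n) ≡ ι m * ι n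
ι-* zero n = sym (*-zeroˡ (ι n))
ι-* (suc m) n = trans (ι-+ n (m ℕ.* n)) (trans (cong (ι n +_) (ι-* m n)) (lemma (ι m) (ι n)))
  where
  lemma : ∀ x y → y + x * y ≡ (1ℚ + x) * y
  lemma = solve-∀ ℚ-ring

0≤ι : ∀ n → 0ℚ ≤ ι n
0≤ι zero = ≤-refl
0≤ι (suc n) = 0≤+ 0≤1 (0≤ι n)

ι-mono : ∀ {m n} → m ℕ.≤ n → ι m ≤ ι n
ι-mono {n = n} ℕ.z≤n = 0≤ι n
ι-mono (ℕ.s≤s m≤n) = +-monoʳ-≤ 1ℚ (ι-mono m≤n)

ι-mono-< : ∀ {m n} → m ℕ.< n → ι m < ι n
ι-mono-< {m} m<n = <-≤-trans (<-by 1ℚ 0<1 (+-comm 1ℚ (ι m))) (ι-mono m<n)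

ι-cancel : ∀ {m n} → ι m ≤ ι n → m ℕ.≤ n
ι-cancel {m} {n} le with m ℕₚ.≤? n
... | yes p = p
... | no ¬p = ⊥-elim (<⇒≱ (ι-mono-< (ℕₚ.≰⇒> ¬p)) le)

0<ι : ∀ {n} → 0 ℕ.< n → 0ℚ < ι n
0<ι = ι-mono-<

1≤ι : ∀ {n} → 0 ℕ.< n → 1ℚ ≤ ι n
1≤ι = ι-mono {1}

infixr 8 _^ℚ_
_^ℚ_ : ℚ → ℕ → ℚ
p ^ℚ zero  = 1ℚ
p ^ℚ suc n = p * p ^ℚ n

^ℚ-nonNeg : ∀ {p} → 0ℚ ≤ p → ∀ n → 0ℚ ≤ p ^ℚ n
^ℚ-nonNeg 0≤p zero = 0≤1
^ℚ-nonNeg 0≤p (suc n) = 0≤* 0≤p (^ℚ-nonNeg 0≤p n)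

^ℚ-pos : ∀ {p} → 0ℚ < p → ∀ n → 0ℚ < p ^ℚ n
^ℚ-pos 0<p zero = 0<1
^ℚ-pos 0<p (suc n) = 0<* 0<p (^ℚ-pos 0<p n)

^ℚ-mono : ∀ {p q} → 0ℚ ≤ p → p ≤ q → ∀ n → p ^ℚ n ≤ q ^ℚ n
^ℚ-mono 0≤p p≤q zero = ≤-refl
^ℚ-mono 0≤p p≤q (suc n) = *-mono 0≤p (^ℚ-nonNeg 0≤p n) p≤q (^ℚ-mono 0≤p p≤q n)

^ℚ-mono-< : ∀ {p q} → 0ℚ ≤ p → p < q → ∀ n → p ^ℚ suc n < q ^ℚ suc n
^ℚ-mono-< {p} {q} 0≤p p<q zero = subst₂ _<_ (sym (*-identityʳ p)) (sym (*-identityʳ q)) p<q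
^ℚ-mono-< {p} {q} 0≤p p<q (suc n) = *-mono-< 0≤p (^ℚ-nonNeg 0≤p (suc n)) p<q (^ℚ-mono-< 0≤p p<q n)

^ℚ-distrib-* : ∀ p q n → (p * q) ^ℚ n ≡ p ^ℚ n * q ^ℚ n
^ℚ-distrib-* p q zero = sym (*-identityˡ 1ℚ)
^ℚ-distrib-* p q (suc n) = trans (cong ((p * q) *_) (^ℚ-distrib-* p q n)) (lemma p q (p ^ℚ n) (q ^ℚ n))
  where
  lemma : ∀ p q r s → (p * q) * (r * s) ≡ (p * r) * (q * s)
  lemma = solve-∀ ℚ-ring

ι-^ : ∀ m n → ι (m ℕ.^ n) ≡ ι m ^ℚ n
ι-^ m zero = +-identityʳ 1ℚ
ι-^ m (suc n) = trans (ι-* m (m ℕ.^ n)) (cong (ι m *_) (ι-^ m n))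

-- Finite sums over lists

sumᴸ : ∀ {A : Set} → List A → (A → ℚ) → ℚ
sumᴸ []       f = 0ℚ
sumᴸ (x ∷ xs) f = f x + sumᴸ xs f

syntax sumᴸ xs (λ x → e) = ∑[ x ∈ xs ] e

module _ {A : Set} where

  sum-cong : ∀ (xs : List A) {f g : A → ℚ} → (∀ x → f x ≡ g x) → sumᴸ xs f ≡ sumᴸ xs g
  sum-cong [] eq = refl
  sum-cong (x ∷ xs) eq = cong₂ _+_ (eq x) (sum-cong xs eq)

  sum-+ : ∀ (xs : List A) (f g : A → ℚ) → ∑[ x ∈ xs ] (f x + g x) ≡ sumᴸ xs f + sumᴸ xs g
  sum-+ [] f g = sym (+-identityˡ 0ℚ)
  sum-+ (x ∷ xs) f g = trans (cong (f x + g x +_) (sum-+ xs f g)) (lemma (f x) (g x) _ _)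
    where
    lemma : ∀ a b c d → a + b + (c + d) ≡ a + c + (b + d)
    lemma = solve-∀ ℚ-ring

  sum-*ˡ : ∀ (xs : List A) k (f : A → ℚ) → ∑[ x ∈ xs ] (k * f x) ≡ k * sumᴸ xs f
  sum-*ˡ [] k f = sym (*-zeroʳ k)
  sum-*ˡ (x ∷ xs) k f = trans (cong (k * f x +_) (sum-*ˡ xs k f)) (sym (*-distribˡ-+ k (f x) _))

  sum-*ʳ : ∀ (xs : List A) k (f : A → ℚ) → ∑[ x ∈ xs ] (f x * k) ≡ sumᴸ xs f * k
  sum-*ʳ xs k f = trans (sum-cong xs (λ x → *-comm (f x) k)) (trans (sum-*ˡ xs k f) (*-comm k _))

  sum-0 : ∀ (xs : List A) → ∑[ _ ∈ xs ] 0ℚ ≡ 0ℚ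
  sum-0 [] = refl
  sum-0 (x ∷ xs) = trans (+-identityˡ _) (sum-0 xs)

  sum-mono : ∀ (xs : List A) {f g : A → ℚ} → (∀ x → f x ≤ g x) → sumᴸ xs f ≤ sumᴸ xs g
  sum-mono [] le = ≤-refl
  sum-mono (x ∷ xs) le = +-mono-≤ (le x) (sum-mono xs le)

  sum-mono-∈ : ∀ (xs : List A) {f g : A → ℚ} → (∀ {x} → x ∈ xs → f x ≤ g x) → sumᴸ xs f ≤ sumᴸ xs g
  sum-mono-∈ [] le = ≤-refl
  sum-mono-∈ (x ∷ xs) le = +-mono-≤ (le (here refl)) (sum-mono-∈ xs (λ m → le (there m)))

  sum-nonNeg : ∀ (xs : List A) {f : A → ℚ} → (∀ x → 0ℚ ≤ f x) → 0ℚ ≤ sumᴸ xs f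
  sum-nonNeg [] le = ≤-refl
  sum-nonNeg (x ∷ xs) le = 0≤+ (le x) (sum-nonNeg xs le)

  sum-nonNeg-∈ : ∀ (xs : List A) {f : A → ℚ} → (∀ {x} → x ∈ xs → 0ℚ ≤ f x) → 0ℚ ≤ sumᴸ xs f
  sum-nonNeg-∈ [] le = ≤-refl
  sum-nonNeg-∈ (x ∷ xs) le = 0≤+ (le (here refl)) (sum-nonNeg-∈ xs (λ m → le (there m)))

  sum-cong-∈ : ∀ (xs : List A) {f g : A → ℚ} → (∀ {x} → x ∈ xs → f x ≡ g x) → sumᴸ xs f ≡ sumᴸ xs g
  sum-cong-∈ [] eq = refl
  sum-cong-∈ (x ∷ xs) eq = cong₂ _+_ (eq (here refl)) (sum-cong-∈ xs (λ m → eq (there m)))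

  ≤-sum : ∀ {xs : List A} {f : A → ℚ} → (∀ x → 0ℚ ≤ f x) → ∀ {x} → x ∈ xs → f x ≤ sumᴸ xs f
  ≤-sum {_ ∷ xs} {f} le {x} (here refl) = ≤-by (sumᴸ xs f) (sum-nonNeg xs le) refl
  ≤-sum {y ∷ xs} {f} le {x} (there m) = ≤-trans (≤-sum le m) (≤-by (f y) (le y) (+-comm (f y) _))

  sum-const : ∀ (xs : List A) k → ∑[ _ ∈ xs ] k ≡ ι (length xs) * k
  sum-const [] k = sym (*-zeroˡ k)
  sum-const (x ∷ xs) k = trans (cong (k +_) (sum-const xs k)) (lemma k (ι (length xs)))
    where
    lemma : ∀ k l → k + l * k ≡ (1ℚ + l) * k
    lemma = solve-∀ ℚ-ring

  sum-++ : ∀ (xs ys : List A) f → sumᴸ (xs ++ ys) f ≡ sumᴸ xs f + sumᴸ ys f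
  sum-++ [] ys f = sym (+-identityˡ _)
  sum-++ (x ∷ xs) ys f = trans (cong (f x +_) (sum-++ xs ys f)) (sym (+-assoc (f x) _ _))

  sum-pick : ∀ (xs : List A) (f g : A → ℚ) → sumᴸ xs f < sumᴸ xs g → ∃[ x ] x ∈ xs × f x < g x
  sum-pick [] f g lt = ⊥-elim (<-irrefl refl lt)
  sum-pick (x ∷ xs) f g lt with f x <? g x
  ... | yes p = x , here refl , p
  ... | no ¬p with sumᴸ xs f <? sumᴸ xs g
  ... | yes p = let y , m , q = sum-pick xs f g p in y , there m , q
  ... | no ¬q = ⊥-elim (<⇒≱ lt (+-mono-≤ (≮⇒≥ ¬p) (≮⇒≥ ¬q)))

module _ {A B : Set} where

  sum-map : ∀ (h : A → B) (xs : List A) f → sumᴸ (map h xs) f ≡ ∑[ x ∈ xs ] f (h x)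
  sum-map h [] f = refl
  sum-map h (x ∷ xs) f = cong (f (h x) +_) (sum-map h xs f)

  sum-swap : ∀ (xs : List A) (ys : List B) (f : A → B → ℚ) →
             ∑[ x ∈ xs ] ∑[ y ∈ ys ] f x y ≡ ∑[ y ∈ ys ] ∑[ x ∈ xs ] f x y
  sum-swap [] ys f = sym (sum-0 ys)
  sum-swap (x ∷ xs) ys f = trans (cong (sumᴸ ys (f x) +_) (sum-swap xs ys f)) (sym (sum-+ ys (f x) _))

-- The potential of the Gram–Schmidt walk

-- Convexity of s ↦ s^(r+1), as the tangent at s′. Multiplying the inductive hypothesis by s leaves
-- the surplus (r+1) s′^r (s - s′)². This replaces differentiation in all estimates of Ψ and in
-- `am-gm`.
pow-tangent : ∀ {s s′} → 0ℚ ≤ s → 0ℚ ≤ s′ → ∀ r →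
              s′ ^ℚ suc r + ι (suc r) * s′ ^ℚ r * (s - s′) ≤ s ^ℚ suc r
pow-tangent {s} {s′} 0≤s 0≤s′ zero = ≤-reflexive (lemma s s′)
  where
  lemma : ∀ s s′ → s′ * 1ℚ + (1ℚ + 0ℚ) * 1ℚ * (s - s′) ≡ s * 1ℚ
  lemma = solve-∀ ℚ-ring
pow-tangent {s} {s′} 0≤s 0≤s′ (suc r) =
  ≤-trans (≤-by (ι (suc r) * s′ ^ℚ r * ((s - s′) * (s - s′)))
                (0≤* (0≤* (0≤ι (suc r)) (^ℚ-nonNeg 0≤s′ r)) (0≤sq (s - s′)))
                (lemma s s′ (s′ ^ℚ r) (ι (suc r))))
          (*-monoˡ s 0≤s (pow-tangent 0≤s 0≤s′ r))
  where
  lemma : ∀ s s′ t k → s * (s′ * t + k * t * (s - s′))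
                     ≡ s′ * (s′ * t) + (1ℚ + k) * (s′ * t) * (s - s′) + k * t * ((s - s′) * (s - s′))
  lemma = solve-∀ ℚ-ring

-- The derivative of u (u² + v)^r is at most (1 + 2r)(u² + v)^r. The finite form comes from the
-- tangent of the power at u² + v, evaluated at w² + v.
odd-lip : ∀ r {u w v} → 0ℚ ≤ v → 0ℚ ≤ w → w ≤ u →
          u * (u * u + v) ^ℚ r - w * (w * w + v) ^ℚ r ≤ (u - w) * (1ℚ + ι 2 * ι r) * (u * u + v) ^ℚ r
odd-lip zero {u} {w} _ _ _ = ≤-reflexive (lemma u w)
  where
  lemma : ∀ u w → u * 1ℚ - w * 1ℚ ≡ (u - w) * (1ℚ + ι 2 * 0ℚ) * 1ℚ
  lemma = solve-∀ ℚ-ring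
odd-lip (suc r) {u} {w} {v} 0≤v 0≤w w≤u = ≤-trans
  (≤-by (w * (T ^ℚ suc r - (S ^ℚ suc r + ι (suc r) * S ^ℚ r * (T - S))))
        (0≤* 0≤w (0≤- (pow-tangent (0≤+ (0≤sq w) 0≤v) 0≤S r)))
        (lemma₁ u w v (S ^ℚ suc r) (T ^ℚ suc r) (S ^ℚ r) (ι (suc r))))
  (≤-by ((u - w) * ι (suc r) * S ^ℚ r * (u * (u - w) + (u * u - w * w) + ι 2 * v))
        (0≤* (0≤* (0≤* (0≤- w≤u) (0≤ι (suc r))) (^ℚ-nonNeg 0≤S r))
             (0≤+ (0≤+ (0≤* 0≤u (0≤- w≤u)) (0≤- (*-mono 0≤w 0≤w w≤u w≤u))) (0≤* (0≤ι 2) 0≤v)))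
        (lemma₂ u w v (S ^ℚ r) (ι (suc r))))
  where
  S = u * u + v
  T = w * w + v
  0≤S = 0≤+ (0≤sq u) 0≤v
  0≤u = ≤-trans 0≤w w≤u
  lemma₁ : ∀ u w v s t p k →
    (u - w) * s + w * (k * p * ((u * u + v) - (w * w + v)))
    ≡ u * s - w * t + w * (t - (s + k * p * ((w * w + v) - (u * u + v))))
  lemma₁ = solve-∀ ℚ-ring
  lemma₂ : ∀ u w v p k →
    (u - w) * (1ℚ + ι 2 * k) * ((u * u + v) * p)
    ≡ (u - w) * ((u * u + v) * p) + w * (k * p * ((u * u + v) - (w * w + v)))
      + (u - w) * k * p * (u * (u - w) + (u * u - w * w) + ι 2 * v)
  lemma₂ = solve-∀ ℚ-ring

-- Up to the factor 2(r+1), `F` is the derivative of u ↦ (u² + v)^(r+1). Its monotonicity expresses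
-- convexity of that function, and `F-lip` bounds the curvature.
module Odd (r : ℕ) (v : ℚ) (0≤v : 0ℚ ≤ v) where

  S : ℚ → ℚ
  S u = u * u + v

  0≤S : ∀ u → 0ℚ ≤ S u
  0≤S u = 0≤+ (0≤sq u) 0≤v

  0≤Sʳ : ∀ u n → 0ℚ ≤ S u ^ℚ n
  0≤Sʳ u n = ^ℚ-nonNeg (0≤S u) n

  F : ℚ → ℚ
  F u = u * S u ^ℚ r

  S-neg : ∀ u → S (- u) ≡ S u
  S-neg u = cong (_+ v) (lemma u)
    where
    lemma : ∀ u → (- u) * (- u) ≡ u * u
    lemma = solve-∀ ℚ-ring

  F-neg : ∀ u → F (- u) ≡ - F u
  F-neg u = trans (cong (λ z → (- u) * z ^ℚ r) (S-neg u)) (sym (neg-distribˡ-* u _))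

  S-mono : ∀ {u w} → 0ℚ ≤ u → u ≤ w → S u ≤ S w
  S-mono 0≤u u≤w = +-monoˡ-≤ v (*-mono 0≤u 0≤u u≤w u≤w)

  F-mono⁺ : ∀ {u w} → 0ℚ ≤ u → u ≤ w → F u ≤ F w
  F-mono⁺ {u} 0≤u u≤w = *-mono 0≤u (0≤Sʳ u r) u≤w (^ℚ-mono (0≤S u) (S-mono 0≤u u≤w) r)

  F-nonNeg : ∀ {u} → 0ℚ ≤ u → 0ℚ ≤ F u
  F-nonNeg {u} 0≤u = 0≤* 0≤u (0≤Sʳ u r)

  F-nonPos : ∀ {u} → u ≤ 0ℚ → F u ≤ 0ℚ
  F-nonPos {u} u≤0 = ≡-≤-trans (trans (cong F (neg-involutive′ u)) (F-neg (- u))) (neg-antimono-≤ (F-nonNeg (0≤neg u≤0)))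
    where
    neg-involutive′ : ∀ u → u ≡ - (- u)
    neg-involutive′ = solve-∀ ℚ-ring

  F-mono : ∀ {u w} → u ≤ w → F u ≤ F w
  F-mono {u} {w} u≤w with ≤-total 0ℚ u | ≤-total 0ℚ w
  ... | inj₁ 0≤u | _        = F-mono⁺ 0≤u u≤w
  ... | inj₂ u≤0 | inj₁ 0≤w = ≤-trans (F-nonPos u≤0) (F-nonNeg 0≤w)
  ... | inj₂ u≤0 | inj₂ w≤0 =
    subst₂ _≤_ (lemma u) (lemma w) (neg-antimono-≤ (F-mono⁺ (0≤neg w≤0) (neg-antimono-≤ u≤w)))
    where
    neg² : ∀ u → - (- u) ≡ u
    neg² = solve-∀ ℚ-ring
    lemma : ∀ u → - F (- u) ≡ F u
    lemma u = trans (cong -_ (F-neg u)) (neg² (F u))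

  bound : ℚ
  bound = 1ℚ + ι 2 * ι r

  0≤bound : 0ℚ ≤ bound
  0≤bound = 0≤+ 0≤1 (0≤* (0≤ι 2) (0≤ι r))

  -- With |w| ≤ |u|; the other case is symmetric.
  F-lip⁺ : ∀ {u w} → w ≤ u → S w ≤ S u → F u - F w ≤ (u - w) * bound * S u ^ℚ r
  F-lip⁺ {u} {w} w≤u Sw≤Su with ≤-total w 0ℚ
  ... | inj₁ w≤0 = ≤-by ((- w) * (S u ^ℚ r - S w ^ℚ r) + (u - w) * (ι 2 * ι r) * S u ^ℚ r)
          (0≤+ (0≤* (0≤neg w≤0) (0≤- (^ℚ-mono (0≤S w) Sw≤Su r)))
               (0≤* (0≤* (0≤- w≤u) (0≤* (0≤ι 2) (0≤ι r))) (0≤Sʳ u r)))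
          (lemma u w (S u ^ℚ r) (S w ^ℚ r) (ι 2 * ι r))
    where
    lemma : ∀ u w s t k → (u - w) * (1ℚ + k) * s ≡ u * s - w * t + ((- w) * (s - t) + (u - w) * k * s)
    lemma = solve-∀ ℚ-ring
  ... | inj₂ 0≤w = odd-lip r 0≤v 0≤w w≤u

  F-lip : ∀ {u w} → w ≤ u → F u - F w ≤ (u - w) * bound * (S u ^ℚ r + S w ^ℚ r)
  F-lip {u} {w} w≤u with ≤-total (S w) (S u)
  ... | inj₁ le = ≤-trans (F-lip⁺ w≤u le)
          (*-monoˡ _ (0≤* (0≤- w≤u) 0≤bound) (≤-by (S w ^ℚ r) (0≤Sʳ w r) refl))
  ... | inj₂ le = ≤-trans
          (subst₂ _≤_ (trans (cong₂ _-_ (F-neg w) (F-neg u)) (lemma₁ (F u) (F w)))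
                      (cong₂ (λ z t → z * bound * t ^ℚ r) (lemma₁ u w) (S-neg w))
            (F-lip⁺ (neg-antimono-≤ w≤u) (subst₂ _≤_ (sym (S-neg u)) (sym (S-neg w)) le)))
          (*-monoˡ _ (0≤* (0≤- w≤u) 0≤bound) (≤-by (S u ^ℚ r) (0≤Sʳ u r) (+-comm (S u ^ℚ r) (S w ^ℚ r))))
    where
    lemma₁ : ∀ u w → (- w) - (- u) ≡ u - w
    lemma₁ = solve-∀ ℚ-ring

-- Twice the expectation of ((Y + aζ)² + v)^(r+1), where ζ + x is a random
-- sign of mean x.
Ψ : ℕ → (x Y a v : ℚ) → ℚ
Ψ r x Y a v = (1ℚ + x) * ((Y + a * (1ℚ - x)) * (Y + a * (1ℚ - x)) + v) ^ℚ suc r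
            + (1ℚ - x) * ((Y - a * (1ℚ + x)) * (Y - a * (1ℚ + x)) + v) ^ℚ suc r

Bounded : ℚ → Set
Bounded x = 0ℚ ≤ 1ℚ + x × 0ℚ ≤ 1ℚ - x

Ψ-sym : ∀ r x Y a v → Ψ r x Y a v ≡ Ψ r (- x) Y (- a) v
Ψ-sym r x Y a v = trans (+-comm ((1ℚ + x) * ((Y + a * (1ℚ - x)) * (Y + a * (1ℚ - x)) + v) ^ℚ suc r) _) (cong₂ _+_
  (cong (λ z → (1ℚ - x) * (z * z + v) ^ℚ suc r) (lemma₁ x Y a))
  (cong₂ (λ y z → y * (z * z + v) ^ℚ suc r) (lemma₂ x) (lemma₃ x Y a)))
  where
  lemma₁ : ∀ x Y a → Y - a * (1ℚ + x) ≡ Y + (- a) * (1ℚ - (- x))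
  lemma₁ = solve-∀ ℚ-ring
  lemma₂ : ∀ x → 1ℚ + x ≡ 1ℚ - (- x)
  lemma₂ = solve-∀ ℚ-ring
  lemma₃ : ∀ x Y a → Y + a * (1ℚ - x) ≡ Y - (- a) * (1ℚ + (- x))
  lemma₃ = solve-∀ ℚ-ring

Bounded-neg : ∀ {x} → Bounded x → Bounded (- x)
Bounded-neg {x} (p , q) = q , subst (0ℚ ≤_) (lemma x) p
  where
  lemma : ∀ x → 1ℚ + x ≡ 1ℚ - (- x)
  lemma = solve-∀ ℚ-ring

Ψ-mono : ∀ r {x} → Bounded x → ∀ Y a {v w} → 0ℚ ≤ v → v ≤ w → Ψ r x Y a v ≤ Ψ r x Y a w
Ψ-mono r {x} (p , q) Y a {v} {w} 0≤v v≤w = +-mono-≤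
  (*-monoˡ (1ℚ + x) p (lemma (Y + a * (1ℚ - x))))
  (*-monoˡ (1ℚ - x) q (lemma (Y - a * (1ℚ + x))))
  where
  lemma : ∀ u → (u * u + v) ^ℚ suc r ≤ (u * u + w) ^ℚ suc r
  lemma u = ^ℚ-mono (0≤+ (0≤sq u) 0≤v) (+-monoʳ-≤ (u * u) v≤w) (suc r)

-- Dilating centred noise increases the mean of a convex function. Tangents at the amplitude a′
-- leave squares and a multiple of `F u₊ - F u₋`, which is nonnegative because `F` increases.
Ψ-dilate : ∀ r {x} → Bounded x → ∀ Y {a a′ v} → 0ℚ ≤ v → 0ℚ ≤ a′ → a′ ≤ a → Ψ r x Y a′ v ≤ Ψ r x Y a v
Ψ-dilate r {x} (p , q) Y {a} {a′} {v} 0≤v 0≤a′ a′≤a = ≤-trans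
  (≤-by (k * (ι 2 * (d * ((1ℚ - x) * (1ℚ + x)) * (F u₊ - F u₋))
            + (1ℚ + x) * S u₊ ^ℚ r * ((d * (1ℚ - x)) * (d * (1ℚ - x)))
            + (1ℚ - x) * S u₋ ^ℚ r * ((d * (1ℚ + x)) * (d * (1ℚ + x)))))
        (0≤* (0≤ι (suc r)) (0≤+ (0≤+
          (0≤* (0≤ι 2) (0≤* (0≤* (0≤- a′≤a) (0≤* q p)) (0≤- (F-mono u₋≤u₊))))
          (0≤* (0≤* p (0≤Sʳ u₊ r)) (0≤sq (d * (1ℚ - x))))) (0≤* (0≤* q (0≤Sʳ u₋ r)) (0≤sq (d * (1ℚ + x))))))
        (lemma x Y a a′ v (S u₊ ^ℚ suc r) (S u₋ ^ℚ suc r) (S u₊ ^ℚ r) (S u₋ ^ℚ r) k))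
  (+-mono-≤ (*-monoˡ _ p (pow-tangent (0≤S (Y + a * (1ℚ - x))) (0≤S u₊) r))
            (*-monoˡ _ q (pow-tangent (0≤S (Y - a * (1ℚ + x))) (0≤S u₋) r)))
  where
  open Odd r v 0≤v
  k = ι (suc r)
  d = a - a′
  u₊ = Y + a′ * (1ℚ - x)
  u₋ = Y - a′ * (1ℚ + x)
  u₋≤u₊ : u₋ ≤ u₊
  u₋≤u₊ = ≤-by (ι 2 * a′) (0≤* (0≤ι 2) 0≤a′) (lemma′ Y a′ x)
    where
    lemma′ : ∀ Y a′ x → Y + a′ * (1ℚ - x) ≡ Y - a′ * (1ℚ + x) + ι 2 * a′
    lemma′ = solve-∀ ℚ-ring
  lemma : ∀ x Y a a′ v P M p m k →
    let u₊ = Y + a′ * (1ℚ - x) ; u₋ = Y - a′ * (1ℚ + x) ; w₊ = Y + a * (1ℚ - x) ; w₋ = Y - a * (1ℚ + x) ; d = a - a′ in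
    (1ℚ + x) * (P + k * p * ((w₊ * w₊ + v) - (u₊ * u₊ + v))) + (1ℚ - x) * (M + k * m * ((w₋ * w₋ + v) - (u₋ * u₋ + v)))
    ≡ (1ℚ + x) * P + (1ℚ - x) * M
      + k * (ι 2 * (d * ((1ℚ - x) * (1ℚ + x)) * (u₊ * p - u₋ * m))
            + (1ℚ + x) * p * ((d * (1ℚ - x)) * (d * (1ℚ - x)))
            + (1ℚ - x) * m * ((d * (1ℚ + x)) * (d * (1ℚ + x))))
  lemma = solve-∀ ℚ-ring

-- The variance charged per unit of energy. The proof of `Ψ-grow⁺` needs at least 8(2r+1), where
-- 2r+1 is the Lipschitz factor of `F`; 16(r+1) exceeds this by 8.
noise : ℕ → ℚ
noise r = ι 16 * ι (suc r)

0≤noise : ∀ r → 0ℚ ≤ noise r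
0≤noise r = 0≤* (0≤ι 16) (0≤ι (suc r))

-- A random sign of larger amplitude is cheaper than the variance it replaces: raising a to a′ adds
-- at most a multiple of the curvature of the power, bounded by `F-lip`, while `v` falls by
-- `noise r` times a′² - a². The terms of the surplus are the slack of this comparison.
Ψ-grow⁺ : ∀ r {x} → Bounded x → ∀ Y {a a′ E} → 0ℚ ≤ a → a ≤ a′ → a′ * a′ ≤ E →
          Ψ r x Y a′ (noise r * (E - a′ * a′)) ≤ Ψ r x Y a (noise r * (E - a * a))
Ψ-grow⁺ r {x} (p , q) Y {a} {a′} {E} 0≤a a≤a′ a′²≤E = ≤-trans
  (≤-by (k * (ι 2 * d * ((1ℚ - x) * (1ℚ + x) * gap) + ι 4 * d * a′ * bound * (P * ((1ℚ + x) * (1ℚ + x)) + M * ((1ℚ - x) * (1ℚ - x)))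
            + (1ℚ + x) * P * ((d * (1ℚ - x)) * (d * (1ℚ - x))) + (1ℚ - x) * M * ((d * (1ℚ + x)) * (d * (1ℚ + x)))
            + d * a′ * ι 8 * ((1ℚ + x) * P + (1ℚ - x) * M)
            + noise r * d * a * ((1ℚ + x) * P + (1ℚ - x) * M)))
        (0≤* (0≤ι (suc r))
          (0≤+ (0≤+ (0≤+ (0≤+ (0≤+ (0≤* (0≤* (0≤ι 2) 0≤d) (0≤* (0≤* q p) (0≤- (F-lip u₋≤u₊))))
                              (0≤* (0≤* (0≤* (0≤* (0≤ι 4) 0≤d) 0≤a′) 0≤bound) (0≤+ (0≤* 0≤P (0≤sq (1ℚ + x))) (0≤* 0≤M (0≤sq (1ℚ - x))))))
                         (0≤* (0≤* p 0≤P) (0≤sq (d * (1ℚ - x))))) (0≤* (0≤* q 0≤M) (0≤sq (d * (1ℚ + x)))))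
                    (0≤* (0≤* (0≤* 0≤d 0≤a′) (0≤ι 8)) 0≤Z))
               (0≤* (0≤* (0≤* (0≤noise r) 0≤d) 0≤a) 0≤Z)))
        (lemma x Y a a′ E (S u₊ ^ℚ suc r) (S u₋ ^ℚ suc r) P M (ι r)))
  (+-mono-≤ (*-monoˡ _ p (pow-tangent (0≤S₀ (Y + a * (1ℚ - x))) (0≤S u₊) r))
            (*-monoˡ _ q (pow-tangent (0≤S₀ (Y - a * (1ℚ + x))) (0≤S u₋) r)))
  where
  0≤a′ = ≤-trans 0≤a a≤a′
  open Odd r (noise r * (E - a′ * a′)) (0≤* (0≤noise r) (0≤- a′²≤E))
  open Odd r (noise r * (E - a * a)) (0≤* (0≤noise r) (0≤- (≤-trans (*-mono 0≤a 0≤a a≤a′ a≤a′) a′²≤E)))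
    using () renaming (0≤S to 0≤S₀)
  k = ι (suc r)
  d = a′ - a
  0≤d = 0≤- a≤a′
  u₊ = Y + a′ * (1ℚ - x)
  u₋ = Y - a′ * (1ℚ + x)
  P = S u₊ ^ℚ r
  M = S u₋ ^ℚ r
  0≤P = 0≤Sʳ u₊ r
  0≤M = 0≤Sʳ u₋ r
  0≤Z = 0≤+ (0≤* p 0≤P) (0≤* q 0≤M)
  gap = (u₊ - u₋) * bound * (P + M) - (F u₊ - F u₋)
  u₋≤u₊ : u₋ ≤ u₊
  u₋≤u₊ = ≤-by (ι 2 * a′) (0≤* (0≤ι 2) 0≤a′) (lemma′ Y a′ x)
    where
    lemma′ : ∀ Y a′ x → Y + a′ * (1ℚ - x) ≡ Y - a′ * (1ℚ + x) + ι 2 * a′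
    lemma′ = solve-∀ ℚ-ring
  lemma : ∀ x Y a a′ E PP MM P M n →
    let u₊ = Y + a′ * (1ℚ - x) ; u₋ = Y - a′ * (1ℚ + x) ; w₊ = Y + a * (1ℚ - x) ; w₋ = Y - a * (1ℚ + x) ; d = a′ - a
        L = ι 16 * (1ℚ + n) ; k = 1ℚ + n ; bd = 1ℚ + ι 2 * n
        v = L * (E - a′ * a′) ; v₀ = L * (E - a * a)
        gap = (u₊ - u₋) * bd * (P + M) - (u₊ * P - u₋ * M) in
    (1ℚ + x) * (PP + k * P * ((w₊ * w₊ + v₀) - (u₊ * u₊ + v))) + (1ℚ - x) * (MM + k * M * ((w₋ * w₋ + v₀) - (u₋ * u₋ + v)))
    ≡ (1ℚ + x) * PP + (1ℚ - x) * MM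
      + k * (ι 2 * d * ((1ℚ - x) * (1ℚ + x) * gap) + ι 4 * d * a′ * bd * (P * ((1ℚ + x) * (1ℚ + x)) + M * ((1ℚ - x) * (1ℚ - x)))
            + (1ℚ + x) * P * ((d * (1ℚ - x)) * (d * (1ℚ - x))) + (1ℚ - x) * M * ((d * (1ℚ + x)) * (d * (1ℚ + x)))
            + d * a′ * ι 8 * ((1ℚ + x) * P + (1ℚ - x) * M)
            + L * d * a * ((1ℚ + x) * P + (1ℚ - x) * M))
  lemma = solve-∀ ℚ-ring

Ψ-at-0 : ∀ r x Y v → Ψ r x Y 0ℚ v ≡ ι 2 * (Y * Y + v) ^ℚ suc r
Ψ-at-0 r x Y v = trans
  (cong₂ (λ y z → (1ℚ + x) * (y * y + v) ^ℚ suc r + (1ℚ - x) * (z * z + v) ^ℚ suc r) (l₁ x Y) (l₂ x Y))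
  (l₃ x ((Y * Y + v) ^ℚ suc r))
  where
  l₁ : ∀ x Y → Y + 0ℚ * (1ℚ - x) ≡ Y
  l₁ = solve-∀ ℚ-ring
  l₂ : ∀ x Y → Y - 0ℚ * (1ℚ + x) ≡ Y
  l₂ = solve-∀ ℚ-ring
  l₃ : ∀ x z → (1ℚ + x) * z + (1ℚ - x) * z ≡ ι 2 * z
  l₃ = solve-∀ ℚ-ring

-sq : ∀ a → (- a) * (- a) ≡ a * a
-sq = solve-∀ ℚ-ring

-- The conclusion of the case a ≥ 0 also holds for a ≤ 0, by the symmetry
-- (x , a) ↦ (- x , - a).
Ψ-grow : ∀ r {x} → Bounded x → ∀ Y {a E} → a * a ≤ E →
         Ψ r x Y a (noise r * (E - a * a)) ≤ ι 2 * (Y * Y + noise r * E) ^ℚ suc r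
Ψ-grow r {x} bx Y {a} {E} a²≤E with ≤-total 0ℚ a
... | inj₁ 0≤a = ≤-trans (Ψ-grow⁺ r {x} bx Y ≤-refl 0≤a a²≤E)
        (≤-reflexive (trans (cong (λ z → Ψ r x Y 0ℚ (noise r * z)) (lemma E)) (Ψ-at-0 r x Y (noise r * E))))
  where
  lemma : ∀ E → E - 0ℚ * 0ℚ ≡ E
  lemma = solve-∀ ℚ-ring
... | inj₂ a≤0 = subst (_≤ ι 2 * (Y * Y + noise r * E) ^ℚ suc r)
        (trans (cong (λ z → Ψ r (- x) Y (- a) (noise r * (E - z))) (-sq a)) (sym (Ψ-sym r x Y a _)))
        (Ψ-grow′ (0≤neg a≤0) (subst (_≤ E) (sym (-sq a)) a²≤E))
  where
  lemma : ∀ E → E - 0ℚ * 0ℚ ≡ E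
  lemma = solve-∀ ℚ-ring
  Ψ-grow′ : 0ℚ ≤ - a → (- a) * (- a) ≤ E → Ψ r (- x) Y (- a) (noise r * (E - (- a) * (- a))) ≤ ι 2 * (Y * Y + noise r * E) ^ℚ suc r
  Ψ-grow′ 0≤a le = ≤-trans (Ψ-grow⁺ r {(- x)} (Bounded-neg {x} bx) Y ≤-refl 0≤a le)
    (≤-reflexive (trans (cong (λ z → Ψ r (- x) Y 0ℚ (noise r * z)) (lemma E)) (Ψ-at-0 r (- x) Y (noise r * E))))

-- How one row changes when an element other than the pivot is frozen: a is its coefficient along
-- the pivot direction, E its energy in the alive span. The last three fields serve the three cases
-- of `Ψ-shrink⁺`: `total` when a grows, `rest` when it shrinks without changing sign, `flip` when
-- the sign changes.
record Shrinks (a a′ E E′ : ℚ) : Set where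
  field
    old   : a * a ≤ E
    new   : a′ * a′ ≤ E′
    total : E′ ≤ E
    rest  : E′ - a′ * a′ ≤ E - a * a
    flip  : a * a′ ≤ 0ℚ → E′ ≤ E - a * a

Shrinks-neg : ∀ {a a′ E E′} → Shrinks a a′ E E′ → Shrinks (- a) (- a′) E E′
Shrinks-neg {a} {a′} {E} {E′} s = record
  { old = subst (_≤ E) (sym (-sq a)) old ; new = subst (_≤ E′) (sym (-sq a′)) new ; total = total
  ; rest = subst₂ (λ y z → E′ - y ≤ E - z) (sym (-sq a′)) (sym (-sq a)) rest
  ; flip = λ le → subst (λ z → E′ ≤ E - z) (sym (-sq a)) (flip (subst (_≤ 0ℚ) (lemma a a′) le)) }
  where
  open Shrinks s
  lemma : ∀ a b → (- a) * (- b) ≡ a * b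
  lemma = solve-∀ ℚ-ring

Ψ-shrink⁺ : ∀ r {x} → Bounded x → ∀ Y {a a′ E E′} → 0ℚ ≤ a → Shrinks a a′ E E′ →
            Ψ r x Y a′ (noise r * (E′ - a′ * a′)) ≤ Ψ r x Y a (noise r * (E - a * a))
Ψ-shrink⁺ r {x} bx Y {a} {a′} {E} {E′} 0≤a s with ≤-total a a′ | ≤-total 0ℚ a′
... | inj₁ a≤a′ | _ = ≤-trans
        (Ψ-mono r {x} bx Y a′ 0≤v′ (*-monoˡ (noise r) (0≤noise r) (+-monoˡ-≤ (- (a′ * a′)) total)))
        (Ψ-grow⁺ r {x} bx Y 0≤a a≤a′ (≤-trans new total))
  where
  open Shrinks s
  0≤v′ = 0≤* (0≤noise r) (0≤- new)
... | inj₂ a′≤a | inj₁ 0≤a′ = ≤-trans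
        (Ψ-mono r {x} bx Y a′ (0≤* (0≤noise r) (0≤- new)) (*-monoˡ (noise r) (0≤noise r) rest))
        (Ψ-dilate r {x} bx Y (0≤* (0≤noise r) (0≤- old)) 0≤a′ a′≤a)
  where open Shrinks s
-- Across a change of sign the comparison passes through amplitude 0: `flip` leaves E - a² for the
-- new energy, from which the amplitude a′ is grown, and a is dilated from 0.
... | inj₂ _ | inj₂ a′≤0 = ≤-trans
        (Ψ-mono r {x} bx Y a′ (0≤* (0≤noise r) (0≤- new)) (*-monoˡ (noise r) (0≤noise r) (+-monoˡ-≤ (- (a′ * a′)) E′≤)))
        (≤-trans (Ψ-grow r {x} bx Y {a′} (≤-trans new E′≤))
          (≤-trans (≤-reflexive (sym (Ψ-at-0 r x Y (noise r * (E - a * a)))))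
                   (Ψ-dilate r {x} bx Y (0≤* (0≤noise r) (0≤- old)) ≤-refl 0≤a)))
  where
  open Shrinks s
  lemma : ∀ a b → a * (- b) ≡ - (a * b)
  lemma = solve-∀ ℚ-ring
  neg² : ∀ u → - (- u) ≡ u
  neg² = solve-∀ ℚ-ring
  E′≤ : E′ ≤ E - a * a
  E′≤ = flip (subst (_≤ 0ℚ) (neg² (a * a′)) (neg-antimono-≤ (subst (0ℚ ≤_) (lemma a a′) (0≤* 0≤a (0≤neg a′≤0)))))

Ψ-shrink : ∀ r {x} → Bounded x → ∀ Y {a a′ E E′} → Shrinks a a′ E E′ →
           Ψ r x Y a′ (noise r * (E′ - a′ * a′)) ≤ Ψ r x Y a (noise r * (E - a * a))
Ψ-shrink r {x} bx Y {a} {a′} {E} {E′} s with ≤-total 0ℚ a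
... | inj₁ 0≤a = Ψ-shrink⁺ r {x} bx Y 0≤a s
... | inj₂ a≤0 = subst₂ _≤_ (eq a′ E′) (eq a E) (Ψ-shrink⁺ r {(- x)} (Bounded-neg {x} bx) Y (0≤neg a≤0) (Shrinks-neg s))
  where
  eq : ∀ a E → Ψ r (- x) Y (- a) (noise r * (E - (- a) * (- a))) ≡ Ψ r x Y a (noise r * (E - a * a))
  eq a E = trans (cong (λ z → Ψ r (- x) Y (- a) (noise r * (E - z))) (-sq a)) (sym (Ψ-sym r x Y a _))

-- Semi-inner products and orthogonal projection

infixl 6 _⊕_
infixr 7 _⊙_

_⊕_ : ∀ {X : Set} → (X → ℚ) → (X → ℚ) → X → ℚ
(u ⊕ v) x = u x + v x

_⊙_ : ∀ {X : Set} → ℚ → (X → ℚ) → X → ℚ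
(k ⊙ u) x = k * u x

-- Only semidefinite, because weights may vanish and columns may be dependent; null vectors are
-- dealt with by `null-⊥`.
record SemiInner (X : Set) : Set where
  field
    ⟨_,_⟩ : (X → ℚ) → (X → ℚ) → ℚ
    comm  : ∀ u v → ⟨ u , v ⟩ ≡ ⟨ v , u ⟩
    addˡ  : ∀ u v w → ⟨ u ⊕ v , w ⟩ ≡ ⟨ u , w ⟩ + ⟨ v , w ⟩
    mulˡ  : ∀ k u w → ⟨ k ⊙ u , w ⟩ ≡ k * ⟨ u , w ⟩
    nonneg : ∀ u → 0ℚ ≤ ⟨ u , u ⟩

module Inner {X : Set} (H : SemiInner X) where
  open SemiInner H public

  addʳ : ∀ u v w → ⟨ w , u ⊕ v ⟩ ≡ ⟨ w , u ⟩ + ⟨ w , v ⟩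
  addʳ u v w = trans (comm w _) (trans (addˡ u v w) (cong₂ _+_ (comm u w) (comm v w)))

  mulʳ : ∀ k u w → ⟨ w , k ⊙ u ⟩ ≡ k * ⟨ w , u ⟩
  mulʳ k u w = trans (comm w _) (trans (mulˡ k u w) (cong (k *_) (comm u w)))

  subʳ : ∀ u k v w → ⟨ w , u ⊕ (k ⊙ v) ⟩ ≡ ⟨ w , u ⟩ + k * ⟨ w , v ⟩
  subʳ u k v w = trans (addʳ u (k ⊙ v) w) (cong (⟨ w , u ⟩ +_) (mulʳ k v w))

  subˡ : ∀ u k v w → ⟨ u ⊕ (k ⊙ v) , w ⟩ ≡ ⟨ u , w ⟩ + k * ⟨ v , w ⟩
  subˡ u k v w = trans (addˡ u (k ⊙ v) w) (cong (⟨ u , w ⟩ +_) (mulˡ k v w))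

  sq-sub : ∀ u k v → ⟨ u ⊕ (k ⊙ v) , u ⊕ (k ⊙ v) ⟩ ≡ ⟨ u , u ⟩ + ι 2 * k * ⟨ u , v ⟩ + k * k * ⟨ v , v ⟩
  sq-sub u k v = trans (subʳ u k v (u ⊕ (k ⊙ v)))
    (trans (cong₂ (λ y z → y + k * z) (subˡ u k v u) (subˡ u k v v))
    (trans (cong (λ z → ⟨ u , u ⟩ + k * z + k * (⟨ u , v ⟩ + k * ⟨ v , v ⟩)) (comm v u))
           (lemma ⟨ u , u ⟩ k ⟨ u , v ⟩ ⟨ v , v ⟩)))
    where
    lemma : ∀ a k b c → a + k * b + k * (b + k * c) ≡ a + ι 2 * k * b + k * k * c
    lemma = solve-∀ ℚ-ring

  -- For a null v the square |u + k v|² is affine in k. If t = ⟨ u , v ⟩ were not 0, the choice k =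
  -- -(|u|² + 1)/t would make it negative.
  null-⊥ : ∀ u {v} → ⟨ v , v ⟩ ≡ 0ℚ → ⟨ u , v ⟩ ≡ 0ℚ
  null-⊥ u {v} v²≡0 with ⟨ u , v ⟩ ≟ 0ℚ
  ... | yes eq = eq
  ... | no t≢0 = ⊥-elim (<⇒≱ (<-by (⟨ u , u ⟩ + ι 2) (+-mono-≤-< (nonneg u) (0<ι {2} (ℕ.s≤s ℕ.z≤n))) (lemma₃ ⟨ u , u ⟩)) (≤-trans 0≤q (≤-reflexive q≡)))
    where
    t = ⟨ u , v ⟩
    k = - (⟨ u , u ⟩ + 1ℚ) * inv t
    0≤q = nonneg (u ⊕ (k ⊙ v))
    lemma₁ : ∀ a t i → a + ι 2 * (- (a + 1ℚ) * i) * t ≡ a - ι 2 * (a + 1ℚ) * (t * i)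
    lemma₁ = solve-∀ ℚ-ring
    lemma₂ : ∀ a k s → a + k * 0ℚ ≡ a
    lemma₂ = solve-∀ ℚ-ring
    lemma₃ : ∀ a → 0ℚ ≡ a - ι 2 * (a + 1ℚ) * 1ℚ + (a + ι 2)
    lemma₃ = solve-∀ ℚ-ring
    q≡ : ⟨ u ⊕ (k ⊙ v) , u ⊕ (k ⊙ v) ⟩ ≡ ⟨ u , u ⟩ - ι 2 * (⟨ u , u ⟩ + 1ℚ) * 1ℚ
    q≡ = trans (sq-sub u k v) (trans (cong (λ z → ⟨ u , u ⟩ + ι 2 * k * t + k * k * z) v²≡0)
         (trans (lemma₂ (⟨ u , u ⟩ + ι 2 * k * t) (k * k) 0ℚ) (trans (lemma₁ ⟨ u , u ⟩ t (inv t))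
         (cong (λ z → ⟨ u , u ⟩ - ι 2 * (⟨ u , u ⟩ + 1ℚ) * z) (inv-r≢ t≢0)))))

  cauchy-schwarz : ∀ u v → ⟨ u , v ⟩ * ⟨ u , v ⟩ ≤ ⟨ u , u ⟩ * ⟨ v , v ⟩
  cauchy-schwarz u v with ⟨ v , v ⟩ ≟ 0ℚ
  ... | yes eq = ≤-reflexive (trans (cong₂ _*_ (null-⊥ u eq) (null-⊥ u eq)) (sym (trans (cong (⟨ u , u ⟩ *_) eq) (*-zeroʳ ⟨ u , u ⟩))))
  ... | no n≢0 = ≤-by (n * ⟨ u ⊕ (k ⊙ v) , u ⊕ (k ⊙ v) ⟩) (0≤* (nonneg v) (nonneg (u ⊕ (k ⊙ v))))
          (sym (trans (cong (λ z → t * t + n * z) (sq-sub u k v))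
               (trans (lemma ⟨ u , u ⟩ t n (inv n)) (trans (cong (λ z → ⟨ u , u ⟩ * n + t * t * (1ℚ - z) * (1ℚ - z)) (inv-r≢ n≢0))
                      (lemma′ ⟨ u , u ⟩ n t)))))
    where
    t = ⟨ u , v ⟩
    n = ⟨ v , v ⟩
    k = - t * inv n
    lemma : ∀ a t n i → t * t + n * (a + ι 2 * (- t * i) * t + (- t * i) * (- t * i) * n)
                      ≡ a * n + t * t * (1ℚ - n * i) * (1ℚ - n * i)
    lemma = solve-∀ ℚ-ring
    lemma′ : ∀ a n t → a * n + t * t * (1ℚ - 1ℚ) * (1ℚ - 1ℚ) ≡ a * n
    lemma′ = solve-∀ ℚ-ring

  module Projection {J : Set} (c : J → X → ℚ) where

    infix 4 _⊥_
    _⊥_ : (X → ℚ) → List J → Set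
    z ⊥ js = ∀ {k} → k ∈ js → ⟨ z , c k ⟩ ≡ 0ℚ

    -- Gram-Schmidt: the part of `b` orthogonal to the listed columns. If `c j` depends on the rest
    -- of the list its residue is null, and the convention inv 0 = 0 makes the step trivial.
    perp : List J → (X → ℚ) → X → ℚ
    ratio : J → List J → (X → ℚ) → ℚ
    perp []       b = b
    perp (j ∷ js) b = perp js b ⊕ (ratio j js b ⊙ perp js (c j))
    ratio j js b = - ⟨ perp js b , perp js (c j) ⟩ * inv ⟨ perp js (c j) , perp js (c j) ⟩

    perp-≈ : ∀ js b {z} → z ⊥ js → ⟨ z , perp js b ⟩ ≡ ⟨ z , b ⟩
    perp-≈ [] b z⊥ = refl
    perp-≈ (j ∷ js) b {z} z⊥ =
      trans (subʳ (perp js b) (ratio j js b) (perp js (c j)) z)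
      (trans (cong₂ (λ y w → y + ratio j js b * w) (perp-≈ js b (λ m → z⊥ (there m)))
                    (trans (perp-≈ js (c j) (λ m → z⊥ (there m))) (z⊥ (here refl))))
             (lemma ⟨ z , b ⟩ (ratio j js b)))
      where
      lemma : ∀ a k → a + k * 0ℚ ≡ a
      lemma = solve-∀ ℚ-ring

    perp-⊥ : ∀ js b → perp js b ⊥ js
    perp-⊥ (j ∷ js) b (there m) =
      trans (subˡ (perp js b) (ratio j js b) (perp js (c j)) _)
      (trans (cong₂ (λ y w → y + ratio j js b * w) (perp-⊥ js b m) (perp-⊥ js (c j) m))
             (lemma (ratio j js b)))
      where
      lemma : ∀ k → 0ℚ + k * 0ℚ ≡ 0ℚ
      lemma = solve-∀ ℚ-ring
    perp-⊥ (j ∷ js) b (here refl) =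
      trans (subˡ b′ (ratio j js b) c′ (c j))
      (trans (cong₂ (λ y w → y + ratio j js b * w) (sym (perp-≈ js (c j) (perp-⊥ js b))) (sym (perp-≈ js (c j) (perp-⊥ js (c j)))))
             final)
      where
      b′ = perp js b
      c′ = perp js (c j)
      lemma₁ : ∀ t i n → t + - t * i * n ≡ t - t * (n * i)
      lemma₁ = solve-∀ ℚ-ring
      lemma₂ : ∀ t → t - t * 1ℚ ≡ 0ℚ
      lemma₂ = solve-∀ ℚ-ring
      lemma₃ : ∀ x → 0ℚ - 0ℚ * x ≡ 0ℚ
      lemma₃ = solve-∀ ℚ-ring
      final : ⟨ b′ , c′ ⟩ + ratio j js b * ⟨ c′ , c′ ⟩ ≡ 0ℚ
      final = go (⟨ c′ , c′ ⟩ ≟ 0ℚ)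
        where
        go : Dec (⟨ c′ , c′ ⟩ ≡ 0ℚ) → ⟨ b′ , c′ ⟩ + ratio j js b * ⟨ c′ , c′ ⟩ ≡ 0ℚ
        go (yes eq) = trans (lemma₁ ⟨ b′ , c′ ⟩ (inv ⟨ c′ , c′ ⟩) ⟨ c′ , c′ ⟩)
             (trans (cong (λ t → t - t * (⟨ c′ , c′ ⟩ * inv ⟨ c′ , c′ ⟩)) (null-⊥ b′ eq)) (lemma₃ (⟨ c′ , c′ ⟩ * inv ⟨ c′ , c′ ⟩)))
        go (no n≢0) = trans (lemma₁ ⟨ b′ , c′ ⟩ (inv ⟨ c′ , c′ ⟩) ⟨ c′ , c′ ⟩)
             (trans (cong (λ z → ⟨ b′ , c′ ⟩ - ⟨ b′ , c′ ⟩ * z) (inv-r≢ n≢0)) (lemma₂ ⟨ b′ , c′ ⟩))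

    res : List J → (X → ℚ) → ℚ
    res js b = ⟨ perp js b , perp js b ⟩

    res≡ : ∀ js b → res js b ≡ ⟨ perp js b , b ⟩
    res≡ js b = perp-≈ js b (perp-⊥ js b)

    res-sub : ∀ {V V′} → (∀ {k} → k ∈ V′ → k ∈ V) → ∀ b →
      ⟨ perp V′ b ⊕ (- 1ℚ ⊙ perp V b) , perp V′ b ⊕ (- 1ℚ ⊙ perp V b) ⟩ ≡ res V′ b - res V b
    res-sub {V} {V′} V′⊆V b = trans (sq-sub (perp V′ b) (- 1ℚ) (perp V b))
      (trans (cong (λ z → res V′ b + ι 2 * - 1ℚ * z + - 1ℚ * - 1ℚ * res V b)
               (trans (comm (perp V′ b) (perp V b)) (trans (perp-≈ V′ b (λ m → perp-⊥ V b (V′⊆V m))) (sym (res≡ V b)))))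
             (lemma (res V′ b) (res V b)))
      where
      lemma : ∀ x y → x + ι 2 * - 1ℚ * y + - 1ℚ * - 1ℚ * y ≡ x - y
      lemma = solve-∀ ℚ-ring

    res-mono : ∀ {V V′} → (∀ {k} → k ∈ V′ → k ∈ V) → ∀ b → res V b ≤ res V′ b
    res-mono {V} {V′} V′⊆V b = ≤-by (res V′ b - res V b) (subst (0ℚ ≤_) (res-sub V′⊆V b) (nonneg _)) (lemma (res V b) (res V′ b))
      where
      lemma : ∀ y x → x ≡ y + (x - y)
      lemma = solve-∀ ℚ-ring

    -- The hypotheses say that f lies in the span of V and is orthogonal to V′.
    res-drop : ∀ {V V′} → (∀ {k} → k ∈ V′ → k ∈ V) → ∀ b f → (∀ z → z ⊥ V → ⟨ z , f ⟩ ≡ 0ℚ) → f ⊥ V′ →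
               ⟨ b , f ⟩ * ⟨ b , f ⟩ ≤ ⟨ f , f ⟩ * (res V′ b - res V b)
    res-drop {V} {V′} V′⊆V b f f∈V f⊥V′ =
      subst₂ _≤_ (cong₂ _*_ eq eq) (cong (⟨ f , f ⟩ *_) (res-sub V′⊆V b))
        (cauchy-schwarz f (perp V′ b ⊕ (- 1ℚ ⊙ perp V b)))
      where
      lemma : ∀ x → x + - 1ℚ * 0ℚ ≡ x
      lemma = solve-∀ ℚ-ring
      eq : ⟨ f , perp V′ b ⊕ (- 1ℚ ⊙ perp V b) ⟩ ≡ ⟨ b , f ⟩
      eq = trans (subʳ (perp V′ b) (- 1ℚ) (perp V b) f)
           (trans (cong₂ (λ y z → y + - 1ℚ * z) (trans (perp-≈ V′ b f⊥V′) (comm f b))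
                         (trans (comm f (perp V b)) (f∈V (perp V b) (perp-⊥ V b))))
                  (lemma ⟨ b , f ⟩))

-- Expanding (a - κ a′)² shows it to be at least (1 - κ)(a² - a′²), and at least (1 - κ) a² if a a′
-- ≤ 0; dividing by 1 - κ gives `rest` and `flip`. For κ = 1 the hypothesis forces a = a′.
shrinks : ∀ {a a′ E E′ κ} → a * a ≤ E → a′ * a′ ≤ E′ → E′ ≤ E → 0ℚ ≤ κ → κ ≤ 1ℚ →
          (a - κ * a′) * (a - κ * a′) ≤ (1ℚ - κ) * (E - E′) → Shrinks a a′ E E′
shrinks {a} {a′} {E} {E′} {κ} old new E′≤E 0≤κ κ≤1 drop with κ ≟ 1ℚ
... | yes refl = record
  { old = old ; new = new ; total = E′≤E
  ; rest = subst (λ z → E′ - z * z ≤ E - a * a) a≡a′ (+-monoˡ-≤ (- (a * a)) E′≤E)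
  ; flip = λ aa′≤0 → ≤-by (E - E′) (0≤- E′≤E)
      (trans (cong (λ z → E - z * z) (sq≡0⇒≡0 a (subst (λ z → a * z ≤ 0ℚ) (sym a≡a′) aa′≤0))) (lemma₂ E E′)) }
  where
  lemma₁ : ∀ a a′ → a ≡ (a - 1ℚ * a′) + a′
  lemma₁ = solve-∀ ℚ-ring
  lemma₂ : ∀ E E′ → E - 0ℚ * 0ℚ ≡ E′ + (E - E′)
  lemma₂ = solve-∀ ℚ-ring
  lemma₃ : ∀ x → (1ℚ - 1ℚ) * x ≡ 0ℚ
  lemma₃ = solve-∀ ℚ-ring
  a≡a′ : a ≡ a′
  a≡a′ = trans (lemma₁ a a′) (trans (cong (_+ a′) (sq≡0⇒≡0 (a - 1ℚ * a′) (≤-≡-trans drop (lemma₃ (E - E′))))) (+-identityˡ a′))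
... | no κ≢1 = record
  { old = old ; new = new ; total = E′≤E
  ; rest = ≤-by (E - E′ - (a * a - a′ * a′)) (0≤- (*-cancelˡ (1ℚ - κ) 0<1-κ (≤-trans
      (≤-by (κ * ((a - a′) * (a - a′)) + (1ℚ - κ) * (1ℚ - κ) * (a′ * a′))
            (0≤+ (0≤* 0≤κ (0≤sq (a - a′))) (0≤* (0≤sq (1ℚ - κ)) (0≤sq a′))) (lemma₁ a a′ κ)) drop)))
      (lemma₂ E E′ (a * a) (a′ * a′))
  ; flip = λ aa′≤0 → ≤-by (E - E′ - a * a) (0≤- (*-cancelˡ (1ℚ - κ) 0<1-κ (≤-trans
      (≤-by (κ * (a * a) + ι 2 * (κ * - (a * a′)) + (κ * a′) * (κ * a′))
            (0≤+ (0≤+ (0≤* 0≤κ (0≤sq a)) (0≤* (0≤ι 2) (0≤* 0≤κ (0≤neg aa′≤0)))) (0≤sq (κ * a′))) (lemma₃ a a′ κ)) drop)))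
      (lemma₄ E E′ (a * a)) }
  where
  lemma₁ : ∀ a a′ κ → (a - κ * a′) * (a - κ * a′)
    ≡ (1ℚ - κ) * (a * a - a′ * a′) + (κ * ((a - a′) * (a - a′)) + (1ℚ - κ) * (1ℚ - κ) * (a′ * a′))
  lemma₁ = solve-∀ ℚ-ring
  lemma₂ : ∀ E E′ x y → E - x ≡ E′ - y + (E - E′ - (x - y))
  lemma₂ = solve-∀ ℚ-ring
  lemma₃ : ∀ a a′ κ → (a - κ * a′) * (a - κ * a′)
    ≡ (1ℚ - κ) * (a * a) + (κ * (a * a) + ι 2 * (κ * - (a * a′)) + (κ * a′) * (κ * a′))
  lemma₃ = solve-∀ ℚ-ring
  lemma₄ : ∀ E E′ x → E - x ≡ E′ + (E - E′ - x)
  lemma₄ = solve-∀ ℚ-ring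
  0<1-κ : 0ℚ < 1ℚ - κ
  0<1-κ = 0<- (≤∧≢⇒< κ≤1 κ≢1)

module Energy {X : Set} (H : SemiInner X) {J : Set} (c : J → X → ℚ)
              (c≤1 : ∀ j → SemiInner.⟨_,_⟩ H (c j) (c j) ≤ 1ℚ) where
  open Inner H public
  open Projection c public

  normal : J → List J → X → ℚ
  normal p W = perp W (c p)

  -- By Pythagoras, the squared length of the projection of `b` to the span of the columns in `V`.
  energy : List J → (X → ℚ) → ℚ
  energy V b = ⟨ b , b ⟩ - res V b

  normal-⊥ : ∀ p W → normal p W ⊥ W
  normal-⊥ p W = perp-⊥ W (c p)

  normal-span : ∀ p W z → z ⊥ (p ∷ W) → ⟨ z , normal p W ⟩ ≡ 0ℚ
  normal-span p W z z⊥ = trans (perp-≈ W (c p) (λ m → z⊥ (there m))) (z⊥ (here refl))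

  normal≤1 : ∀ p W → ⟨ normal p W , normal p W ⟩ ≤ 1ℚ
  normal≤1 p W = ≤-trans (res-mono {W} {[]} (λ ()) (c p)) (c≤1 p)

  energy-mono : ∀ {V V′} → (∀ {k} → k ∈ V′ → k ∈ V) → ∀ b → energy V′ b ≤ energy V b
  energy-mono V′⊆V b = +-monoʳ-≤ ⟨ b , b ⟩ (neg-antimono-≤ (res-mono V′⊆V b))

  energy-nonNeg : ∀ V b → 0ℚ ≤ energy V b
  energy-nonNeg V b = 0≤- (res-mono {V} {[]} (λ ()) b)

  energy-≤ : ∀ V b → energy V b ≤ ⟨ b , b ⟩
  energy-≤ V b = ≤-by (res V b) (nonneg (perp V b)) (lemma ⟨ b , b ⟩ (res V b))
    where
    lemma : ∀ x y → x ≡ x - y + y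
    lemma = solve-∀ ℚ-ring

  -- Bessel's inequality for the unit-length-bounded vector normal p W ⊥ W.
  energy-pivot : ∀ p W b → ⟨ b , normal p W ⟩ * ⟨ b , normal p W ⟩ ≤ energy (p ∷ W) b - energy W b
  energy-pivot p W b = ≤-trans (res-drop {p ∷ W} {W} there b (normal p W) (normal-span p W) (normal-⊥ p W))
    (≤-trans (*-monoʳ (res W b - res (p ∷ W) b) (0≤- (res-mono {p ∷ W} {W} there b)) (normal≤1 p W))
             (≤-reflexive (lemma ⟨ b , b ⟩ (res W b) (res (p ∷ W) b))))
    where
    lemma : ∀ x y z → 1ℚ * (y - z) ≡ x - z - (x - y)
    lemma = solve-∀ ℚ-ring

  pivot²≤energy : ∀ p W b → ⟨ b , normal p W ⟩ * ⟨ b , normal p W ⟩ ≤ energy (p ∷ W) b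
  pivot²≤energy p W b = ≤-trans (energy-pivot p W b) (≤-by (energy W b) (energy-nonNeg W b) (lemma (energy (p ∷ W) b) (energy W b)))
    where
    lemma : ∀ x y → x ≡ x - y + y
    lemma = solve-∀ ℚ-ring

  -- With g and g′ the normals before and after, κ = |g|²/|g′|² makes f = g - κ g′ orthogonal to the
  -- pivot column and to W′, while f stays in the old span and |f|² = |g|²(1 - κ). Bessel's
  -- inequality for f is the hypothesis of `shrinks`.
  pivot-shrinks : ∀ p {W W′} → (∀ {k} → k ∈ W′ → k ∈ W) → ∀ b →
    Shrinks ⟨ b , normal p W ⟩ ⟨ b , normal p W′ ⟩ (energy (p ∷ W) b) (energy (p ∷ W′) b)
  pivot-shrinks p {W} {W′} W′⊆W b = shrinks (pivot²≤energy p W b) (pivot²≤energy p W′ b) (energy-mono V′⊆V b)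
    (0≤* (nonneg g) (inv-nonNeg (nonneg g′))) κ≤1 drop
    where
    g = normal p W
    g′ = normal p W′
    ρ = ⟨ g , g ⟩
    ρ′ = ⟨ g′ , g′ ⟩
    κ = ρ * inv ρ′
    V′⊆V : ∀ {k} → k ∈ p ∷ W′ → k ∈ p ∷ W
    V′⊆V (here eq) = here eq
    V′⊆V (there m) = there (W′⊆W m)
    ρ≤ρ′ : ρ ≤ ρ′
    ρ≤ρ′ = res-mono W′⊆W (c p)
    f = g ⊕ (- κ ⊙ g′)
    l0 : ∀ x → x - x * 1ℚ ≡ 0ℚ
    l0 = solve-∀ ℚ-ring
    l1 : ∀ x i y → x + - (x * i) * y ≡ x - x * (y * i)
    l1 = solve-∀ ℚ-ring
    l2 : ∀ y → 0ℚ - 0ℚ * y ≡ 0ℚ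
    l2 = solve-∀ ℚ-ring
    l3 : ∀ k → 0ℚ + - k * 0ℚ ≡ 0ℚ
    l3 = solve-∀ ℚ-ring
    κρ′ : Dec (ρ′ ≡ 0ℚ) → ρ + - κ * ρ′ ≡ 0ℚ
    κρ′ (yes eq) = trans (l1 ρ (inv ρ′) ρ′) (trans (cong (λ x → x - x * (ρ′ * inv ρ′)) ρ≡0) (l2 (ρ′ * inv ρ′)))
      where
      ρ≡0 : ρ ≡ 0ℚ
      ρ≡0 = ≤-antisym (≤-≡-trans ρ≤ρ′ eq) (nonneg g)
    κρ′ (no neq) = trans (l1 ρ (inv ρ′) ρ′) (trans (cong (λ z → ρ - ρ * z) (inv-r≢ neq)) (l0 ρ))
    κ≤1′ : Dec (ρ′ ≡ 0ℚ) → κ ≤ 1ℚ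
    κ≤1′ (yes eq) = ≤-trans (≤-reflexive (trans (cong (_* inv ρ′) (≤-antisym (≤-≡-trans ρ≤ρ′ eq) (nonneg g))) (*-zeroˡ (inv ρ′)))) 0≤1
    κ≤1′ (no neq) = ≤-≡-trans (*-monoʳ (inv ρ′) (inv-nonNeg (nonneg g′)) ρ≤ρ′) (inv-r≢ neq)
    κ≤1 = κ≤1′ (ρ′ ≟ 0ℚ)
    f-p : ⟨ f , c p ⟩ ≡ 0ℚ
    f-p = trans (subˡ g (- κ) g′ (c p)) (trans (cong₂ (λ x y → x + - κ * y) (sym (res≡ W (c p))) (sym (res≡ W′ (c p)))) (κρ′ (ρ′ ≟ 0ℚ)))
    f⊥W′ : f ⊥ W′
    f⊥W′ m = trans (subˡ g (- κ) g′ _) (trans (cong₂ (λ x y → x + - κ * y) (normal-⊥ p W (W′⊆W m)) (normal-⊥ p W′ m)) (l3 κ))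
    f⊥V′ : f ⊥ (p ∷ W′)
    f⊥V′ (here refl) = f-p
    f⊥V′ (there m) = f⊥W′ m
    f∈V : ∀ z → z ⊥ (p ∷ W) → ⟨ z , f ⟩ ≡ 0ℚ
    f∈V z z⊥ = trans (subʳ g (- κ) g′ z) (trans (cong₂ (λ x y → x + - κ * y) (normal-span p W z z⊥)
                 (normal-span p W′ z (λ m → z⊥ (V′⊆V m)))) (l3 κ))
    l4 : ∀ x k → x + - k * x + - k * 0ℚ ≡ x * (1ℚ - k)
    l4 = solve-∀ ℚ-ring
    f² : ⟨ f , f ⟩ ≡ ρ * (1ℚ - κ)
    f² = trans (subʳ g (- κ) g′ f) (trans (cong₂ (λ x y → x + - κ * y)
           (trans (subˡ g (- κ) g′ g) (cong (λ z → ρ + - κ * z) (trans (comm g′ g) (trans (perp-≈ W′ (c p) (λ m → normal-⊥ p W (W′⊆W m))) (sym (res≡ W (c p)))))))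
           (trans (perp-≈ W′ (c p) f⊥W′) f-p)) (l4 ρ κ))
    l5 : ∀ x k y → x + - k * y ≡ x - k * y
    l5 = solve-∀ ℚ-ring
    bf : ⟨ b , f ⟩ ≡ ⟨ b , g ⟩ - κ * ⟨ b , g′ ⟩
    bf = trans (subʳ g (- κ) g′ b) (l5 ⟨ b , g ⟩ κ ⟨ b , g′ ⟩)
    l6 : ∀ x y z → y - z ≡ x - z - (x - y)
    l6 = solve-∀ ℚ-ring
    l7 : ∀ k → 1ℚ * (1ℚ - k) ≡ 1ℚ - k
    l7 = solve-∀ ℚ-ring
    drop : (⟨ b , g ⟩ - κ * ⟨ b , g′ ⟩) * (⟨ b , g ⟩ - κ * ⟨ b , g′ ⟩) ≤ (1ℚ - κ) * (energy (p ∷ W) b - energy (p ∷ W′) b)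
    drop = subst₂ _≤_ (cong₂ _*_ bf bf) (cong ((1ℚ - κ) *_) (l6 ⟨ b , b ⟩ (res (p ∷ W′) b) (res (p ∷ W) b)))
      (≤-trans (res-drop {p ∷ W} {p ∷ W′} V′⊆V b f f∈V f⊥V′)
               (*-monoʳ (res (p ∷ W′) b - res (p ∷ W) b) (0≤- (res-mono V′⊆V b))
                 (≡-≤-trans f² (≤-≡-trans (*-monoʳ (1ℚ - κ) (0≤- κ≤1) (normal≤1 p W)) (l7 κ)))))

-- Removal from lists and the Kronecker delta

module _ {J : Set} where

  remove : ∀ {j : J} (W : List J) → j ∈ W → List J
  remove (_ ∷ W) (here _)  = W
  remove (k ∷ W) (there m) = k ∷ remove W m

  remove-⊆ : ∀ {j : J} W (m : j ∈ W) {k} → k ∈ remove W m → k ∈ W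
  remove-⊆ (_ ∷ W) (here _) k∈ = there k∈
  remove-⊆ (_ ∷ W) (there m) (here eq) = here eq
  remove-⊆ (_ ∷ W) (there m) (there k∈) = there (remove-⊆ W m k∈)

  remove-split : ∀ {j : J} W (m : j ∈ W) {k} → k ∈ W → k ≡ j ⊎ k ∈ remove W m
  remove-split (_ ∷ W) (here refl) (here refl) = inj₁ refl
  remove-split (_ ∷ W) (here _) (there k∈) = inj₂ k∈
  remove-split (_ ∷ W) (there m) (here eq) = inj₂ (here eq)
  remove-split (_ ∷ W) (there m) (there k∈) with remove-split W m k∈
  ... | inj₁ eq = inj₁ eq
  ... | inj₂ k∈′ = inj₂ (there k∈′)

  remove-length : ∀ {j : J} W (m : j ∈ W) → suc (length (remove W m)) ≡ length W
  remove-length (_ ∷ W) (here _) = refl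
  remove-length (_ ∷ W) (there m) = cong suc (remove-length W m)

  All-remove : ∀ {P : J → Set} {j : J} W (m : j ∈ W) → All P W → All P (remove W m)
  All-remove (_ ∷ W) (here _) (_ ∷ ps) = ps
  All-remove (_ ∷ W) (there m) (p ∷ ps) = p ∷ All-remove W m ps

  Unique-remove : ∀ {j : J} W (m : j ∈ W) → Unique W → Unique (remove W m)
  Unique-remove (_ ∷ W) (here _) (_ ∷ u) = u
  Unique-remove (_ ∷ W) (there m) (p ∷ u) = All-remove W m p ∷ Unique-remove W m u

kron : ∀ {n} → Fin n → Fin n → ℚ
kron zero    zero    = 1ℚ
kron zero    (suc _) = 0ℚ
kron (suc _) zero    = 0ℚ
kron (suc j) (suc k) = kron j k

kron-≡ : ∀ {n} (j : Fin n) → kron j j ≡ 1ℚ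
kron-≡ zero = refl
kron-≡ (suc j) = kron-≡ j

kron-≢ : ∀ {n} {j k : Fin n} → j ≢ k → kron j k ≡ 0ℚ
kron-≢ {j = zero} {zero} neq = ⊥-elim (neq refl)
kron-≢ {j = zero} {suc k} neq = refl
kron-≢ {j = suc j} {zero} neq = refl
kron-≢ {j = suc j} {suc k} neq = kron-≢ (λ eq → neq (cong suc eq))

sum-allFin : ∀ {n} (f : Fin (suc n) → ℚ) → sumᴸ (allFin (suc n)) f ≡ f zero + ∑[ k ∈ allFin n ] f (suc k)
sum-allFin {n} f = cong (f zero +_) (trans (cong (λ xs → sumᴸ xs f) (sym (Listₚ.map-tabulate (λ k → k) suc))) (sum-map suc (allFin n) f))

sum-kron : ∀ {n} (j : Fin n) (f : Fin n → ℚ) → ∑[ k ∈ allFin n ] (kron j k * f k) ≡ f j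
sum-kron {suc n} zero f = trans (sum-allFin (λ k → kron zero k * f k))
  (trans (cong (1ℚ * f zero +_) (trans (sum-cong (allFin n) (λ k → *-zeroˡ (f (suc k)))) (sum-0 (allFin n)))) (lemma (f zero)))
  where
  lemma : ∀ x → 1ℚ * x + 0ℚ ≡ x
  lemma = solve-∀ ℚ-ring
sum-kron {suc n} (suc j) f = trans (sum-allFin (λ k → kron (suc j) k * f k))
  (trans (cong₂ _+_ (*-zeroˡ (f zero)) (sum-kron j (λ k → f (suc k)))) (+-identityˡ (f (suc j))))

-- Moving to the boundary of the cube

IsSign : ℚ → Set
IsSign x = x ≡ 1ℚ ⊎ x ≡ - 1ℚ

Bounded-between : ∀ {x u s t} → 0ℚ ≤ s → s ≤ t → Bounded x → Bounded (x + t * u) → Bounded (x + s * u)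
Bounded-between {x} {u} {s} {t} 0≤s s≤t (p , q) (p′ , q′) with ≤-total 0ℚ u
... | inj₁ 0≤u = ≤-trans p (≤-by (s * u) (0≤* 0≤s 0≤u) (l₁ x s u)) , ≤-trans q′ (≤-by ((t - s) * u) (0≤* (0≤- s≤t) 0≤u) (l₂ x s t u))
  where
  l₁ : ∀ x s u → 1ℚ + (x + s * u) ≡ 1ℚ + x + s * u
  l₁ = solve-∀ ℚ-ring
  l₂ : ∀ x s t u → 1ℚ - (x + s * u) ≡ 1ℚ - (x + t * u) + (t - s) * u
  l₂ = solve-∀ ℚ-ring
... | inj₂ u≤0 = ≤-trans p′ (≤-by ((t - s) * - u) (0≤* (0≤- s≤t) (0≤neg u≤0)) (l₂ x s t u)) , ≤-trans q (≤-by (s * - u) (0≤* 0≤s (0≤neg u≤0)) (l₁ x s u))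
  where
  l₁ : ∀ x s u → 1ℚ - (x + s * u) ≡ 1ℚ - x + s * - u
  l₁ = solve-∀ ℚ-ring
  l₂ : ∀ x s t u → 1ℚ + (x + s * u) ≡ 1ℚ + (x + t * u) + (t - s) * - u
  l₂ = solve-∀ ℚ-ring

exit-time : ∀ {y t u} → 0ℚ ≤ y → 0ℚ ≤ t → y < t * u → ∃[ s ] 0ℚ ≤ s × s ≤ t × s * u ≡ y
exit-time {y} {t} {u} 0≤y 0≤t y<tu = s , 0≤* 0≤y (<⇒≤ (inv-pos 0<u)) , s≤t , su≡y
  where
  0<u : 0ℚ < u
  0<u with 0ℚ <? u
  ... | yes p = p
  ... | no ¬p = ⊥-elim (<⇒≱ (≤-<-trans 0≤y y<tu) (≤-≡-trans (*-monoˡ t 0≤t (≮⇒≥ ¬p)) (*-zeroʳ t)))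
  s = y * inv u
  l₁ : ∀ y u i → y * i * u ≡ y * (u * i)
  l₁ = solve-∀ ℚ-ring
  su≡y : s * u ≡ y
  su≡y = trans (l₁ y u (inv u)) (trans (cong (y *_) (inv-r 0<u)) (*-identityʳ y))
  s≤t : s ≤ t
  s≤t = *-cancelˡ u 0<u (subst₂ _≤_ (trans (sym su≡y) (*-comm s u)) (*-comm t u) (<⇒≤ y<tu))

module _ {J : Set} (x u : J → ℚ) where

  private
    at : ℚ → J → ℚ
    at t k = x k + t * u k

  -- The time is shortened one coordinate at a time: if the next coordinate has left [-1, 1] by time
  -- t, its exit time replaces t, and convexity keeps the coordinates treated before inside.
  boundary : ∀ L → (∀ {k} → k ∈ L → Bounded (x k)) → ∀ {t₀} → 0ℚ ≤ t₀ →
             ∃[ t ] 0ℚ ≤ t × (∀ {k} → k ∈ L → Bounded (at t k)) × (t ≡ t₀ ⊎ (∃[ k ] k ∈ L × IsSign (at t k)))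
  boundary [] _ {t₀} 0≤t₀ = t₀ , 0≤t₀ , (λ ()) , inj₁ refl
  boundary (k ∷ L) bd {t₀} 0≤t₀ with boundary L (λ m → bd (there m)) 0≤t₀
  ... | t , 0≤t , bt , hit with 0ℚ ≤? 1ℚ + at t k | 0ℚ ≤? 1ℚ - at t k
  ... | yes p | yes q = t , 0≤t , (λ { (here refl) → p , q ; (there m) → bt m }) ,
        (case hit)
    where
    case : t ≡ t₀ ⊎ (∃[ k ] k ∈ L × IsSign (at t k)) → t ≡ t₀ ⊎ (∃[ k′ ] k′ ∈ k ∷ L × IsSign (at t k′))
    case (inj₁ eq) = inj₁ eq
    case (inj₂ (k′ , m , sg)) = inj₂ (k′ , there m , sg)
  ... | yes _ | no ¬q =
    let s , 0≤s , s≤t , su = exit-time {1ℚ - x k} {t} {u k} (proj₂ (bd (here refl))) 0≤t (<-by _ (0<- (≰⇒> ¬q)) (l (x k) (t * u k)))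
        eq : at s k ≡ 1ℚ
        eq = trans (cong (x k +_) su) (l′ (x k))
    in s , 0≤s , (λ { (here refl) → subst Bounded (sym eq) (0≤ι 2 , ≤-refl) ; (there m) → Bounded-between {x _} {u _} 0≤s s≤t (bd (there m)) (bt m) })
         , inj₂ (k , here refl , inj₁ eq)
    where
    l : ∀ x y → y ≡ 1ℚ - x + (0ℚ - (1ℚ - (x + y)))
    l = solve-∀ ℚ-ring
    l′ : ∀ x → x + (1ℚ - x) ≡ 1ℚ
    l′ = solve-∀ ℚ-ring
  ... | no ¬p | _ =
    let s , 0≤s , s≤t , su = exit-time {1ℚ + x k} {t} { - u k} (proj₁ (bd (here refl))) 0≤t (<-by _ (0<- (≰⇒> ¬p)) (l (x k) t (u k)))
        eq : at s k ≡ - 1ℚ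
        eq = trans (l″ (x k) s (u k)) (trans (cong (λ z → x k - z) su) (l′ (x k)))
    in s , 0≤s , (λ { (here refl) → subst Bounded (sym eq) (≤-refl , 0≤ι 2) ; (there m) → Bounded-between {x _} {u _} 0≤s s≤t (bd (there m)) (bt m) })
         , inj₂ (k , here refl , inj₂ eq)
    where
    l : ∀ x t u → t * - u ≡ 1ℚ + x + (0ℚ - (1ℚ + (x + t * u)))
    l = solve-∀ ℚ-ring
    l′ : ∀ x → x - (1ℚ + x) ≡ - 1ℚ
    l′ = solve-∀ ℚ-ring
    l″ : ∀ x s u → x + s * u ≡ x - s * - u
    l″ = solve-∀ ℚ-ring

  -- The coordinate p moves at unit speed in an interval of length 2. If nothing is hit before time
  -- 2, then p has crossed the whole interval and is itself at an end.
  hit-boundary : ∀ L → (∀ {k} → k ∈ L → Bounded (x k)) → ∀ {p} → p ∈ L → IsSign (u p) →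
             ∃[ t ] 0ℚ ≤ t × (∀ {k} → k ∈ L → Bounded (at t k)) × (∃[ k ] k ∈ L × IsSign (at t k))
  hit-boundary L bd {p} p∈ sgn with boundary L bd (0≤ι 2)
  ... | t , 0≤t , bt , inj₂ hit = t , 0≤t , bt , hit
  ... | t , 0≤t , bt , inj₁ refl = t , 0≤t , bt , p , p∈ , at2 sgn (bd p∈) (bt p∈)
    where
    at2 : IsSign (u p) → Bounded (x p) → Bounded (x p + ι 2 * u p) → IsSign (x p + ι 2 * u p)
    at2 (inj₁ eq) (q , _) (_ , q′) rewrite eq = inj₁ (trans (≤-antisym (≤-by _ q′ (l₁ (x p))) (≤-by _ q (l₂ (x p)))) refl)
      where
      l₁ : ∀ x → 1ℚ ≡ x + ι 2 * 1ℚ + (1ℚ - (x + ι 2 * 1ℚ))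
      l₁ = solve-∀ ℚ-ring
      l₂ : ∀ x → x + ι 2 * 1ℚ ≡ 1ℚ + (1ℚ + x)
      l₂ = solve-∀ ℚ-ring
    at2 (inj₂ eq) (_ , q) (q′ , _) rewrite eq = inj₂ (≤-antisym (≤-by _ q (l₂ (x p))) (≤-by _ q′ (l₁ (x p))))
      where
      l₁ : ∀ x → x + ι 2 * - 1ℚ ≡ - 1ℚ + (1ℚ + (x + ι 2 * - 1ℚ))
      l₁ = solve-∀ ℚ-ring
      l₂ : ∀ x → - 1ℚ ≡ x + ι 2 * - 1ℚ + (1ℚ - x)
      l₂ = solve-∀ ℚ-ring

-- The derandomised Gram-Schmidt walk

module Walk {X : Set} (H : SemiInner X) {n : ℕ} (c : Fin n → X → ℚ)
            (c≤1 : ∀ j → SemiInner.⟨_,_⟩ H (c j) (c j) ≤ 1ℚ)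
            {I : Set} (is : List I) (b : I → X → ℚ) (r : ℕ) where
  open Energy H c c≤1

  all : List (Fin n)
  all = allFin n

  Y : (Fin n → ℚ) → I → ℚ
  Y x i = ∑[ k ∈ all ] (x k * ⟨ b i , c k ⟩)

  -- Coefficients of the correction `perp js v - v` in the columns. They turn the geometric
  -- direction `normal p W` into a direction in the cube.
  coef : List (Fin n) → (X → ℚ) → Fin n → ℚ
  coef []       v k = 0ℚ
  coef (j ∷ js) v k = coef js v k + ratio j js v * (kron j k + coef js (c j) k)

  coef-spec : ∀ js v z → ⟨ z , perp js v ⟩ ≡ ⟨ z , v ⟩ + ∑[ k ∈ all ] (coef js v k * ⟨ z , c k ⟩)
  coef-spec [] v z = sym (trans (cong (⟨ z , v ⟩ +_) (trans (sum-cong all (λ k → *-zeroˡ ⟨ z , c k ⟩)) (sum-0 all))) (+-identityʳ _))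
  coef-spec (j ∷ js) v z = trans (subʳ (perp js v) ρ (perp js (c j)) z)
    (trans (cong₂ (λ y w → y + ρ * w) (coef-spec js v z) (coef-spec js (c j) z))
    (trans (l ⟨ z , v ⟩ ρ ⟨ z , c j ⟩ s₁ s₂)
    (cong (⟨ z , v ⟩ +_) (sym eq))))
    where
    ρ = ratio j js v
    s₁ = ∑[ k ∈ all ] (coef js v k * ⟨ z , c k ⟩)
    s₂ = ∑[ k ∈ all ] (coef js (c j) k * ⟨ z , c k ⟩)
    l : ∀ a ρ b s t → a + s + ρ * (b + t) ≡ a + (s + ρ * (b + t))
    l = solve-∀ ℚ-ring
    l′ : ∀ x ρ d y w → (x + ρ * (d + y)) * w ≡ x * w + ρ * (d * w + y * w)
    l′ = solve-∀ ℚ-ring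
    eq : ∑[ k ∈ all ] (coef (j ∷ js) v k * ⟨ z , c k ⟩) ≡ s₁ + ρ * (⟨ z , c j ⟩ + s₂)
    eq = trans (sum-cong all (λ k → l′ (coef js v k) ρ (kron j k) (coef js (c j) k) ⟨ z , c k ⟩))
         (trans (sum-+ all _ _) (cong (s₁ +_) (trans (sum-*ˡ all ρ _) (cong (ρ *_)
         (trans (sum-+ all _ _) (cong (_+ s₂) (sum-kron j (λ k → ⟨ z , c k ⟩))))))))

  coef-supp : ∀ js v {k} → k ∉ js → coef js v k ≡ 0ℚ
  coef-supp [] v k∉ = refl
  coef-supp (j ∷ js) v {k} k∉ = trans (cong₂ (λ y w → y + ratio j js v * w) (coef-supp js v (λ m → k∉ (there m)))
      (cong₂ _+_ (kron-≢ {j = j} (λ eq → k∉ (here (sym eq)))) (coef-supp js (c j) (λ m → k∉ (there m))))) (l (ratio j js v))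
    where
    l : ∀ ρ → 0ℚ + ρ * (0ℚ + 0ℚ) ≡ 0ℚ
    l = solve-∀ ℚ-ring

  dir : Fin n → List (Fin n) → Fin n → ℚ
  dir p W k = kron p k + coef W (c p) k

  dir-Y : ∀ p W i → Y (dir p W) i ≡ ⟨ b i , normal p W ⟩
  dir-Y p W i = trans (sum-cong all (λ k → *-distribʳ-+ ⟨ b i , c k ⟩ (kron p k) (coef W (c p) k)))
    (trans (sum-+ all _ _) (trans (cong (_+ ∑[ k ∈ all ] (coef W (c p) k * ⟨ b i , c k ⟩)) (sum-kron p (λ k → ⟨ b i , c k ⟩)))
           (sym (coef-spec W (c p) (b i)))))

  dir-pivot : ∀ {p W} → p ∉ W → dir p W p ≡ 1ℚ
  dir-pivot {p} {W} p∉ = trans (cong₂ _+_ (kron-≡ p) (coef-supp W (c p) p∉)) (+-identityʳ 1ℚ)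

  dir-supp : ∀ {p W k} → k ∉ (p ∷ W) → dir p W k ≡ 0ℚ
  dir-supp {p} {W} {k} k∉ = trans (cong₂ _+_ (kron-≢ {j = p} (λ eq → k∉ (here (sym eq)))) (coef-supp W (c p) (λ m → k∉ (there m)))) (+-identityʳ 0ℚ)

  Y-move : ∀ x u t i → Y (λ k → x k + t * u k) i ≡ Y x i + t * Y u i
  Y-move x u t i = trans (sum-cong all (λ k → l (x k) t (u k) ⟨ b i , c k ⟩))
    (trans (sum-+ all _ _) (cong (Y x i +_) (sum-*ˡ all t _)))
    where
    l : ∀ x t u a → (x + t * u) * a ≡ x * a + t * (u * a)
    l = solve-∀ ℚ-ring

  pivot : Fin n → List (Fin n) → I → ℚ
  pivot p W i = ⟨ b i , normal p W ⟩

  -- The energy that the pivot direction does not use. It stands for the future of the walk and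
  -- enters Ψ as a deterministic variance.
  spare : Fin n → List (Fin n) → I → ℚ
  spare p W i = noise r * (energy (p ∷ W) (b i) - pivot p W i * pivot p W i)

  0≤spare : ∀ p W i → 0ℚ ≤ spare p W i
  0≤spare p W i = 0≤* (0≤noise r) (0≤- (pivot²≤energy p W (b i)))

  x₀ : Fin n → ℚ
  x₀ _ = 0ℚ

  Y₀ : ∀ i → Y x₀ i ≡ 0ℚ
  Y₀ i = trans (sum-cong all (λ k → *-zeroˡ ⟨ b i , c k ⟩)) (sum-0 all)

  -- Along the walk the two arguments of the powers in Ψ are constant, so Ψ is affine.
  slope : Fin n → List (Fin n) → (Fin n → ℚ) → I → ℚ
  slope p W x i = ((Y x i + a * (1ℚ - x p)) * (Y x i + a * (1ℚ - x p)) + v) ^ℚ suc r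
                - ((Y x i - a * (1ℚ + x p)) * (Y x i - a * (1ℚ + x p)) + v) ^ℚ suc r
    where
    a = pivot p W i
    v = spare p W i

  Ψ-affine : ∀ x t Y a v → Ψ r (x + t) (Y + t * a) a v ≡ Ψ r x Y a v
     + t * (((Y + a * (1ℚ - x)) * (Y + a * (1ℚ - x)) + v) ^ℚ suc r - ((Y - a * (1ℚ + x)) * (Y - a * (1ℚ + x)) + v) ^ℚ suc r)
  Ψ-affine x t Y a v = trans
    (cong₂ (λ y z → (1ℚ + (x + t)) * (y * y + v) ^ℚ suc r + (1ℚ - (x + t)) * (z * z + v) ^ℚ suc r) (l₁ x t Y a) (l₂ x t Y a))
    (l₃ x t (((Y + a * (1ℚ - x)) * (Y + a * (1ℚ - x)) + v) ^ℚ suc r) (((Y - a * (1ℚ + x)) * (Y - a * (1ℚ + x)) + v) ^ℚ suc r))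
    where
    l₁ : ∀ x t Y a → Y + t * a + a * (1ℚ - (x + t)) ≡ Y + a * (1ℚ - x)
    l₁ = solve-∀ ℚ-ring
    l₂ : ∀ x t Y a → Y + t * a - a * (1ℚ + (x + t)) ≡ Y - a * (1ℚ + x)
    l₂ = solve-∀ ℚ-ring
    l₃ : ∀ x t P M → (1ℚ + (x + t)) * P + (1ℚ - (x + t)) * M ≡ (1ℚ + x) * P + (1ℚ - x) * M + t * (P - M)
    l₃ = solve-∀ ℚ-ring

  final : (Fin n → ℚ) → ℚ
  final x = ∑[ i ∈ is ] (ι 2 * (Y x i * Y x i) ^ℚ suc r)

  Ψ-sign : ∀ {x} → IsSign x → ∀ Y a v → Ψ r x Y a v ≡ ι 2 * (Y * Y + v) ^ℚ suc r
  Ψ-sign (inj₁ refl) Y a v = trans (cong (λ y → (1ℚ + 1ℚ) * (y * y + v) ^ℚ suc r + (1ℚ - 1ℚ) * ((Y - a * (1ℚ + 1ℚ)) * (Y - a * (1ℚ + 1ℚ)) + v) ^ℚ suc r) (l₁ Y a))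
      (l₂ ((Y * Y + v) ^ℚ suc r) (((Y - a * (1ℚ + 1ℚ)) * (Y - a * (1ℚ + 1ℚ)) + v) ^ℚ suc r))
    where
    l₁ : ∀ Y a → Y + a * (1ℚ - 1ℚ) ≡ Y
    l₁ = solve-∀ ℚ-ring
    l₂ : ∀ z w → (1ℚ + 1ℚ) * z + (1ℚ - 1ℚ) * w ≡ ι 2 * z
    l₂ = solve-∀ ℚ-ring
  Ψ-sign (inj₂ refl) Y a v = trans (cong (λ y → (1ℚ + - 1ℚ) * ((Y + a * (1ℚ - - 1ℚ)) * (Y + a * (1ℚ - - 1ℚ)) + v) ^ℚ suc r + (1ℚ - - 1ℚ) * (y * y + v) ^ℚ suc r) (l₁ Y a))
      (l₂ ((Y * Y + v) ^ℚ suc r) (((Y + a * (1ℚ - - 1ℚ)) * (Y + a * (1ℚ - - 1ℚ)) + v) ^ℚ suc r))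
    where
    l₁ : ∀ Y a → Y - a * (1ℚ + - 1ℚ) ≡ Y
    l₁ = solve-∀ ℚ-ring
    l₂ : ∀ z w → (1ℚ + - 1ℚ) * w + (1ℚ - - 1ℚ) * z ≡ ι 2 * z
    l₂ = solve-∀ ℚ-ring

  abstract
    -- A pessimistic estimator of Σ_i 2 Y_i^(2(r+1)): the pivot is resolved to a random sign of mean
    -- `x p` along its direction, and all later moves are replaced by `spare`.
    pot : Fin n → List (Fin n) → (Fin n → ℚ) → ℚ
    pot p W x = ∑[ i ∈ is ] Ψ r (x p) (Y x i) (pivot p W i) (spare p W i)

    total-slope : Fin n → List (Fin n) → (Fin n → ℚ) → ℚ
    total-slope p W x = sumᴸ is (slope p W x)

    pot-move : ∀ p W x t → p ∉ W → pot p W (λ k → x k + t * dir p W k) ≡ pot p W x + t * total-slope p W x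
    pot-move p W x t p∉ = trans (sum-cong is (λ i → trans
        (cong₂ (λ y z → Ψ r y z (pivot p W i) (spare p W i))
          (cong (x p +_) (trans (cong (t *_) (dir-pivot {p} {W} p∉)) (*-identityʳ t)))
          (trans (Y-move x (dir p W) t i) (cong (λ z → Y x i + t * z) (dir-Y p W i))))
        (Ψ-affine (x p) t (Y x i) (pivot p W i) (spare p W i))))
      (trans (sum-+ is _ _) (cong (pot p W x +_) (sum-*ˡ is t (slope p W x))))

    pot-final : ∀ p W x → IsSign (x p) → final x ≤ pot p W x
    pot-final p W x sg = sum-mono is λ i → ≤-≡-trans
      (*-monoˡ (ι 2) (0≤ι 2) (^ℚ-mono (0≤sq (Y x i)) (≤-by (spare p W i) (0≤spare p W i) refl) (suc r)))
      (sym (Ψ-sign sg (Y x i) (pivot p W i) (spare p W i)))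

    -- Once the pivot is a sign, Ψ collapses to a power of Y² + `spare`. By Bessel's inequality this
    -- spare still contains the whole energy of the remaining span, and `Ψ-grow` converts part of it
    -- into the amplitude of the new pivot.
    pot-next : ∀ p p′ W x → IsSign (x p) → Bounded (x p′) → pot p′ W x ≤ pot p (p′ ∷ W) x
    pot-next p p′ W x sg bd = sum-mono is λ i → ≤-trans
      (Ψ-grow r {x p′} bd (Y x i) {pivot p′ W i} (pivot²≤energy p′ W (b i)))
      (≤-≡-trans (*-monoˡ (ι 2) (0≤ι 2) (^ℚ-mono (0≤+ (0≤sq (Y x i)) (0≤* (0≤noise r) (energy-nonNeg (p′ ∷ W) (b i))))
          (+-monoʳ-≤ (Y x i * Y x i) (*-monoˡ (noise r) (0≤noise r) (le i))) (suc r)))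
        (sym (Ψ-sign sg (Y x i) (pivot p (p′ ∷ W) i) (spare p (p′ ∷ W) i))))
      where
      l : ∀ x y z → x - z ≡ y + (x - y - z)
      l = solve-∀ ℚ-ring
      le : ∀ i → energy (p′ ∷ W) (b i) ≤ energy (p ∷ p′ ∷ W) (b i) - pivot p (p′ ∷ W) i * pivot p (p′ ∷ W) i
      le i = ≤-by _ (0≤- (energy-pivot p (p′ ∷ W) (b i))) (l (energy (p ∷ p′ ∷ W) (b i)) (energy (p′ ∷ W) (b i)) (pivot p (p′ ∷ W) i * pivot p (p′ ∷ W) i))

    pot-remove : ∀ p W {j} (m : j ∈ W) x → Bounded (x p) → pot p (remove W m) x ≤ pot p W x
    pot-remove p W m x bd = sum-mono is λ i →
      Ψ-shrink r {x p} bd (Y x i) (pivot-shrinks p {W} {remove W m} (remove-⊆ W m) (b i))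

    pot-start : ∀ p W → pot p W (λ _ → 0ℚ) ≤ ∑[ i ∈ is ] (ι 2 * (noise r * ⟨ b i , b i ⟩) ^ℚ suc r)
    pot-start p W = sum-mono is λ i → ≤-trans (Ψ-grow r {0ℚ} (0≤1 , 0≤1) (Y x₀ i) {pivot p W i} (pivot²≤energy p W (b i)))
          (*-monoˡ (ι 2) (0≤ι 2) (^ℚ-mono (0≤+ (0≤sq (Y x₀ i)) (0≤* (0≤noise r) (energy-nonNeg (p ∷ W) (b i))))
            (≡-≤-trans (trans (cong (λ y → y * y + noise r * energy (p ∷ W) (b i)) (Y₀ i)) (l (noise r * energy (p ∷ W) (b i))))
              (*-monoˡ (noise r) (0≤noise r) (energy-≤ (p ∷ W) (b i)))) (suc r)))
      where
      l : ∀ x → 0ℚ * 0ℚ + x ≡ x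
      l = solve-∀ ℚ-ring

  Outcome : ℚ → Set
  Outcome B = ∃[ x ] (∀ k → IsSign (x k)) × final x ≤ B

  -- This choice replaces the random step: the potential is affine along `dir p W`, so in one of the
  -- two orientations it does not increase.
  descent : ∀ s → ∃[ σ ] IsSign σ × σ * s ≤ 0ℚ
  descent s with ≤-total s 0ℚ
  ... | inj₁ s≤0 = 1ℚ , inj₁ refl , ≡-≤-trans (*-identityˡ s) s≤0
  ... | inj₂ 0≤s = - 1ℚ , inj₂ refl , ≡-≤-trans (l s) (neg-antimono-≤ 0≤s)
    where
    l : ∀ s → - 1ℚ * s ≡ - s
    l = solve-∀ ℚ-ring

  record Advanced (p : Fin n) (W : List (Fin n)) (x : Fin n → ℚ) : Set where
    field
      x′      : Fin n → ℚ
      bounded : ∀ k → Bounded (x′ k)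
      frozen  : ∀ k → k ∈ (p ∷ W) ⊎ IsSign (x′ k)
      smaller : pot p W x′ ≤ pot p W x
      hit     : ∃[ k ] k ∈ (p ∷ W) × IsSign (x′ k)

  alive? : ∀ k (L : List (Fin n)) → Dec (k ∈ L)
  alive? k L = k ∈? L
    where open import Data.List.Membership.DecPropositional (Fin._≟_ {n}) using (_∈?_)

  dir-fixed : ∀ {p W k} x t → k ∉ (p ∷ W) → x + t * dir p W k ≡ x
  dir-fixed {p} {W} {k} x t k∉ = trans (cong (λ z → x + t * z) (dir-supp {p} {W} k∉)) (l x t)
    where
    l : ∀ x t → x + t * 0ℚ ≡ x
    l = solve-∀ ℚ-ring

  moved : ∀ p W x t s → p ∉ W → (∀ k → Bounded (x k)) → (∀ k → k ∈ (p ∷ W) ⊎ IsSign (x k)) →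
          (∀ {k} → k ∈ p ∷ W → Bounded (x k + t * dir p W k)) →
          (∃[ k ] k ∈ (p ∷ W) × IsSign (x k + t * dir p W k)) →
          s ≡ total-slope p W x → t * s ≤ 0ℚ → Advanced p W x
  moved p W x t s p∉ bd fz bd′ hit s≡ ts≤0 = record
    { x′ = λ k → x k + t * dir p W k
    ; bounded = λ k → bounded k (alive? k (p ∷ W))
    ; frozen = λ k → frozen k (alive? k (p ∷ W))
    ; smaller = ≤-trans (≤-reflexive (pot-move p W x t p∉))
        (≤-by (- (t * s)) (0≤neg ts≤0) (trans (l₁ (pot p W x) (t * s)) (cong (λ z → pot p W x + t * z + - (t * s)) s≡)))
    ; hit = hit }
    where
    l₁ : ∀ P z → P ≡ P + z + - z
    l₁ = solve-∀ ℚ-ring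
    bounded : ∀ k → Dec (k ∈ p ∷ W) → Bounded (x k + t * dir p W k)
    bounded k (yes m) = bd′ m
    bounded k (no ¬m) = subst Bounded (sym (dir-fixed {p} {W} {k} (x k) t ¬m)) (bd k)
    frozen : ∀ k → Dec (k ∈ p ∷ W) → k ∈ (p ∷ W) ⊎ IsSign (x k + t * dir p W k)
    frozen k (yes m) = inj₁ m
    frozen k (no ¬m) with fz k
    ... | inj₁ m = inj₁ m
    ... | inj₂ sg = inj₂ (subst IsSign (sym (dir-fixed {p} {W} {k} (x k) t ¬m)) sg)

  advance : ∀ p W x → p ∉ W → (∀ k → Bounded (x k)) → (∀ k → k ∈ (p ∷ W) ⊎ IsSign (x k)) → Advanced p W x
  advance p W x p∉ bd fz = go (total-slope p W x) refl (descent (total-slope p W x))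
    where
    go : ∀ s → s ≡ total-slope p W x → (∃[ σ ] IsSign σ × σ * s ≤ 0ℚ) → Advanced p W x
    go s s≡ (σ , sgn , σs≤0) = go′ (hit-boundary x (λ k → σ * dir p W k) (p ∷ W) (λ {k} _ → bd k) {p} (here refl)
             (subst IsSign (sym (trans (cong (σ *_) (dir-pivot {p} {W} p∉)) (*-identityʳ σ))) sgn))
      where
      go′ : (∃[ t ] 0ℚ ≤ t × (∀ {k} → k ∈ p ∷ W → Bounded (x k + t * (σ * dir p W k)))
              × (∃[ k ] k ∈ p ∷ W × IsSign (x k + t * (σ * dir p W k)))) → Advanced p W x
      go′ (t , 0≤t , bd′ , k , k∈ , hit) = moved p W x (t * σ) s p∉ bd fz
        (λ {k} m → subst Bounded (assoc k) (bd′ m)) (k , k∈ , subst IsSign (assoc k) hit) s≡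
        (≡-≤-trans (*-assoc t σ s) (≤-≡-trans (*-monoˡ t 0≤t σs≤0) (*-zeroʳ t)))
        where
        assoc : ∀ k → x k + t * (σ * dir p W k) ≡ x k + t * σ * dir p W k
        assoc k = cong (x k +_) (sym (*-assoc t σ (dir p W k)))

  walk : ∀ N p W x → length W ℕ.≤ N → Unique (p ∷ W) → (∀ k → Bounded (x k)) → (∀ k → k ∈ (p ∷ W) ⊎ IsSign (x k)) →
         Outcome (pot p W x)
  walk N p W x len (p∉ ∷ uW) bd fz = step N W len p∉ uW fz (advance p W x (λ m → All.lookup p∉ m refl) bd fz)
    where
    after : ∀ N W x → length W ℕ.≤ N → Unique W → IsSign (x p) → (∀ k → Bounded (x k)) → (∀ k → k ∈ (p ∷ W) ⊎ IsSign (x k)) →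
            Outcome (pot p W x)
    after N [] x len uW sg bd fz = x , all-frozen , pot-final p [] x sg
      where
      all-frozen : ∀ k → IsSign (x k)
      all-frozen k with fz k
      ... | inj₁ (here refl) = sg
      ... | inj₂ sg′ = sg′
    after (suc N) (p′ ∷ W) x (ℕ.s≤s len) uW sg bd fz =
      let x″ , sgn , le = walk N p′ W x len uW bd fz′ in x″ , sgn , ≤-trans le (pot-next p p′ W x sg (bd p′))
      where
      fz′ : ∀ k → k ∈ (p′ ∷ W) ⊎ IsSign (x k)
      fz′ k with fz k
      ... | inj₁ (here refl) = inj₂ sg
      ... | inj₁ (there m) = inj₁ m
      ... | inj₂ sg′ = inj₂ sg′
    step : ∀ N W → length W ℕ.≤ N → All (p ≢_) W → Unique W → (∀ k → k ∈ (p ∷ W) ⊎ IsSign (x k)) →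
           Advanced p W x → Outcome (pot p W x)
    step N W len p∉ uW fz adv with Advanced.hit adv
    ... | _ , here refl , sg = let open Advanced adv ; x″ , sgn , le = after N W x′ len uW sg bounded frozen in x″ , sgn , ≤-trans le smaller
    step zero [] len p∉ uW fz adv | _ , there () , sg
    step (suc N) W len p∉ uW fz adv | j , there m , sg =
      let x″ , sgn , le = walk N p (remove W m) x′ (ℕ.s≤s⁻¹ (subst (ℕ._≤ suc N) (sym (remove-length W m)) len))
                            (All-remove W m p∉ ∷ Unique-remove W m uW) bounded fz′
      in x″ , sgn , ≤-trans le (≤-trans (pot-remove p W m x′ (bounded p)) smaller)
      where
      open Advanced adv
      fz′ : ∀ k → k ∈ (p ∷ remove W m) ⊎ IsSign (x′ k)
      fz′ k with frozen k
      ... | inj₁ (here eq) = inj₁ (here eq)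
      ... | inj₂ sg′ = inj₂ sg′
      ... | inj₁ (there k∈) with remove-split W m k∈
      ... | inj₁ refl = inj₂ sg
      ... | inj₂ k∈′ = inj₁ (there k∈′)

  balanced : Outcome (∑[ i ∈ is ] (ι 2 * (noise r * ⟨ b i , b i ⟩) ^ℚ suc r))
  balanced = start all (allFin⁺ n) (λ k → ∈-allFin k)
    where
    start : ∀ W → Unique W → (∀ k → k ∈ W) → Outcome (∑[ i ∈ is ] (ι 2 * (noise r * ⟨ b i , b i ⟩) ^ℚ suc r))
    start [] u mem = x₀ , (λ k → ⊥-elim (∉[] (mem k))) ,
      sum-mono is (λ i → *-monoˡ (ι 2) (0≤ι 2) (^ℚ-mono (0≤sq (Y x₀ i))
        (≤-trans (≤-reflexive (cong (λ y → y * y) (Y₀ i))) (0≤* (0≤noise r) (nonneg (b i)))) (suc r)))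
      where
      ∉[] : ∀ {k : Fin n} → k ∉ []
      ∉[] ()
    start (p ∷ W) u mem = let x″ , sgn , le = walk (length W) p W x₀ ℕₚ.≤-refl u (λ _ → 0≤1 , 0≤1) (λ k → inj₁ (mem k)) in
      x″ , sgn , ≤-trans le (pot-start p W)

-- Weighted sums

Weights : Set → Set
Weights X = List (ℚ × X)

wsum : ∀ {X : Set} → Weights X → (X → ℚ) → ℚ
wsum []             f = 0ℚ
wsum ((w , x) ∷ ws) f = w * f x + wsum ws f

NonNeg : ∀ {X : Set} → Weights X → Set
NonNeg = All (λ t → 0ℚ ≤ proj₁ t)

mass : ∀ {X : Set} → Weights X → ℚ
mass ws = wsum ws (λ _ → 1ℚ)

module _ {X : Set} where

  wsum-cong : ∀ (ws : Weights X) {f g : X → ℚ} → (∀ x → f x ≡ g x) → wsum ws f ≡ wsum ws g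
  wsum-cong [] eq = refl
  wsum-cong ((w , x) ∷ ws) eq = cong₂ (λ y z → w * y + z) (eq x) (wsum-cong ws eq)

  wsum-+ : ∀ (ws : Weights X) (f g : X → ℚ) → wsum ws (λ x → f x + g x) ≡ wsum ws f + wsum ws g
  wsum-+ [] f g = sym (+-identityˡ 0ℚ)
  wsum-+ ((w , x) ∷ ws) f g = trans (cong (w * (f x + g x) +_) (wsum-+ ws f g)) (lemma w (f x) (g x) (wsum ws f) (wsum ws g))
    where
    lemma : ∀ w a b c d → w * (a + b) + (c + d) ≡ w * a + c + (w * b + d)
    lemma = solve-∀ ℚ-ring

  wsum-*ˡ : ∀ (ws : Weights X) k (f : X → ℚ) → wsum ws (λ x → k * f x) ≡ k * wsum ws f
  wsum-*ˡ [] k f = sym (*-zeroʳ k)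
  wsum-*ˡ ((w , x) ∷ ws) k f = trans (cong (w * (k * f x) +_) (wsum-*ˡ ws k f)) (lemma w k (f x) (wsum ws f))
    where
    lemma : ∀ w k a b → w * (k * a) + k * b ≡ k * (w * a + b)
    lemma = solve-∀ ℚ-ring

  wsum-*ʳ : ∀ (ws : Weights X) k (f : X → ℚ) → wsum ws (λ x → f x * k) ≡ wsum ws f * k
  wsum-*ʳ ws k f = trans (wsum-cong ws (λ x → *-comm (f x) k)) (trans (wsum-*ˡ ws k f) (*-comm k _))

  wsum-0 : ∀ (ws : Weights X) → wsum ws (λ _ → 0ℚ) ≡ 0ℚ
  wsum-0 [] = refl
  wsum-0 ((w , x) ∷ ws) = trans (cong (w * 0ℚ +_) (wsum-0 ws)) (lemma w)
    where
    lemma : ∀ w → w * 0ℚ + 0ℚ ≡ 0ℚ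
    lemma = solve-∀ ℚ-ring

  wsum-mono : ∀ {ws : Weights X} → NonNeg ws → {f g : X → ℚ} → (∀ x → f x ≤ g x) → wsum ws f ≤ wsum ws g
  wsum-mono [] le = ≤-refl
  wsum-mono {(w , x) ∷ _} (0≤w ∷ nn) le = +-mono-≤ (*-monoˡ w 0≤w (le x)) (wsum-mono nn le)

  wsum-nonNeg : ∀ {ws : Weights X} → NonNeg ws → {f : X → ℚ} → (∀ x → 0ℚ ≤ f x) → 0ℚ ≤ wsum ws f
  wsum-nonNeg [] le = ≤-refl
  wsum-nonNeg {(w , x) ∷ _} (0≤w ∷ nn) le = 0≤+ (0≤* 0≤w (le x)) (wsum-nonNeg nn le)

  wsum-sum : ∀ {Y : Set} (ws : Weights X) (ys : List Y) (f : X → Y → ℚ) →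
             wsum ws (λ x → ∑[ y ∈ ys ] f x y) ≡ ∑[ y ∈ ys ] wsum ws (λ x → f x y)
  wsum-sum ws [] f = wsum-0 ws
  wsum-sum ws (y ∷ ys) f = trans (wsum-+ ws (λ x → f x y) _) (cong (wsum ws (λ x → f x y) +_) (wsum-sum ws ys f))

  wsum-sub : ∀ (ws : Weights X) k (f g : X → ℚ) → wsum ws (λ x → f x + k * g x) ≡ wsum ws f + k * wsum ws g
  wsum-sub ws k f g = trans (wsum-+ ws f _) (cong (wsum ws f +_) (wsum-*ˡ ws k g))

wsum-swap : ∀ {X Y : Set} (ws : Weights X) (vs : Weights Y) (f : X → Y → ℚ) →
            wsum ws (λ x → wsum vs (f x)) ≡ wsum vs (λ y → wsum ws (λ x → f x y))
wsum-swap [] vs f = sym (wsum-0 vs)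
wsum-swap ((w , x) ∷ ws) vs f = trans (cong₂ _+_ (sym (wsum-*ˡ vs w (f x))) (wsum-swap ws vs f)) (sym (wsum-+ vs _ _))

wsum-++ : ∀ {X : Set} (ws vs : Weights X) f → wsum (ws ++ vs) f ≡ wsum ws f + wsum vs f
wsum-++ [] vs f = sym (+-identityˡ _)
wsum-++ ((w , x) ∷ ws) vs f = trans (cong (w * f x +_) (wsum-++ ws vs f)) (sym (+-assoc (w * f x) (wsum ws f) (wsum vs f)))

NonNeg-++ : ∀ {X : Set} {ws vs : Weights X} → NonNeg ws → NonNeg vs → NonNeg (ws ++ vs)
NonNeg-++ [] q = q
NonNeg-++ (p ∷ ps) q = p ∷ NonNeg-++ ps q

rescale : ∀ {X Y : Set} → ℚ → (X → Y) → Weights X → Weights Y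
rescale k h = map (λ t → k * proj₁ t , h (proj₂ t))

wsum-rescale : ∀ {X Y : Set} k (h : X → Y) ws f → wsum (rescale k h ws) f ≡ k * wsum ws (λ x → f (h x))
wsum-rescale k h [] f = sym (*-zeroʳ k)
wsum-rescale k h ((w , x) ∷ ws) f = trans (cong (k * w * f (h x) +_) (wsum-rescale k h ws f)) (l k w (f (h x)) _)
  where
  l : ∀ k w y s → k * w * y + k * s ≡ k * (w * y + s)
  l = solve-∀ ℚ-ring

NonNeg-rescale : ∀ {X Y : Set} {k} → 0ℚ ≤ k → (h : X → Y) → ∀ {ws} → NonNeg ws → NonNeg (rescale k h ws)
NonNeg-rescale 0≤k h [] = []
NonNeg-rescale 0≤k h (p ∷ ps) = 0≤* 0≤k p ∷ NonNeg-rescale 0≤k h ps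

-- Linear operators on functions

record Lin (X : Set) : Set where
  field
    fun   : (X → ℚ) → X → ℚ
    congᴸ : ∀ {u v} → (∀ x → u x ≡ v x) → ∀ x → fun u x ≡ fun v x
    addᴸ  : ∀ u v x → fun (u ⊕ v) x ≡ fun u x + fun v x
    mulᴸ  : ∀ k u x → fun (k ⊙ u) x ≡ k * fun u x

open Lin public

subᴸ : ∀ {X} (N : Lin X) u k v x → fun N (u ⊕ (k ⊙ v)) x ≡ fun N u x + k * fun N v x
subᴸ N u k v x = trans (addᴸ N u (k ⊙ v) x) (cong (fun N u x +_) (mulᴸ N k v x))

record Functional (X : Set) : Set where
  field
    val   : (X → ℚ) → ℚ
    congᶠ : ∀ {u v} → (∀ x → u x ≡ v x) → val u ≡ val v
    subᶠ  : ∀ u k v → val (u ⊕ (k ⊙ v)) ≡ val u + k * val v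

open Functional public

record Inverse {X : Set} (N ρ : Lin X) : Set where
  field
    right : ∀ v x → fun N (fun ρ v) x ≡ v x
    left  : ∀ v x → fun ρ (fun N v) x ≡ v x

id-Lin : ∀ {X} → Lin X
id-Lin = record { fun = λ u → u ; congᴸ = λ eq → eq ; addᴸ = λ _ _ _ → refl ; mulᴸ = λ _ _ _ → refl }

-- The Sherman-Morrison formula: adding the rank-one term κ f(v) g to N changes its inverse by -κ
-- f(ρ v) ρ g / (1 + κ f(ρ g)).
module RankOne {X : Set} {N ρ : Lin X} (inverse : Inverse N ρ) (f : Functional X) (g : X → ℚ) (κ : ℚ)
               (0<d : 0ℚ < 1ℚ + κ * val f (fun ρ g)) where
  open Inverse inverse

  τ : ℚ
  τ = inv (1ℚ + κ * val f (fun ρ g))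

  θ : (X → ℚ) → ℚ
  θ v = - (κ * τ * val f (fun ρ v))

  updated : (X → ℚ) → X → ℚ
  updated v = fun ρ v ⊕ (θ v ⊙ fun ρ g)

  private
    h = val f (fun ρ g)
    d*τ : (1ℚ + κ * h) * τ ≡ 1ℚ
    d*τ = inv-r 0<d

  θ-sub : ∀ u k v → θ (u ⊕ (k ⊙ v)) ≡ θ u + k * θ v
  θ-sub u k v = trans (cong (λ z → - (κ * τ * z)) (trans (congᶠ f (subᴸ ρ u k v)) (subᶠ f (fun ρ u) k (fun ρ v))))
                      (l κ τ (val f (fun ρ u)) k (val f (fun ρ v)))
    where
    l : ∀ κ τ a k b → - (κ * τ * (a + k * b)) ≡ - (κ * τ * a) + k * - (κ * τ * b)
    l = solve-∀ ℚ-ring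

  ρ′ : Lin X
  ρ′ = record
    { fun = updated
    ; congᴸ = λ eq x → cong₂ (λ y z → y + - (κ * τ * z) * fun ρ g x) (congᴸ ρ eq x) (congᶠ f (congᴸ ρ eq))
    ; addᴸ = λ u v x → trans
        (cong₂ (λ y z → y + z * fun ρ g x) (addᴸ ρ u v x)
          (trans (cong (λ z → - (κ * τ * z)) (congᶠ f (congᴸ ρ {u ⊕ v} {u ⊕ (1ℚ ⊙ v)} (λ x → cong (u x +_) (sym (*-identityˡ (v x)))))))
                 (θ-sub u 1ℚ v)))
        (l₁ (fun ρ u x) (fun ρ v x) (θ u) (θ v) (fun ρ g x))
    ; mulᴸ = λ k u x → trans
        (cong₂ (λ y z → y + z * fun ρ g x) (mulᴸ ρ k u x)
          (trans (cong (λ z → - (κ * τ * z)) (congᶠ f (congᴸ ρ {k ⊙ u} {(0ℚ ⊙ u) ⊕ (k ⊙ u)} (λ x → l₀ (u x) (k * u x)))))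
                 (trans (θ-sub (0ℚ ⊙ u) k u) (cong (_+ k * θ u) (trans (cong (λ z → - (κ * τ * z)) (zero-val u)) (l₃ (κ * τ)))))))
        (l₂ (fun ρ u x) k (θ u) (fun ρ g x)) }
    where
    l₀ : ∀ a b → b ≡ 0ℚ * a + b
    l₀ = solve-∀ ℚ-ring
    l₁ : ∀ a b s t g → a + b + (s + 1ℚ * t) * g ≡ a + s * g + (b + t * g)
    l₁ = solve-∀ ℚ-ring
    l₂ : ∀ a k t g → k * a + (0ℚ + k * t) * g ≡ k * (a + t * g)
    l₂ = solve-∀ ℚ-ring
    l₃ : ∀ a → - (a * 0ℚ) ≡ 0ℚ
    l₃ = solve-∀ ℚ-ring
    l₄ : ∀ a → a + - 1ℚ * a ≡ 0ℚ
    l₄ = solve-∀ ℚ-ring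
    l₅ : ∀ a → 0ℚ * a ≡ a + - 1ℚ * a
    l₅ = solve-∀ ℚ-ring
    zero-val : ∀ u → val f (fun ρ (0ℚ ⊙ u)) ≡ 0ℚ
    zero-val u = trans (congᶠ f (λ x → trans (mulᴸ ρ 0ℚ u x) (l₅ (fun ρ u x)))) (trans (subᶠ f (fun ρ u) (- 1ℚ) (fun ρ u)) (l₄ (val f (fun ρ u))))

  inverse′ : ∀ (N′ : Lin X) → (∀ v x → fun N′ v x ≡ fun N v x + κ * val f v * g x) → Inverse N′ ρ′
  inverse′ N′ N′≡ = record { right = right′ ; left = left′ }
    where
    l₁ : ∀ v κ τ t g h → v + - (κ * τ * t) * g + κ * (t + - (κ * τ * t) * h) * g ≡ v + κ * t * g * (1ℚ - (1ℚ + κ * h) * τ)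
    l₁ = solve-∀ ℚ-ring
    l₂ : ∀ a b → a + b * (1ℚ - 1ℚ) ≡ a
    l₂ = solve-∀ ℚ-ring
    right′ : ∀ v x → fun N′ (updated v) x ≡ v x
    right′ v x = trans (N′≡ (updated v) x) (trans (cong₂ (λ y z → y + κ * z * g x)
        (trans (subᴸ N (fun ρ v) (θ v) (fun ρ g) x) (cong₂ (λ y z → y + θ v * z) (right v x) (right g x)))
        (subᶠ f (fun ρ v) (θ v) (fun ρ g)))
      (trans (l₁ (v x) κ τ (val f (fun ρ v)) (g x) h)
      (trans (cong (λ z → v x + κ * val f (fun ρ v) * g x * (1ℚ - z)) d*τ) (l₂ (v x) (κ * val f (fun ρ v) * g x)))))
    l₃ : ∀ v κ τ t g h → v + κ * t * g + - (κ * τ * (t + κ * t * h)) * g ≡ v + κ * t * g * (1ℚ - (1ℚ + κ * h) * τ)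
    l₃ = solve-∀ ℚ-ring
    left′ : ∀ v x → updated (fun N′ v) x ≡ v x
    left′ v x = trans (cong₂ (λ y z → y + - (κ * τ * z) * fun ρ g x) (ρN′ x)
        (trans (congᶠ f ρN′) (subᶠ f v (κ * val f v) (fun ρ g))))
      (trans (l₃ (v x) κ τ (val f v) (fun ρ g x) h)
      (trans (cong (λ z → v x + κ * val f v * fun ρ g x * (1ℚ - z)) d*τ) (l₂ (v x) (κ * val f v * fun ρ g x))))
      where
      ρN′ : ∀ x → fun ρ (fun N′ v) x ≡ v x + κ * val f v * fun ρ g x
      ρN′ x = trans (congᴸ ρ (N′≡ v) x) (trans (subᴸ ρ (fun N v) (κ * val f v) g x) (cong (_+ κ * val f v * fun ρ g x) (left v x)))

-- The operator 1 + c S P and its inverse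

module Scale {I J : Set} (A : I → J → ℚ) where

  col : J → I → ℚ
  col j i = A i j

  module Forms (ps : Weights I) (qs : Weights J) where

    ⟪_,_⟫ : (I → ℚ) → (I → ℚ) → ℚ
    ⟪ u , v ⟫ = wsum ps (λ i → u i * v i)

    ⟪⟫-cong : ∀ {u u′ v v′} → (∀ i → u i ≡ u′ i) → (∀ i → v i ≡ v′ i) → ⟪ u , v ⟫ ≡ ⟪ u′ , v′ ⟫
    ⟪⟫-cong eq eq′ = wsum-cong ps (λ i → cong₂ _*_ (eq i) (eq′ i))

    ⟪⟫-comm : ∀ u v → ⟪ u , v ⟫ ≡ ⟪ v , u ⟫
    ⟪⟫-comm u v = wsum-cong ps (λ i → *-comm (u i) (v i))

    ⟪⟫-subˡ : ∀ u k v w → ⟪ u ⊕ (k ⊙ v) , w ⟫ ≡ ⟪ u , w ⟫ + k * ⟪ v , w ⟫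
    ⟪⟫-subˡ u k v w = trans (wsum-cong ps (λ i → l (u i) k (v i) (w i))) (wsum-sub ps k _ _)
      where
      l : ∀ a k b w → (a + k * b) * w ≡ a * w + k * (b * w)
      l = solve-∀ ℚ-ring

    ⟪⟫-subʳ : ∀ u k v w → ⟪ w , u ⊕ (k ⊙ v) ⟫ ≡ ⟪ w , u ⟫ + k * ⟪ w , v ⟫
    ⟪⟫-subʳ u k v w = trans (⟪⟫-comm w _) (trans (⟪⟫-subˡ u k v w) (cong₂ (λ y z → y + k * z) (⟪⟫-comm u w) (⟪⟫-comm v w)))

    ⟪⟫-combʳ : ∀ (h : J → ℚ) w → ⟪ w , (λ i → wsum qs (λ j → h j * A i j)) ⟫ ≡ wsum qs (λ j → h j * ⟪ w , col j ⟫)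
    ⟪⟫-combʳ h w = trans (wsum-cong ps (λ i → sym (wsum-*ˡ qs (w i) _)))
      (trans (wsum-swap ps qs _) (wsum-cong qs (λ j → trans (wsum-cong ps (λ i → l (w i) (h j) (A i j))) (wsum-*ˡ ps (h j) _))))
      where
      l : ∀ w h a → w * (h * a) ≡ h * (w * a)
      l = solve-∀ ℚ-ring

    -- P is the diagonal matrix of the row weights and S = Σ_j q_j a_j a_jᵀ. The product is
    -- symmetric for the form weighted by P, which avoids P^½.
    SP : (I → ℚ) → I → ℚ
    SP v i = wsum qs (λ j → ⟪ col j , v ⟫ * A i j)

    SP-sub : ∀ u k v i → SP (u ⊕ (k ⊙ v)) i ≡ SP u i + k * SP v i
    SP-sub u k v i = trans (wsum-cong qs (λ j → trans (cong (_* A i j) (⟪⟫-subʳ u k v (col j))) (l ⟪ col j , u ⟫ k ⟪ col j , v ⟫ (A i j))))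
                           (wsum-sub qs k _ _)
      where
      l : ∀ a k b w → (a + k * b) * w ≡ a * w + k * (b * w)
      l = solve-∀ ℚ-ring

    SP-cong : ∀ {u v} → (∀ i → u i ≡ v i) → ∀ i → SP u i ≡ SP v i
    SP-cong eq i = wsum-cong qs (λ j → cong (_* A i j) (⟪⟫-cong {col j} (λ _ → refl) eq))

    ⟪⟫-SP : ∀ w v → ⟪ w , SP v ⟫ ≡ wsum qs (λ j → ⟪ col j , v ⟫ * ⟪ w , col j ⟫)
    ⟪⟫-SP w v = ⟪⟫-combʳ (λ j → ⟪ col j , v ⟫) w

    1+cSP : ℚ → Lin I
    1+cSP c = record
      { fun = λ v → v ⊕ (c ⊙ SP v)
      ; congᴸ = λ eq i → cong₂ (λ y z → y + c * z) (eq i) (SP-cong eq i)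
      ; addᴸ = λ u v i → trans (cong (λ z → u i + v i + c * z) (trans (SP-cong {u ⊕ v} {u ⊕ (1ℚ ⊙ v)} (λ i → cong (u i +_) (sym (*-identityˡ (v i)))) i) (SP-sub u 1ℚ v i)))
                               (l₁ (u i) (v i) c (SP u i) (SP v i))
      ; mulᴸ = λ k u i → trans (cong (λ z → k * u i + c * z)
                 (trans (wsum-cong qs (λ j → trans (cong (_* A i j) (trans (wsum-cong ps (λ i → l₃ (A i j) k (u i))) (wsum-*ˡ ps k _))) (*-assoc k ⟪ col j , u ⟫ (A i j)))) (wsum-*ˡ qs k _)))
                               (l₂ k (u i) c (SP u i)) }
      where
      l₁ : ∀ a b c s t → a + b + c * (s + 1ℚ * t) ≡ a + c * s + (b + c * t)
      l₁ = solve-∀ ℚ-ring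
      l₂ : ∀ k a c s → k * a + c * (k * s) ≡ k * (a + c * s)
      l₂ = solve-∀ ℚ-ring
      l₃ : ∀ a k u → a * (k * u) ≡ k * (a * u)
      l₃ = solve-∀ ℚ-ring

    record Resolvent (c : ℚ) : Set where
      field
        op      : Lin I
        inverse : Inverse (1+cSP c) op
      open Inverse inverse public

      ρ : (I → ℚ) → I → ℚ
      ρ = fun op

      Γ : (I → ℚ) → (I → ℚ) → ℚ
      Γ u v = ⟪ u , ρ v ⟫

      -- Σ_j q_j ⟨a_j, ρ u⟩ ⟨a_j, ρ v⟩
      cross : (I → ℚ) → (I → ℚ) → ℚ
      cross u v = wsum qs (λ j → ⟪ col j , ρ u ⟫ * ⟪ col j , ρ v ⟫)

      -- Substituting u = (1 + c S P) ρ u exhibits Γ as a sum of two visibly symmetric positive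
      -- forms; this takes the place of a spectral decomposition.
      Γ-expand : ∀ u v → Γ u v ≡ ⟪ ρ u , ρ v ⟫ + c * cross u v
      Γ-expand u v = trans (⟪⟫-cong (λ i → sym (right u i)) (λ _ → refl))
        (trans (⟪⟫-subˡ (ρ u) c (SP (ρ u)) (ρ v))
        (cong (λ z → ⟪ ρ u , ρ v ⟫ + c * z) (trans (⟪⟫-comm (SP (ρ u)) (ρ v)) (trans (⟪⟫-SP (ρ v) (ρ u))
          (wsum-cong qs (λ j → cong (⟪ col j , ρ u ⟫ *_) (⟪⟫-comm (ρ v) (col j))))))))

      Γ-comm : ∀ u v → Γ u v ≡ Γ v u
      Γ-comm u v = trans (Γ-expand u v) (trans (cong₂ (λ y z → y + c * z) (⟪⟫-comm (ρ u) (ρ v)) (wsum-cong qs (λ j → *-comm ⟪ col j , ρ u ⟫ _))) (sym (Γ-expand v u)))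

      -- The square of v = ρ v + c S P ρ v. All terms are nonnegative, so `contraction`,
      -- `cross-bound` and `Γ≤⟪⟫` each follow by dropping some of them.
      ⟪⟫-expand : ∀ v → ⟪ v , v ⟫ ≡ ⟪ ρ v , ρ v ⟫ + ι 2 * c * cross v v + c * c * ⟪ SP (ρ v) , SP (ρ v) ⟫
      ⟪⟫-expand v = trans (⟪⟫-cong (λ i → sym (right v i)) (λ i → sym (right v i)))
        (trans (⟪⟫-subˡ (ρ v) c s (ρ v ⊕ (c ⊙ s))) (trans (cong₂ (λ y z → y + c * z) (⟪⟫-subʳ (ρ v) c s (ρ v)) (⟪⟫-subʳ (ρ v) c s s))
        (trans (cong₂ (λ y z → ⟪ ρ v , ρ v ⟫ + c * y + c * (z + c * ⟪ s , s ⟫)) eq (trans (⟪⟫-comm s (ρ v)) eq))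
               (l ⟪ ρ v , ρ v ⟫ c (cross v v) ⟪ s , s ⟫))))
        where
        s = SP (ρ v)
        eq : ⟪ ρ v , s ⟫ ≡ cross v v
        eq = trans (⟪⟫-SP (ρ v) (ρ v)) (wsum-cong qs (λ j → cong (⟪ col j , ρ v ⟫ *_) (⟪⟫-comm (ρ v) (col j))))
        l : ∀ a c x s → a + c * x + c * (x + c * s) ≡ a + ι 2 * c * x + c * c * s
        l = solve-∀ ℚ-ring

      module Positive (0≤c : 0ℚ ≤ c) (0≤ps : NonNeg ps) (0≤qs : NonNeg qs) where

        ⟪⟫-nonNeg : ∀ u → 0ℚ ≤ ⟪ u , u ⟫
        ⟪⟫-nonNeg u = wsum-nonNeg 0≤ps (λ i → 0≤sq (u i))

        cross-nonNeg : ∀ u → 0ℚ ≤ cross u u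
        cross-nonNeg u = wsum-nonNeg 0≤qs (λ j → 0≤sq ⟪ col j , ρ u ⟫)

        Γ-nonNeg : ∀ u → 0ℚ ≤ Γ u u
        Γ-nonNeg u = subst (0ℚ ≤_) (sym (Γ-expand u u)) (0≤+ (⟪⟫-nonNeg (ρ u)) (0≤* 0≤c (cross-nonNeg u)))

        contraction : ∀ v → ⟪ ρ v , ρ v ⟫ ≤ ⟪ v , v ⟫
        contraction v = ≤-by (ι 2 * c * cross v v + c * c * ⟪ SP (ρ v) , SP (ρ v) ⟫)
          (0≤+ (0≤* (0≤* (0≤ι 2) 0≤c) (cross-nonNeg v)) (0≤* (0≤* 0≤c 0≤c) (⟪⟫-nonNeg (SP (ρ v)))))
          (trans (⟪⟫-expand v) (+-assoc ⟪ ρ v , ρ v ⟫ (ι 2 * c * cross v v) (c * c * ⟪ SP (ρ v) , SP (ρ v) ⟫)))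

        cross-bound : ∀ v → c * cross v v ≤ ⟪ v , v ⟫
        cross-bound v = ≤-by (⟪ ρ v , ρ v ⟫ + c * cross v v + c * c * ⟪ SP (ρ v) , SP (ρ v) ⟫)
          (0≤+ (0≤+ (⟪⟫-nonNeg (ρ v)) (0≤* 0≤c (cross-nonNeg v))) (0≤* (0≤* 0≤c 0≤c) (⟪⟫-nonNeg (SP (ρ v)))))
          (trans (⟪⟫-expand v) (l ⟪ ρ v , ρ v ⟫ c (cross v v) (c * c * ⟪ SP (ρ v) , SP (ρ v) ⟫)))
          where
          l : ∀ a c x s → a + ι 2 * c * x + s ≡ c * x + (a + c * x + s)
          l = solve-∀ ℚ-ring

        Γ≤⟪⟫ : ∀ v → Γ v v ≤ ⟪ v , v ⟫
        Γ≤⟪⟫ v = ≤-by (c * cross v v + c * c * ⟪ SP (ρ v) , SP (ρ v) ⟫)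
          (0≤+ (0≤* 0≤c (cross-nonNeg v)) (0≤* (0≤* 0≤c 0≤c) (⟪⟫-nonNeg (SP (ρ v)))))
          (trans (⟪⟫-expand v) (trans (l ⟪ ρ v , ρ v ⟫ c (cross v v) (c * c * ⟪ SP (ρ v) , SP (ρ v) ⟫))
                 (cong (_+ (c * cross v v + c * c * ⟪ SP (ρ v) , SP (ρ v) ⟫)) (sym (Γ-expand v v)))))
          where
          l : ∀ a c x s → a + ι 2 * c * x + s ≡ a + c * x + (c * x + s)
          l = solve-∀ ℚ-ring

        Γ-inner : SemiInner I
        Γ-inner = record
          { ⟨_,_⟩ = Γ ; comm = Γ-comm
          ; addˡ = λ u v w → trans (wsum-cong ps (λ i → *-distribʳ-+ (ρ w i) (u i) (v i))) (wsum-+ ps _ _)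
          ; mulˡ = λ k u w → trans (wsum-cong ps (λ i → *-assoc k (u i) (ρ w i))) (wsum-*ˡ ps k _)
          ; nonneg = Γ-nonNeg }

½≤inv : ∀ {d} → 0ℚ < d → d ≤ ι 2 → ½ ≤ inv d
½≤inv {d} 0<d d≤2 = *-cancelˡ d 0<d (≤-≡-trans (*-monoʳ ½ (nonNegative⁻¹ ½) d≤2) (sym (inv-r 0<d)))

-- The gain in trace from raising one weight

module Updates {I J : Set} (A : I → J → ℚ) (ps : Weights I) (qs : Weights J)
               (0≤ps : NonNeg ps) (0≤qs : NonNeg qs) {c δ : ℚ} (0≤c : 0ℚ ≤ c) (0≤δ : 0ℚ ≤ δ)
               (R : Scale.Forms.Resolvent A ps qs c) where
  open Scale A
  open Forms ps qs using (⟪_,_⟫; ⟪⟫-cong; ⟪⟫-comm; ⟪⟫-subˡ; ⟪⟫-subʳ; ⟪⟫-combʳ; SP; 1+cSP)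
  open Forms.Resolvent R
  open Positive 0≤c 0≤ps 0≤qs

  trace : ℚ
  trace = wsum qs (λ j → Γ (col j) (col j))

  0≤cδ : 0ℚ ≤ c * δ
  0≤cδ = 0≤* 0≤c 0≤δ

  module AddColumn (j₀ : J) where
    a = col j₀
    y = Γ a a
    qs′ = (δ , j₀) ∷ qs

    f : Functional I
    f = record { val = ⟪ a ,_⟫ ; congᶠ = λ eq → ⟪⟫-cong {a} (λ _ → refl) eq ; subᶠ = λ u k v → ⟪⟫-subʳ u k v a }

    0<d : 0ℚ < 1ℚ + c * δ * y
    0<d = +-mono-<-≤ 0<1 (0≤* 0≤cδ (Γ-nonNeg a))

    module U = RankOne inverse f a (c * δ) 0<d
    open U using (τ; θ)

    R′ : Forms.Resolvent ps qs′ c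
    R′ = record { op = U.ρ′ ; inverse = U.inverse′ (Forms.1+cSP ps qs′ c) (λ v i → l (v i) c δ ⟪ a , v ⟫ (A i j₀) (SP v i)) }
      where
      l : ∀ v c δ t a s → v + c * (δ * (t * a) + s) ≡ v + c * s + c * δ * t * a
      l = solve-∀ ℚ-ring

    -- The new column contributes δ τ y, because (1 + c δ y) τ = 1, and the old ones lose c δ τ
    -- `cross a a`. By `Γ-expand` the difference y - c `cross a a` is |ρ a|².
    trace-gain : wsum qs′ (λ j → Forms.Resolvent.Γ R′ (col j) (col j)) ≡ trace + δ * τ * ⟪ ρ a , ρ a ⟫
    trace-gain = trans (cong₂ (λ x z → δ * x + z) (Γ′ a a)
        (trans (wsum-cong qs (λ j → trans (Γ′ (col j) (col j)) (cong (Γ (col j) (col j) +_) (eq j)))) (wsum-sub qs (- (c * δ * τ)) _ _)))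
      (trans (l₁ δ y c τ trace (cross a a)) (trans (cong (λ z → trace + δ * (y * (z - c * δ * τ * y) - c * τ * cross a a)) (sym (inv-r 0<d)))
      (trans (l₂ trace δ y c τ (cross a a)) (trans (cong (λ z → trace + δ * τ * (z - c * cross a a)) (Γ-expand a a)) (l₃ trace (δ * τ) ⟪ ρ a , ρ a ⟫ (c * cross a a))))))
      where
      Γ′ : ∀ u v → Forms.Resolvent.Γ R′ u v ≡ Γ u v + θ v * Γ u a
      Γ′ u v = ⟪⟫-subʳ (ρ v) (θ v) (ρ a) u
      eq : ∀ j → θ (col j) * Γ (col j) a ≡ - (c * δ * τ) * (⟪ col j , ρ a ⟫ * ⟪ col j , ρ a ⟫)
      eq j = trans (cong (λ z → - (c * δ * τ * z) * Γ (col j) a) (Γ-comm a (col j))) (l (c * δ * τ) (Γ (col j) a))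
        where
        l : ∀ k t → - (k * t) * t ≡ - k * (t * t)
        l = solve-∀ ℚ-ring
      l₁ : ∀ δ y c τ T X → δ * (y + - (c * δ * τ * y) * y) + (T + - (c * δ * τ) * X)
                         ≡ T + δ * (y * (1ℚ - c * δ * τ * y) - c * τ * X)
      l₁ = solve-∀ ℚ-ring
      l₂ : ∀ T δ y c τ X → T + δ * (y * ((1ℚ + c * δ * y) * τ - c * δ * τ * y) - c * τ * X) ≡ T + δ * τ * (y - c * X)
      l₂ = solve-∀ ℚ-ring
      l₃ : ∀ T k x z → T + k * (x + z - z) ≡ T + k * x
      l₃ = solve-∀ ℚ-ring

    gain : c * δ * ⟪ a , a ⟫ ≤ 1ℚ → trace + δ * ½ * ⟪ ρ a , ρ a ⟫ ≤ wsum qs′ (λ j → Forms.Resolvent.Γ R′ (col j) (col j))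
    gain le = ≤-≡-trans (+-monoʳ-≤ trace (*-monoʳ ⟪ ρ a , ρ a ⟫ (⟪⟫-nonNeg (ρ a)) (*-monoˡ δ 0≤δ
        (½≤inv 0<d (+-monoʳ-≤ 1ℚ (≤-trans (*-monoˡ (c * δ) 0≤cδ (Γ≤⟪⟫ a)) (≤-≡-trans le (sym (+-identityʳ 1ℚ)))))))))
      (sym trace-gain)

  module AddRow (i₀ : I) where
    ps′ = (δ , i₀) ∷ ps

    f : Functional I
    f = record { val = λ u → u i₀ ; congᶠ = λ eq → eq i₀ ; subᶠ = λ _ _ _ → refl }

    g : I → ℚ
    g i = wsum qs (λ j → A i₀ j * A i j)

    ⟪,g⟫ : ∀ u → ⟪ u , g ⟫ ≡ wsum qs (λ j → A i₀ j * ⟪ u , col j ⟫)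
    ⟪,g⟫ u = ⟪⟫-combʳ (λ j → A i₀ j) u

    SP-at : ∀ u → SP u i₀ ≡ ⟪ u , g ⟫
    SP-at u = trans (wsum-cong qs (λ j → trans (*-comm ⟪ col j , u ⟫ (A i₀ j)) (cong (A i₀ j *_) (⟪⟫-comm (col j) u)))) (sym (⟪,g⟫ u))

    c⟪,ρg⟫ : ∀ u → c * ⟪ u , ρ g ⟫ ≡ u i₀ - ρ u i₀
    c⟪,ρg⟫ u = trans (cong (c *_) (trans (Γ-comm u g) (trans (⟪⟫-comm g (ρ u)) (sym (SP-at (ρ u))))))
      (trans (l (ρ u i₀) (c * SP (ρ u) i₀)) (cong (_- ρ u i₀) (right u i₀)))
      where
      l : ∀ r s → s ≡ r + s - r
      l = solve-∀ ℚ-ring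

    h : ℚ
    h = ρ g i₀

    -- Evaluation at i₀ need not be given by the weighted form, as i₀ may carry no weight, so the
    -- sign of h is not a case of `Γ-nonNeg`. This sum of squares settles it and makes the
    -- Sherman-Morrison denominator positive.
    h≡ : h ≡ wsum qs (λ j → (A i₀ j - c * ⟪ col j , ρ g ⟫) * (A i₀ j - c * ⟪ col j , ρ g ⟫)) + c * ⟪ ρ g , ρ g ⟫
    h≡ = sym (trans (cong (_+ c * ⟪ ρ g , ρ g ⟫) (trans (wsum-cong qs (λ j → l₁ (A i₀ j) c ⟪ col j , ρ g ⟫))
           (trans (wsum-+ qs _ _) (cong₂ _+_ (wsum-sub qs (- (ι 2 * c)) _ _) (wsum-*ˡ qs (c * c) _)))))
         (trans (cong (λ z → g i₀ + - (ι 2 * c) * z + c * c * cross g g + c * ⟪ ρ g , ρ g ⟫) eq)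
         (trans (cong (λ z → g i₀ + - (ι 2 * c) * z + c * c * cross g g + c * ⟪ ρ g , ρ g ⟫) (Γ-expand g g))
         (trans (l₂ (g i₀) c ⟪ ρ g , ρ g ⟫ (cross g g)) (trans (cong (λ z → g i₀ - c * z) (sym (Γ-expand g g))) (trans (cong (λ z → g i₀ - z) (c⟪,ρg⟫ g)) (l₃ (g i₀) h)))))))
      where
      l₁ : ∀ a c t → (a - c * t) * (a - c * t) ≡ a * a + - (ι 2 * c) * (a * t) + c * c * (t * t)
      l₁ = solve-∀ ℚ-ring
      l₂ : ∀ g c x X → g + - (ι 2 * c) * (x + c * X) + c * c * X + c * x ≡ g - c * (x + c * X)
      l₂ = solve-∀ ℚ-ring
      l₃ : ∀ g h → g - (g - h) ≡ h
      l₃ = solve-∀ ℚ-ring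
      eq : wsum qs (λ j → A i₀ j * ⟪ col j , ρ g ⟫) ≡ Γ g g
      eq = trans (wsum-cong qs (λ j → cong (A i₀ j *_) (⟪⟫-comm (col j) (ρ g)))) (trans (sym (⟪,g⟫ (ρ g))) (⟪⟫-comm (ρ g) g))

    0≤h : 0ℚ ≤ h
    0≤h = subst (0ℚ ≤_) (sym h≡) (0≤+ (wsum-nonNeg 0≤qs (λ j → 0≤sq (A i₀ j - c * ⟪ col j , ρ g ⟫))) (0≤* 0≤c (⟪⟫-nonNeg (ρ g))))

    h≤ : h ≤ g i₀
    h≤ = ≤-by (g i₀ - h) (subst (0ℚ ≤_) (c⟪,ρg⟫ g) (0≤* 0≤c (Γ-nonNeg g))) (l (g i₀) h)
      where
      l : ∀ x y → x ≡ y + (x - y)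
      l = solve-∀ ℚ-ring

    0<d : 0ℚ < 1ℚ + c * δ * h
    0<d = +-mono-<-≤ 0<1 (0≤* 0≤cδ 0≤h)

    module U = RankOne inverse f g (c * δ) 0<d
    open U using (τ; θ)

    R′ : Forms.Resolvent ps′ qs c
    R′ = record { op = U.ρ′ ; inverse = U.inverse′ (Forms.1+cSP ps′ qs c) eq }
      where
      l₁ : ∀ δ a v t b → (δ * (a * v) + t) * b ≡ t * b + δ * v * (a * b)
      l₁ = solve-∀ ℚ-ring
      l₂ : ∀ v c s δ w g → v + c * (s + δ * w * g) ≡ v + c * s + c * δ * w * g
      l₂ = solve-∀ ℚ-ring
      eq : ∀ v i → fun (Forms.1+cSP ps′ qs c) v i ≡ fun (1+cSP c) v i + c * δ * v i₀ * g i
      eq v i = trans (cong (λ z → v i + c * z) (trans (wsum-cong qs (λ j → l₁ δ (A i₀ j) (v i₀) ⟪ col j , v ⟫ (A i j))) (wsum-sub qs (δ * v i₀) _ _)))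
                     (l₂ (v i) c (SP v i) δ (v i₀) (g i))

    trace-gain : wsum qs (λ j → Forms.Resolvent.Γ R′ (col j) (col j)) ≡ trace + δ * τ * wsum qs (λ j → ρ (col j) i₀ * ρ (col j) i₀)
    trace-gain = trans (wsum-cong qs (λ j → Γ′ (col j) (col j))) (wsum-sub qs (δ * τ) _ _)
      where
      l₁ : ∀ δ u r c τ h G X → δ * (u * (r + - (c * δ * τ * r) * h)) + (G + - (c * δ * τ * r) * X)
           ≡ G + δ * r * (u * (1ℚ - c * δ * τ * h) - τ * (c * X))
      l₁ = solve-∀ ℚ-ring
      l₂ : ∀ G δ r u c τ h w → G + δ * r * (u * ((1ℚ + c * δ * h) * τ - c * δ * τ * h) - τ * (u - w)) ≡ G + δ * τ * (w * r)
      l₂ = solve-∀ ℚ-ring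
      Γ′ : ∀ u v → Forms.Resolvent.Γ R′ u v ≡ Γ u v + δ * τ * (ρ u i₀ * ρ v i₀)
      Γ′ u v = trans (cong (δ * (u i₀ * (ρ v i₀ + θ v * h)) +_) (⟪⟫-subʳ (ρ v) (θ v) (ρ g) u))
        (trans (l₁ δ (u i₀) (ρ v i₀) c τ h (Γ u v) ⟪ u , ρ g ⟫)
        (trans (cong₂ (λ x z → Γ u v + δ * ρ v i₀ * (u i₀ * (x - c * δ * τ * h) - τ * z)) (sym (inv-r 0<d)) (c⟪,ρg⟫ u))
               (l₂ (Γ u v) δ (ρ v i₀) (u i₀) c τ h (ρ u i₀))))

    gain : c * δ * g i₀ ≤ 1ℚ → trace + δ * ½ * wsum qs (λ j → ρ (col j) i₀ * ρ (col j) i₀) ≤ wsum qs (λ j → Forms.Resolvent.Γ R′ (col j) (col j))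
    gain le = ≤-≡-trans (+-monoʳ-≤ trace (*-monoʳ (wsum qs (λ j → ρ (col j) i₀ * ρ (col j) i₀)) (wsum-nonNeg 0≤qs (λ j → 0≤sq (ρ (col j) i₀))) (*-monoˡ δ 0≤δ
        (½≤inv 0<d (+-monoʳ-≤ 1ℚ (≤-trans (*-monoˡ (c * δ) 0≤cδ h≤) (≤-≡-trans le (sym (+-identityʳ 1ℚ)))))))))
      (sym trace-gain)

-- Greedy increase of the weights

scales : ℕ → List ℕ
scales zero    = 0 ∷ []
scales (suc L) = suc L ∷ scales L

∈-scales : ∀ {L l} → l ∈ scales L → l ℕ.≤ L
∈-scales {zero} (here refl) = ℕ.z≤n
∈-scales {suc L} (here refl) = ℕₚ.≤-refl
∈-scales {suc L} (there m) = ℕₚ.≤-trans (∈-scales m) (ℕₚ.n≤1+n L)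

2^ : ℕ → ℚ
2^ l = ι 2 ^ℚ l

4^ : ℕ → ℚ
4^ l = ι 4 ^ℚ l

0<2^ : ∀ l → 0ℚ < 2^ l
0<2^ = ^ℚ-pos (0<ι {2} (ℕ.s≤s ℕ.z≤n))

0<4^ : ∀ l → 0ℚ < 4^ l
0<4^ = ^ℚ-pos (0<ι {4} (ℕ.s≤s ℕ.z≤n))

0≤2^ : ∀ l → 0ℚ ≤ 2^ l
0≤2^ l = <⇒≤ (0<2^ l)

0≤4^ : ∀ l → 0ℚ ≤ 4^ l
0≤4^ l = <⇒≤ (0<4^ l)

4^-mono : ∀ {l L} → l ℕ.≤ L → 4^ l ≤ 4^ L
4^-mono {zero} {zero} ℕ.z≤n = ≤-refl
4^-mono {zero} {suc L} ℕ.z≤n = ≤-trans (4^-mono {zero} {L} ℕ.z≤n) (≡-≤-trans (sym (*-identityˡ (4^ L))) (*-monoʳ (4^ L) (0≤4^ L) (ι-mono {1} {4} (ℕ.s≤s ℕ.z≤n))))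
4^-mono (ℕ.s≤s le) = *-monoˡ (ι 4) (0≤ι 4) (4^-mono le)

exceeds : ∀ {X : Set} (f : X → ℚ) b (xs : List X) → (∃[ x ] b < f x) ⊎ (∀ {x} → x ∈ xs → f x ≤ b)
exceeds f b [] = inj₂ λ ()
exceeds f b (x ∷ xs) with b <? f x
... | yes p = inj₁ (x , p)
... | no ¬p with exceeds f b xs
... | inj₁ r = inj₁ r
... | inj₂ r = inj₂ λ { (here refl) → ≮⇒≥ ¬p ; (there m) → r m }

module Greedy {I J : Set} (A : I → J → ℚ) (A²≤1 : ∀ i j → A i j * A i j ≤ 1ℚ)
              (is : List I) (js : List J) (0<m : 0 ℕ.< length is) (L : ℕ) where
  open Scale A public

  record State : Set where
    field
      ps   : Weights I
      qs   : Weights J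
      0≤ps : NonNeg ps
      0≤qs : NonNeg qs
      res  : ∀ l → Forms.Resolvent ps qs (4^ l)

    open Forms ps qs public
    module R l = Forms.Resolvent (res l)
    module R⁺ l = R.Positive l (0≤4^ l) 0≤ps 0≤qs

    value : ℚ
    value = ∑[ l ∈ scales L ] (2^ l * wsum qs (λ j → R.Γ l (col j) (col j)))

    -- The partial derivative of `value` in the weight of row `i`, as the `trace-gain` formulas show
    -- for δ → 0; likewise `gradCol` for columns.
    gradRow : I → ℚ
    gradRow i = ∑[ l ∈ scales L ] (2^ l * wsum qs (λ j → R.ρ l (col j) i * R.ρ l (col j) i))

    gradCol : J → ℚ
    gradCol j = ∑[ l ∈ scales L ] (2^ l * ⟪ R.ρ l (col j) , R.ρ l (col j) ⟫)

    field
      -- The row weights start uniform and only grow, so the unweighted norm stays under control;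
      -- the last term of the factorization needs this.
      base : ∀ u → ∑[ i ∈ is ] (u i * u i) ≤ ι (length is) * ⟪ u , u ⟫

  -- With δ = 1/`steps`, all steps together add mass 1, so the masses stay at most 2. Then 4^l δ · 2
  -- ≤ 1 at every scale l ≤ L, which keeps each Sherman-Morrison factor τ at least ½.
  steps : ℕ
  steps = 2 ℕ.* 4 ℕ.^ L

  ι-steps : ι steps ≡ ι 2 * 4^ L
  ι-steps = trans (ι-* 2 (4 ℕ.^ L)) (cong (ι 2 *_) (ι-^ 4 L))

  0<steps : 0ℚ < ι steps
  0<steps = subst (0ℚ <_) (sym ι-steps) (0<* (0<ι {2} (ℕ.s≤s ℕ.z≤n)) (0<4^ L))

  δ : ℚ
  δ = inv (ι steps)

  0≤δ : 0ℚ ≤ δ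
  0≤δ = <⇒≤ (inv-pos 0<steps)

  small : ∀ {l x} → l ℕ.≤ L → 0ℚ ≤ x → x ≤ ι 2 → 4^ l * δ * x ≤ 1ℚ
  small {l} {x} l≤L 0≤x x≤2 = ≤-trans (*-mono (0≤* (0≤4^ l) 0≤δ) 0≤x (*-monoʳ δ 0≤δ (4^-mono l≤L)) x≤2)
    (≤-reflexive (trans (lem (4^ L) δ (ι 2)) (trans (cong (_* δ) (sym ι-steps)) (inv-r 0<steps))))
    where
    lem : ∀ c d t → c * d * t ≡ t * c * d
    lem = solve-∀ ℚ-ring

  value-gain : ∀ {t t′ x : ℕ → ℚ} → (∀ l → l ℕ.≤ L → t l + δ * ½ * x l ≤ t′ l) →
               ∑[ l ∈ scales L ] (2^ l * t l) + δ * ½ * ∑[ l ∈ scales L ] (2^ l * x l) ≤ ∑[ l ∈ scales L ] (2^ l * t′ l)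
  value-gain {t} {t′} {x} le = ≡-≤-trans
    (trans (cong (∑[ l ∈ scales L ] (2^ l * t l) +_) (sym (sum-*ˡ (scales L) (δ * ½) (λ l → 2^ l * x l))))
           (sym (sum-+ (scales L) (λ l → 2^ l * t l) (λ l → δ * ½ * (2^ l * x l)))))
    (sum-mono-∈ (scales L) (λ {l} m → ≡-≤-trans (lem (2^ l) (t l) (δ * ½) (x l)) (*-monoˡ (2^ l) (0≤2^ l) (le l (∈-scales m)))))
    where
    lem : ∀ a t k x → a * t + k * (a * x) ≡ a * (t + k * x)
    lem = solve-∀ ℚ-ring

  module _ (st : State) where
    open State st

    addColumn : J → State
    addColumn j₀ = record
      { ps = ps ; qs = (δ , j₀) ∷ qs ; 0≤ps = 0≤ps ; 0≤qs = 0≤δ ∷ 0≤qs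
      ; res = λ l → Updates.AddColumn.R′ A ps qs 0≤ps 0≤qs (0≤4^ l) 0≤δ (res l) j₀ ; base = base }

    addColumn-gain : mass ps ≤ ι 2 → ∀ j₀ → value + δ * ½ * gradCol j₀ ≤ State.value (addColumn j₀)
    addColumn-gain m≤2 j₀ = value-gain (λ l l≤L →
      Updates.AddColumn.gain A ps qs 0≤ps 0≤qs (0≤4^ l) 0≤δ (res l) j₀
        (small l≤L (wsum-nonNeg 0≤ps (λ i → 0≤sq (A i j₀))) (≤-trans (wsum-mono 0≤ps (λ i → A²≤1 i j₀)) m≤2)))

    addRow : I → State
    addRow i₀ = record
      { ps = (δ , i₀) ∷ ps ; qs = qs ; 0≤ps = 0≤δ ∷ 0≤ps ; 0≤qs = 0≤qs
      ; res = λ l → Updates.AddRow.R′ A ps qs 0≤ps 0≤qs (0≤4^ l) 0≤δ (res l) i₀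
      ; base = λ u → ≤-trans (base u) (*-monoˡ (ι (length is)) (0≤ι (length is))
                 (≤-by (δ * (u i₀ * u i₀)) (0≤* 0≤δ (0≤sq (u i₀))) (+-comm (δ * (u i₀ * u i₀)) ⟪ u , u ⟫))) }

    addRow-gain : mass qs ≤ ι 2 → ∀ i₀ → value + δ * ½ * gradRow i₀ ≤ State.value (addRow i₀)
    addRow-gain m≤2 i₀ = value-gain (λ l l≤L →
      Updates.AddRow.gain A ps qs 0≤ps 0≤qs (0≤4^ l) 0≤δ (res l) i₀
        (small l≤L (wsum-nonNeg 0≤qs (λ j → 0≤sq (A i₀ j))) (≤-trans (wsum-mono 0≤qs (λ j → A²≤1 i₀ j)) m≤2)))

  initial : State
  initial = record
    { ps = uniform ; qs = [] ; 0≤ps = nn is ; 0≤qs = []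
    ; res = λ l → record { op = id-Lin ; inverse = record { right = λ v i → lem (v i) (4^ l) ; left = λ v i → lem (v i) (4^ l) } }
    ; base = λ u → ≤-reflexive (sym (trans (cong (ι (length is) *_) (eq is (λ i → u i * u i))) (trans (lem₂ (ι (length is)) w _) (trans (cong (_* sumᴸ is _) (inv-r 0<ιm)) (*-identityˡ _))))) }
    where
    0<ιm = 0<ι 0<m
    w = inv (ι (length is))
    uniform = map (w ,_) is
    nn : ∀ xs → NonNeg (map (w ,_) xs)
    nn [] = []
    nn (x ∷ xs) = <⇒≤ (inv-pos 0<ιm) ∷ nn xs
    lem : ∀ v c → v + c * 0ℚ ≡ v
    lem = solve-∀ ℚ-ring
    lem₂ : ∀ m w s → m * (w * s) ≡ m * w * s
    lem₂ = solve-∀ ℚ-ring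
    eq : ∀ xs (f : I → ℚ) → wsum (map (w ,_) xs) f ≡ w * sumᴸ xs f
    eq [] f = sym (*-zeroʳ w)
    eq (x ∷ xs) f = trans (cong (w * f x +_) (eq xs f)) (sym (*-distribˡ-+ w (f x) _))

  mass-initial : mass (State.ps initial) ≡ 1ℚ
  mass-initial = trans (eq is) (inv-r (0<ι 0<m))
    where
    w = inv (ι (length is))
    lem : ∀ w n → w * 1ℚ + n * w ≡ (1ℚ + n) * w
    lem = solve-∀ ℚ-ring
    eq : ∀ (xs : List I) → wsum (map (w ,_) xs) (λ _ → 1ℚ) ≡ ι (length xs) * w
    eq [] = sym (*-zeroˡ w)
    eq (x ∷ xs) = trans (cong (w * 1ℚ +_) (eq xs)) (lem w (ι (length xs)))

  record Stationary (st : State) (Λ : ℚ) : Set where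
    open State st
    field
      rows : ∀ {i} → i ∈ is → gradRow i ≤ Λ
      cols : ∀ {j} → j ∈ js → gradCol j ≤ Λ

  record Light (st : State) : Set where
    open State st
    field
      ps≤2 : mass ps ≤ ι 2
      qs≤2 : mass qs ≤ ι 2

  record Reached (Λ : ℚ) (k : ℕ) : Set where
    field
      st    : State
      ps≤   : mass (State.ps st) ≤ 1ℚ + ι k * δ
      qs≤   : mass (State.qs st) ≤ ι k * δ
      value≥ : ι k * (δ * ½ * Λ) ≤ State.value st

  kδ≤1 : ∀ {k} → k ℕ.≤ steps → ι k * δ ≤ 1ℚ
  kδ≤1 {k} k≤ = ≤-≡-trans (*-monoʳ δ 0≤δ (ι-mono k≤)) (inv-r 0<steps)

  light : ∀ {Λ k} → k ℕ.≤ steps → (r : Reached Λ k) → Light (Reached.st r)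
  light {Λ} {k} k≤ r = record
    { ps≤2 = ≤-trans ps≤ (+-monoʳ-≤ 1ℚ (≤-≡-trans (kδ≤1 k≤) (sym (+-identityʳ 1ℚ))))
    ; qs≤2 = ≤-trans qs≤ (≤-trans (kδ≤1 k≤) (ι-mono {1} {2} (ℕ.s≤s ℕ.z≤n))) }
    where open Reached r

  -- While some gradient exceeds Λ, raising that weight by δ gains at least ½ δ Λ. If this never
  -- stops, the `steps` moves add up to ½ Λ.
  run : ∀ {Λ} → ∀ fuel k → fuel ℕ.+ k ≡ steps → Reached Λ k →
        ∃[ st ] Light st × (Stationary st Λ ⊎ ½ * Λ ≤ State.value st)
  run {Λ} zero k refl r = st , light ℕₚ.≤-refl r , inj₂ (≡-≤-trans eq value≥)
    where
    open Reached r
    lem : ∀ k d h Λ → k * d * (h * Λ) ≡ k * (d * h * Λ)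
    lem = solve-∀ ℚ-ring
    eq : ½ * Λ ≡ ι steps * (δ * ½ * Λ)
    eq = trans (sym (*-identityˡ (½ * Λ))) (trans (cong (_* (½ * Λ)) (sym (inv-r 0<steps))) (lem (ι steps) δ ½ Λ))
  run {Λ} (suc f) k eq r = go (exceeds gradRow Λ is) (exceeds gradCol Λ js)
    where
    open Reached r
    open State st using (gradRow; gradCol; value; ps; qs)
    k<steps : k ℕ.≤ steps
    k<steps = subst (k ℕ.≤_) eq (ℕₚ.≤-trans (ℕₚ.m≤n+m k f) (ℕₚ.n≤1+n _))
    open Light (light k<steps r)
    eq′ : f ℕ.+ suc k ≡ steps
    eq′ = trans (ℕₚ.+-suc f k) eq
    lem₂ : ∀ d k x → d * 1ℚ + (x + k * d) ≡ x + (1ℚ + k) * d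
    lem₂ = solve-∀ ℚ-ring
    lem₃ : ∀ d k → d * 1ℚ + k * d ≡ (1ℚ + k) * d
    lem₃ = solve-∀ ℚ-ring
    grow : ∀ {x} → x ≤ ι k * δ → x ≤ ι (suc k) * δ
    grow {x} le = ≤-trans le (≤-by δ 0≤δ (lem (ι k) δ))
      where
      lem : ∀ k d → (1ℚ + k) * d ≡ k * d + d
      lem = solve-∀ ℚ-ring
    value′ : ∀ {G V} → Λ < G → value + δ * ½ * G ≤ V → ι (suc k) * (δ * ½ * Λ) ≤ V
    value′ {G} {V} Λ<G le = ≤-trans (≤-trans (≤-reflexive (lem (ι k) (δ * ½ * Λ)))
        (+-mono-≤ value≥ (*-monoˡ (δ * ½) (0≤* 0≤δ (nonNegative⁻¹ ½)) (<⇒≤ Λ<G)))) le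
      where
      lem : ∀ k x → (1ℚ + k) * x ≡ k * x + x
      lem = solve-∀ ℚ-ring
    go : (∃[ i ] Λ < gradRow i) ⊎ (∀ {i} → i ∈ is → gradRow i ≤ Λ) →
         (∃[ j ] Λ < gradCol j) ⊎ (∀ {j} → j ∈ js → gradCol j ≤ Λ) →
         ∃[ st ] Light st × (Stationary st Λ ⊎ ½ * Λ ≤ State.value st)
    go (inj₁ (i , Λ<)) _ = run f (suc k) eq′ (record
      { st = addRow st i
      ; ps≤ = ≤-trans (+-monoʳ-≤ (δ * 1ℚ) ps≤) (≤-reflexive (lem₂ δ (ι k) 1ℚ))
      ; qs≤ = grow qs≤
      ; value≥ = value′ Λ< (addRow-gain st qs≤2 i) })
    go (inj₂ _) (inj₁ (j , Λ<)) = run f (suc k) eq′ (record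
      { st = addColumn st j
      ; ps≤ = ≤-trans ps≤ (+-monoʳ-≤ 1ℚ (grow ≤-refl))
      ; qs≤ = ≤-trans (+-monoʳ-≤ (δ * 1ℚ) qs≤) (≤-reflexive (lem₃ δ (ι k)))
      ; value≥ = value′ Λ< (addColumn-gain st ps≤2 j) })
    go (inj₂ rows) (inj₂ cols) = st , light k<steps r , inj₁ (record { rows = rows ; cols = cols })

  dichotomy : ∀ Λ → ∃[ st ] Light st × (Stationary st Λ ⊎ ½ * Λ ≤ State.value st)
  dichotomy Λ = run steps 0 (ℕₚ.+-identityʳ steps) (record
    { st = initial
    ; ps≤ = ≤-reflexive (trans mass-initial (sym (lem δ)))
    ; qs≤ = ≤-reflexive (sym (*-zeroˡ δ))
    ; value≥ = ≤-reflexive (trans (*-zeroˡ (δ * ½ * Λ)) (sym (trans (sum-cong (scales L) (λ l → *-zeroʳ (2^ l))) (sum-0 (scales L))))) })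
    where
    lem : ∀ d → 1ℚ + 0ℚ * d ≡ 1ℚ
    lem = solve-∀ ℚ-ring

-- A factorization of A through a weighted Euclidean space, all of whose
-- row and column vectors have squared length at most γ; the least γ is γ₂(A).
record Factorization {I J : Set} (A : I → J → ℚ) (γ : ℚ) : Set where
  field
    terms    : Weights ((I → ℚ) × (J → ℚ))
    0≤terms  : NonNeg terms
    entry    : ∀ i j → A i j ≡ wsum terms (λ t → proj₁ t i * proj₂ t j)
    row-norm : ∀ i → wsum terms (λ t → proj₁ t i * proj₁ t i) ≤ γ
    col-norm : ∀ j → wsum terms (λ t → proj₂ t j * proj₂ t j) ≤ γ

-- Resolvent identities

module Resolvents {I J : Set} (A : I → J → ℚ) (ps : Weights I) (qs : Weights J) where
  open Scale A
  open Forms ps qs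

  module Two {c c′ : ℚ} (R : Resolvent c) (R′ : Resolvent c′) where
    open Resolvent R using (ρ; op; left; right)
    open Resolvent R′ using () renaming (ρ to ρ′; op to op′; left to left′; right to right′)

    ρ-SP : ∀ z i → ρ (SP z) i ≡ wsum qs (λ j → ⟪ col j , z ⟫ * ρ (col j) i)
    ρ-SP z i = comb qs (λ j → ⟪ col j , z ⟫) i
      where
      l : ∀ w h a s → w * (h * a) + s ≡ s + w * h * a
      l = solve-∀ ℚ-ring
      l₀ : ∀ x → 0ℚ ≡ 0ℚ * x
      l₀ = solve-∀ ℚ-ring
      comb : ∀ ws (h : J → ℚ) i → ρ (λ i → wsum ws (λ j → h j * A i j)) i ≡ wsum ws (λ j → h j * ρ (col j) i)
      comb [] h i = trans (congᴸ op {v = 0ℚ ⊙ λ _ → 0ℚ} (λ _ → refl) i) (trans (mulᴸ op 0ℚ (λ _ → 0ℚ) i) (*-zeroˡ (ρ (λ _ → 0ℚ) i)))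
      comb ((w , j) ∷ ws) h i = trans (congᴸ op (λ i → l w (h j) (A i j) (wsum ws (λ j → h j * A i j))) i)
        (trans (subᴸ op (λ i → wsum ws (λ j → h j * A i j)) (w * h j) (col j) i)
        (trans (cong (_+ w * h j * ρ (col j) i) (comb ws h i)) (sym (l w (h j) (ρ (col j) i) _))))

    -- Write w = (1 + c′ S P) ρ′ w as (1 + c S P) ρ′ w + (c′ - c) S P ρ′ w and apply ρ.
    ρ-diff : ∀ w i → ρ w i - ρ′ w i ≡ (c′ - c) * ρ (SP (ρ′ w)) i
    ρ-diff w i = trans (cong (_- ρ′ w i)
        (trans (congᴸ op (λ i → trans (sym (right′ w i)) (l₁ (ρ′ w i) c c′ (SP (ρ′ w) i))) i)
        (trans (subᴸ op (ρ′ w ⊕ (c ⊙ SP (ρ′ w))) (c′ - c) (SP (ρ′ w)) i) (cong (_+ (c′ - c) * ρ (SP (ρ′ w)) i) (left (ρ′ w) i)))))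
      (l₂ (ρ′ w i) ((c′ - c) * ρ (SP (ρ′ w)) i))
      where
      l₁ : ∀ r c c′ s → r + c′ * s ≡ r + c * s + (c′ - c) * s
      l₁ = solve-∀ ℚ-ring
      l₂ : ∀ r x → r + x - r ≡ x
      l₂ = solve-∀ ℚ-ring

    -- (c′ − c) ρ ρ′ = c′ ρ′ − c ρ
    ρρ′ : ∀ w i → (c′ - c) * ρ (ρ′ w) i ≡ c′ * ρ′ w i - c * ρ w i
    ρρ′ w i = trans (l (c′ - c) (ρ (ρ′ w) i) (ρ w i)) (trans (cong (λ z → (c′ - c) * ρ w i - z) eq) (l₂ c c′ (ρ w i) (ρ′ w i)))
      where
      l : ∀ d y x → d * y ≡ d * x - (d * (x - y))
      l = solve-∀ ℚ-ring
      l₁ : ∀ r s → s ≡ r + s - r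
      l₁ = solve-∀ ℚ-ring
      l₂ : ∀ c c′ x y → (c′ - c) * x - c′ * (x - y) ≡ c′ * y - c * x
      l₂ = solve-∀ ℚ-ring
      l₃ : ∀ d c x → d * (c * x) ≡ c * (d * x)
      l₃ = solve-∀ ℚ-ring
      l₄ : ∀ w r → w + - 1ℚ * r ≡ w - r
      l₄ = solve-∀ ℚ-ring
      eq : (c′ - c) * (ρ w i - ρ (ρ′ w) i) ≡ c′ * (ρ w i - ρ′ w i)
      eq = trans (cong ((c′ - c) *_) (trans (sym (l₄ (ρ w i) (ρ (ρ′ w) i))) (trans (sym (subᴸ op w (- 1ℚ) (ρ′ w) i))
             (trans (congᴸ op (λ i → trans (l₄ (w i) (ρ′ w i)) (trans (cong (_- ρ′ w i) (sym (right′ w i))) (sym (l₁ (ρ′ w i) (c′ * SP (ρ′ w) i))))) i)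
                    (mulᴸ op c′ (SP (ρ′ w)) i)))))
           (trans (l₃ (c′ - c) c′ (ρ (SP (ρ′ w)) i)) (cong (c′ *_) (sym (ρ-diff w i))))

  -- The identity `ρρ′` with the two resolvents exchanged has both sides negated except for the
  -- order of the product; c′ - c cancels.
  ρ-comm : ∀ {c c′} → c < c′ → (R : Resolvent c) (R′ : Resolvent c′) → ∀ w i →
           Resolvent.ρ R′ (Resolvent.ρ R w) i ≡ Resolvent.ρ R (Resolvent.ρ R′ w) i
  ρ-comm {c} {c′} c<c′ R R′ w i = cancel (trans (trans (l₁ c c′ (ρ′ (ρ w) i)) (cong -_ (Two.ρρ′ R′ R w i))) (trans (l₂ c c′ (ρ w i) (ρ′ w i)) (sym (Two.ρρ′ R R′ w i))))
    where
    open Resolvent R using (ρ)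
    open Resolvent R′ using () renaming (ρ to ρ′)
    l₁ : ∀ c c′ x → (c′ - c) * x ≡ - ((c - c′) * x)
    l₁ = solve-∀ ℚ-ring
    l₂ : ∀ c c′ x y → - (c * x - c′ * y) ≡ c′ * y - c * x
    l₂ = solve-∀ ℚ-ring
    l₃ : ∀ d i x → x * (d * i) ≡ d * x * i
    l₃ = solve-∀ ℚ-ring
    d = c′ - c
    dinv : d * inv d ≡ 1ℚ
    dinv = inv-r (0<- c<c′)
    norm : ∀ x → x ≡ d * x * inv d
    norm x = trans (sym (*-identityʳ x)) (trans (cong (x *_) (sym dinv)) (l₃ d (inv d) x))
    cancel : ∀ {x y} → d * x ≡ d * y → x ≡ y
    cancel {x} {y} e = trans (norm x) (trans (cong (_* inv d) e) (sym (norm y)))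

4^-< : ∀ l → 4^ l < 4^ (suc l)
4^-< l = <-by (ι 3 * 4^ l) (0<* (0<ι {3} (ℕ.s≤s ℕ.z≤n)) (0<4^ l)) (lem (4^ l))
  where
  lem : ∀ x → ι 4 * x ≡ x + ι 3 * x
  lem = solve-∀ ℚ-ring

4^≡2^*2^ : ∀ l → 4^ l ≡ 2^ l * 2^ l
4^≡2^*2^ zero = sym (*-identityˡ 1ℚ)
4^≡2^*2^ (suc l) = trans (cong (ι 4 *_) (4^≡2^*2^ l)) (lem (2^ l))
  where
  lem : ∀ x → ι 4 * (x * x) ≡ ι 2 * x * (ι 2 * x)
  lem = solve-∀ ℚ-ring

-- A factorization from stationary weights

module Primal {m n : ℕ} (A : Fin m → Fin n → ℚ) (A²≤1 : ∀ i j → A i j * A i j ≤ 1ℚ)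
              (0<m : 0 ℕ.< length (allFin m)) (L : ℕ) (m≤2^L : ι m ≤ 2^ L) where
  open Greedy A A²≤1 (allFin m) (allFin n) 0<m L

  module _ (st : State) (Λ : ℚ) (1≤Λ : 1ℚ ≤ Λ) (lt : Light st) (stat : Stationary st Λ) where
    open State st
    open Light lt
    open Stationary stat

    Term : Set
    Term = (Fin m → ℚ) × (Fin n → ℚ)

    lr : Term → Fin m → Fin n → ℚ
    lr t i j = proj₁ t i * proj₂ t j

    ll : Term → Fin m → ℚ
    ll t i = proj₁ t i * proj₁ t i

    rr : Term → Fin n → ℚ
    rr t j = proj₂ t j * proj₂ t j

    -- The columns telescope along these products of two consecutive resolvents. A difference of
    -- single resolvents would not do: here it equals (4^(l+2) - 4^l) ρ_l S P ρ_(l+2) ρ_(l+1) a_j,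
    -- which splits at S into a row factor measured by `gradRow` at scale l and a column factor
    -- measured by `gradCol` at scale l+1.
    Π : ℕ → Fin n → Fin m → ℚ
    Π l j = R.ρ (suc l) (R.ρ l (col j))

    η : ℕ → Fin n → ℚ
    η l j = ⟪ R.ρ l (col j) , R.ρ l (col j) ⟫

    ξ : ℕ → Fin m → ℚ
    ξ l i = wsum qs (λ j → R.ρ l (col j) i * R.ρ l (col j) i)

    0≤η : ∀ l j → 0ℚ ≤ η l j
    0≤η l j = wsum-nonNeg 0≤ps (λ i → 0≤sq (R.ρ l (col j) i))

    0≤ξ : ∀ l i → 0ℚ ≤ ξ l i
    0≤ξ l i = wsum-nonNeg 0≤qs (λ j → 0≤sq (R.ρ l (col j) i))

    col≤2 : ∀ j → ⟪ col j , col j ⟫ ≤ ι 2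
    col≤2 j = ≤-trans (wsum-mono 0≤ps (λ i → A²≤1 i j)) ps≤2

    -- The terms for col j - Π 0 j.
    headTerm : Fin n → Term
    headTerm k = (λ i → A i k) , (λ j → 4^ 0 * ⟪ col k , R.ρ 0 (col j) ⟫ + 4^ 1 * ⟪ col k , Π 0 j ⟫)

    head : Weights Term
    head = rescale 1ℚ headTerm qs

    head-lr : ∀ i j → wsum head (λ t → lr t i j) ≡ A i j - Π 0 j i
    head-lr i j = trans (wsum-rescale 1ℚ headTerm qs (λ t → lr t i j)) (trans (*-identityˡ _)
      (trans (wsum-cong qs (λ k → l₁ (A i k) (4^ 0) ⟪ col k , R.ρ 0 (col j) ⟫ (4^ 1) ⟪ col k , Π 0 j ⟫))
      (trans (wsum-+ qs _ _) (trans (cong₂ _+_ (wsum-*ˡ qs (4^ 0) _) (wsum-*ˡ qs (4^ 1) _))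
      (trans (l₂ (R.ρ 0 (col j) i) (4^ 0 * SP (R.ρ 0 (col j)) i) (Π 0 j i) (4^ 1 * SP (Π 0 j) i))
      (trans (cong₂ (λ x y → x - R.ρ 0 (col j) i + (y - Π 0 j i)) (R.right 0 (col j) i) (R.right 1 (R.ρ 0 (col j)) i))
             (l₃ (A i j) (R.ρ 0 (col j) i) (Π 0 j i))))))))
      where
      l₁ : ∀ a c x c′ y → a * (c * x + c′ * y) ≡ c * (x * a) + c′ * (y * a)
      l₁ = solve-∀ ℚ-ring
      l₂ : ∀ r s r′ s′ → s + s′ ≡ r + s - r + (r′ + s′ - r′)
      l₂ = solve-∀ ℚ-ring
      l₃ : ∀ a r p → a - r + (r - p) ≡ a - p
      l₃ = solve-∀ ℚ-ring

    head-ll : ∀ i → wsum head (λ t → ll t i) ≤ ι 2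
    head-ll i = ≡-≤-trans (trans (wsum-rescale 1ℚ headTerm qs (λ t → ll t i)) (*-identityˡ _))
      (≤-trans (wsum-mono 0≤qs (λ k → A²≤1 i k)) qs≤2)

    head-rr : ∀ j → wsum head (λ t → rr t j) ≤ ι 20
    head-rr j = ≡-≤-trans (trans (wsum-rescale 1ℚ headTerm qs (λ t → rr t j)) (*-identityˡ _))
      (≤-trans (wsum-mono 0≤qs (λ k → ≤-by ((4^ 0 * x k - 4^ 1 * y k) * (4^ 0 * x k - 4^ 1 * y k)) (0≤sq (4^ 0 * x k - 4^ 1 * y k)) (l₁ (4^ 0) (x k) (4^ 1) (y k))))
      (≡-≤-trans (trans (wsum-+ qs _ _) (cong₂ _+_ (wsum-*ˡ qs (ι 2 * 4^ 0 * 4^ 0) _) (wsum-*ˡ qs (ι 2 * 4^ 1 * 4^ 1) _)))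
      (≤-trans (≤-reflexive (l₂ (4^ 0) (4^ 1) (R.cross 0 (col j) (col j)) (R.cross 1 w w)))
      (≤-trans (+-mono-≤ (*-monoˡ (ι 2 * 4^ 0) (0≤* (0≤ι 2) (0≤4^ 0)) (≤-trans (R⁺.cross-bound 0 (col j)) (col≤2 j)))
                         (*-monoˡ (ι 2 * 4^ 1) (0≤* (0≤ι 2) (0≤4^ 1)) (≤-trans (R⁺.cross-bound 1 w) (≤-trans (R⁺.contraction 0 (col j)) (col≤2 j)))))
               (≤-reflexive refl)))))
      where
      w = R.ρ 0 (col j)
      x : Fin n → ℚ
      x k = ⟪ col k , R.ρ 0 (col j) ⟫
      y : Fin n → ℚ
      y k = ⟪ col k , Π 0 j ⟫
      l₁ : ∀ c x c′ y → ι 2 * c * c * (x * x) + ι 2 * c′ * c′ * (y * y) ≡ (c * x + c′ * y) * (c * x + c′ * y) + (c * x - c′ * y) * (c * x - c′ * y)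
      l₁ = solve-∀ ℚ-ring
      l₂ : ∀ c c′ x y → ι 2 * c * c * x + ι 2 * c′ * c′ * y ≡ ι 2 * c * (c * x) + ι 2 * c′ * (c′ * y)
      l₂ = solve-∀ ℚ-ring

    -- The terms for Π l j - Π (l + 1) j.
    midTerm : ℕ → Fin n → Term
    midTerm l k = (λ i → R.ρ l (col k) i) , (λ j → ι 15 * 2^ l * ⟪ col k , R.ρ (suc (suc l)) (R.ρ (suc l) (col j)) ⟫)

    mid : ℕ → Weights Term
    mid l = rescale (2^ l) (midTerm l) qs

    mid-lr : ∀ l i j → wsum (mid l) (λ t → lr t i j) ≡ Π l j i - Π (suc l) j i
    mid-lr l i j = trans (wsum-rescale (2^ l) (midTerm l) qs (λ t → lr t i j))
      (trans (cong (2^ l *_) (trans (wsum-cong qs (λ k → l₁ (R.ρ l (col k) i) (ι 15 * 2^ l) ⟪ col k , z ⟫)) (wsum-*ˡ qs (ι 15 * 2^ l) _)))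
      (trans (cong (λ s → 2^ l * (ι 15 * 2^ l * s)) (sym (Two.ρ-SP (res l) (res (suc (suc l))) z i)))
      (trans (l₂ (2^ l) (R.ρ l (SP z) i)) (trans (cong (λ s → (ι 4 * (ι 4 * s) - s) * R.ρ l (SP z) i) (sym (4^≡2^*2^ l)))
      (trans (sym (Two.ρ-diff (res l) (res (suc (suc l))) w i)) (cong (_- Π (suc l) j i) (sym (ρ-comm (4^-< l) (res l) (res (suc l)) (col j) i))))))))
      where
      open Resolvents A ps qs
      w = R.ρ (suc l) (col j)
      z = R.ρ (suc (suc l)) w
      l₁ : ∀ r k x → r * (k * x) ≡ k * (x * r)
      l₁ = solve-∀ ℚ-ring
      l₂ : ∀ t s → t * (ι 15 * t * s) ≡ (ι 4 * (ι 4 * (t * t)) - t * t) * s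
      l₂ = solve-∀ ℚ-ring

    mid-ll : ∀ l i → wsum (mid l) (λ t → ll t i) ≡ 2^ l * ξ l i
    mid-ll l i = wsum-rescale (2^ l) (midTerm l) qs (λ t → ll t i)

    -- 15 = 4² - 1 is the gap between the scales l and l+2 in units of 4^l. By `cross-bound` at
    -- scale l+2, 225 · 4^l X ≤ (225/16) η, which is below 15 η.
    mid-rr : ∀ l j → wsum (mid l) (λ t → rr t j) ≤ ι 15 * (2^ (suc l) * η (suc l) j)
    mid-rr l j = ≡-≤-trans (trans (wsum-rescale (2^ l) (midTerm l) qs (λ t → rr t j))
        (cong (2^ l *_) (trans (wsum-cong qs (λ k → l₁ (2^ l) ⟪ col k , z ⟫)) (trans (wsum-*ˡ qs (ι 225 * (2^ l * 2^ l)) _) (cong (λ s → ι 225 * s * X) (sym (4^≡2^*2^ l)))))))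
      (≤-by (2^ l * (ι 15 * (4^ l * X) + ι 15 * (η (suc l) j - 4^ (suc (suc l)) * X) + ι 15 * η (suc l) j))
            (0≤* (0≤2^ l) (0≤+ (0≤+ (0≤* (0≤ι 15) (0≤* (0≤4^ l) (R⁺.cross-nonNeg (suc (suc l)) w))) (0≤* (0≤ι 15) (0≤- (R⁺.cross-bound (suc (suc l)) w)))) (0≤* (0≤ι 15) (0≤η (suc l) j))))
            (l₂ (2^ l) (4^ l) X (η (suc l) j)))
      where
      w = R.ρ (suc l) (col j)
      z = R.ρ (suc (suc l)) w
      X = R.cross (suc (suc l)) w w
      l₁ : ∀ t x → ι 15 * t * x * (ι 15 * t * x) ≡ ι 225 * (t * t) * (x * x)
      l₁ = solve-∀ ℚ-ring
      l₂ : ∀ t f X e → ι 15 * (ι 2 * t * e) ≡ t * (ι 225 * f * X) + t * (ι 15 * (f * X) + ι 15 * (e - ι 4 * (ι 4 * f) * X) + ι 15 * e)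
      l₂ = solve-∀ ℚ-ring

    mids : ℕ → Weights Term
    mids zero    = []
    mids (suc l) = mid l ++ mids l

    mids-lr : ∀ l i j → wsum (mids l) (λ t → lr t i j) ≡ Π 0 j i - Π l j i
    mids-lr zero i j = sym (+-inverseʳ (Π 0 j i))
    mids-lr (suc l) i j = trans (wsum-++ (mid l) (mids l) _) (trans (cong₂ _+_ (mid-lr l i j) (mids-lr l i j)) (lem (Π l j i) (Π (suc l) j i) (Π 0 j i)))
      where
      lem : ∀ a b c → a - b + (c - a) ≡ c - b
      lem = solve-∀ ℚ-ring

    mids-ll : ∀ l i → wsum (mids l) (λ t → ll t i) + 2^ l * ξ l i ≡ ∑[ k ∈ scales l ] (2^ k * ξ k i)
    mids-ll zero i = +-comm 0ℚ (2^ 0 * ξ 0 i)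
    mids-ll (suc l) i = trans (cong (_+ 2^ (suc l) * ξ (suc l) i) (trans (wsum-++ (mid l) (mids l) _)
        (trans (cong (_+ wsum (mids l) (λ t → ll t i)) (mid-ll l i)) (trans (+-comm (2^ l * ξ l i) _) (mids-ll l i)))))
      (+-comm _ (2^ (suc l) * ξ (suc l) i))

    mids-rr : ∀ l j → wsum (mids l) (λ t → rr t j) ≤ ι 15 * ∑[ k ∈ scales l ] (2^ k * η k j)
    mids-rr zero j = 0≤* (0≤ι 15) (0≤+ (0≤* (0≤2^ 0) (0≤η 0 j)) ≤-refl)
    mids-rr (suc l) j = ≡-≤-trans (wsum-++ (mid l) (mids l) _)
      (≤-≡-trans (+-mono-≤ (mid-rr l j) (mids-rr l j)) (sym (*-distribˡ-+ (ι 15) (2^ (suc l) * η (suc l) j) _)))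

    -- The terms for Π L j.
    lastTerm : Fin m → Term
    lastTerm k = kron k , (λ j → Π L j k)

    last : Weights Term
    last = map (λ k → 1ℚ , lastTerm k) (allFin m)

    wsum-last : ∀ ks f → wsum (map (λ k → 1ℚ , lastTerm k) ks) f ≡ ∑[ k ∈ ks ] f (lastTerm k)
    wsum-last [] f = refl
    wsum-last (k ∷ ks) f = cong₂ _+_ (*-identityˡ (f (lastTerm k))) (wsum-last ks f)

    kron-sym : ∀ {n} (j k : Fin n) → kron j k ≡ kron k j
    kron-sym zero zero = refl
    kron-sym zero (suc k) = refl
    kron-sym (suc j) zero = refl
    kron-sym (suc j) (suc k) = kron-sym j k

    last-lr : ∀ i j → wsum last (λ t → lr t i j) ≡ Π L j i
    last-lr i j = trans (wsum-last (allFin m) _) (trans (sum-cong (allFin m) (λ k → cong (_* Π L j k) (kron-sym k i))) (sum-kron i (Π L j)))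

    last-ll : ∀ i → wsum last (λ t → ll t i) ≡ 1ℚ
    last-ll i = trans (wsum-last (allFin m) _) (trans (sum-cong (allFin m) (λ k → cong (_* kron k i) (kron-sym k i)))
      (trans (sum-kron i (λ k → kron k i)) (kron-≡ i)))

    -- The last term is factored trivially through the unit vectors. By `base` its unweighted norm
    -- costs a factor m ≤ 2^L, exactly the weight of scale L in `gradCol`; this determines how many
    -- scales are needed.
    last-rr : ∀ j → wsum last (λ t → rr t j) ≤ Λ
    last-rr j = ≡-≤-trans (wsum-last (allFin m) _) (≤-trans (base (Π L j))
      (≤-trans (*-mono (0≤ι (length (allFin m))) (wsum-nonNeg 0≤ps (λ i → 0≤sq (Π L j i)))
          (≡-≤-trans (cong ι (Listₚ.length-tabulate {n = m} (λ k → k))) m≤2^L) (R⁺.contraction (suc L) (R.ρ L (col j))))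
      (≤-trans (top L) (cols (∈-allFin j)))))
      where
      top : ∀ L → 2^ L * η L j ≤ ∑[ k ∈ scales L ] (2^ k * η k j)
      top zero = ≤-reflexive (sym (+-identityʳ _))
      top (suc L) = ≤-by (∑[ k ∈ scales L ] (2^ k * η k j)) (sum-nonNeg (scales L) (λ k → 0≤* (0≤2^ k) (0≤η k j))) refl

    nonNeg-mids : ∀ l → NonNeg (mids l)
    nonNeg-mids zero = []
    nonNeg-mids (suc l) = NonNeg-++ (NonNeg-rescale (0≤2^ l) (midTerm l) 0≤qs) (nonNeg-mids l)

    nonNeg-last : ∀ ks → NonNeg (map (λ k → 1ℚ , lastTerm k) ks)
    nonNeg-last [] = []
    nonNeg-last (k ∷ ks) = 0≤1 ∷ nonNeg-last ks

    split : ∀ f → wsum (head ++ mids L ++ last) f ≡ wsum head f + (wsum (mids L) f + wsum last f)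
    split f = trans (wsum-++ head (mids L ++ last) f) (cong (wsum head f +_) (wsum-++ (mids L) last f))

    0≤Λ-1 : 0ℚ ≤ Λ - 1ℚ
    0≤Λ-1 = 0≤- 1≤Λ

    -- 36 = 20 + 15 + 1, from the column norms of the first, middle and last terms together with 1 ≤
    -- Λ. Here 20 = 2 · (4^0 + 4^1) · 2, the final 2 being the bound on the mass of the row weights.
    stationary⇒factorization : Factorization A (ι 36 * Λ)
    stationary⇒factorization = record
      { terms = head ++ mids L ++ last
      ; 0≤terms = NonNeg-++ (NonNeg-rescale 0≤1 headTerm 0≤qs) (NonNeg-++ (nonNeg-mids L) (nonNeg-last (allFin m)))
      ; entry = λ i j → sym (trans (split (λ t → lr t i j)) (trans (cong₂ _+_ (head-lr i j) (cong₂ _+_ (mids-lr L i j) (last-lr i j)))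
                   (l₁ (A i j) (Π 0 j i) (Π L j i))))
      ; row-norm = λ i → ≡-≤-trans (split (λ t → ll t i)) (≤-trans
          (+-mono-≤ (head-ll i) (+-mono-≤ (≤-trans (≤-by {wsum (mids L) (λ t → ll t i)} (2^ L * ξ L i) (0≤* (0≤2^ L) (0≤ξ L i)) (sym (mids-ll L i))) (rows (∈-allFin i))) (≤-reflexive (last-ll i))))
          (≤-by (ι 32 * Λ + ι 3 * (Λ - 1ℚ)) (0≤+ (0≤* (0≤ι 32) (≤-trans 0≤1 1≤Λ)) (0≤* (0≤ι 3) 0≤Λ-1)) (l₂ Λ)))
      ; col-norm = λ j → ≡-≤-trans (split (λ t → rr t j)) (≤-trans
          (+-mono-≤ (head-rr j) (+-mono-≤ (≤-trans (mids-rr L j) (*-monoˡ (ι 15) (0≤ι 15) (cols (∈-allFin j)))) (last-rr j)))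
          (≤-by (ι 20 * (Λ - 1ℚ)) (0≤* (0≤ι 20) 0≤Λ-1) (l₃ Λ))) }
      where
      l₁ : ∀ a p q → a - p + (p - q + q) ≡ a
      l₁ = solve-∀ ℚ-ring
      l₂ : ∀ x → ι 36 * x ≡ ι 2 + (x + 1ℚ) + (ι 32 * x + ι 3 * (x - 1ℚ))
      l₂ = solve-∀ ℚ-ring
      l₃ : ∀ x → ι 36 * x ≡ ι 20 + (ι 15 * x + x) + ι 20 * (x - 1ℚ)
      l₃ = solve-∀ ℚ-ring

-- A feasible point of the dual program: up to the weights, T is an operator
-- of squared norm at most K, and v bounds the trace pairing of T and A.
record Witness {I J : Set} (A : I → J → ℚ) (s K v : ℚ) : Set where
  field
    ps       : Weights I
    qs       : Weights J
    0≤ps     : NonNeg ps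
    0≤qs     : NonNeg qs
    ps≤      : mass ps ≤ s
    qs≤      : mass qs ≤ s
    T        : I → J → ℚ
    contract : ∀ (x : I → ℚ) → wsum qs (λ j → wsum ps (λ i → T i j * x i) * wsum ps (λ i → T i j * x i)) ≤ K * wsum ps (λ i → x i * x i)
    pairing  : v ≤ wsum ps (λ i → wsum qs (λ j → T i j * A i j))

-- A dual witness from the trace

module Dual {I J : Set} (A : I → J → ℚ) (A²≤1 : ∀ i j → A i j * A i j ≤ 1ℚ)
            (is : List I) (js : List J) (0<m : 0 ℕ.< length is) (L : ℕ) where
  open Greedy A A²≤1 is js 0<m L

  module _ (st : State) where
    open State st
    open Resolvents A ps qs

    module Vector (x : I → ℚ) where

      τ : ℕ → ℚ
      τ l = R.Γ l x x

      f : ℕ → J → ℚ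
      f l j = ⟪ col j , R.ρ l x ⟫

      X : ℕ → ℕ → ℚ
      X l k = wsum qs (λ j → f l j * f k j)

      τ-diff : ∀ l k → τ l - τ k ≡ (4^ k - 4^ l) * X l k
      τ-diff l k = trans (lem₁ (τ l) (τ k)) (trans (sym (⟪⟫-subʳ (R.ρ l x) (- 1ℚ) (R.ρ k x) x))
        (trans (wsum-cong ps (λ i → cong (x i *_) (trans (lem₂ (R.ρ l x i) (R.ρ k x i)) (Two.ρ-diff (res l) (res k) x i))))
        (trans (wsum-cong ps (λ i → lem₃ (x i) (4^ k - 4^ l) (R.ρ l (SP (R.ρ k x)) i))) (trans (wsum-*ˡ ps (4^ k - 4^ l) _)
        (cong ((4^ k - 4^ l) *_) (trans (R.Γ-comm l x (SP (R.ρ k x))) (trans (⟪⟫-comm (SP (R.ρ k x)) (R.ρ l x)) (trans (⟪⟫-SP (R.ρ l x) (R.ρ k x))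
          (wsum-cong qs (λ j → trans (cong (f k j *_) (⟪⟫-comm (R.ρ l x) (col j))) (*-comm (f k j) (f l j))))))))))))
        where
        lem₁ : ∀ a b → a - b ≡ a + - 1ℚ * b
        lem₁ = solve-∀ ℚ-ring
        lem₂ : ∀ a b → a + - 1ℚ * b ≡ a - b
        lem₂ = solve-∀ ℚ-ring
        lem₃ : ∀ x d y → x * (d * y) ≡ d * (x * y)
        lem₃ = solve-∀ ℚ-ring

      X-nonNeg : ∀ l → 0ℚ ≤ X l l
      X-nonNeg l = wsum-nonNeg 0≤qs (λ j → 0≤sq (f l j))

      -- For l ≤ k the difference X l k - X k k is (4^k - 4^l) Γ_l(s, s) with s = S P ρ_k x.
      X-mono : ∀ {l k} → l ℕ.≤ k → X k k ≤ X l k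
      X-mono {l} {k} l≤k = ≤-by ((4^ k - 4^ l) * R.Γ l s s) (0≤* (0≤- (4^-mono l≤k)) (R⁺.Γ-nonNeg l s))
        (trans (wsum-cong qs (λ j → trans (lem₁ (f l j) (f k j)) (cong (λ z → f k j * f k j + f k j * z) (diff j))))
        (trans (wsum-+ qs (λ j → f k j * f k j) _) (cong (X k k +_) (trans (wsum-cong qs (λ j → lem₂ (f k j) (4^ k - 4^ l) ⟪ col j , R.ρ l s ⟫))
          (trans (wsum-*ˡ qs (4^ k - 4^ l) _) (cong ((4^ k - 4^ l) *_) (trans (wsum-cong qs (λ j → cong (f k j *_) (⟪⟫-comm (col j) (R.ρ l s))))
            (trans (sym (⟪⟫-SP (R.ρ l s) (R.ρ k x))) (⟪⟫-comm (R.ρ l s) s)))))))))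
        where
        s = SP (R.ρ k x)
        lem₁ : ∀ a b → a * b ≡ b * b + b * (a - b)
        lem₁ = solve-∀ ℚ-ring
        lem₂ : ∀ a d b → a * (d * b) ≡ d * (a * b)
        lem₂ = solve-∀ ℚ-ring
        lem₃ : ∀ a b → a - b ≡ a + - 1ℚ * b
        lem₃ = solve-∀ ℚ-ring
        lem₄ : ∀ a b → a + - 1ℚ * b ≡ a - b
        lem₄ = solve-∀ ℚ-ring
        diff : ∀ j → f l j - f k j ≡ (4^ k - 4^ l) * ⟪ col j , R.ρ l s ⟫
        diff j = trans (lem₃ (f l j) (f k j)) (trans (sym (⟪⟫-subʳ (R.ρ l x) (- 1ℚ) (R.ρ k x) (col j)))
          (trans (wsum-cong ps (λ i → cong (A i j *_) (trans (lem₄ (R.ρ l x i) (R.ρ k x i)) (Two.ρ-diff (res l) (res k) x i))))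
          (trans (wsum-cong ps (λ i → lem₂ (A i j) (4^ k - 4^ l) (R.ρ l s i))) (wsum-*ˡ ps (4^ k - 4^ l) _))))

      0≤X : ∀ {l k} → l ℕ.≤ k → 0ℚ ≤ X l k
      0≤X {l} {k} l≤k = ≤-trans (X-nonNeg k) (X-mono l≤k)

      τ-anti : ∀ {l k} → l ℕ.≤ k → 0ℚ ≤ τ l - τ k
      τ-anti {l} {k} l≤k = subst (0ℚ ≤_) (sym (τ-diff l k)) (0≤* (0≤- (4^-mono l≤k)) (0≤X l≤k))

      -- By `τ-diff`, since 4^(n+1) - 4^l is at least ¾ 4^(n+1). Different scales are thus nearly
      -- orthogonal, with overlaps paid by the decreasing sequence τ.
      X-off : ∀ {l n} → l ℕ.≤ n → ι 3 * 4^ (suc n) * X l (suc n) ≤ ι 4 * (τ l - τ (suc n))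
      X-off {l} {n} l≤n = ≤-by (ι 4 * ((4^ n - 4^ l) * X l (suc n))) (0≤* (0≤ι 4) (0≤* (0≤- (4^-mono l≤n)) (0≤X (ℕₚ.≤-trans l≤n (ℕₚ.n≤1+n n)))))
        (trans (cong (ι 4 *_) (τ-diff l (suc n))) (lem (4^ n) (4^ l) (X l (suc n))))
        where
        lem : ∀ a b x → ι 4 * ((ι 4 * a - b) * x) ≡ ι 3 * (ι 4 * a) * x + ι 4 * ((a - b) * x)
        lem = solve-∀ ℚ-ring

      X-diag : ∀ n → ι 3 * (4^ (suc n) * X (suc n) (suc n)) ≤ ι 4 * (τ n - τ (suc n))
      X-diag n = ≤-trans (≤-≡-trans (*-monoˡ (ι 3) (0≤ι 3) (*-monoˡ (4^ (suc n)) (0≤4^ (suc n)) (X-mono (ℕₚ.n≤1+n n)))) (sym (*-assoc (ι 3) (4^ (suc n)) (X n (suc n))))) (X-off ℕₚ.≤-refl)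

      F : ℕ → J → ℚ
      F n j = ∑[ l ∈ scales n ] (2^ l * f l j)

      norm : ℕ → ℚ
      norm n = wsum qs (λ j → F n j * F n j)

      U : ℕ → ℚ
      U n = ∑[ l ∈ scales n ] (2^ l * (τ l - τ (suc n)))

      -- A geometrically discounted sum of the decrements of τ, built to majorise `U n` / 2^(n+1)
      -- (see `U≤`).
      m : ℕ → ℚ
      m zero    = ½ * (τ 0 - τ 1)
      m (suc n) = ½ * m n + (τ (suc n) - τ (suc (suc n)))

      0≤m : ∀ n → 0ℚ ≤ m n
      0≤m zero = 0≤* (nonNegative⁻¹ ½) (τ-anti ℕ.z≤n)
      0≤m (suc n) = 0≤+ (0≤* (nonNegative⁻¹ ½) (0≤m n)) (τ-anti (ℕₚ.n≤1+n (suc n)))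

      sum-2^ : ∀ n → sumᴸ (scales n) 2^ ≤ 2^ (suc n)
      sum-2^ zero = ι-mono {1} {2} (ℕ.s≤s ℕ.z≤n)
      sum-2^ (suc n) = ≤-trans (+-monoʳ-≤ (2^ (suc n)) (sum-2^ n)) (≤-reflexive (lem (2^ (suc n))))
        where
        lem : ∀ x → x + x ≡ ι 2 * x
        lem = solve-∀ ℚ-ring

      U≤ : ∀ n → U n ≤ 2^ (suc n) * m n
      U≤ zero = ≤-reflexive (lem (τ 0 - τ 1))
        where
        lem : ∀ d → 1ℚ * d + 0ℚ ≡ ι 2 * 1ℚ * (½ * d)
        lem = solve-∀ ℚ-ring
      U≤ (suc n) = ≤-trans (≤-reflexive (cong (2^ (suc n) * Δ +_) eq))
        (≤-trans (+-monoʳ-≤ (2^ (suc n) * Δ) (+-mono-≤ (U≤ n) (*-monoʳ Δ (τ-anti (ℕₚ.n≤1+n (suc n))) (sum-2^ n))))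
                 (≤-reflexive (lem₂ (2^ (suc n)) Δ (m n))))
        where
        Δ = τ (suc n) - τ (suc (suc n))
        lem₁ : ∀ t a b c → t * (a - c) ≡ t * (a - b) + t * (b - c)
        lem₁ = solve-∀ ℚ-ring
        lem₂ : ∀ t d m → t * d + (t * m + t * d) ≡ ι 2 * t * (½ * m + d)
        lem₂ = solve-∀ ℚ-ring
        eq : ∑[ l ∈ scales n ] (2^ l * (τ l - τ (suc (suc n)))) ≡ U n + sumᴸ (scales n) 2^ * Δ
        eq = trans (sum-cong (scales n) (λ l → lem₁ (2^ l) (τ l) (τ (suc n)) (τ (suc (suc n))))) (trans (sum-+ (scales n) _ _) (cong (U n +_) (sum-*ʳ (scales n) Δ 2^)))

      off : ℕ → ℚ
      off n = 2^ (suc n) * wsum qs (λ j → F n j * f (suc n) j)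

      off≡ : ∀ n → off n ≡ 2^ (suc n) * ∑[ l ∈ scales n ] (2^ l * X l (suc n))
      off≡ n = cong (2^ (suc n) *_) (trans (wsum-cong qs (λ j → trans (sym (sum-*ʳ (scales n) (f (suc n) j) _)) (sum-cong (scales n) (λ l → *-assoc (2^ l) (f l j) (f (suc n) j)))))
        (trans (wsum-sum qs (scales n) _) (sum-cong (scales n) (λ l → wsum-*ˡ qs (2^ l) _))))

      off≤ : ∀ n → ι 3 * off n ≤ ι 4 * m n
      off≤ n = *-cancelˡ (2^ (suc n)) (0<2^ (suc n)) (≤-trans (≤-reflexive eq) (≤-trans
          (sum-mono-∈ (scales n) (λ {l} l∈ → *-monoˡ (2^ l) (0≤2^ l) (X-off {l} {n} (∈-scales l∈))))
          (≤-trans (≤-reflexive eq′) (≤-trans (*-monoˡ (ι 4) (0≤ι 4) (U≤ n)) (≤-reflexive (lem₃ (2^ (suc n)) (m n)))))))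
        where
        lem₁ : ∀ t s → t * (ι 3 * (t * s)) ≡ ι 3 * (t * t) * s
        lem₁ = solve-∀ ℚ-ring
        lem₂ : ∀ a t x → a * (t * x) ≡ t * (a * x)
        lem₂ = solve-∀ ℚ-ring
        lem₃ : ∀ t m → ι 4 * (t * m) ≡ t * (ι 4 * m)
        lem₃ = solve-∀ ℚ-ring
        eq : 2^ (suc n) * (ι 3 * off n) ≡ ∑[ l ∈ scales n ] (2^ l * (ι 3 * 4^ (suc n) * X l (suc n)))
        eq = trans (cong (λ z → 2^ (suc n) * (ι 3 * z)) (off≡ n)) (trans (lem₁ (2^ (suc n)) (∑[ l ∈ scales n ] (2^ l * X l (suc n)))) (trans (cong (λ z → ι 3 * z * ∑[ l ∈ scales n ] (2^ l * X l (suc n))) (sym (4^≡2^*2^ (suc n))))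
             (trans (sym (sum-*ˡ (scales n) (ι 3 * 4^ (suc n)) _)) (sum-cong (scales n) (λ l → lem₂ (ι 3 * 4^ (suc n)) (2^ l) (X l (suc n)))))))
        eq′ : ∑[ l ∈ scales n ] (2^ l * (ι 4 * (τ l - τ (suc n)))) ≡ ι 4 * U n
        eq′ = trans (sum-cong (scales n) (λ l → lem₂ (2^ l) (ι 4) (τ l - τ (suc n)))) (sum-*ˡ (scales n) (ι 4) _)

      norm-suc : ∀ n → norm (suc n) ≡ norm n + ι 2 * off n + 4^ (suc n) * X (suc n) (suc n)
      norm-suc n = trans (wsum-cong qs (λ j → lem (2^ (suc n)) (f (suc n) j) (F n j)))
        (trans (wsum-+ qs _ _) (cong₂ _+_ (trans (wsum-+ qs _ _) (cong (norm n +_) (trans (wsum-*ˡ qs (ι 2 * 2^ (suc n)) _) (*-assoc (ι 2) (2^ (suc n)) _))))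
          (trans (wsum-*ˡ qs (2^ (suc n) * 2^ (suc n)) _) (cong (_* X (suc n) (suc n)) (sym (4^≡2^*2^ (suc n)))))))
        where
        lem : ∀ t f F → (t * f + F) * (t * f + F) ≡ F * F + ι 2 * t * (F * f) + t * t * (f * f)
        lem = solve-∀ ℚ-ring

      -- Adding scale n+1 raises 3 `norm` by at most 8 m_n + 4 (τ_n - τ_(n+1)). The halving of m
      -- pays the first part and the decrease of τ the second; 16 and 4 are the coefficients for
      -- which everything cancels, so Q never increases.
      Q : ℕ → ℚ
      Q n = ι 3 * norm n + ι 16 * m n + ι 16 * τ (suc n) + ι 4 * τ n

      Q-mono : ∀ n → Q (suc n) ≤ Q n
      Q-mono n = ≤-by (ι 2 * (ι 4 * m n - ι 3 * off n) + (ι 4 * (τ n - τ (suc n)) - ι 3 * (4^ (suc n) * X (suc n) (suc n))))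
        (0≤+ (0≤* (0≤ι 2) (0≤- (off≤ n))) (0≤- (X-diag n)))
        (sym (trans (cong (λ z → ι 3 * z + ι 16 * m (suc n) + ι 16 * τ (suc (suc n)) + ι 4 * τ (suc n)
                 + (ι 2 * (ι 4 * m n - ι 3 * off n) + (ι 4 * (τ n - τ (suc n)) - ι 3 * (4^ (suc n) * X (suc n) (suc n))))) (norm-suc n))
             (lem (norm n) (off n) (4^ (suc n) * X (suc n) (suc n)) (m n) (τ n) (τ (suc n)) (τ (suc (suc n))))))
        where
        lem : ∀ N o x m a b c → ι 3 * (N + ι 2 * o + x) + ι 16 * (½ * m + (b - c)) + ι 16 * c + ι 4 * b
              + (ι 2 * (ι 4 * m - ι 3 * o) + (ι 4 * (a - b) - ι 3 * x)) ≡ ι 3 * N + ι 16 * m + ι 16 * b + ι 4 * a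
        lem = solve-∀ ℚ-ring

      Q0 : Q 0 ≤ ι 23 * ⟪ x , x ⟫
      Q0 = ≤-by (ι 3 * (⟪ x , x ⟫ - 4^ 0 * R.cross 0 x x) + ι 12 * (⟪ x , x ⟫ - τ 0) + ι 8 * (⟪ x , x ⟫ - τ 1))
        (0≤+ (0≤+ (0≤* (0≤ι 3) (0≤- (R⁺.cross-bound 0 x))) (0≤* (0≤ι 12) (0≤- (R⁺.Γ≤⟪⟫ 0 x)))) (0≤* (0≤ι 8) (0≤- (R⁺.Γ≤⟪⟫ 1 x))))
        (sym (trans (cong (λ z → ι 3 * z + ι 16 * (½ * (τ 0 - τ 1)) + ι 16 * τ 1 + ι 4 * τ 0
                 + (ι 3 * (⟪ x , x ⟫ - 4^ 0 * R.cross 0 x x) + ι 12 * (⟪ x , x ⟫ - τ 0) + ι 8 * (⟪ x , x ⟫ - τ 1))) (wsum-cong qs (λ j → lem₀ (f 0 j))))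
             (lem (X 0 0) (τ 0) (τ 1) ⟪ x , x ⟫)))
        where
        lem₀ : ∀ f → (1ℚ * f + 0ℚ) * (1ℚ * f + 0ℚ) ≡ f * f
        lem₀ = solve-∀ ℚ-ring
        lem : ∀ X a b p → ι 3 * X + ι 16 * (½ * (a - b)) + ι 16 * b + ι 4 * a
              + (ι 3 * (p - 1ℚ * X) + ι 12 * (p - a) + ι 8 * (p - b)) ≡ ι 23 * p
        lem = solve-∀ ℚ-ring

      Q≤ : ∀ n → Q n ≤ ι 23 * ⟪ x , x ⟫
      Q≤ zero = Q0
      Q≤ (suc n) = ≤-trans (Q-mono n) (Q≤ n)

      norm≤ : ∀ n → norm n ≤ ι 8 * ⟪ x , x ⟫
      norm≤ n = *-cancelˡ (ι 3) (0<ι {3} (ℕ.s≤s ℕ.z≤n)) (≤-trans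
        (≤-by (ι 16 * m n + ι 16 * τ (suc n) + ι 4 * τ n)
              (0≤+ (0≤+ (0≤* (0≤ι 16) (0≤m n)) (0≤* (0≤ι 16) (R⁺.Γ-nonNeg (suc n) x))) (0≤* (0≤ι 4) (R⁺.Γ-nonNeg n x)))
              (lem₁ (ι 3 * norm n) (ι 16 * m n) (ι 16 * τ (suc n)) (ι 4 * τ n)))
        (≤-trans (Q≤ n) (≤-by ⟪ x , x ⟫ (R⁺.⟪⟫-nonNeg n x) (lem₂ ⟪ x , x ⟫))))
        where
        lem₁ : ∀ a b c d → a + b + c + d ≡ a + (b + c + d)
        lem₁ = solve-∀ ℚ-ring
        lem₂ : ∀ x → ι 3 * (ι 8 * x) ≡ ι 23 * x + x
        lem₂ = solve-∀ ℚ-ring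

    -- Σ_l 2^l ρ_l imitates (S P)^(-½), so T imitates the partial isometry in the polar
    -- decomposition of the weighted matrix. An isometry would have squared norm 1; the bound
    -- obtained is 23/3 < 8.
    T : I → J → ℚ
    T i j = ∑[ l ∈ scales L ] (2^ l * R.ρ l (col j) i)

    state⇒witness : Light st → Witness A (ι 2) (ι 8) value
    state⇒witness lt = record
      { ps = ps ; qs = qs ; 0≤ps = 0≤ps ; 0≤qs = 0≤qs ; ps≤ = Light.ps≤2 lt ; qs≤ = Light.qs≤2 lt ; T = T
      ; contract = λ x → ≡-≤-trans (wsum-cong qs (λ j → cong₂ _*_ (eq x j) (eq x j))) (Vector.norm≤ x L)
      ; pairing = ≤-reflexive (sym (trans (wsum-swap ps qs _) (trans (wsum-cong qs (λ j → eq (col j) j)) pair))) }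
      where
      eq : ∀ x j → wsum ps (λ i → T i j * x i) ≡ ∑[ l ∈ scales L ] (2^ l * ⟪ col j , R.ρ l x ⟫)
      eq x j = trans (wsum-cong ps (λ i → trans (sym (sum-*ʳ (scales L) (x i) _)) (sum-cong (scales L) (λ l → lem (2^ l) (R.ρ l (col j) i) (x i)))))
        (trans (wsum-sum ps (scales L) _) (sum-cong (scales L) (λ l → trans (wsum-*ˡ ps (2^ l) _) (cong (2^ l *_) (R.Γ-comm l x (col j))))))
        where
        lem : ∀ t r x → t * r * x ≡ t * (x * r)
        lem = solve-∀ ℚ-ring
      pair : wsum qs (λ j → ∑[ l ∈ scales L ] (2^ l * R.Γ l (col j) (col j))) ≡ value
      pair = trans (wsum-sum qs (scales L) _) (sum-cong (scales L) (λ l → wsum-*ˡ qs (2^ l) _))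

-- AM-GM and a summable weight on the line

prod : List ℚ → ℚ
prod []       = 1ℚ
prod (x ∷ xs) = x * prod xs

total : List ℚ → ℚ
total xs = sumᴸ xs (λ x → x)

data NonNegs : List ℚ → Set where
  []  : NonNegs []
  _∷_ : ∀ {x xs} → 0ℚ ≤ x → NonNegs xs → NonNegs (x ∷ xs)

total-nonNeg : ∀ {xs} → NonNegs xs → 0ℚ ≤ total xs
total-nonNeg [] = ≤-refl
total-nonNeg (p ∷ ps) = 0≤+ p (total-nonNeg ps)

-- With a the mean of the n tail entries, x - a = (n+1)(b - a). Hence x a^n is the value at b of the
-- tangent of s ↦ s^(n+1) at a.
am-gm : ∀ {xs b} → NonNegs xs → 0ℚ ≤ b → total xs ≡ ι (length xs) * b → prod xs ≤ b ^ℚ length xs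
am-gm [] 0≤b eq = ≤-refl
am-gm {x ∷ []} {b} (0≤x ∷ []) 0≤b eq = ≤-reflexive (trans (lem₁ x) (trans eq (lem₂ b)))
  where
  lem₁ : ∀ x → x * 1ℚ ≡ x + 0ℚ
  lem₁ = solve-∀ ℚ-ring
  lem₂ : ∀ b → (1ℚ + 0ℚ) * b ≡ b * 1ℚ
  lem₂ = solve-∀ ℚ-ring
am-gm {x ∷ y ∷ ys} {b} (0≤x ∷ nn) 0≤b eq = ≤-trans (*-monoˡ x 0≤x (am-gm {y ∷ ys} {a} nn 0≤a eq′))
  (≤-trans (≤-reflexive (trans (lem₁ x a (a ^ℚ n)) (cong (λ z → a * a ^ℚ n + a ^ℚ n * z) x-a))) (≤-trans (≤-reflexive (lem₃ a b (a ^ℚ n) (ι (suc n)))) (pow-tangent 0≤b 0≤a n)))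
  where
  n = length (y ∷ ys)
  0<n : 0ℚ < ι n
  0<n = 0<ι {n} (ℕ.s≤s ℕ.z≤n)
  a = total (y ∷ ys) * inv (ι n)
  0≤a : 0ℚ ≤ a
  0≤a = 0≤* (total-nonNeg nn) (inv-nonNeg (<⇒≤ 0<n))
  lem₀ : ∀ n t i → t * (n * i) ≡ n * (t * i)
  lem₀ = solve-∀ ℚ-ring
  eq′ : total (y ∷ ys) ≡ ι n * a
  eq′ = trans (sym (*-identityʳ _)) (trans (cong (total (y ∷ ys) *_) (sym (inv-r 0<n))) (lem₀ (ι n) (total (y ∷ ys)) (inv (ι n))))
  lem₁ : ∀ x a p → x * p ≡ a * p + p * (x - a)
  lem₁ = solve-∀ ℚ-ring
  lem₂ : ∀ x n a b → x + n * a ≡ (1ℚ + n) * b → x - a ≡ (1ℚ + n) * (b - a)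
  lem₂ x n a b e = trans (l x n a) (trans (cong (_- (1ℚ + n) * a) e) (l′ n a b))
    where
    l : ∀ x n a → x - a ≡ x + n * a - (1ℚ + n) * a
    l = solve-∀ ℚ-ring
    l′ : ∀ n a b → (1ℚ + n) * b - (1ℚ + n) * a ≡ (1ℚ + n) * (b - a)
    l′ = solve-∀ ℚ-ring
  x-a : x - a ≡ ι (suc n) * (b - a)
  x-a = lem₂ x (ι n) a b (trans (cong (x +_) (sym eq′)) eq)
  lem₃ : ∀ a b p k → a * p + p * (k * (b - a)) ≡ a * p + k * p * (b - a)
  lem₃ = solve-∀ ℚ-ring

-- The reciprocal of `spread` plays the part of a density in the volume count: rational, with sum at
-- most 2 over any run of unit steps (`weight-sum`), yet not too small near 0 (`P-large`).
spread : ℚ → ℚ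
spread s = (1ℚ + ∣ s ∣) * (ι 2 + ∣ s ∣)

0<1+∣∣ : ∀ s → 0ℚ < 1ℚ + ∣ s ∣
0<1+∣∣ s = +-mono-<-≤ 0<1 (0≤∣p∣ s)

0<2+∣∣ : ∀ s → 0ℚ < ι 2 + ∣ s ∣
0<2+∣∣ s = +-mono-<-≤ (0<ι {2} (ℕ.s≤s ℕ.z≤n)) (0≤∣p∣ s)

0<spread : ∀ s → 0ℚ < spread s
0<spread s = 0<* (0<1+∣∣ s) (0<2+∣∣ s)

weight : ℚ → ℚ
weight s = inv (spread s)

0≤weight : ∀ s → 0ℚ ≤ weight s
0≤weight s = <⇒≤ (inv-pos (0<spread s))

inv-unique : ∀ {p q} → 0ℚ < p → p * q ≡ 1ℚ → inv p ≡ q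
inv-unique {p} {q} 0<p eq = trans (sym (*-identityʳ (inv p))) (trans (cong (inv p *_) (sym eq)) (trans (lem (inv p) p q) (trans (cong (_* q) (inv-r 0<p)) (*-identityˡ q))))
  where
  lem : ∀ i p q → i * (p * q) ≡ p * i * q
  lem = solve-∀ ℚ-ring

inv-anti : ∀ {p q} → 0ℚ < p → p ≤ q → inv q ≤ inv p
inv-anti {p} {q} 0<p p≤q = *-cancelˡ q 0<q (≡-≤-trans (inv-r 0<q) (≡-≤-trans (sym (inv-r 0<p)) (*-monoʳ (inv p) (<⇒≤ (inv-pos 0<p)) p≤q)))
  where 0<q = <-≤-trans 0<p p≤q

-- weight s = 1/(1+|s|) - 1/(2+|s|), which telescopes.
weight≡ : ∀ {a} → 0ℚ ≤ a → inv ((1ℚ + a) * (ι 2 + a)) ≡ inv (1ℚ + a) - inv (ι 2 + a)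
weight≡ {a} 0≤a = inv-unique (0<* 0<p 0<q) (trans (lem (1ℚ + a) (ι 2 + a) (inv (1ℚ + a)) (inv (ι 2 + a)))
    (trans (cong₂ (λ x y → (ι 2 + a) * x - (1ℚ + a) * y) (inv-r 0<p) (inv-r 0<q)) (lem₂ a)))
  where
  0<p : 0ℚ < 1ℚ + a
  0<p = +-mono-<-≤ 0<1 0≤a
  0<q : 0ℚ < ι 2 + a
  0<q = +-mono-<-≤ (0<ι {2} (ℕ.s≤s ℕ.z≤n)) 0≤a
  lem : ∀ p q i j → p * q * (i - j) ≡ q * (p * i) - p * (q * j)
  lem = solve-∀ ℚ-ring
  lem₂ : ∀ a → (ι 2 + a) * 1ℚ - (1ℚ + a) * 1ℚ ≡ 1ℚ
  lem₂ = solve-∀ ℚ-ring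

-- A bounded discrete antiderivative of `weight`, glued at 0 from the telescoping sums of the two
-- half-lines.
G : ℚ → ℚ
G s with 0ℚ ≤? s
... | yes _ = ι 2 - inv (1ℚ + s)
... | no  _ = inv (ι 2 - s)

G-bounds : ∀ s → 0ℚ ≤ G s × G s ≤ ι 2
G-bounds s with 0ℚ ≤? s
... | yes 0≤s = 0≤- (≤-trans (inv-≤1 (≤-by s 0≤s refl)) (ι-mono {1} {2} (ℕ.s≤s ℕ.z≤n)))
              , ≤-by (inv (1ℚ + s)) (inv-nonNeg (0≤+ 0≤1 0≤s)) (lem (ι 2) (inv (1ℚ + s)))
  where
  lem : ∀ x y → x ≡ x - y + y
  lem = solve-∀ ℚ-ring
... | no ¬p = inv-nonNeg (≤-trans 0≤1 1≤) , ≤-trans (inv-≤1 1≤) (ι-mono {1} {2} (ℕ.s≤s ℕ.z≤n))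
  where
  lem : ∀ s → ι 2 - s ≡ 1ℚ + (1ℚ + - s)
  lem = solve-∀ ℚ-ring
  1≤ : 1ℚ ≤ ι 2 - s
  1≤ = ≤-by (1ℚ + - s) (0≤+ 0≤1 (0≤neg (<⇒≤ (≰⇒> ¬p)))) (lem s)

weight≤G : ∀ s → weight s ≤ G (1ℚ + s) - G s
weight≤G s with 0ℚ ≤? s | 0ℚ ≤? 1ℚ + s
... | yes 0≤s | yes _ = ≤-reflexive (trans (cong (λ a → inv ((1ℚ + a) * (ι 2 + a))) (0≤p⇒∣p∣≡p 0≤s)) (trans (weight≡ 0≤s)
        (trans (cong (λ z → inv (1ℚ + s) - inv z) (lem₁ s)) (lem₂ (inv (1ℚ + s)) (inv (1ℚ + (1ℚ + s)))))))
  where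
  lem₁ : ∀ s → ι 2 + s ≡ 1ℚ + (1ℚ + s)
  lem₁ = solve-∀ ℚ-ring
  lem₂ : ∀ x y → x - y ≡ ι 2 - y - (ι 2 - x)
  lem₂ = solve-∀ ℚ-ring
... | yes 0≤s | no ¬q = ⊥-elim (¬q (0≤+ 0≤1 0≤s))
... | no ¬p | no ¬q = ≤-reflexive (trans (cong (λ a → inv ((1ℚ + a) * (ι 2 + a))) ∣s∣) (trans (weight≡ (0≤neg s≤0))
        (cong (λ z → inv z - inv (ι 2 - s)) (lem s))))
  where
  s≤0 = <⇒≤ (≰⇒> ¬p)
  lem : ∀ s → 1ℚ + - s ≡ ι 2 - (1ℚ + s)
  lem = solve-∀ ℚ-ring
  ∣s∣ : ∣ s ∣ ≡ - s
  ∣s∣ = trans (sym (∣-p∣≡∣p∣ s)) (0≤p⇒∣p∣≡p (0≤neg s≤0))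
-- The step straddles 0 and does not telescope. The weight is at most ½, and the increment 2 -
-- 1/(2+s) - 1/(2-s) is at least 2 - 1 - ½.
... | no ¬p | yes 0≤1+s = ≤-trans (inv-anti (0<ι {2} (ℕ.s≤s ℕ.z≤n)) (≤-by (ι 3 * ∣ s ∣ + ∣ s ∣ * ∣ s ∣) (0≤+ (0≤* (0≤ι 3) (0≤∣p∣ s)) (0≤sq ∣ s ∣)) (lem₁ ∣ s ∣)))
    (≤-trans (≤-by 0ℚ ≤-refl refl) (≤-by (1ℚ - inv (1ℚ + (1ℚ + s)) + (½ - inv (ι 2 - s))) (0≤+ (0≤- (inv-≤1 (≤-by (1ℚ + s) 0≤1+s refl)))
      (0≤- (inv-anti (0<ι {2} (ℕ.s≤s ℕ.z≤n)) (≤-by (- s) (0≤neg (<⇒≤ (≰⇒> ¬p))) refl)))) (lem₂ (inv (1ℚ + (1ℚ + s))) (inv (ι 2 - s)))))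
  where
  lem₁ : ∀ a → (1ℚ + a) * (ι 2 + a) ≡ ι 2 + (ι 3 * a + a * a)
  lem₁ = solve-∀ ℚ-ring
  lem₂ : ∀ x y → ι 2 - x - y ≡ ½ + (1ℚ - x + (½ - y))
  lem₂ = solve-∀ ℚ-ring

weight-sum : ∀ N s → ∑[ k ∈ upTo N ] weight (s + ι k) ≤ ι 2
weight-sum N s = ≤-trans (telescope N s) (≤-by (ι 2 - G (s + ι N) + G s) (0≤+ (0≤- (proj₂ (G-bounds (s + ι N)))) (proj₁ (G-bounds s))) (lem (G (s + ι N)) (G s)))
  where
  lem : ∀ x y → ι 2 ≡ x - y + (ι 2 - x + y)
  lem = solve-∀ ℚ-ring
  sum-upTo : ∀ N f → sumᴸ (upTo (suc N)) f ≡ f 0 + ∑[ k ∈ upTo N ] f (suc k)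
  sum-upTo N f = cong (f 0 +_) (trans (cong (λ xs → sumᴸ xs f) (sym (Listₚ.map-applyUpTo (λ k → k) suc N))) (sum-map suc (upTo N) f))
  lem₁ : ∀ s k → s + (1ℚ + k) ≡ 1ℚ + s + k
  lem₁ = solve-∀ ℚ-ring
  lem₂ : ∀ x y z → x - y + (z - x) ≡ z - y
  lem₂ = solve-∀ ℚ-ring
  telescope : ∀ N s → ∑[ k ∈ upTo N ] weight (s + ι k) ≤ G (s + ι N) - G s
  telescope zero s = ≤-reflexive (sym (trans (cong (λ z → G z - G s) (+-identityʳ s)) (+-inverseʳ (G s))))
  telescope (suc N) s = ≤-trans (≤-reflexive (trans (sum-upTo N (λ k → weight (s + ι k))) (cong₂ _+_ (cong weight (+-identityʳ s)) (sum-cong (upTo N) (λ k → cong weight (lem₁ s (ι k)))))))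
    (≤-trans (+-mono-≤ (weight≤G s) (telescope N (1ℚ + s))) (≤-reflexive (trans (cong (λ z → G (1ℚ + s) - G s + (G z - G (1ℚ + s))) (sym (lem₁ s (ι N)))) (lem₂ (G (1ℚ + s)) (G s) (G (s + ι (suc N)))))))

-- Counting grid points against vertices

sum-cart : ∀ {A B C : Set} (h : A → B → C) xs ys f → sumᴸ (cartesianProductWith h xs ys) f ≡ ∑[ x ∈ xs ] ∑[ y ∈ ys ] f (h x y)
sum-cart h [] ys f = refl
sum-cart h (x ∷ xs) ys f = trans (sum-++ (map (h x) ys) (cartesianProductWith h xs ys) f) (cong₂ _+_ (sum-map (h x) ys f) (sum-cart h xs ys f))

abstract
  -- A power of two, for the halving, above 28 = 4 · 7: a coordinate contributes 4 in `tally` (two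
  -- vertices, each with weight sum 2) and 7 in `P-large`.
  side : ℕ
  side = 32

  side≡ : side ≡ 2 ℕ.^ 5
  side≡ = refl

  bits : List ℕ
  bits = 0 ∷ 1 ∷ []

  sum-bits : ∀ f → sumᴸ bits f ≡ f 0 + f 1
  sum-bits f = cong (f 0 +_) (+-identityʳ (f 1))

  ∈-bits : ∀ {z} → z ℕ.≤ 1 → z ∈ bits
  ∈-bits ℕ.z≤n = here refl
  ∈-bits (ℕ.s≤s ℕ.z≤n) = there (here refl)

  28<side : ι 28 < ι side
  28<side = ι-mono-< {28} {32} (ℕ.s≤s (ℕₚ.m≤m+n 28 3))

grid : ∀ r → List (Vec ℕ r)
grid = vectors (upTo side)

cube : ∀ r → List (Vec ℕ r)
cube = vectors bits

sum-grid : ∀ r k → ∑[ _ ∈ grid r ] k ≡ ι side ^ℚ r * k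
sum-grid zero k = trans (+-identityʳ k) (sym (*-identityˡ k))
sum-grid (suc r) k = trans (sum-cart _∷_ (upTo side) (grid r) (λ _ → k)) (trans (sum-cong (upTo side) (λ _ → sum-grid r k))
  (trans (trans (sum-const (upTo side) (ι side ^ℚ r * k)) (cong (λ l → ι l * (ι side ^ℚ r * k)) (Listₚ.length-upTo side))) (sym (*-assoc (ι side) (ι side ^ℚ r) k))))

offset : ℕ → ℕ → ℚ
offset k z = ι k - ι side * ι z

-- The error vector when the grid point w is rounded to the vertex `side` · z of the large cube.
comb : ∀ {X J : Set} (c : J → X → ℚ) (js : List J) → Vec ℕ (length js) → Vec ℕ (length js) → X → ℚ
comb c []       []      []       = λ _ → 0ℚ
comb c (j ∷ js) (k ∷ w) (z ∷ zs) = (offset k z ⊙ c j) ⊕ comb c js w zs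

module Count {X : Set} (H : SemiInner X) {J : Set} (c : J → X → ℚ) where
  open Inner H
  open Projection c

  -- Each column has squared distance at least d from the span of those after it in the list, so the
  -- columns span a large volume.
  data Chain (d : ℚ) : List J → Set where
    []  : Chain d []
    _∷_ : ∀ {j js} → d ≤ res js (c j) → Chain d js → Chain d (j ∷ js)

  slot : J → List J → (X → ℚ) → ℚ
  slot j js U = ⟨ U , perp js (c j) ⟩ * inv (res js (c j))

  slots : List J → (X → ℚ) → List ℚ
  slots []       U = []
  slots (j ∷ js) U = slot j js U ∷ slots js U

  P : List J → (X → ℚ) → ℚ
  P js U = prod (map weight (slots js U))

  P-cong : ∀ js {U U′} → (∀ v → ⟨ U , v ⟩ ≡ ⟨ U′ , v ⟩) → P js U ≡ P js U′
  P-cong [] eq = refl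
  P-cong (j ∷ js) eq = cong₂ (λ y z → weight (y * inv (res js (c j))) * z) (eq (perp js (c j))) (P-cong js eq)

  0≤P : ∀ js U → 0ℚ ≤ P js U
  0≤P [] U = 0≤1
  0≤P (j ∷ js) U = 0≤* (0≤weight (slot j js U)) (0≤P js U)

  zero-⊥ : ∀ g → ⟨ (λ _ → 0ℚ) , g ⟩ ≡ 0ℚ
  zero-⊥ g = trans (mulˡ 0ℚ (λ _ → 0ℚ) g) (*-zeroˡ ⟨ (λ _ → 0ℚ) , g ⟩)

  comb-⊥ : ∀ js w z {g} → g ⊥ js → ⟨ comb c js w z , g ⟩ ≡ 0ℚ
  comb-⊥ [] [] [] {g} g⊥ = zero-⊥ g
  comb-⊥ (j ∷ js) (k ∷ w) (z ∷ zs) {g} g⊥ = trans (addˡ (offset k z ⊙ c j) (comb c js w zs) g)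
    (trans (cong₂ _+_ (trans (mulˡ (offset k z) (c j) g) (cong (offset k z *_) (trans (comm (c j) g) (g⊥ (here refl))))) (comb-⊥ js w zs (λ m → g⊥ (there m)))) (lem (offset k z)))
    where
    lem : ∀ k → k * 0ℚ + 0ℚ ≡ 0ℚ
    lem = solve-∀ ℚ-ring

  module _ {d : ℚ} (0<d : 0ℚ < d) where

    -- Gram-Schmidt coordinates are triangular: the columns in js do not affect the slot of j. As k
    -- runs over a side of the grid, the slot runs through consecutive unit steps, and `weight-sum`
    -- applies.
    slot-comb : ∀ {j js} → d ≤ res js (c j) → ∀ u k z w zs →
      slot j js (u ⊕ comb c (j ∷ js) (k ∷ w) (z ∷ zs)) ≡ slot j js u - ι side * ι z + ι k
    slot-comb {j} {js} d≤ u k z w zs = trans (cong (_* i)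
        (trans (addˡ u (comb c (j ∷ js) (k ∷ w) (z ∷ zs)) g) (cong (⟨ u , g ⟩ +_)
        (trans (addˡ (offset k z ⊙ c j) (comb c js w zs) g) (cong₂ _+_
          (trans (mulˡ (offset k z) (c j) g) (cong (offset k z *_) (trans (comm (c j) g) (sym (res≡ js (c j))))))
          (comb-⊥ js w zs (perp-⊥ js (c j))))))))
      (trans (lem ⟨ u , g ⟩ (offset k z) n i) (trans (cong (λ x → ⟨ u , g ⟩ * i + offset k z * x) (inv-r (<-≤-trans 0<d d≤)))
        (lem₂ (ι side) (⟨ u , g ⟩ * i) (ι k) (ι z))))
      where
      g = perp js (c j)
      n = res js (c j)
      i = inv n
      lem : ∀ a o n i → (a + (o * n + 0ℚ)) * i ≡ a * i + o * (n * i)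
      lem = solve-∀ ℚ-ring
      lem₂ : ∀ t s k z → s + (k - t * z) * 1ℚ ≡ s - t * z + k
      lem₂ = solve-∀ ℚ-ring

    -- Summing out the first coordinate gives at most 2 for each of the two values of z; its effect
    -- on the other slots is absorbed by the arbitrary translate u.
    tally : ∀ {js} → Chain d js → ∀ u →
      ∑[ w ∈ grid (length js) ] ∑[ z ∈ cube (length js) ] P js (u ⊕ comb c js w z) ≤ ι 4 ^ℚ length js
    tally [] u = ≤-refl
    tally {j ∷ js} (d≤ ∷ ch) u = ≤-trans (≤-reflexive expand) (≤-trans
        (sum-mono (upTo side) (λ k → sum-mono bits (λ z → *-monoˡ (weight (s₀ z + ι k)) (0≤weight (s₀ z + ι k)) (tally ch (u ⊕ (offset k z ⊙ c j))))))
        (≤-trans (≤-reflexive regroup) (*-monoʳ (ι 4 ^ℚ r) (^ℚ-nonNeg (0≤ι 4) r)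
            (≤-trans (sum-mono bits (λ z → weight-sum side (s₀ z))) (≤-reflexive (sum-bits (λ _ → ι 2)))))))
      where
      r = length js
      s₀ : ℕ → ℚ
      s₀ z = slot j js u - ι side * ι z
      term : ℕ → ℕ → Vec ℕ r → Vec ℕ r → ℚ
      term k z w zs = weight (s₀ z + ι k) * P js ((u ⊕ (offset k z ⊙ c j)) ⊕ comb c js w zs)
      step : ∀ k z w zs → P (j ∷ js) (u ⊕ comb c (j ∷ js) (k ∷ w) (z ∷ zs)) ≡ term k z w zs
      step k z w zs = cong₂ _*_ (cong weight (slot-comb {j} {js} d≤ u k z w zs))
        (P-cong js (λ v → trans (addˡ u (comb c (j ∷ js) (k ∷ w) (z ∷ zs)) v) (trans (cong (⟨ u , v ⟩ +_) (addˡ (offset k z ⊙ c j) (comb c js w zs) v))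
          (trans (sym (+-assoc ⟨ u , v ⟩ ⟨ offset k z ⊙ c j , v ⟩ ⟨ comb c js w zs , v ⟩)) (trans (cong (_+ ⟨ comb c js w zs , v ⟩) (sym (addˡ u (offset k z ⊙ c j) v)))
            (sym (addˡ (u ⊕ (offset k z ⊙ c j)) (comb c js w zs) v)))))))
      expand : ∑[ w ∈ grid (suc r) ] ∑[ z ∈ cube (suc r) ] P (j ∷ js) (u ⊕ comb c (j ∷ js) w z)
             ≡ ∑[ k ∈ upTo side ] ∑[ z ∈ bits ] (weight (s₀ z + ι k) * ∑[ w ∈ grid r ] ∑[ zs ∈ cube r ] P js ((u ⊕ (offset k z ⊙ c j)) ⊕ comb c js w zs))
      expand = trans (sum-cart _∷_ (upTo side) (grid r) _) (sum-cong (upTo side) (λ k →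
        trans (sum-cong (grid r) (λ w → trans (sum-cart _∷_ bits (cube r) _) (sum-cong bits (λ z → trans (sum-cong (cube r) (λ zs → step k z w zs)) (sum-*ˡ (cube r) (weight (s₀ z + ι k)) _)))))
        (trans (sum-swap (grid r) bits _) (sum-cong bits (λ z → sum-*ˡ (grid r) (weight (s₀ z + ι k)) _)))))
      regroup : ∑[ k ∈ upTo side ] ∑[ z ∈ bits ] (weight (s₀ z + ι k) * ι 4 ^ℚ r)
              ≡ ∑[ z ∈ bits ] (∑[ k ∈ upTo side ] weight (s₀ z + ι k)) * ι 4 ^ℚ r
      regroup = trans (sum-swap (upTo side) bits _) (trans (sum-cong bits (λ z → sum-*ʳ (upTo side) (ι 4 ^ℚ r) (λ k → weight (s₀ z + ι k))))
        (sum-*ʳ bits (ι 4 ^ℚ r) _))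

    squares : List J → (X → ℚ) → ℚ
    squares js U = sumᴸ (slots js U) (λ s → s * s)

    spreads : List J → (X → ℚ) → List ℚ
    spreads js U = map spread (slots js U)

    -- Since (1 + a)(2 + a) ≤ 4 + 3a², the spreads have mean at most 4 + 3 = 7, and AM-GM bounds
    -- their product by 7^r.
    P-large : ∀ js U → squares js U ≤ ι (length js) → 1ℚ ≤ P js U * ι 7 ^ℚ length js
    P-large js U le = ≤-trans (≤-reflexive (sym (reciprocal (slots js U)))) (*-monoˡ (P js U) (0≤P js U) (bound js le))
      where
      reciprocal : ∀ ss → prod (map weight ss) * prod (map spread ss) ≡ 1ℚ
      reciprocal [] = *-identityˡ 1ℚ
      reciprocal (s ∷ ss) = trans (lem (weight s) (prod (map weight ss)) (spread s) (prod (map spread ss)))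
          (trans (cong₂ _*_ (inv-r (0<spread s)) (reciprocal ss)) (*-identityˡ 1ℚ))
        where
        lem : ∀ a b c d → a * b * (c * d) ≡ c * a * (b * d)
        lem = solve-∀ ℚ-ring
      nonNegs : ∀ ss → NonNegs (map spread ss)
      nonNegs [] = []
      nonNegs (s ∷ ss) = <⇒≤ (0<spread s) ∷ nonNegs ss
      total≤ : ∀ ss → total (map spread ss) ≤ ι (length ss) * ι 4 + ι 3 * sumᴸ ss (λ s → s * s)
      total≤ [] = ≤-refl
      total≤ (s ∷ ss) = ≤-trans (+-mono-≤ (≤-by {spread s} (½ + (ι 3 * ½) * ((1ℚ - ∣ s ∣) * (1ℚ - ∣ s ∣)) + ½ * (∣ s ∣ * ∣ s ∣))
            (0≤+ (0≤+ (nonNegative⁻¹ ½) (0≤* (nonNegative⁻¹ (ι 3 * ½)) (0≤sq (1ℚ - ∣ s ∣)))) (0≤* (nonNegative⁻¹ ½) (0≤sq ∣ s ∣))) (lem ∣ s ∣))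
          (total≤ ss)) (≤-reflexive (trans (lem₂ (∣ s ∣ * ∣ s ∣) (ι (length ss)) (sumᴸ ss (λ s → s * s))) (cong (λ x → (1ℚ + ι (length ss)) * ι 4 + ι 3 * (x + sumᴸ ss (λ s → s * s))) (abs-sq s))))
        where
        lem : ∀ a → ι 4 + ι 3 * (a * a) ≡ (1ℚ + a) * (ι 2 + a) + (½ + (ι 3 * ½) * ((1ℚ - a) * (1ℚ - a)) + ½ * (a * a))
        lem = solve-∀ ℚ-ring
        lem₂ : ∀ a n q → ι 4 + ι 3 * a + (n * ι 4 + ι 3 * q) ≡ (1ℚ + n) * ι 4 + ι 3 * (a + q)
        lem₂ = solve-∀ ℚ-ring
        abs-sq : ∀ s → ∣ s ∣ * ∣ s ∣ ≡ s * s
        abs-sq s = trans (sym (∣p*q∣≡∣p∣*∣q∣ s s)) (0≤p⇒∣p∣≡p (0≤sq s))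
      length-slots : ∀ js → length (slots js U) ≡ length js
      length-slots [] = refl
      length-slots (j ∷ js) = cong suc (length-slots js)
      bound : ∀ js → squares js U ≤ ι (length js) → prod (spreads js U) ≤ ι 7 ^ℚ length js
      bound [] _ = ≤-refl
      bound js@(_ ∷ _) le = ≤-trans (am-gm (nonNegs (slots js U)) 0≤b eq) (≤-≡-trans (^ℚ-mono 0≤b b≤7 (length (spreads js U))) (cong (ι 7 ^ℚ_) len))
        where
        len : length (spreads js U) ≡ length js
        len = trans (Listₚ.length-map spread (slots js U)) (length-slots js)
        n = ι (length js)
        0<n : 0ℚ < n
        0<n = 0<ι {length js} (ℕ.s≤s ℕ.z≤n)
        b = total (spreads js U) * inv n
        0≤b : 0ℚ ≤ b
        0≤b = 0≤* (total-nonNeg (nonNegs (slots js U))) (inv-nonNeg (<⇒≤ 0<n))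
        lem : ∀ n t i → t * (n * i) ≡ n * (t * i)
        lem = solve-∀ ℚ-ring
        eq : total (spreads js U) ≡ ι (length (spreads js U)) * b
        eq = trans (sym (*-identityʳ _)) (trans (cong (total (spreads js U) *_) (sym (inv-r 0<n))) (trans (lem n (total (spreads js U)) (inv n)) (cong (λ l → ι l * b) (sym len))))
        lem₂ : ∀ n → n * ι 4 + ι 3 * n ≡ ι 7 * n
        lem₂ = solve-∀ ℚ-ring
        b≤7 : b ≤ ι 7
        b≤7 = ≤-trans (*-monoʳ (inv n) (inv-nonNeg (<⇒≤ 0<n)) (≤-trans (total≤ (slots js U)) (≡-≤-trans (cong (λ l → ι l * ι 4 + ι 3 * squares js U) (length-slots js))
            (≤-≡-trans (+-monoʳ-≤ (n * ι 4) (*-monoˡ (ι 3) (0≤ι 3) le)) (lem₂ n)))))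
          (≤-reflexive (trans (*-assoc (ι 7) n (inv n)) (trans (cong (ι 7 *_) (inv-r 0<n)) (*-identityʳ (ι 7)))))

    bessel : ∀ {js} → Chain d js → ∀ U → d * squares js U + res js U ≤ ⟨ U , U ⟩
    bessel [] U = ≤-reflexive (lem d ⟨ U , U ⟩)
      where
      lem : ∀ d u → d * 0ℚ + u ≡ u
      lem = solve-∀ ℚ-ring
    bessel {j ∷ js} (d≤ ∷ ch) U = ≤-trans (≤-reflexive (lem d (s * s) (squares js U) (res (j ∷ js) U))) (≤-trans (+-monoʳ-≤ (d * squares js U) le) (bessel ch U))
      where
      lem : ∀ d s q r → d * (s + q) + r ≡ d * q + (d * s + r)
      lem = solve-∀ ℚ-ring
      g = perp js (c j)
      n = res js (c j)
      0<n = <-≤-trans 0<d d≤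
      s = slot j js U
      lem₁ : ∀ a i n → a * a * (n * i) * i ≡ n * (a * i * (a * i))
      lem₁ = solve-∀ ℚ-ring
      lem₂ : ∀ n x i → n * x * i ≡ n * i * x
      lem₂ = solve-∀ ℚ-ring
      lem₃ : ∀ x y → x - y + y ≡ x
      lem₃ = solve-∀ ℚ-ring
      span : ∀ z → z ⊥ (j ∷ js) → ⟨ z , g ⟩ ≡ 0ℚ
      span z z⊥ = trans (perp-≈ js (c j) (λ m → z⊥ (there m))) (z⊥ (here refl))
      ns² : n * (s * s) ≤ res js U - res (j ∷ js) U
      ns² = ≤-trans (≤-reflexive (trans (sym (lem₁ ⟨ U , g ⟩ (inv n) n)) (trans (cong (λ x → ⟨ U , g ⟩ * ⟨ U , g ⟩ * x * inv n) (inv-r 0<n)) (cong (_* inv n) (*-identityʳ (⟨ U , g ⟩ * ⟨ U , g ⟩))))))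
        (≤-trans (*-monoʳ (inv n) (<⇒≤ (inv-pos 0<n)) (res-drop {j ∷ js} {js} there U g span (perp-⊥ js (c j))))
        (≤-reflexive (trans (lem₂ n (res js U - res (j ∷ js) U) (inv n)) (trans (cong (_* (res js U - res (j ∷ js) U)) (inv-r 0<n)) (*-identityˡ _)))))
      le : d * (s * s) + res (j ∷ js) U ≤ res js U
      le = ≤-trans (+-monoˡ-≤ (res (j ∷ js) U) (≤-trans (*-monoʳ (s * s) (0≤sq s) d≤) ns²)) (≤-reflexive (lem₃ (res js U) (res (j ∷ js) U)))

    far : ∀ {js} → Chain d js → ∀ U → P js U < inv (ι 7 ^ℚ length js) → d * ι (length js) < ⟨ U , U ⟩
    far {js} ch U small with squares js U ≤? ι (length js)
    ... | yes le = ⊥-elim (<⇒≱ small (*-cancelˡ (ι 7 ^ℚ length js) 0<7ʳ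
            (≡-≤-trans (inv-r 0<7ʳ) (≤-≡-trans (P-large js U le) (*-comm (P js U) (ι 7 ^ℚ length js))))))
      where
      0<7ʳ : 0ℚ < ι 7 ^ℚ length js
      0<7ʳ = ^ℚ-pos (0<ι {7} (ℕ.s≤s ℕ.z≤n)) (length js)
    ... | no ¬le = <-≤-trans (*-monoʳ-<-pos d {{positive 0<d}} (≰⇒> ¬le))
            (≤-trans (≤-by (res js U) (nonneg (perp js U)) refl) (bessel ch U))

    28ʳ<sideʳ : ∀ r → 0 ℕ.< r → ι 4 ^ℚ r < ι side ^ℚ r * inv (ι 7 ^ℚ r)
    28ʳ<sideʳ (suc r) _ = ≤-<-trans (≤-reflexive (trans (sym (*-identityʳ (ι 4 ^ℚ suc r))) (trans (cong (ι 4 ^ℚ suc r *_) (sym (inv-r 0<7ʳ)))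
          (trans (sym (*-assoc (ι 4 ^ℚ suc r) (ι 7 ^ℚ suc r) (inv (ι 7 ^ℚ suc r)))) (cong (_* inv (ι 7 ^ℚ suc r)) (sym (^ℚ-distrib-* (ι 4) (ι 7) (suc r))))))))
        (*-monoˡ-<-pos (inv (ι 7 ^ℚ suc r)) {{positive (inv-pos 0<7ʳ)}} (^ℚ-mono-< (0≤ι 28) 28<side r))
      where
      0<7ʳ : 0ℚ < ι 7 ^ℚ suc r
      0<7ʳ = ^ℚ-pos (0<ι {7} (ℕ.s≤s ℕ.z≤n)) (suc r)

    -- The weights over all pairs sum to at most 4^r, which is less than 7^(-r) for each of the 32^r
    -- grid points. So for some w every vertex has weight below 7^(-r), and by `far` it is at a
    -- large distance.
    unroundable : ∀ {js} → Chain d js → 0 ℕ.< length js →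
      ∃[ w ] w ∈ grid (length js) × (∀ {z} → z ∈ cube (length js) → d * ι (length js) < ⟨ comb c js w z , comb c js w z ⟩)
    unroundable {js} ch 0<r = finish (sum-pick (grid r) f (λ _ → inv (ι 7 ^ℚ r)) lt)
      where
      r = length js
      o : X → ℚ
      o _ = 0ℚ
      f : Vec ℕ r → ℚ
      f w = ∑[ z ∈ cube r ] P js (o ⊕ comb c js w z)
      lt : sumᴸ (grid r) f < ∑[ _ ∈ grid r ] inv (ι 7 ^ℚ r)
      lt = ≤-<-trans (tally ch o) (<-respʳ-≡ (sym (sum-grid r (inv (ι 7 ^ℚ r)))) (28ʳ<sideʳ r 0<r))
      eq : ∀ U v → ⟨ o ⊕ U , v ⟩ ≡ ⟨ U , v ⟩
      eq U v = trans (addˡ o U v) (trans (cong (_+ ⟨ U , v ⟩) (zero-⊥ v)) (+-identityˡ ⟨ U , v ⟩))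
      finish : (∃[ w ] w ∈ grid r × f w < inv (ι 7 ^ℚ r)) →
        ∃[ w ] w ∈ grid r × (∀ {z} → z ∈ cube r → d * ι r < ⟨ comb c js w z , comb c js w z ⟩)
      finish (w , w∈ , fw<) = w , w∈ , λ {z} z∈ → far ch (comb c js w z)
        (≤-<-trans (≤-trans (≤-reflexive (sym (P-cong js (eq (comb c js w z))))) (≤-sum {xs = cube r} (λ z → 0≤P js (o ⊕ comb c js w z)) z∈)) fw<)

-- Selecting independent columns from a large trace

wsum-pick : ∀ {X : Set} {ws : Weights X} → NonNeg ws → (f g : X → ℚ) → wsum ws f < wsum ws g → ∃[ x ] f x < g x
wsum-pick [] f g lt = ⊥-elim (<-irrefl refl lt)
wsum-pick {ws = (w , x) ∷ ws} (0≤w ∷ nn) f g lt with f x <? g x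
... | yes p = x , p
... | no ¬p with wsum ws f <? wsum ws g
... | yes p = wsum-pick nn f g p
... | no ¬q = ⊥-elim (<⇒≱ lt (+-mono-≤ (*-monoˡ w 0≤w (≮⇒≥ ¬p)) (≮⇒≥ ¬q)))

-- Every integral point of the cube [0, side)^js can be rounded to a multiple
-- of side with squared row error at most B.
Roundable : ∀ {I J : Set} → (I → J → ℚ) → ℚ → Set
Roundable {I} {J} A B = ∀ (js : List J) → Unique js → ∀ {w} → w ∈ grid (length js) →
  ∃[ z ] z ∈ cube (length js) × (∀ i → comb (λ j i → A i j) js w z i * comb (λ j i → A i j) js w z i ≤ B)

module Selection {I J : Set} (A : I → J → ℚ) (ps : Weights I) (qs : Weights J)
                 (0≤ps : NonNeg ps) (0≤qs : NonNeg qs) (ps≤2 : mass ps ≤ ι 2) (qs≤2 : mass qs ≤ ι 2)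
                 {c : ℚ} (0<c : 0ℚ < c) (R : Scale.Forms.Resolvent A ps qs c) where
  open Scale A
  open Forms ps qs using (⟪_,_⟫)
  open Forms.Resolvent R
  open Positive (<⇒≤ 0<c) 0≤ps 0≤qs
  open Inner Γ-inner hiding (⟨_,_⟩; comm)
  open Projection col
  open Count Γ-inner col

  trace : ℚ
  trace = wsum qs (λ j → Γ (col j) (col j))

  remaining : List J → ℚ
  remaining js = wsum qs (λ j → res js (col j))

  res-step : ∀ j₀ js → 0ℚ < res js (col j₀) → ∀ j →
    res (j₀ ∷ js) (col j) ≡ res js (col j) + - inv (res js (col j₀)) * (⟪ col j , ρ (perp js (col j₀)) ⟫ * ⟪ col j , ρ (perp js (col j₀)) ⟫)
  res-step j₀ js 0<n j = trans (sq-sub b′ k g) (trans (cong (λ z → res js (col j) + ι 2 * k * Γ b′ g + k * z * n) k≡)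
      (trans (lem (res js (col j)) (Γ b′ g) i n) (trans (cong (λ z → res js (col j) + - i * (Γ b′ g * Γ b′ g) * (ι 2 - z)) (inv-r 0<n))
      (trans (lem₂ (res js (col j)) (- i * (Γ b′ g * Γ b′ g))) (cong (λ z → res js (col j) + - i * (z * z)) Γb′g)))))
    where
    b′ = perp js (col j)
    g = perp js (col j₀)
    n = res js (col j₀)
    i = inv n
    k = ratio j₀ js (col j)
    k≡ : k ≡ - Γ b′ g * i
    k≡ = refl
    lem : ∀ a t i n → a + ι 2 * (- t * i) * t + (- t * i) * (- t * i) * n ≡ a + - i * (t * t) * (ι 2 - n * i)
    lem = solve-∀ ℚ-ring
    lem₂ : ∀ a x → a + x * (ι 2 - 1ℚ) ≡ a + x
    lem₂ = solve-∀ ℚ-ring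
    Γb′g : Γ b′ g ≡ ⟪ col j , ρ g ⟫
    Γb′g = trans (Γ-comm b′ g) (trans (perp-≈ js (col j) {g} (perp-⊥ js (col j₀))) (Γ-comm g (col j)))

  -- Projecting out one direction g lowers the trace by `cross g g` / Γ(g, g), and Γ(g, g) ≥ c
  -- `cross g g`. The scale c thus makes every selected column cost at most 1/c.
  remaining-step : ∀ j₀ js → 0ℚ < res js (col j₀) → c * remaining js - 1ℚ ≤ c * remaining (j₀ ∷ js)
  remaining-step j₀ js 0<n = ≤-by (i * (n - c * cross g g)) (0≤* (inv-nonNeg (<⇒≤ 0<n)) (0≤- cross≤))
    (trans (cong (c *_) (trans (wsum-cong qs (res-step j₀ js 0<n)) (wsum-sub qs (- i) _ _)))
    (trans (lem c (remaining js) i (cross g g) n) (cong (λ z → c * remaining js - z + i * (n - c * cross g g)) (inv-r 0<n))))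
    where
    g = perp js (col j₀)
    n = res js (col j₀)
    i = inv n
    lem : ∀ c r i x n → c * (r + - i * x) ≡ c * r - n * i + i * (n - c * x)
    lem = solve-∀ ℚ-ring
    cross≤ : c * cross g g ≤ n
    cross≤ = ≤-by ⟪ ρ g , ρ g ⟫ (⟪⟫-nonNeg (ρ g)) (trans (Γ-expand g g) (+-comm ⟪ ρ g , ρ g ⟫ (c * cross g g)))

  module _ (r : ℕ) (0<r : 0 ℕ.< r) (big : ι 2 * ι r ≤ c * trace) where

    d : ℚ
    d = ι r * ½ * inv c

    0<d : 0ℚ < d
    0<d = 0<* (0<* (0<ι 0<r) (positive⁻¹ ½)) (inv-pos 0<c)

    2cd : c * (ι 2 * d) ≡ ι r
    2cd = trans (lem c (ι r) (inv c)) (trans (cong (ι r *_) (inv-r 0<c)) (*-identityʳ (ι r)))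
      where
      lem : ∀ c r i → c * (ι 2 * (r * ½ * i)) ≡ r * (c * i)
      lem = solve-∀ ℚ-ring

    -- After t < r columns more than r/c of the trace remains. As the column weights sum to at most
    -- 2, some column keeps a residue above r/(2c) = d.
    select : ∀ t → t ℕ.≤ r → ∃[ js ] length js ≡ t × Chain d js × c * trace - ι t ≤ c * remaining js
    select zero _ = [] , refl , [] , ≤-reflexive (+-identityʳ (c * trace))
    select (suc t) t<r with select t (ℕₚ.≤-trans (ℕₚ.n≤1+n t) t<r)
    ... | js , len , ch , rem = extend (wsum-pick 0≤qs (λ _ → d) (λ j → res js (col j)) lt)
      where
      lem₁ : ∀ t r → ι 2 * r - t ≡ r + (r - t)
      lem₁ = solve-∀ ℚ-ring
      lem₂ : ∀ a t → a - (1ℚ + t) ≡ a - t - 1ℚ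
      lem₂ = solve-∀ ℚ-ring
      r<rem : ι r < c * remaining js
      r<rem = <-≤-trans (<-by (ι r - ι t) (0<- (ι-mono-< t<r)) (lem₁ (ι t) (ι r))) (≤-trans (+-monoˡ-≤ (- ι t) big) rem)
      lt : wsum qs (λ _ → d) < remaining js
      lt = *-cancelˡ-<-nonNeg c {{nonNegative (<⇒≤ 0<c)}} (≤-<-trans (*-monoˡ c (<⇒≤ 0<c)
             (≤-trans (≤-reflexive (trans (wsum-cong qs (λ _ → sym (*-identityˡ d))) (wsum-*ʳ qs d (λ _ → 1ℚ)))) (*-monoʳ d (<⇒≤ 0<d) qs≤2)))
             (≤-<-trans (≤-reflexive 2cd) r<rem))
      extend : (∃[ j ] d < res js (col j)) → ∃[ js ] length js ≡ suc t × Chain d js × c * trace - ι (suc t) ≤ c * remaining js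
      extend (j , d<) = j ∷ js , cong suc len , <⇒≤ d< ∷ ch ,
        ≤-trans (≤-reflexive (lem₂ (c * trace) (ι t))) (≤-trans (+-monoˡ-≤ (- 1ℚ) rem) (remaining-step j js (<-trans 0<d d<)))

    chain-unique : ∀ {js} → Chain d js → Unique js
    chain-unique [] = []
    chain-unique {j ∷ js} (d≤ ∷ ch) = All.tabulate (λ {k} k∈ j≡k → absurd (subst (_∈ js) (sym j≡k) k∈)) ∷ chain-unique ch
      where
      absurd : ¬ (j ∈ js)
      absurd j∈ = <⇒≱ 0<d (≤-trans d≤ (≤-reflexive (trans (res≡ js (col j)) (perp-⊥ js (col j) j∈))))

    -- The badly rounded point of `unroundable` is nevertheless rounded by hypothesis, giving an
    -- error U with d r < Γ(U, U) ≤ |U|² ≤ 2B; multiply by 2c, where 2cd = r.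
    trace-bound : ∀ {B} → 0ℚ ≤ B → Roundable A B → ι r * ι r < ι 4 * c * B
    trace-bound {B} 0≤B round = use (select r ℕₚ.≤-refl)
      where
      lem : ∀ c d r → c * (ι 2 * d) * r ≡ ι 2 * c * (d * r)
      lem = solve-∀ ℚ-ring
      lem₂ : ∀ c B → ι 2 * c * (ι 2 * B) ≡ ι 4 * c * B
      lem₂ = solve-∀ ℚ-ring
      conclude : ∀ U → (∀ i → U i * U i ≤ B) → d * ι r < Γ U U → ι r * ι r < ι 4 * c * B
      conclude U U≤ lt = ≤-<-trans (≤-reflexive (trans (cong (_* ι r) (sym 2cd)) (lem c d (ι r))))
        (<-≤-trans (*-monoʳ-<-pos (ι 2 * c) {{positive (0<* (0<ι {2} (ℕ.s≤s ℕ.z≤n)) 0<c)}} lt)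
        (≤-trans (*-monoˡ (ι 2 * c) (0≤* (0≤ι 2) (<⇒≤ 0<c)) (≤-trans (Γ≤⟪⟫ U) (≤-trans (wsum-mono 0≤ps U≤)
            (≤-trans (≤-reflexive (trans (wsum-cong ps (λ _ → sym (*-identityˡ B))) (wsum-*ʳ ps B (λ _ → 1ℚ)))) (*-monoʳ B 0≤B ps≤2)))))
          (≤-reflexive (lem₂ c B))))
      use : (∃[ js ] length js ≡ r × Chain d js × c * trace - ι r ≤ c * remaining js) → ι r * ι r < ι 4 * c * B
      use (js , len , ch , _) = finish (unroundable 0<d ch (subst (0 ℕ.<_) (sym len) 0<r))
        where
        Rounded : Vec ℕ (length js) → Set
        Rounded w = ∃[ z ] z ∈ cube (length js) × (∀ i → comb col js w z i * comb col js w z i ≤ B)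
        Far : Vec ℕ (length js) → Set
        Far w = ∀ {z} → z ∈ cube (length js) → d * ι (length js) < Γ (comb col js w z) (comb col js w z)
        finish′ : ∀ w → Far w → Rounded w → ι r * ι r < ι 4 * c * B
        finish′ w far (z , z∈ , le) = conclude (comb col js w z) le (subst (λ l → d * ι l < Γ (comb col js w z) (comb col js w z)) len (far z∈))
        finish : (∃[ w ] w ∈ grid (length js) × Far w) → ι r * ι r < ι 4 * c * B
        finish (w , w∈ , far) = finish′ w far (round js (chain-unique ch) w∈)

-- Duality up to constants

Factorization-mono : ∀ {I J : Set} {A : I → J → ℚ} {γ γ′} → γ ≤ γ′ → Factorization A γ → Factorization A γ′
Factorization-mono le F = record
  { terms = terms ; 0≤terms = 0≤terms ; entry = entry
  ; row-norm = λ i → ≤-trans (row-norm i) le ; col-norm = λ j → ≤-trans (col-norm j) le }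
  where open Factorization F

Witness-mono : ∀ {I J : Set} {A : I → J → ℚ} {s K v v′} → v′ ≤ v → Witness A s K v → Witness A s K v′
Witness-mono le W = record
  { ps = ps ; qs = qs ; 0≤ps = 0≤ps ; 0≤qs = 0≤qs ; ps≤ = ps≤ ; qs≤ = qs≤ ; T = T ; contract = contract ; pairing = ≤-trans le pairing }
  where open Witness W

entry-witness : ∀ {I J : Set} {A : I → J → ℚ} {i j} → A i j ≡ 1ℚ → Witness A (ι 2) (ι 8) 1ℚ
entry-witness {A = A} {i} {j} eq = record
  { ps = (1ℚ , i) ∷ [] ; qs = (1ℚ , j) ∷ [] ; 0≤ps = 0≤1 ∷ [] ; 0≤qs = 0≤1 ∷ []
  ; ps≤ = ι-mono {1} {2} (ℕ.s≤s ℕ.z≤n) ; qs≤ = ι-mono {1} {2} (ℕ.s≤s ℕ.z≤n) ; T = λ _ _ → 1ℚ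
  ; contract = λ x → ≤-by (ι 7 * (x i * x i)) (0≤* (0≤ι 7) (0≤sq (x i))) (lem (x i))
  ; pairing = ≤-reflexive (sym (trans (cong (λ z → 1ℚ * (1ℚ * (1ℚ * z) + 0ℚ) + 0ℚ) eq) refl)) }
  where
  lem : ∀ x → ι 8 * (1ℚ * (x * x) + 0ℚ)
            ≡ 1ℚ * ((1ℚ * (1ℚ * x) + 0ℚ) * (1ℚ * (1ℚ * x) + 0ℚ)) + 0ℚ + ι 7 * (x * x)
  lem = solve-∀ ℚ-ring

n<2^n : ∀ n → n ℕ.< 2 ℕ.^ n
n<2^n zero = ℕ.s≤s ℕ.z≤n
n<2^n (suc n) = ℕₚ.<-≤-trans (ℕₚ.+-mono-≤-< (ℕₚ.≤-trans (ℕ.s≤s ℕ.z≤n) (n<2^n n)) (n<2^n n))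
  (ℕₚ.≤-reflexive (cong (2 ℕ.^ n ℕ.+_) (sym (ℕₚ.+-identityʳ (2 ℕ.^ n)))))

module Duality {m n : ℕ} (A : Fin m → Fin n → ℚ) (A²≤1 : ∀ i j → A i j * A i j ≤ 1ℚ)
               (0<m : 0 ℕ.< length (allFin m)) (L : ℕ) (m≤2^L : ι m ≤ 2^ L)
               (h : ℕ) (0<h : 0 ℕ.< h) (0<side : 0 ℕ.< side)
               (round : Roundable A (ι (side ℕ.* h) * ι (side ℕ.* h))) where
  open Greedy A A²≤1 (allFin m) (allFin n) 0<m L
  open Primal A A²≤1 0<m L m≤2^L
  open Dual A A²≤1 (allFin m) (allFin n) 0<m L

  k₀ : ℕ
  k₀ = side ℕ.* h

  0<k₀ : 0 ℕ.< k₀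
  0<k₀ = ℕₚ.*-mono-≤ 0<side 0<h

  -- The choice r = 2 · 2^l · k₀ makes r² equal to 4 · 4^l · k₀², the bound of `trace-bound` for B =
  -- k₀²; its strict inequality is then absurd.
  trace≤ : ∀ st → Light st → ∀ l → 2^ l * wsum (State.qs st) (λ j → State.R.Γ st l (col j) (col j)) ≤ ι 4 * ι k₀
  trace≤ st lt l with 2^ l * wsum (State.qs st) (λ j → State.R.Γ st l (col j) (col j)) ≤? ι 4 * ι k₀
  ... | yes le = le
  ... | no ¬le = ⊥-elim (<-irrefl refl (≤-<-trans (≤-reflexive (sym eq)) (Selection.trace-bound A ps qs 0≤ps 0≤qs ps≤2 qs≤2 (0<4^ l) (res l) r 0<r big (0≤sq (ι k₀)) round)))
    where
    open State st
    open Light lt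
    T₀ = wsum qs (λ j → R.Γ l (col j) (col j))
    r : ℕ
    r = 2 ℕ.* 2 ℕ.^ l ℕ.* k₀
    0<r : 0 ℕ.< r
    0<r = ℕₚ.*-mono-≤ (ℕₚ.*-mono-≤ {1} {2} (ℕ.s≤s ℕ.z≤n) (ℕₚ.m^n>0 2 l)) 0<k₀
    ιr : ι r ≡ ι 2 * 2^ l * ι k₀
    ιr = trans (ι-* (2 ℕ.* 2 ℕ.^ l) k₀) (cong (_* ι k₀) (trans (ι-* 2 (2 ℕ.^ l)) (cong (ι 2 *_) (ι-^ 2 l))))
    lem₁ : ∀ t k → ι 2 * t * k * (ι 2 * t * k) ≡ ι 4 * (t * t) * (k * k)
    lem₁ = solve-∀ ℚ-ring
    eq : ι r * ι r ≡ ι 4 * 4^ l * (ι k₀ * ι k₀)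
    eq = trans (cong₂ _*_ ιr ιr) (trans (lem₁ (2^ l) (ι k₀)) (cong (λ z → ι 4 * z * (ι k₀ * ι k₀)) (sym (4^≡2^*2^ l))))
    lem₂ : ∀ t k → ι 2 * (ι 2 * t * k) ≡ t * (ι 4 * k)
    lem₂ = solve-∀ ℚ-ring
    big : ι 2 * ι r ≤ 4^ l * T₀
    big = ≤-trans (≤-reflexive (trans (cong (ι 2 *_) ιr) (lem₂ (2^ l) (ι k₀)))) (≤-trans (*-monoˡ (2^ l) (0≤2^ l) (<⇒≤ (≰⇒> ¬le)))
      (≤-reflexive (trans (sym (*-assoc (2^ l) (2^ l) T₀)) (cong (_* T₀) (sym (4^≡2^*2^ l))))))

  length-scales : ∀ L → length (scales L) ≡ suc L
  length-scales zero = refl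
  length-scales (suc L) = cong suc (length-scales L)

  value≤ : ∀ st → Light st → State.value st ≤ ι (suc L) * (ι 4 * ι k₀)
  value≤ st lt = ≤-trans (sum-mono (scales L) (trace≤ st lt)) (≤-reflexive (trans (sum-const (scales L) (ι 4 * ι k₀)) (cong (λ l → ι l * (ι 4 * ι k₀)) (length-scales L))))

  bound : ℕ
  bound = suc L ℕ.* (4 ℕ.* k₀)

  ι-bound : ι bound ≡ ι (suc L) * (ι 4 * ι k₀)
  ι-bound = trans (ι-* (suc L) (4 ℕ.* k₀)) (cong (ι (suc L) *_) (ι-* 4 k₀))

  decide : ∀ M → 0 ℕ.< M → Factorization A (ι 36 * ι M) ⊎ Witness A (ι 2) (ι 8) (½ * ι M) × M ℕ.≤ 2 ℕ.* bound
  decide M 0<M = go (dichotomy (ι M))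
    where
    lem : ∀ x y → ½ * x ≤ y → x ≤ ι 2 * y
    lem x y le = ≤-trans (≤-reflexive (l x)) (*-monoˡ (ι 2) (0≤ι 2) le)
      where
      l : ∀ x → x ≡ ι 2 * (½ * x)
      l = solve-∀ ℚ-ring
    go : (∃[ st ] Light st × (Stationary st (ι M) ⊎ ½ * ι M ≤ State.value st)) →
         Factorization A (ι 36 * ι M) ⊎ Witness A (ι 2) (ι 8) (½ * ι M) × M ℕ.≤ 2 ℕ.* bound
    go (st , lt , inj₁ stat) = inj₁ (stationary⇒factorization st (ι M) (1≤ι 0<M) lt stat)
    go (st , lt , inj₂ le) = inj₂ (Witness-mono le (state⇒witness st lt) ,
      ι-cancel (≤-≡-trans (lem (ι M) (ι bound) (≤-trans le (≤-≡-trans (value≤ st lt) (sym ι-bound)))) (sym (ι-* 2 bound))))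

  Verdict : ℕ → Set
  Verdict M = Factorization A (ι 36 * ι M) ⊎ Witness A (ι 2) (ι 8) (½ * ι M) × M ℕ.≤ 2 ℕ.* bound

  large : ∀ {M} → 2 ℕ.* bound ℕ.< M → Verdict M → Factorization A (ι 36 * ι M)
  large lt (inj₁ F)        = F
  large lt (inj₂ (_ , le)) = ⊥-elim (ℕₚ.<⇒≱ lt le)

  -- Beyond 2 `bound` no state has value ½ M, so the greedy process must have become stationary.
  factorization : Factorization A (ι 36 * ι (suc (2 ℕ.* bound)))
  factorization = large (ℕₚ.n<1+n (2 ℕ.* bound)) (decide (suc (2 ℕ.* bound)) (ℕ.s≤s ℕ.z≤n))

  Tight : Set
  Tight = ∃[ M ] 0 ℕ.< M × Factorization A (ι 36 * ι M) × Witness A (ι 2) (ι 8) (½ * ½ * ι M)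

  -- Descend through the powers of two from one too large for a witness. At the first failure 2^k
  -- has a witness of value ½ 2^k while 2^(k+1) still has a factorization, which explains ½ * ½. If
  -- nothing fails down to 1, a single entry is the witness.
  tight : ∀ {i j} → A i j ≡ 1ℚ → Tight
  tight {i} {j} one = descend (2 ℕ.* bound) (large (n<2^n (2 ℕ.* bound)) (decide (2 ℕ.^ (2 ℕ.* bound)) (ℕₚ.m^n>0 2 (2 ℕ.* bound))))
    where
    lem : ∀ x → ½ * x ≡ ½ * ½ * (ι 2 * x)
    lem = solve-∀ ℚ-ring
    descend : ∀ k → Factorization A (ι 36 * ι (2 ℕ.^ k)) → Tight
    refine  : ∀ k → Factorization A (ι 36 * ι (2 ℕ.^ suc k)) → Verdict (2 ℕ.^ k) → Tight
    descend zero    F = 1 , ℕ.s≤s ℕ.z≤n , F , Witness-mono (≤-by (½ + ½ * ½) (nonNegative⁻¹ (½ + ½ * ½)) refl) (entry-witness {A = A} {i} {j} one)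
    descend (suc k) F = refine k F (decide (2 ℕ.^ k) (ℕₚ.m^n>0 2 k))
    refine k F (inj₁ F′)      = descend k F′
    refine k F (inj₂ (W , _)) = 2 ℕ.^ suc k , ℕₚ.m^n>0 2 (suc k) , F ,
      subst (Witness A (ι 2) (ι 8)) (trans (lem (ι (2 ℕ.^ k))) (cong (½ * ½ *_) (sym (ι-* 2 (2 ℕ.^ k))))) W

-- From factorizations to colourings, and weak duality

^ℚ-cancel : ∀ {p q} → 0ℚ ≤ q → ∀ r → p ^ℚ suc r ≤ q ^ℚ suc r → p ≤ q
^ℚ-cancel {p} {q} 0≤q r le with p ≤? q
... | yes p≤q = p≤q
... | no p≰q = ⊥-elim (<⇒≱ (^ℚ-mono-< 0≤q (≰⇒> p≰q) r) le)

module _ {I : Set} {n : ℕ} {A : I → Fin n → ℚ} {γ : ℚ} (0<γ : 0ℚ < γ) (F : Factorization A γ) where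
  open Factorization F

  -- The form is divided by γ and the row vectors are multiplied by γ: entries are kept, columns get
  -- squared length at most 1 and rows at most γ², without √γ. One row's power is at most the sum
  -- over m ≤ 2^(r+1) rows, so the root of order r+1 costs only a factor 2. The factor χ restricts
  -- to a subset of the columns.
  colouring : ∀ (is : List I) r → ι (length is) ≤ ι 2 ^ℚ suc r → ∀ (χ : Fin n → ℚ) → (∀ k → χ k * χ k ≤ 1ℚ) →
    ∃[ x ] (∀ k → IsSign (x k)) ×
           (∀ {i} → i ∈ is → (∑[ k ∈ allFin n ] (x k * (χ k * A i k))) * (∑[ k ∈ allFin n ] (x k * (χ k * A i k))) ≤ ι 2 * (noise r * (γ * γ)))
  colouring is r len χ χ≤1 = finish W.balanced
    where
    X : Set
    X = (I → ℚ) × (Fin n → ℚ)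
    g = inv γ
    0≤g : 0ℚ ≤ g
    0≤g = <⇒≤ (inv-pos 0<γ)
    H : SemiInner X
    H = record
      { ⟨_,_⟩ = λ u v → g * wsum terms (λ t → u t * v t)
      ; comm = λ u v → cong (g *_) (wsum-cong terms (λ t → *-comm (u t) (v t)))
      ; addˡ = λ u v w → trans (cong (g *_) (trans (wsum-cong terms (λ t → *-distribʳ-+ (w t) (u t) (v t))) (wsum-+ terms _ _))) (*-distribˡ-+ g _ _)
      ; mulˡ = λ k u w → trans (cong (g *_) (trans (wsum-cong terms (λ t → *-assoc k (u t) (w t))) (wsum-*ˡ terms k _))) (lem g k (wsum terms (λ t → u t * w t)))
      ; nonneg = λ u → 0≤* 0≤g (wsum-nonNeg 0≤terms (λ t → 0≤sq (u t))) }
      where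
      lem : ∀ g k s → g * (k * s) ≡ k * (g * s)
      lem = solve-∀ ℚ-ring
    c : Fin n → X → ℚ
    c k t = χ k * proj₂ t k
    b : I → X → ℚ
    b i t = γ * proj₁ t i
    c≤1 : ∀ k → g * wsum terms (λ t → c k t * c k t) ≤ 1ℚ
    c≤1 k = ≤-trans (*-monoˡ g 0≤g (≤-trans (≤-reflexive (trans (wsum-cong terms (λ t → lem (χ k) (proj₂ t k))) (wsum-*ˡ terms (χ k * χ k) _)))
        (*-mono (0≤sq (χ k)) (wsum-nonNeg 0≤terms (λ t → 0≤sq (proj₂ t k))) (χ≤1 k) (col-norm k))))
      (≤-reflexive (trans (lem₂ g γ) (inv-r 0<γ)))
      where
      lem : ∀ x y → x * y * (x * y) ≡ x * x * (y * y)
      lem = solve-∀ ℚ-ring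
      lem₂ : ∀ g γ → g * (1ℚ * γ) ≡ γ * g
      lem₂ = solve-∀ ℚ-ring
    module W = Walk H c c≤1 is b r
    bc : ∀ i k → g * wsum terms (λ t → b i t * c k t) ≡ χ k * A i k
    bc i k = trans (cong (g *_) (trans (wsum-cong terms (λ t → lem γ (proj₁ t i) (χ k) (proj₂ t k))) (trans (wsum-*ˡ terms (γ * χ k) _) (cong (γ * χ k *_) (sym (entry i k))))))
      (trans (lem₂ g γ (χ k) (A i k)) (trans (cong (_* (χ k * A i k)) (inv-r 0<γ)) (*-identityˡ _)))
      where
      lem : ∀ γ x χ y → γ * x * (χ * y) ≡ γ * χ * (x * y)
      lem = solve-∀ ℚ-ring
      lem₂ : ∀ g γ χ a → g * (γ * χ * a) ≡ γ * g * (χ * a)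
      lem₂ = solve-∀ ℚ-ring
    bb : ∀ i → g * wsum terms (λ t → b i t * b i t) ≤ γ * γ
    bb i = ≤-trans (≤-reflexive (trans (cong (g *_) (trans (wsum-cong terms (λ t → lem γ (proj₁ t i))) (wsum-*ˡ terms (γ * γ) _))) (trans (lem₂ g γ _) (cong (λ z → z * (γ * wsum terms (λ t → proj₁ t i * proj₁ t i))) (inv-r 0<γ)))))
      (≤-trans (≤-reflexive (*-identityˡ _)) (*-monoˡ γ (<⇒≤ 0<γ) (row-norm i)))
      where
      lem : ∀ γ x → γ * x * (γ * x) ≡ γ * γ * (x * x)
      lem = solve-∀ ℚ-ring
      lem₂ : ∀ g γ s → g * (γ * γ * s) ≡ γ * g * (γ * s)
      lem₂ = solve-∀ ℚ-ring
    N = noise r * (γ * γ)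
    0≤N : 0ℚ ≤ N
    0≤N = 0≤* (0≤noise r) (0≤sq γ)
    Y : (Fin n → ℚ) → I → ℚ
    Y x i = ∑[ k ∈ allFin n ] (x k * (χ k * A i k))
    conclude : ∀ x i → i ∈ is → W.final x ≤ ∑[ i ∈ is ] (ι 2 * (noise r * (g * wsum terms (λ t → b i t * b i t))) ^ℚ suc r) →
               Y x i * Y x i ≤ ι 2 * N
    conclude x i i∈ le = ^ℚ-cancel (0≤* (0≤ι 2) 0≤N) r (*-cancelˡ (ι 2) (0<ι {2} (ℕ.s≤s ℕ.z≤n)) (≤-trans
        (≤-reflexive (cong (λ y → ι 2 * (y * y) ^ℚ suc r) (sym Y≡)))
        (≤-trans (≤-sum {xs = is} {f = λ i → ι 2 * (W.Y x i * W.Y x i) ^ℚ suc r} (λ i → 0≤* (0≤ι 2) (^ℚ-nonNeg (0≤sq (W.Y x i)) (suc r))) i∈)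
        (≤-trans le (≤-trans (sum-mono is (λ i → *-monoˡ (ι 2) (0≤ι 2) (^ℚ-mono (0≤* (0≤noise r) (0≤* 0≤g (wsum-nonNeg 0≤terms (λ t → 0≤sq (b i t))))) (*-monoˡ (noise r) (0≤noise r) (bb i)) (suc r))))
        (≤-trans (≤-reflexive (sum-const is (ι 2 * N ^ℚ suc r))) (≤-trans (*-monoʳ (ι 2 * N ^ℚ suc r) (0≤* (0≤ι 2) (^ℚ-nonNeg 0≤N (suc r))) len)
        (≤-reflexive (trans (lem (ι 2 ^ℚ suc r) (N ^ℚ suc r)) (cong (ι 2 *_) (sym (^ℚ-distrib-* (ι 2) N (suc r)))))))))))))
      where
      Y≡ : W.Y x i ≡ Y x i
      Y≡ = sum-cong (allFin n) (λ k → cong (x k *_) (bc i k))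
      lem : ∀ a b → a * (ι 2 * b) ≡ ι 2 * (a * b)
      lem = solve-∀ ℚ-ring
    finish : W.Outcome (∑[ i ∈ is ] (ι 2 * (noise r * (g * wsum terms (λ t → b i t * b i t))) ^ℚ suc r)) →
      ∃[ x ] (∀ k → IsSign (x k)) × (∀ {i} → i ∈ is → Y x i * Y x i ≤ ι 2 * N)
    finish (x , sg , le) = x , sg , λ {i} i∈ → conclude x i i∈ le

-- Insert the factorization into the pairing and use x y ≤ ½ (x² + y²) for each term instead of
-- Cauchy-Schwarz. This gives ½ (1 + K) s γ, which avoids √K and is enough for K ≥ 1.
weak-duality : ∀ {I J : Set} {A : I → J → ℚ} {γ s K v} → 0ℚ ≤ γ → 1ℚ ≤ K → 0ℚ ≤ s →
               Factorization A γ → Witness A s K v → v ≤ K * s * γ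
weak-duality {A = A} {γ} {s} {K} {v} 0≤γ 1≤K 0≤s F W = ≤-trans pairing (≤-trans (≤-reflexive expand) (≤-trans (wsum-mono 0≤terms each) (≤-trans (≤-reflexive collect)
    (≤-trans (*-monoˡ ½ (nonNegative⁻¹ ½) (+-mono-≤ cols (*-monoˡ K 0≤K rows))) (≤-by (½ * ((K - 1ℚ) * (s * γ))) (0≤* (nonNegative⁻¹ ½) (0≤* (0≤- 1≤K) (0≤* 0≤s 0≤γ))) (lem K s γ))))))
  where
  open Factorization F
  open Witness W
  0≤K = ≤-trans 0≤1 1≤K
  lem : ∀ K s γ → K * s * γ ≡ ½ * (s * γ + K * (s * γ)) + ½ * ((K - 1ℚ) * (s * γ))
  lem = solve-∀ ℚ-ring
  Tx : _ → _ → ℚ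
  Tx t j = wsum ps (λ i → T i j * proj₁ t i)
  expand : wsum ps (λ i → wsum qs (λ j → T i j * A i j)) ≡ wsum terms (λ t → wsum qs (λ j → proj₂ t j * Tx t j))
  expand = trans (wsum-swap ps qs _) (trans (wsum-cong qs (λ j → trans (wsum-cong ps (λ i → trans (cong (T i j *_) (entry i j)) (sym (wsum-*ˡ terms (T i j) _))))
      (trans (wsum-swap ps terms _) (wsum-cong terms (λ t → trans (wsum-cong ps (λ i → lem₁ (T i j) (proj₁ t i) (proj₂ t j))) (wsum-*ˡ ps (proj₂ t j) _))))))
    (wsum-swap qs terms _))
    where
    lem₁ : ∀ T x y → T * (x * y) ≡ y * (T * x)
    lem₁ = solve-∀ ℚ-ring
  each : ∀ t → wsum qs (λ j → proj₂ t j * Tx t j) ≤ ½ * (wsum qs (λ j → proj₂ t j * proj₂ t j) + K * wsum ps (λ i → proj₁ t i * proj₁ t i))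
  each t = ≤-trans (wsum-mono 0≤qs (λ j → ≤-by (½ * ((proj₂ t j - Tx t j) * (proj₂ t j - Tx t j))) (0≤* (nonNegative⁻¹ ½) (0≤sq (proj₂ t j - Tx t j))) (lem₁ (proj₂ t j) (Tx t j))))
    (≤-trans (≤-reflexive (trans (wsum-*ˡ qs ½ _) (cong (½ *_) (wsum-+ qs _ _)))) (*-monoˡ ½ (nonNegative⁻¹ ½) (+-monoʳ-≤ (wsum qs (λ j → proj₂ t j * proj₂ t j)) (contract (proj₁ t)))))
    where
    lem₁ : ∀ x y → ½ * (x * x + y * y) ≡ x * y + ½ * ((x - y) * (x - y))
    lem₁ = solve-∀ ℚ-ring
  collect : wsum terms (λ t → ½ * (wsum qs (λ j → proj₂ t j * proj₂ t j) + K * wsum ps (λ i → proj₁ t i * proj₁ t i)))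
          ≡ ½ * (wsum qs (λ j → wsum terms (λ t → proj₂ t j * proj₂ t j)) + K * wsum ps (λ i → wsum terms (λ t → proj₁ t i * proj₁ t i)))
  collect = trans (wsum-*ˡ terms ½ _) (cong (½ *_) (trans (wsum-sub terms K _ _) (cong₂ (λ x y → x + K * y) (wsum-swap terms qs _) (wsum-swap terms ps _))))
  const≤ : ∀ {X : Set} (ws : Weights X) → NonNeg ws → mass ws ≤ s → ∀ {f} → (∀ x → f x ≤ γ) → wsum ws f ≤ s * γ
  const≤ ws nn m≤ f≤ = ≤-trans (wsum-mono nn f≤) (≤-trans (≤-reflexive (trans (wsum-cong ws (λ _ → sym (*-identityˡ γ))) (wsum-*ʳ ws γ (λ _ → 1ℚ)))) (*-monoʳ γ 0≤γ m≤))
  cols : wsum qs (λ j → wsum terms (λ t → proj₂ t j * proj₂ t j)) ≤ s * γ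
  cols = const≤ qs 0≤qs qs≤ col-norm
  rows : wsum ps (λ i → wsum terms (λ t → proj₁ t i * proj₁ t i)) ≤ s * γ
  rows = const≤ ps 0≤ps ps≤ row-norm

pullback : ∀ {I J I′ J′ : Set} {A : I → J → ℚ} {γ} (f : I′ → I) (g : J′ → J) {A′ : I′ → J′ → ℚ} →
           (∀ i j → A′ i j ≡ A (f i) (g j)) → Factorization A γ → Factorization A′ γ
pullback f g eq F = record
  { terms = rescale 1ℚ h terms ; 0≤terms = NonNeg-rescale 0≤1 h 0≤terms
  ; entry = λ i j → trans (eq i j) (trans (entry (f i) (g j)) (sym (trans (wsum-rescale 1ℚ h terms _) (*-identityˡ _))))
  ; row-norm = λ i → ≤-trans (≤-reflexive (trans (wsum-rescale 1ℚ h terms _) (*-identityˡ _))) (row-norm (f i))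
  ; col-norm = λ j → ≤-trans (≤-reflexive (trans (wsum-rescale 1ℚ h terms _) (*-identityˡ _))) (col-norm (g j)) }
  where
  open Factorization F
  h : _ → _
  h t = (λ i → proj₁ t (f i)) , (λ j → proj₂ t (g j))

-- Tensor products

infixr 7 _⊠_
_⊠_ : ∀ {X Y : Set} → Weights X → Weights Y → Weights (X × Y)
[]             ⊠ vs = []
((w , x) ∷ ws) ⊠ vs = rescale w (x ,_) vs ++ (ws ⊠ vs)

wsum-⊠ : ∀ {X Y : Set} (ws : Weights X) (vs : Weights Y) f → wsum (ws ⊠ vs) f ≡ wsum ws (λ x → wsum vs (λ y → f (x , y)))
wsum-⊠ [] vs f = refl
wsum-⊠ ((w , x) ∷ ws) vs f = trans (wsum-++ (rescale w (x ,_) vs) (ws ⊠ vs) f) (cong₂ _+_ (wsum-rescale w (x ,_) vs f) (wsum-⊠ ws vs f))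

NonNeg-⊠ : ∀ {X Y : Set} {ws : Weights X} {vs : Weights Y} → NonNeg ws → NonNeg vs → NonNeg (ws ⊠ vs)
NonNeg-⊠ [] q = []
NonNeg-⊠ (p ∷ ps) q = NonNeg-++ (NonNeg-rescale p _ q) (NonNeg-⊠ ps q)

wsum-⊠-* : ∀ {X Y : Set} (ws : Weights X) (vs : Weights Y) (f : X → ℚ) (g : Y → ℚ) →
           wsum (ws ⊠ vs) (λ t → f (proj₁ t) * g (proj₂ t)) ≡ wsum ws f * wsum vs g
wsum-⊠-* ws vs f g = trans (wsum-⊠ ws vs _) (trans (wsum-cong ws (λ x → wsum-*ˡ vs (f x) g)) (wsum-*ʳ ws (wsum vs g) f))

mass-⊠ : ∀ {X Y : Set} (ws : Weights X) (vs : Weights Y) → mass (ws ⊠ vs) ≡ mass ws * mass vs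
mass-⊠ ws vs = trans (wsum-cong (ws ⊠ vs) (λ _ → sym (*-identityˡ 1ℚ))) (wsum-⊠-* ws vs (λ _ → 1ℚ) (λ _ → 1ℚ))

kronecker : ∀ {I J I′ J′ : Set} → (I → J → ℚ) → (I′ → J′ → ℚ) → I × I′ → J × J′ → ℚ
kronecker A B (i , i′) (j , j′) = A i j * B i′ j′

interchange : ∀ a b c d → a * b * (c * d) ≡ a * c * (b * d)
interchange = solve-∀ ℚ-ring

⊗-factorization : ∀ {I J I′ J′ : Set} {A : I → J → ℚ} {B : I′ → J′ → ℚ} {γ γ′} →
                  Factorization A γ → Factorization B γ′ → Factorization (kronecker A B) (γ * γ′)
⊗-factorization {I} {J} {I′} {J′} {A} {B} F G = record
  { terms = rescale 1ℚ h (F.terms ⊠ G.terms) ; 0≤terms = NonNeg-rescale 0≤1 h (NonNeg-⊠ F.0≤terms G.0≤terms)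
  ; entry = λ { (i , i′) (j , j′) → trans (cong₂ _*_ (F.entry i j) (G.entry i′ j′)) (sym (norm (λ t → proj₁ t i * proj₂ t j) (λ t → proj₁ t i′ * proj₂ t j′) _ λ s t → interchange (proj₁ s i) (proj₁ t i′) (proj₂ s j) (proj₂ t j′))) }
  ; row-norm = λ { (i , i′) → ≤-trans (≤-reflexive (norm (λ t → proj₁ t i * proj₁ t i) (λ t → proj₁ t i′ * proj₁ t i′) _ λ s t → interchange (proj₁ s i) (proj₁ t i′) (proj₁ s i) (proj₁ t i′)))
        (*-mono (wsum-nonNeg F.0≤terms (λ t → 0≤sq (proj₁ t i))) (wsum-nonNeg G.0≤terms (λ t → 0≤sq (proj₁ t i′))) (F.row-norm i) (G.row-norm i′)) }
  ; col-norm = λ { (j , j′) → ≤-trans (≤-reflexive (norm (λ t → proj₂ t j * proj₂ t j) (λ t → proj₂ t j′ * proj₂ t j′) _ λ s t → interchange (proj₂ s j) (proj₂ t j′) (proj₂ s j) (proj₂ t j′)))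
        (*-mono (wsum-nonNeg F.0≤terms (λ t → 0≤sq (proj₂ t j))) (wsum-nonNeg G.0≤terms (λ t → 0≤sq (proj₂ t j′))) (F.col-norm j) (G.col-norm j′)) } }
  where
  module F = Factorization F
  module G = Factorization G
  Pair = ((I → ℚ) × (J → ℚ)) × ((I′ → ℚ) × (J′ → ℚ))
  Term = (I × I′ → ℚ) × (J × J′ → ℚ)
  h : Pair → Term
  h (s , t) = (λ { (i , i′) → proj₁ s i * proj₁ t i′ }) , (λ { (j , j′) → proj₂ s j * proj₂ t j′ })
  norm : ∀ (f : _ → ℚ) (g : _ → ℚ) (k : Term → ℚ) → (∀ s t → k (h (s , t)) ≡ f s * g t) →
         wsum (rescale 1ℚ h (F.terms ⊠ G.terms)) k ≡ wsum F.terms f * wsum G.terms g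
  norm f g k eq = trans (wsum-rescale 1ℚ h (F.terms ⊠ G.terms) k) (trans (*-identityˡ _)
    (trans (wsum-cong (F.terms ⊠ G.terms) (λ p → eq (proj₁ p) (proj₂ p))) (wsum-⊠-* F.terms G.terms f g)))

-- The norm bound holds because the tensor operator acts in one coordinate at a time, the other
-- being a parameter; the constants K′ and K are paid one after the other.
⊗-witness : ∀ {I J I′ J′ : Set} {A : I → J → ℚ} {B : I′ → J′ → ℚ} {s K v s′ K′ v′} → 0ℚ ≤ K → 0ℚ ≤ K′ → 0ℚ ≤ v → 0ℚ ≤ v′ →
            Witness A s K v → Witness B s′ K′ v′ → Witness (kronecker A B) (s * s′) (K * K′) (v * v′)
⊗-witness {A = A} {B} {s} {K} {v} {s′} {K′} {v′} 0≤K 0≤K′ 0≤v 0≤v′ V W = record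
  { ps = V.ps ⊠ W.ps ; qs = V.qs ⊠ W.qs ; 0≤ps = NonNeg-⊠ V.0≤ps W.0≤ps ; 0≤qs = NonNeg-⊠ V.0≤qs W.0≤qs
  ; ps≤ = ≤-trans (≤-reflexive (mass-⊠ V.ps W.ps)) (*-mono (wsum-nonNeg V.0≤ps (λ _ → 0≤1)) (wsum-nonNeg W.0≤ps (λ _ → 0≤1)) V.ps≤ W.ps≤)
  ; qs≤ = ≤-trans (≤-reflexive (mass-⊠ V.qs W.qs)) (*-mono (wsum-nonNeg V.0≤qs (λ _ → 0≤1)) (wsum-nonNeg W.0≤qs (λ _ → 0≤1)) V.qs≤ W.qs≤)
  ; T = kronecker V.T W.T
  ; contract = contract
  ; pairing = ≤-trans (*-mono 0≤v 0≤v′ V.pairing W.pairing) (≤-reflexive (sym pair)) }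
  where
  module V = Witness V
  module W = Witness W
  pair : wsum (V.ps ⊠ W.ps) (λ i → wsum (V.qs ⊠ W.qs) (λ j → kronecker V.T W.T i j * kronecker A B i j))
       ≡ wsum V.ps (λ i → wsum V.qs (λ j → V.T i j * A i j)) * wsum W.ps (λ i → wsum W.qs (λ j → W.T i j * B i j))
  pair = trans (wsum-cong (V.ps ⊠ W.ps) (λ { (i , i′) → trans (wsum-cong (V.qs ⊠ W.qs) (λ { (j , j′) → interchange (V.T i j) (W.T i′ j′) (A i j) (B i′ j′) }))
           (wsum-⊠-* V.qs W.qs (λ j → V.T i j * A i j) (λ j′ → W.T i′ j′ * B i′ j′)) }))
         (wsum-⊠-* V.ps W.ps (λ i → wsum V.qs (λ j → V.T i j * A i j)) (λ i′ → wsum W.qs (λ j′ → W.T i′ j′ * B i′ j′)))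
  contract : ∀ x → wsum (V.qs ⊠ W.qs) (λ j → wsum (V.ps ⊠ W.ps) (λ i → kronecker V.T W.T i j * x i) * wsum (V.ps ⊠ W.ps) (λ i → kronecker V.T W.T i j * x i))
                 ≤ K * K′ * wsum (V.ps ⊠ W.ps) (λ i → x i * x i)
  contract x = ≤-trans (≤-reflexive (trans (wsum-⊠ V.qs W.qs _) (wsum-cong V.qs (λ j → wsum-cong W.qs (λ j′ → cong₂ _*_ (inner j j′) (inner j j′))))))
    (≤-trans (wsum-mono V.0≤qs (λ j → W.contract (z j)))
    (≤-trans (≤-reflexive (trans (wsum-*ˡ V.qs K′ _) (cong (K′ *_) (wsum-swap V.qs W.ps _))))
    (≤-trans (*-monoˡ K′ 0≤K′ (wsum-mono W.0≤ps (λ i′ → V.contract (λ i → x (i , i′)))))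
    (≤-reflexive (trans (cong (K′ *_) (wsum-*ˡ W.ps K _)) (trans (lem K K′ _) (cong (K * K′ *_) (trans (wsum-swap W.ps V.ps _) (sym (wsum-⊠ V.ps W.ps _))))))))))
    where
    z : _ → _ → ℚ
    z j i′ = wsum V.ps (λ i → V.T i j * x (i , i′))
    lem : ∀ a b s → b * (a * s) ≡ a * b * s
    lem = solve-∀ ℚ-ring
    lem₁ : ∀ a b x → a * b * x ≡ b * (a * x)
    lem₁ = solve-∀ ℚ-ring
    inner : ∀ j j′ → wsum (V.ps ⊠ W.ps) (λ i → kronecker V.T W.T i (j , j′) * x i) ≡ wsum W.ps (λ i′ → W.T i′ j′ * z j i′)
    inner j j′ = trans (wsum-⊠ V.ps W.ps _) (trans (wsum-swap V.ps W.ps _) (wsum-cong W.ps (λ i′ →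
      trans (wsum-cong V.ps (λ i → lem₁ (V.T i j) (W.T i′ j′) (x (i , i′)))) (wsum-*ˡ V.ps (W.T i′ j′) _))))

-- Signed sums over sets as rational sums

⟦_⟧ : ℤ → ℚ
⟦ ℤ.+ n ⟧      = ι n
⟦ -[1+ n ] ⟧ = - ι (suc n)

⟦⟧-sq : ∀ z → ⟦ z ⟧ * ⟦ z ⟧ ≡ ι ℤ.∣ z ∣ * ι ℤ.∣ z ∣
⟦⟧-sq (ℤ.+ n) = refl
⟦⟧-sq -[1+ n ] = lem (ι (suc n))
  where
  lem : ∀ x → (- x) * (- x) ≡ x * x
  lem = solve-∀ ℚ-ring

sgn : Sign → ℚ
sgn Sign.+ = 1ℚ
sgn Sign.- = - 1ℚ

⟦⟧-step : ∀ s z → ⟦ (s ◃ 1) ℤ.+ z ⟧ ≡ sgn s + ⟦ z ⟧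
⟦⟧-step Sign.+ (ℤ.+ n) = refl
⟦⟧-step Sign.+ -[1+ zero ] = refl
⟦⟧-step Sign.+ -[1+ suc n ] = lem (ι n)
  where
  lem : ∀ x → - (1ℚ + x) ≡ 1ℚ + - (1ℚ + (1ℚ + x))
  lem = solve-∀ ℚ-ring
⟦⟧-step Sign.- (ℤ.+ zero) = refl
⟦⟧-step Sign.- (ℤ.+ suc n) = lem (ι n)
  where
  lem : ∀ x → x ≡ - 1ℚ + (1ℚ + x)
  lem = solve-∀ ℚ-ring
⟦⟧-step Sign.- -[1+ n ] = lem (ι n)
  where
  lem : ∀ x → - (1ℚ + (1ℚ + x)) ≡ - 1ℚ + - (1ℚ + x)
  lem = solve-∀ ℚ-ring

bit : Bool → ℚ
bit true  = 1ℚ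
bit false = 0ℚ

bit-∧ : ∀ a b → bit (a ∧ b) ≡ bit a * bit b
bit-∧ true b = sym (*-identityˡ (bit b))
bit-∧ false b = sym (*-zeroˡ (bit b))

bit² : ∀ a → bit a * bit a ≤ 1ℚ
bit² true = ≤-reflexive (*-identityˡ 1ℚ)
bit² false = ≡-≤-trans (*-zeroˡ 0ℚ) 0≤1

char : ∀ {n} → Subset n → Fin n → ℚ
char S k = bit (lookup S k)

∑-rational : ∀ {n} (S : Subset n) (x : Vec Sign n) → ⟦ ∑ S x ⟧ ≡ ∑[ k ∈ allFin n ] (sgn (lookup x k) * char S k)
∑-rational [] [] = refl
∑-rational (true ∷ S) (s ∷ x) = trans (⟦⟧-step s (∑ S x)) (trans (cong₂ _+_ (sym (*-identityʳ (sgn s))) (∑-rational S x))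
  (sym (sum-allFin (λ k → sgn (lookup (s ∷ x) k) * char (true ∷ S) k))))
∑-rational (false ∷ S) (s ∷ x) = trans (∑-rational S x) (trans (lem (sgn s) _) (sym (sum-allFin (λ k → sgn (lookup (s ∷ x) k) * char (false ∷ S) k))))
  where
  lem : ∀ a b → b ≡ a * 0ℚ + b
  lem = solve-∀ ℚ-ring

char-∩ : ∀ {n} (S T : Subset n) k → char (S ∩ T) k ≡ char T k * char S k
char-∩ S T k = trans (cong bit (lookup-zipWith _∧_ k S T)) (trans (bit-∧ (lookup S k) (lookup T k)) (*-comm (char S k) (char T k)))

-- Discrepancy through colourings

∈-vectors : ∀ {A : Set} {xs : List A} {n} {v : Vec A n} → (∀ k → lookup v k ∈ xs) → v ∈ vectors xs n
∈-vectors {v = []} mem = here refl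
∈-vectors {xs = xs} {v = x ∷ v} mem = ∈-cartesianProductWith⁺ _∷_ (mem zero) (∈-vectors (λ k → mem (suc k)))

∈-colourings : ∀ {n} (x : Vec Sign n) → x ∈ colourings n
∈-colourings x = ∈-vectors (λ k → both (lookup x k))
  where
  both : ∀ s → s ∈ (Sign.+ ∷ Sign.- ∷ [])
  both Sign.+ = here refl
  both Sign.- = there (here refl)

∈-subsets : ∀ {n} (J : Subset n) → J ∈ subsets n
∈-subsets J = ∈-vectors (λ k → both (lookup J k))
  where
  both : ∀ b → b ∈ (outside ∷ inside ∷ [])
  both false = here refl
  both true = there (here refl)

module _ {n : ℕ} (𝓕 : SetSystem n) where

  ∣ˢ-mem⁺ : ∀ {F} J → F ∈ members 𝓕 → F ∩ J ∈ members (𝓕 ∣ˢ J)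
  ∣ˢ-mem⁺ J F∈ = ∈-deduplicate⁺ _≟ˢ_ (∈-map⁺ (_∩ J) F∈)

  ∣ˢ-mem⁻ : ∀ {G} J → G ∈ members (𝓕 ∣ˢ J) → ∃[ F ] F ∈ members 𝓕 × G ≡ F ∩ J
  ∣ˢ-mem⁻ J G∈ = ∈-map⁻ (_∩ J) (∈-deduplicate⁻ _≟ˢ_ (map (_∩ J) (members 𝓕)) G∈)

  balanced-colouring : ∀ J → ∃[ x ] (∀ {F} → F ∈ members 𝓕 → ℤ.∣ ∑ (F ∩ J) x ∣ ℕ.≤ herdisc 𝓕)
  balanced-colouring J = attained (argmin-sel (λ v → v) (imbalance 𝓕J (Vec.replicate n Sign.+)) (map (imbalance 𝓕J) (colourings n)))
    where
    𝓕J = 𝓕 ∣ˢ J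
    disc≤ : disc 𝓕J ℕ.≤ herdisc 𝓕
    disc≤ = All.lookup (xs≤max 0 (map (λ J → disc (𝓕 ∣ˢ J)) (subsets n))) (∈-map⁺ (λ J → disc (𝓕 ∣ˢ J)) (∈-subsets J))
    good : ∀ x → disc 𝓕J ≡ imbalance 𝓕J x → ∀ {F} → F ∈ members 𝓕 → ℤ.∣ ∑ (F ∩ J) x ∣ ℕ.≤ herdisc 𝓕
    good x eq F∈ = ℕₚ.≤-trans (All.lookup (xs≤max 0 (map (λ F → ℤ.∣ ∑ F x ∣) (members 𝓕J))) (∈-map⁺ (λ F → ℤ.∣ ∑ F x ∣) (∣ˢ-mem⁺ J F∈)))
      (subst (ℕ._≤ herdisc 𝓕) eq disc≤)
    attained : disc 𝓕J ≡ imbalance 𝓕J (Vec.replicate n Sign.+) ⊎ disc 𝓕J ∈ map (imbalance 𝓕J) (colourings n) →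
               ∃[ x ] (∀ {F} → F ∈ members 𝓕 → ℤ.∣ ∑ (F ∩ J) x ∣ ℕ.≤ herdisc 𝓕)
    attained (inj₁ eq) = Vec.replicate n Sign.+ , good (Vec.replicate n Sign.+) eq
    attained (inj₂ m) = let x , _ , eq = ∈-map⁻ (imbalance 𝓕J) m in x , good x eq

  sel-max : ∀ {B} xs → (∀ {v} → v ∈ xs → v ℕ.* v ℕ.≤ B) → max 0 xs ℕ.* max 0 xs ℕ.≤ B
  sel-max {B} xs le = case (argmax-sel (λ v → v) 0 xs)
    where
    case : max 0 xs ≡ 0 ⊎ max 0 xs ∈ xs → max 0 xs ℕ.* max 0 xs ℕ.≤ B
    case (inj₁ eq) = subst (λ v → v ℕ.* v ℕ.≤ B) (sym eq) ℕ.z≤n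
    case (inj₂ m) = le m

  -- In squared form because the walk bounds squares and B need not be a perfect square.
  herdisc²≤ : ∀ {B} → (∀ J → ∃[ x ] (∀ {F} → F ∈ members 𝓕 → ℤ.∣ ∑ (F ∩ J) x ∣ ℕ.* ℤ.∣ ∑ (F ∩ J) x ∣ ℕ.≤ B)) →
              herdisc 𝓕 ℕ.* herdisc 𝓕 ℕ.≤ B
  herdisc²≤ {B} colour = sel-max (map (λ J → disc (𝓕 ∣ˢ J)) (subsets n)) λ v∈ → let J , _ , eq = ∈-map⁻ (λ J → disc (𝓕 ∣ˢ J)) v∈ in subst (λ v → v ℕ.* v ℕ.≤ B) (sym eq) (each J)
    where
    each : ∀ J → disc (𝓕 ∣ˢ J) ℕ.* disc (𝓕 ∣ˢ J) ℕ.≤ B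
    each J = ℕₚ.≤-trans (ℕₚ.*-mono-≤ disc≤ disc≤) (sel-max (map (λ F → ℤ.∣ ∑ F x ∣) (members (𝓕 ∣ˢ J))) λ v∈ → let G , G∈ , eq = ∈-map⁻ (λ F → ℤ.∣ ∑ F x ∣) v∈ in subst (λ v → v ℕ.* v ℕ.≤ B) (sym eq) (bound G G∈))
      where
      x = proj₁ (colour J)
      disc≤ : disc (𝓕 ∣ˢ J) ℕ.≤ imbalance (𝓕 ∣ˢ J) x
      disc≤ = All.lookup (min≤xs (imbalance (𝓕 ∣ˢ J) (Vec.replicate n Sign.+)) (map (imbalance (𝓕 ∣ˢ J)) (colourings n))) (∈-map⁺ (imbalance (𝓕 ∣ˢ J)) (∈-colourings x))
      bound : ∀ G → G ∈ members (𝓕 ∣ˢ J) → ℤ.∣ ∑ G x ∣ ℕ.* ℤ.∣ ∑ G x ∣ ℕ.≤ B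
      bound G G∈ with ∣ˢ-mem⁻ J G∈
      ... | F , F∈ , refl = proj₂ (colour J) F∈

-- Rounding by repeated halving

sum-support : ∀ {n} (js : List (Fin n)) → Unique js → (f : Fin n → ℚ) → (∀ {k} → k ∉ js → f k ≡ 0ℚ) → sumᴸ (allFin n) f ≡ sumᴸ js f
sum-support {n} [] _ f off = trans (sum-cong (allFin n) (λ k → off (λ ()))) (sum-0 (allFin n))
sum-support {n} (j ∷ js) (j∉ ∷ u) f off = trans (sum-cong (allFin n) (λ k → lem₁ (f k) (kron j k * f j)))
  (trans (sum-+ (allFin n) _ _) (cong₂ _+_ (sum-kron j (λ _ → f j))
    (trans (sum-support js u f₁ off₁) (sum-cong-∈ js (λ {k} k∈ → trans (cong (λ z → f k - z * f j) (kron-≢ {j = j} (λ j≡k → All.lookup j∉ k∈ j≡k))) (lem₂ (f k) (f j)))))))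
  where
  f₁ : Fin n → ℚ
  f₁ k = f k - kron j k * f j
  lem₁ : ∀ a b → a ≡ b + (a - b)
  lem₁ = solve-∀ ℚ-ring
  lem₂ : ∀ a b → a - 0ℚ * b ≡ a
  lem₂ = solve-∀ ℚ-ring
  lem₃ : ∀ a → a - 1ℚ * a ≡ 0ℚ
  lem₃ = solve-∀ ℚ-ring
  off₁ : ∀ {k} → k ∉ js → f₁ k ≡ 0ℚ
  off₁ {k} k∉ with j Fin.≟ k
  ... | yes refl = trans (cong (λ z → f j - z * f j) (kron-≡ j)) (lem₃ (f j))
  ... | no j≢k = trans (cong (λ z → f k - z * f j) (kron-≢ {j = j} j≢k)) (trans (lem₂ (f k) (f j)) (off λ { (here eq) → j≢k (sym eq) ; (there m) → k∉ m }))

data Parity (n : ℕ) : Set where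
  even : ∀ k → n ≡ k ℕ.+ k → Parity n
  odd  : ∀ k → n ≡ suc (k ℕ.+ k) → Parity n

parity : ∀ n → Parity n
parity zero = even 0 refl
parity (suc n) with parity n
... | even k refl = odd k refl
... | odd k refl = even (suc k) (cong suc (sym (ℕₚ.+-suc k k)))

isOdd : ∀ {n} → Parity n → Bool
isOdd (even _ _) = false
isOdd (odd _ _)  = true

half : ∀ {n} → Parity n → Sign → ℕ
half (even k _) _      = k
half (odd k _)  Sign.+ = suc k
half (odd k _)  Sign.- = k

half-error : ∀ {n} (p : Parity n) s → ι n - ι 2 * ι (half p s) ≡ - (sgn s * bit (isOdd p))
half-error (even k refl) s = trans (cong (_- ι 2 * ι k) (ι-+ k k)) (lem (ι k) (sgn s))
  where
  lem : ∀ k s → k + k - ι 2 * k ≡ - (s * 0ℚ)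
  lem = solve-∀ ℚ-ring
half-error (odd k refl) Sign.+ = trans (cong (λ z → 1ℚ + z - ι 2 * (1ℚ + ι k)) (ι-+ k k)) (lem (ι k))
  where
  lem : ∀ k → 1ℚ + (k + k) - ι 2 * (1ℚ + k) ≡ - (1ℚ * 1ℚ)
  lem = solve-∀ ℚ-ring
half-error (odd k refl) Sign.- = trans (cong (λ z → 1ℚ + z - ι 2 * ι k) (ι-+ k k)) (lem (ι k))
  where
  lem : ∀ k → 1ℚ + (k + k) - ι 2 * k ≡ - (- 1ℚ * 1ℚ)
  lem = solve-∀ ℚ-ring

half-bound : ∀ {n N} (p : Parity n) s → n ℕ.≤ 2 ℕ.* N → half p s ℕ.≤ N
half-bound {N = N} (even k refl) s le = ℕₚ.*-cancelˡ-≤ 2 (subst (ℕ._≤ 2 ℕ.* N) (cong (k ℕ.+_) (sym (ℕₚ.+-identityʳ k))) le)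
half-bound {N = N} (odd k refl) Sign.+ le = ℕₚ.*-cancelˡ-< 2 k N (subst (ℕ._< 2 ℕ.* N) (cong (k ℕ.+_) (sym (ℕₚ.+-identityʳ k))) le)
half-bound {N = N} (odd k refl) Sign.- le = ℕₚ.<⇒≤ (ℕₚ.*-cancelˡ-< 2 k N (subst (ℕ._< 2 ℕ.* N) (cong (k ℕ.+_) (sym (ℕₚ.+-identityʳ k))) le))

half-zero : ∀ {n} (p : Parity n) s → n ≡ 0 → half p s ≡ 0
half-zero (even zero _) s _ = refl
half-zero (even (suc k) ()) s refl
half-zero (odd k ()) s refl

mat : ∀ {n} (𝓕 : SetSystem n) → Fin (card 𝓕) → Fin n → ℚ
mat 𝓕 i = char (List.lookup (members 𝓕) i)

∣⟦⟧∣ : ∀ z → ∣ ⟦ z ⟧ ∣ ≡ ι ℤ.∣ z ∣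
∣⟦⟧∣ (ℤ.+ n) = 0≤p⇒∣p∣≡p (0≤ι n)
∣⟦⟧∣ -[1+ n ] = trans (∣-p∣≡∣p∣ (ι (suc n))) (0≤p⇒∣p∣≡p (0≤ι (suc n)))

module Rounding {n : ℕ} (𝓕 : SetSystem n) where

  h : ℕ
  h = herdisc 𝓕

  error : Subset n → (Fin n → ℚ) → ℚ
  error F e = ∑[ k ∈ allFin n ] (e k * char F k)

  error-+ : ∀ F e e′ c → error F (λ k → e k + c * e′ k) ≡ error F e + c * error F e′
  error-+ F e e′ c = trans (sum-cong (allFin n) (λ k → lem (e k) c (e′ k) (char F k))) (trans (sum-+ (allFin n) _ _) (cong (error F e +_) (sum-*ˡ (allFin n) c _)))
    where
    lem : ∀ a c b x → (a + c * b) * x ≡ a * x + c * (b * x)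
    lem = solve-∀ ℚ-ring

  record Rounded (W : Fin n → ℕ) (s : ℕ) : Set where
    field
      Z     : Fin n → ℕ
      Z≤1   : ∀ k → Z k ℕ.≤ 1
      -- Elements outside the selected columns enter with 0 and must stay 0, so that the error is a
      -- sum over the selected columns only.
      zero′ : ∀ k → W k ≡ 0 → Z k ≡ 0
      close : ∀ {F} → F ∈ members 𝓕 → ∣ error F (λ k → ι (W k) - ι 2 ^ℚ s * ι (Z k)) ∣ ≤ (ι 2 ^ℚ s - 1ℚ) * ι h

  -- A balanced colouring of the set J of odd entries decides which are rounded up to even numbers,
  -- with error at most h. Halving and recursing doubles the later errors: h + 2 (2^s - 1) h =
  -- (2^(s+1) - 1) h.
  round : ∀ s W → (∀ k → W k ℕ.≤ 2 ℕ.^ s) → Rounded W s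
  round zero W W≤ = record
    { Z = W ; Z≤1 = W≤ ; zero′ = λ _ eq → eq
    ; close = λ {F} F∈ → ≤-reflexive (trans (cong ∣_∣ (trans (sum-cong (allFin n) (λ k → lem (ι (W k)) (char F k))) (sum-0 (allFin n)))) (sym (lem′ (ι h)))) }
    where
    lem : ∀ w x → (w - 1ℚ * w) * x ≡ 0ℚ
    lem = solve-∀ ℚ-ring
    lem′ : ∀ h → (1ℚ - 1ℚ) * h ≡ 0ℚ
    lem′ = solve-∀ ℚ-ring
  round (suc s) W W≤ = record { Z = Z ; Z≤1 = Z≤1 ; zero′ = λ k eq → zero′ k (half-zero (p k) (lookup x k) eq) ; close = close′ }
    where
    p : ∀ k → Parity (W k)
    p k = parity (W k)
    J : Subset n
    J = tabulate (λ k → isOdd (p k))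
    x = proj₁ (balanced-colouring 𝓕 J)
    W′ : Fin n → ℕ
    W′ k = half (p k) (lookup x k)
    open Rounded (round s W′ (λ k → half-bound (p k) (lookup x k) (W≤ k)))
    t = ι 2 ^ℚ s
    lem₁ : ∀ w w′ t z → w - ι 2 * t * z ≡ w - ι 2 * w′ + ι 2 * (w′ - t * z)
    lem₁ = solve-∀ ℚ-ring
    lem₂ : ∀ a b c → - (a * b) * c ≡ - 1ℚ * (a * (b * c))
    lem₂ = solve-∀ ℚ-ring
    lem₃ : ∀ x → - 1ℚ * x ≡ - x
    lem₃ = solve-∀ ℚ-ring
    lem₄ : ∀ h t → h + ι 2 * ((t - 1ℚ) * h) ≡ (ι 2 * t - 1ℚ) * h
    lem₄ = solve-∀ ℚ-ring
    first : ∀ F → error F (λ k → ι (W k) - ι 2 * ι (W′ k)) ≡ - ⟦ ∑ (F ∩ J) x ⟧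
    first F = trans (sum-cong (allFin n) (λ k → trans (cong (_* char F k) (trans (half-error (p k) (lookup x k)) (cong (λ b → - (sgn (lookup x k) * bit b)) (sym (lookup∘tabulate (λ k → isOdd (p k)) k)))))
        (trans (lem₂ (sgn (lookup x k)) (char J k) (char F k)) (cong (λ z → - 1ℚ * (sgn (lookup x k) * z)) (sym (char-∩ F J k))))))
      (trans (sum-*ˡ (allFin n) (- 1ℚ) _) (trans (cong (- 1ℚ *_) (sym (∑-rational (F ∩ J) x))) (lem₃ ⟦ ∑ (F ∩ J) x ⟧)))
    close′ : ∀ {F} → F ∈ members 𝓕 → ∣ error F (λ k → ι (W k) - ι 2 * t * ι (Z k)) ∣ ≤ (ι 2 * t - 1ℚ) * ι h
    close′ {F} F∈ = ≤-trans (≤-reflexive (cong ∣_∣ (trans (sum-cong (allFin n) (λ k → cong (_* char F k) (lem₁ (ι (W k)) (ι (W′ k)) t (ι (Z k)))))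
        (error-+ F (λ k → ι (W k) - ι 2 * ι (W′ k)) (λ k → ι (W′ k) - t * ι (Z k)) (ι 2)))))
      (≤-trans (∣p+q∣≤∣p∣+∣q∣ (error F (λ k → ι (W k) - ι 2 * ι (W′ k))) (ι 2 * error F (λ k → ι (W′ k) - t * ι (Z k))))
      (≤-trans (+-mono-≤
          (≤-trans (≤-reflexive (trans (cong ∣_∣ (first F)) (trans (∣-p∣≡∣p∣ ⟦ ∑ (F ∩ J) x ⟧) (∣⟦⟧∣ (∑ (F ∩ J) x))))) (ι-mono (proj₂ (balanced-colouring 𝓕 J) F∈)))
          (≤-trans (≤-reflexive (trans (∣p*q∣≡∣p∣*∣q∣ (ι 2) (error F (λ k → ι (W′ k) - t * ι (Z k)))) (cong (_* ∣ error F (λ k → ι (W′ k) - t * ι (Z k)) ∣) (0≤p⇒∣p∣≡p (0≤ι 2)))))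
            (*-monoˡ (ι 2) (0≤ι 2) (close F∈))))
        (≤-reflexive (lem₄ (ι h) t))))

  spread′ : (js : List (Fin n)) → Vec ℕ (length js) → Fin n → ℕ
  spread′ [] [] k = 0
  spread′ (j ∷ js) (v ∷ w) k with j Fin.≟ k
  ... | yes _ = v
  ... | no _  = spread′ js w k

  spread-here : ∀ j js v w → spread′ (j ∷ js) (v ∷ w) j ≡ v
  spread-here j js v w with j Fin.≟ j
  ... | yes _ = refl
  ... | no ¬p = ⊥-elim (¬p refl)

  spread-there : ∀ {j k} js v w → j ≢ k → spread′ (j ∷ js) (v ∷ w) k ≡ spread′ js w k
  spread-there {j} {k} js v w j≢k with j Fin.≟ k
  ... | yes p = ⊥-elim (j≢k p)
  ... | no _ = refl

  spread-off : ∀ js w {k} → k ∉ js → spread′ js w k ≡ 0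
  spread-off [] [] _ = refl
  spread-off (j ∷ js) (v ∷ w) {k} k∉ = trans (spread-there js v w (λ j≡k → k∉ (here (sym j≡k)))) (spread-off js w (λ m → k∉ (there m)))

  spread-bound : ∀ {N} js {w} → w ∈ vectors (upTo N) (length js) → ∀ k → spread′ js w k ℕ.≤ N
  spread-bound [] {[]} _ k = ℕ.z≤n
  spread-bound {N} (j ∷ js) {v ∷ w} m k with ∈-cartesianProductWith⁻ _∷_ (upTo N) (vectors (upTo N) (length js)) m
  ... | _ , _ , v∈ , w∈ , refl with j Fin.≟ k
  ... | yes _ = ℕₚ.<⇒≤ (∈-upTo⁻ v∈)
  ... | no _ = spread-bound js w∈ k

  pick : (js : List (Fin n)) → (Fin n → ℕ) → Vec ℕ (length js)
  pick [] Z = []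
  pick (j ∷ js) Z = Z j ∷ pick js Z

  pick∈ : ∀ js Z → (∀ k → Z k ℕ.≤ 1) → pick js Z ∈ cube (length js)
  pick∈ [] Z le = here refl
  pick∈ (j ∷ js) Z le = ∈-cartesianProductWith⁺ _∷_ (∈-bits (le j)) (pick∈ js Z le)

  comb-sum : ∀ {I : Set} (c : Fin n → I → ℚ) js → Unique js → ∀ w Z i →
    comb c js w (pick js Z) i ≡ ∑[ k ∈ js ] (offset (spread′ js w k) (Z k) * c k i)
  comb-sum c [] _ [] Z i = refl
  comb-sum c (j ∷ js) (j∉ ∷ u) (v ∷ w) Z i = cong₂ _+_ (cong (λ z → offset z (Z j) * c j i) (sym (spread-here j js v w)))
    (trans (comb-sum c js u w Z i) (sum-cong-∈ js (λ {k} k∈ → cong (λ z → offset z (Z k) * c k i) (sym (spread-there js v w (λ j≡k → All.lookup j∉ k∈ j≡k))))))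

  roundable : Roundable (mat 𝓕) (ι (side ℕ.* h) * ι (side ℕ.* h))
  roundable js u {w} w∈ = pick js Z , pick∈ js Z Z≤1 , bound
    where
    W = spread′ js w
    open Rounded (round 5 W (λ k → subst (W k ℕ.≤_) side≡ (spread-bound js w∈ k)))
    side-ℚ : ι 2 ^ℚ 5 ≡ ι side
    side-ℚ = trans (sym (ι-^ 2 5)) (cong ι (sym side≡))
    lem : ∀ s x → (0ℚ - s * 0ℚ) * x ≡ 0ℚ
    lem = solve-∀ ℚ-ring
    bound : ∀ i → comb (λ j i → mat 𝓕 i j) js w (pick js Z) i * comb (λ j i → mat 𝓕 i j) js w (pick js Z) i ≤ ι (side ℕ.* h) * ι (side ℕ.* h)
    bound i = ≤-trans (≤-reflexive (trans (cong (λ z → z * z) eq) (sym (abs-sq E)))) (*-mono (0≤∣p∣ E) (0≤∣p∣ E) E≤ E≤)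
      where
      F = List.lookup (members 𝓕) i
      E = error F (λ k → ι (W k) - ι 2 ^ℚ 5 * ι (Z k))
      abs-sq : ∀ s → ∣ s ∣ * ∣ s ∣ ≡ s * s
      abs-sq s = trans (sym (∣p*q∣≡∣p∣*∣q∣ s s)) (0≤p⇒∣p∣≡p (0≤sq s))
      eq : comb (λ j i → mat 𝓕 i j) js w (pick js Z) i ≡ E
      eq = trans (comb-sum (λ j i → mat 𝓕 i j) js u w Z i) (trans (sym (sum-support js u _ off))
           (sum-cong (allFin n) (λ k → cong (λ s → (ι (W k) - s * ι (Z k)) * char F k) (sym side-ℚ))))
        where
        off : ∀ {k} → k ∉ js → offset (W k) (Z k) * char F k ≡ 0ℚ
        off {k} k∉ = trans (cong₂ (λ a b → (ι a - ι side * ι b) * char F k) (spread-off js w k∉) (zero′ k (spread-off js w k∉))) (lem (ι side) (char F k))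
      lem₂ : ∀ s h → s * h ≡ (s - 1ℚ) * h + h
      lem₂ = solve-∀ ℚ-ring
      E≤ : ∣ E ∣ ≤ ι (side ℕ.* h)
      E≤ = ≤-trans (close (∈-lookup i)) (≤-by (ι h) (0≤ι h) (trans (ι-* side h) (trans (cong (_* ι h) (sym side-ℚ)) (lem₂ (ι 2 ^ℚ 5) (ι h)))))

-- Bounds for a single set system

record Bracket (m : ℕ) : Set where
  field
    L    : ℕ
    m≤   : m ℕ.≤ 2 ℕ.^ suc L
    <m   : 2 ℕ.^ L ℕ.< m

-- The integer `suc L` stands for log m from here on: log m ≤ L + 1 ≤ 2 log m.
bracket : ∀ m → 1 ℕ.< m → Bracket m
bracket m 1<m = search m (ℕₚ.<⇒≤ (n<2^n m))
  where
  search : ∀ k → m ℕ.≤ 2 ℕ.^ k → Bracket m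
  search zero le = ⊥-elim (ℕₚ.<⇒≱ 1<m le)
  search (suc k) le with m ℕₚ.≤? 2 ℕ.^ k
  ... | yes le′ = search k le′
  ... | no ¬le = record { L = k ; m≤ = le ; <m = ℕₚ.≰⇒> ¬le }

occupied : ∀ {n} (S : Subset n) → (∃[ k ] lookup S k ≡ true) ⊎ S ≡ Vec.replicate n false
occupied [] = inj₂ refl
occupied (true ∷ S) = inj₁ (zero , refl)
occupied (false ∷ S) with occupied S
... | inj₁ (k , eq) = inj₁ (suc k , eq)
... | inj₂ eq = inj₂ (cong (false ∷_) eq)

two-members : ∀ {n} (𝓕 : SetSystem n) → 1 ℕ.< card 𝓕 → ∃[ A ] ∃[ B ] A ∈ members 𝓕 × B ∈ members 𝓕 × A ≢ B
two-members (mkSystem (A ∷ B ∷ _) ((A≢B ∷ _) ∷ _)) _ = A , B , here refl , there (here refl) , A≢B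
two-members (mkSystem (A ∷ []) _) (ℕ.s≤s ())
two-members (mkSystem [] _) ()

two⇒card : ∀ {n} (𝓕 : SetSystem n) {A B} → A ∈ members 𝓕 → B ∈ members 𝓕 → A ≢ B → 1 ℕ.< card 𝓕
two⇒card (mkSystem (_ ∷ _ ∷ _) _) _ _ _ = ℕ.s≤s (ℕ.s≤s ℕ.z≤n)
two⇒card (mkSystem (_ ∷ []) _) (here refl) (here refl) A≢B = ⊥-elim (A≢B refl)

nonempty-member : ∀ {n} (𝓕 : SetSystem n) → 1 ℕ.< card 𝓕 → ∃[ A ] ∃[ k ] A ∈ members 𝓕 × lookup A k ≡ true
nonempty-member 𝓕 1<m = choose (two-members 𝓕 1<m)
  where
  choose : (∃[ A ] ∃[ B ] A ∈ members 𝓕 × B ∈ members 𝓕 × A ≢ B) → ∃[ A ] ∃[ k ] A ∈ members 𝓕 × lookup A k ≡ true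
  choose (A , B , A∈ , B∈ , A≢B) with occupied A | occupied B
  ... | inj₁ (k , eq) | _ = A , k , A∈ , eq
  ... | inj₂ _ | inj₁ (k , eq) = B , k , B∈ , eq
  ... | inj₂ A≡ | inj₂ B≡ = ⊥-elim (A≢B (trans A≡ (sym B≡)))

position : ∀ {n} (𝓕 : SetSystem n) {A} → A ∈ members 𝓕 → Fin (card 𝓕)
position 𝓕 A∈ = Any.index A∈

mat-position : ∀ {n} (𝓕 : SetSystem n) {A} (A∈ : A ∈ members 𝓕) k → mat 𝓕 (position 𝓕 A∈) k ≡ char A k
mat-position 𝓕 A∈ k = cong (λ S → char S k) (sym (lookup-index A∈))

-- Of two distinct members one contains a point k, and restricted to {k} every colouring has
-- imbalance 1.
herdisc-positive : ∀ {n} (𝓕 : SetSystem n) → 1 ℕ.< card 𝓕 → 0 ℕ.< herdisc 𝓕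
herdisc-positive {n} 𝓕 1<m = go (nonempty-member 𝓕 1<m)
  where
  go : (∃[ A ] ∃[ k ] A ∈ members 𝓕 × lookup A k ≡ true) → 0 ℕ.< herdisc 𝓕
  go (A , k , A∈ , Ak) with herdisc 𝓕 in eq
  ... | suc h = ℕ.s≤s ℕ.z≤n
  ... | zero = ⊥-elim (<-irrefl refl (<-≤-trans 0<1 (≤-trans (≤-reflexive one) (≤-reflexive zero²))))
    where
    J : Subset n
    J = tabulate (λ j → does (k Fin.≟ j))
    x = proj₁ (balanced-colouring 𝓕 J)
    z = ∑ (A ∩ J) x
    charJ : ∀ j → char J j ≡ kron k j
    charJ j = trans (cong bit (lookup∘tabulate (λ j → does (k Fin.≟ j)) j)) (dec (k Fin.≟ j))
      where
      dec : (d : Dec (k ≡ j)) → bit (does d) ≡ kron k j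
      dec (yes refl) = sym (kron-≡ k)
      dec (no k≢j) = sym (kron-≢ {j = k} k≢j)
    lem : ∀ s a b → s * (a * b) ≡ a * (s * b)
    lem = solve-∀ ℚ-ring
    ⟦z⟧ : ⟦ z ⟧ ≡ sgn (lookup x k)
    ⟦z⟧ = trans (∑-rational (A ∩ J) x) (trans (sum-cong (allFin n) (λ j → trans (cong (sgn (lookup x j) *_) (trans (char-∩ A J j) (cong (_* char A j) (charJ j)))) (lem (sgn (lookup x j)) (kron k j) (char A j))))
      (trans (sum-kron k (λ j → sgn (lookup x j) * char A j)) (trans (cong (λ b → sgn (lookup x k) * bit b) Ak) (*-identityʳ _))))
    sgn² : ∀ s → sgn s * sgn s ≡ 1ℚ
    sgn² Sign.+ = refl
    sgn² Sign.- = refl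
    one : 1ℚ ≡ ι ℤ.∣ z ∣ * ι ℤ.∣ z ∣
    one = trans (sym (sgn² (lookup x k))) (trans (cong₂ _*_ (sym ⟦z⟧) (sym ⟦z⟧)) (⟦⟧-sq z))
    zero² : ι ℤ.∣ z ∣ * ι ℤ.∣ z ∣ ≡ 0ℚ
    zero² = trans (cong (λ v → ι v * ι v) (ℕₚ.n≤0⇒n≡0 (subst (ℤ.∣ z ∣ ℕ.≤_) eq (proj₂ (balanced-colouring 𝓕 J) A∈)))) refl

mat²≤1 : ∀ {n} (𝓕 : SetSystem n) i j → mat 𝓕 i j * mat 𝓕 i j ≤ 1ℚ
mat²≤1 𝓕 i j = bit² (lookup (List.lookup (members 𝓕) i) j)

toSign : ∀ {x} → IsSign x → Sign
toSign (inj₁ _) = Sign.+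
toSign (inj₂ _) = Sign.-

sgn-toSign : ∀ {x} (s : IsSign x) → sgn (toSign s) ≡ x
sgn-toSign (inj₁ eq) = sym eq
sgn-toSign (inj₂ eq) = sym eq

factorization⇒herdisc : ∀ {n} (𝓕 : SetSystem n) {g L} → 0 ℕ.< g → card 𝓕 ℕ.≤ 2 ℕ.^ suc L → Factorization (mat 𝓕) (ι g) →
                        herdisc 𝓕 ℕ.* herdisc 𝓕 ℕ.≤ 32 ℕ.* suc L ℕ.* (g ℕ.* g)
factorization⇒herdisc {n} 𝓕 {g} {L} 0<g len F = herdisc²≤ 𝓕 λ J → convert J (colouring (0<ι 0<g) F (allFin (card 𝓕)) L len′ (char J) (λ k → bit² (lookup J k)))
  where
  len′ : ι (length (allFin (card 𝓕))) ≤ ι 2 ^ℚ suc L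
  len′ = ≤-trans (ι-mono (subst (ℕ._≤ 2 ℕ.^ suc L) (sym (Listₚ.length-tabulate {n = card 𝓕} (λ k → k))) len)) (≤-reflexive (ι-^ 2 (suc L)))
  lem : ∀ l g → ι 2 * (ι 16 * l * (g * g)) ≡ ι 32 * l * (g * g)
  lem = solve-∀ ℚ-ring
  bound : ι 2 * (noise L * (ι g * ι g)) ≡ ι (32 ℕ.* suc L ℕ.* (g ℕ.* g))
  bound = trans (lem (ι (suc L)) (ι g)) (sym (trans (ι-* (32 ℕ.* suc L) (g ℕ.* g)) (cong₂ _*_ (ι-* 32 (suc L)) (ι-* g g))))
  convert : ∀ J → (∃[ x ] (∀ k → IsSign (x k)) × (∀ {i} → i ∈ allFin (card 𝓕) →
        (∑[ k ∈ allFin n ] (x k * (char J k * mat 𝓕 i k))) * (∑[ k ∈ allFin n ] (x k * (char J k * mat 𝓕 i k))) ≤ ι 2 * (noise L * (ι g * ι g)))) →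
      ∃[ x ] (∀ {S} → S ∈ members 𝓕 → ℤ.∣ ∑ (S ∩ J) x ∣ ℕ.* ℤ.∣ ∑ (S ∩ J) x ∣ ℕ.≤ 32 ℕ.* suc L ℕ.* (g ℕ.* g))
  convert J (x , sg , le) = y , λ {S} S∈ → ι-cancel (≤-trans (≤-reflexive (trans (ι-* ℤ.∣ ∑ (S ∩ J) y ∣ ℤ.∣ ∑ (S ∩ J) y ∣) (trans (sym (⟦⟧-sq (∑ (S ∩ J) y))) (cong (λ z → z * z) (value S S∈)))))
      (≤-≡-trans (le (∈-allFin (position 𝓕 S∈))) bound))
    where
    y : Vec Sign n
    y = tabulate (λ k → toSign (sg k))
    value : ∀ S (S∈ : S ∈ members 𝓕) → ⟦ ∑ (S ∩ J) y ⟧ ≡ ∑[ k ∈ allFin n ] (x k * (char J k * mat 𝓕 (position 𝓕 S∈) k))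
    value S S∈ = trans (∑-rational (S ∩ J) y) (sum-cong (allFin n) (λ k → cong₂ _*_ (trans (cong sgn (lookup∘tabulate (λ k → toSign (sg k)) k)) (sgn-toSign (sg k)))
      (trans (char-∩ S J k) (cong (char J k *_) (sym (mat-position 𝓕 S∈ k))))))

abstract
  -- `Duality` is applied with `suc L` for L, so its `bound` is (L+2) · 4 · `side` · h ≤ 8 `side`
  -- (L+1) h. Doubling gives 16 `side`, the extra 1 is covered by 1 ≤ (L+1) h, and 36 is the
  -- constant of the factorization.
  c₁ : ℕ
  c₁ = 36 ℕ.* (1 ℕ.+ 16 ℕ.* side)

  c₁≡ : c₁ ≡ 36 ℕ.* (1 ℕ.+ 16 ℕ.* side)
  c₁≡ = refl

  0<c₁ : 0 ℕ.< c₁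
  0<c₁ = ℕ.s≤s ℕ.z≤n

0<side : 0 ℕ.< side
0<side = subst (0 ℕ.<_) (sym side≡) (ℕ.s≤s ℕ.z≤n)

-- `M` is γ₂ up to constants: `witness` bounds γ₂ from below by it, and `h²≤` comes from a
-- factorization of size 36 `M`. The field `factorization` compares γ₂ with herdisc instead.
record Summary {n : ℕ} (𝓕 : SetSystem n) : Set where
  field
    L M           : ℕ
    card≤         : card 𝓕 ℕ.≤ 2 ℕ.^ suc L
    card>         : 2 ℕ.^ L ℕ.< card 𝓕
    0<h           : 0 ℕ.< herdisc 𝓕
    factorization : Factorization (mat 𝓕) (ι (c₁ ℕ.* (suc L ℕ.* herdisc 𝓕)))
    witness       : Witness (mat 𝓕) (ι 2) (ι 8) (½ * ½ * ι M)
    h²≤           : herdisc 𝓕 ℕ.* herdisc 𝓕 ℕ.≤ 32 ℕ.* suc L ℕ.* ((36 ℕ.* M) ℕ.* (36 ℕ.* M))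

abstract
  summary : ∀ {n} (𝓕 : SetSystem n) → 1 ℕ.< card 𝓕 → Summary 𝓕
  summary {n} 𝓕 1<m = build (bracket (card 𝓕) 1<m) (nonempty-member 𝓕 1<m)
    where
    h : ℕ
    h = herdisc 𝓕
    0<h : 0 ℕ.< h
    0<h = herdisc-positive 𝓕 1<m
    build : Bracket (card 𝓕) → (∃[ A ] ∃[ k ] A ∈ members 𝓕 × lookup A k ≡ true) → Summary 𝓕
    build br (A , k , A∈ , Ak) = assemble (D.tight {position 𝓕 A∈} {k} (trans (mat-position 𝓕 A∈ k) (cong bit Ak)))
      where
      open Bracket br
      module D = Duality (mat 𝓕) (mat²≤1 𝓕) (subst (0 ℕ.<_) (sym (Listₚ.length-tabulate {n = card 𝓕} (λ k → k))) (ℕₚ.<-trans (ℕ.s≤s ℕ.z≤n) 1<m)) (suc L)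
        (≤-trans (ι-mono m≤) (≤-reflexive (ι-^ 2 (suc L)))) h 0<h 0<side (Rounding.roundable 𝓕)
      arith : ∀ s l h → 36 ℕ.* ((1 ℕ.+ 16 ℕ.* s) ℕ.* (l ℕ.* h)) ≡ 36 ℕ.* (1 ℕ.+ 16 ℕ.* s) ℕ.* (l ℕ.* h)
      arith = ℕ-Solver.solve-∀
      arith₂ : ∀ s l h → l ℕ.* h ℕ.+ 2 ℕ.* ((l ℕ.+ l) ℕ.* (4 ℕ.* (s ℕ.* h))) ≡ (1 ℕ.+ 16 ℕ.* s) ℕ.* (l ℕ.* h)
      arith₂ = ℕ-Solver.solve-∀
      le : 36 ℕ.* suc (2 ℕ.* D.bound) ℕ.≤ c₁ ℕ.* (suc L ℕ.* h)
      le = ℕₚ.≤-trans (ℕₚ.*-monoʳ-≤ 36 (ℕₚ.≤-trans (ℕₚ.+-mono-≤ (ℕₚ.*-mono-≤ {1} {suc L} (ℕ.s≤s ℕ.z≤n) 0<h)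
            (ℕₚ.*-monoʳ-≤ 2 (ℕₚ.*-monoˡ-≤ (4 ℕ.* (side ℕ.* h)) (ℕₚ.+-monoˡ-≤ (suc L) (ℕ.s≤s (ℕ.z≤n {L}))))))
          (ℕₚ.≤-reflexive (arith₂ side (suc L) h)))) (ℕₚ.≤-reflexive (trans (arith side (suc L) h) (cong (ℕ._* (suc L ℕ.* h)) (sym c₁≡))))
      assemble : D.Tight → Summary 𝓕
      assemble (M , 0<M , F , W) = record
        { L = L ; M = M ; card≤ = m≤ ; card> = <m ; 0<h = 0<h
        ; factorization = Factorization-mono (≤-trans (≤-reflexive (sym (ι-* 36 (suc (2 ℕ.* D.bound))))) (ι-mono le)) D.factorization
        ; witness = W
        ; h²≤ = factorization⇒herdisc 𝓕 {36 ℕ.* M} {L} (ℕₚ.*-mono-≤ {1} {36} (ℕ.s≤s ℕ.z≤n) 0<M) m≤ (subst (Factorization (mat 𝓕)) (sym (ι-* 36 M)) F) }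

-- Products of set systems

module _ {m n : ℕ} (𝓕 : SetSystem m) (𝓖 : SetSystem n) where

  ⊗-mem⁺ : ∀ {A B} → A ∈ members 𝓕 → B ∈ members 𝓖 → A ×ˢ B ∈ members (𝓕 ⊗ 𝓖)
  ⊗-mem⁺ A∈ B∈ = ∈-deduplicate⁺ _≟ˢ_ (∈-cartesianProductWith⁺ _×ˢ_ A∈ B∈)

  ⊗-mem⁻ : ∀ {S} → S ∈ members (𝓕 ⊗ 𝓖) → ∃[ A ] ∃[ B ] A ∈ members 𝓕 × B ∈ members 𝓖 × S ≡ A ×ˢ B
  ⊗-mem⁻ S∈ = ∈-cartesianProductWith⁻ _×ˢ_ (members 𝓕) (members 𝓖) (∈-deduplicate⁻ _≟ˢ_ (cartesianProductWith _×ˢ_ (members 𝓕) (members 𝓖)) S∈)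

  lookup-×ˢ : ∀ (A : Subset m) (B : Subset n) k → lookup (A ×ˢ B) k ≡ lookup A (quotient n k) ∧ lookup B (remainder {m} n k)
  lookup-×ˢ A B k = lookup∘tabulate (λ k → lookup A (quotient n k) ∧ lookup B (remainder {m} n k)) k

  char-×ˢ : ∀ (A : Subset m) (B : Subset n) k → char (A ×ˢ B) k ≡ char A (quotient n k) * char B (remainder {m} n k)
  char-×ˢ A B k = trans (cong bit (lookup-×ˢ A B k)) (bit-∧ (lookup A (quotient n k)) (lookup B (remainder {m} n k)))

  lookup-×ˢ-combine : ∀ (A : Subset m) (B : Subset n) j j′ → lookup (A ×ˢ B) (combine j j′) ≡ lookup A j ∧ lookup B j′
  lookup-×ˢ-combine A B j j′ = trans (lookup-×ˢ A B (combine j j′)) (cong (λ p → lookup A (proj₁ p) ∧ lookup B (proj₂ p)) (Fin.remQuot-combine j j′))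

  -- Products may collapse to the empty set, but a fixed B containing a point k makes A ↦ A × B
  -- injective: A is read off the fibre over k.
  ⊗-card : 1 ℕ.< card 𝓕 → 1 ℕ.< card 𝓖 → 1 ℕ.< card (𝓕 ⊗ 𝓖)
  ⊗-card 1<m 1<n = go (two-members 𝓕 1<m) (nonempty-member 𝓖 1<n)
    where
    go : (∃[ A ] ∃[ A′ ] A ∈ members 𝓕 × A′ ∈ members 𝓕 × A ≢ A′) → (∃[ B ] ∃[ k ] B ∈ members 𝓖 × lookup B k ≡ true) → 1 ℕ.< card (𝓕 ⊗ 𝓖)
    go (A , A′ , A∈ , A′∈ , A≢A′) (B , k , B∈ , Bk) = two⇒card (𝓕 ⊗ 𝓖) (⊗-mem⁺ A∈ B∈) (⊗-mem⁺ A′∈ B∈) (λ eq → A≢A′ (recover eq))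
      where
      ∧-true : ∀ {a} → a ∧ true ≡ a
      ∧-true {true} = refl
      ∧-true {false} = refl
      section : ∀ (C : Subset m) j → lookup (C ×ˢ B) (combine j k) ≡ lookup C j
      section C j = trans (lookup-×ˢ-combine C B j k) (trans (cong (lookup C j ∧_) Bk) ∧-true)
      ext : ∀ {l} (u v : Subset l) → (∀ j → lookup u j ≡ lookup v j) → u ≡ v
      ext [] [] _ = refl
      ext (x ∷ u) (y ∷ v) eq = cong₂ _∷_ (eq zero) (ext u v (λ j → eq (suc j)))
      recover : A ×ˢ B ≡ A′ ×ˢ B → A ≡ A′
      recover eq = ext A A′ (λ j → trans (sym (section A j)) (trans (cong (λ S → lookup S (combine j k)) eq) (section A′ j)))

  -- Different pairs can give the same product, so the matrix of 𝓕 ⊗ 𝓖 is a row selection of the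
  -- Kronecker product: each member is read through one chosen pair of factors.
  ⊗ˢ-factorization : ∀ {γ γ′} → Factorization (mat 𝓕) γ → Factorization (mat 𝓖) γ′ → Factorization (mat (𝓕 ⊗ 𝓖)) (γ * γ′)
  ⊗ˢ-factorization F G = pullback rowOf (λ k → quotient n k , remainder {m} n k) entry′ (⊗-factorization F G)
    where
    parts : ∀ i → ∃[ A ] ∃[ B ] A ∈ members 𝓕 × B ∈ members 𝓖 × List.lookup (members (𝓕 ⊗ 𝓖)) i ≡ A ×ˢ B
    parts i = ⊗-mem⁻ (∈-lookup i)
    rowOf : Fin (card (𝓕 ⊗ 𝓖)) → Fin (card 𝓕) × Fin (card 𝓖)
    rowOf i = let _ , _ , A∈ , B∈ , _ = parts i in position 𝓕 A∈ , position 𝓖 B∈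
    entry′ : ∀ i k → mat (𝓕 ⊗ 𝓖) i k ≡ kronecker (mat 𝓕) (mat 𝓖) (rowOf i) (quotient n k , remainder {m} n k)
    entry′ i k = let A , B , A∈ , B∈ , eq = parts i in
      trans (cong (λ S → char S k) eq) (trans (char-×ˢ A B k) (cong₂ _*_ (sym (mat-position 𝓕 A∈ (quotient n k))) (sym (mat-position 𝓖 B∈ (remainder {m} n k)))))

-- A dual witness for a matrix whose entries are (repeated) entries of mat 𝓕.
record Certificate {n : ℕ} (𝓕 : SetSystem n) (s K v : ℚ) : Set₁ where
  field
    Row Col : Set
    A       : Row → Col → ℚ
    row     : Row → Fin (card 𝓕)
    col     : Col → Fin n
    A≡      : ∀ i j → A i j ≡ mat 𝓕 (row i) (col j)
    witness : Witness A s K v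

certify : ∀ {n} {𝓕 : SetSystem n} {s K v} → Witness (mat 𝓕) s K v → Certificate 𝓕 s K v
certify W = record { A = _ ; row = λ i → i ; col = λ j → j ; A≡ = λ _ _ → refl ; witness = W }

⊗-certificate : ∀ {m n} {𝓕 : SetSystem m} {𝓖 : SetSystem n} {s K v s′ K′ v′} → 0ℚ ≤ K → 0ℚ ≤ K′ → 0ℚ ≤ v → 0ℚ ≤ v′ →
                Certificate 𝓕 s K v → Certificate 𝓖 s′ K′ v′ → Certificate (𝓕 ⊗ 𝓖) (s * s′) (K * K′) (v * v′)
⊗-certificate {m} {n} {𝓕} {𝓖} 0≤K 0≤K′ 0≤v 0≤v′ C D = record
  { A = kronecker C.A D.A
  ; row = λ { (i , i′) → position (𝓕 ⊗ 𝓖) (mem i i′) }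
  ; col = λ { (j , j′) → combine (C.col j) (D.col j′) }
  ; A≡ = λ { (i , i′) (j , j′) → trans (cong₂ _*_ (C.A≡ i j) (D.A≡ i′ j′)) (sym (trans (mat-position (𝓕 ⊗ 𝓖) (mem i i′) (combine (C.col j) (D.col j′)))
      (trans (cong bit (lookup-×ˢ-combine 𝓕 𝓖 (List.lookup (members 𝓕) (C.row i)) (List.lookup (members 𝓖) (D.row i′)) (C.col j) (D.col j′)))
             (bit-∧ (lookup (List.lookup (members 𝓕) (C.row i)) (C.col j)) (lookup (List.lookup (members 𝓖) (D.row i′)) (D.col j′)))))) }
  ; witness = ⊗-witness 0≤K 0≤K′ 0≤v 0≤v′ C.witness D.witness }
  where
  module C = Certificate C
  module D = Certificate D
  mem : ∀ i i′ → List.lookup (members 𝓕) (C.row i) ×ˢ List.lookup (members 𝓖) (D.row i′) ∈ members (𝓕 ⊗ 𝓖)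
  mem i i′ = ⊗-mem⁺ 𝓕 𝓖 (∈-lookup (C.row i)) (∈-lookup (D.row i′))

certificate≤ : ∀ {n} {𝓕 : SetSystem n} {s K v γ} → 0ℚ ≤ γ → 1ℚ ≤ K → 0ℚ ≤ s → Factorization (mat 𝓕) γ → Certificate 𝓕 s K v → v ≤ K * s * γ
certificate≤ 0≤γ 1≤K 0≤s F C = weak-duality 0≤γ 1≤K 0≤s (pullback row col A≡ F) witness
  where open Certificate C

⨂-card : ∀ k {n : Fin (suc k) → ℕ} (𝓕ᵢ : ∀ i → SetSystem (n i)) → (∀ i → 1 ℕ.< card (𝓕ᵢ i)) → 1 ℕ.< card (⨂ 𝓕ᵢ)
⨂-card zero 𝓕ᵢ 1<m = 1<m zero
⨂-card (suc k) 𝓕ᵢ 1<m = ⊗-card (𝓕ᵢ zero) (⨂ (λ i → 𝓕ᵢ (suc i))) (1<m zero) (⨂-card k (λ i → 𝓕ᵢ (suc i)) (λ i → 1<m (suc i)))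

⨂-factorization : ∀ k {n : Fin (suc k) → ℕ} (𝓕ᵢ : ∀ i → SetSystem (n i)) (g : Fin (suc k) → ℕ) →
                  (∀ i → Factorization (mat (𝓕ᵢ i)) (ι (g i))) → Factorization (mat (⨂ 𝓕ᵢ)) (ι (∏ g))
⨂-factorization zero 𝓕ᵢ g F = subst (λ z → Factorization (mat (𝓕ᵢ zero)) (ι z)) (sym (ℕₚ.*-identityʳ (g zero))) (F zero)
⨂-factorization (suc k) 𝓕ᵢ g F = subst (Factorization (mat (⨂ 𝓕ᵢ))) (sym (ι-* (g zero) (∏ (λ i → g (suc i)))))
  (⊗ˢ-factorization (𝓕ᵢ zero) (⨂ (λ i → 𝓕ᵢ (suc i))) (F zero) (⨂-factorization k (λ i → 𝓕ᵢ (suc i)) (λ i → g (suc i)) (λ i → F (suc i))))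

¼ : ℚ
¼ = ½ * ½

0≤¼ : 0ℚ ≤ ¼
0≤¼ = 0≤sq ½

⨂-certificate : ∀ k {n : Fin (suc k) → ℕ} (𝓕ᵢ : ∀ i → SetSystem (n i)) (M : Fin (suc k) → ℕ) →
                (∀ i → Witness (mat (𝓕ᵢ i)) (ι 2) (ι 8) (¼ * ι (M i))) →
                Certificate (⨂ 𝓕ᵢ) (ι 2 ^ℚ suc k) (ι 8 ^ℚ suc k) (¼ ^ℚ suc k * ι (∏ M))
⨂-certificate zero 𝓕ᵢ M W = subst₃′ (certify {𝓕 = 𝓕ᵢ zero} (W zero))
  where
  lem : ∀ q m → q * m ≡ q * 1ℚ * m
  lem = solve-∀ ℚ-ring
  subst₃′ : Certificate (𝓕ᵢ zero) (ι 2) (ι 8) (¼ * ι (M zero)) → Certificate (𝓕ᵢ zero) (ι 2 * 1ℚ) (ι 8 * 1ℚ) (¼ * 1ℚ * ι (∏ M))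
  subst₃′ C = subst (λ v → Certificate (𝓕ᵢ zero) (ι 2 * 1ℚ) (ι 8 * 1ℚ) v) (trans (lem ¼ (ι (M zero))) (cong (λ m → ¼ * 1ℚ * ι m) (sym (ℕₚ.*-identityʳ (M zero)))))
    (subst₂ (λ s K → Certificate (𝓕ᵢ zero) s K (¼ * ι (M zero))) (sym (*-identityʳ (ι 2))) (sym (*-identityʳ (ι 8))) C)
⨂-certificate (suc k) 𝓕ᵢ M W = subst (Certificate (⨂ 𝓕ᵢ) (ι 2 * ι 2 ^ℚ suc k) (ι 8 * ι 8 ^ℚ suc k)) eq
  (⊗-certificate (0≤ι 8) (^ℚ-nonNeg (0≤ι 8) (suc k)) (0≤* 0≤¼ (0≤ι (M zero))) (0≤* (^ℚ-nonNeg 0≤¼ (suc k)) (0≤ι (∏ (λ i → M (suc i)))))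
    (certify {𝓕 = 𝓕ᵢ zero} (W zero)) (⨂-certificate k (λ i → 𝓕ᵢ (suc i)) (λ i → M (suc i)) (λ i → W (suc i))))
  where
  eq : ¼ * ι (M zero) * (¼ ^ℚ suc k * ι (∏ (λ i → M (suc i)))) ≡ ¼ * ¼ ^ℚ suc k * ι (∏ M)
  eq = trans (interchange ¼ (ι (M zero)) (¼ ^ℚ suc k) (ι (∏ (λ i → M (suc i))))) (cong (¼ * ¼ ^ℚ suc k *_) (sym (ι-* (M zero) (∏ (λ i → M (suc i))))))

-- The estimates in natural numbers and their constants

^-distrib-* : ∀ a b t → (a ℕ.* b) ℕ.^ t ≡ a ℕ.^ t ℕ.* b ℕ.^ t
^-distrib-* a b zero = refl
^-distrib-* a b (suc t) = trans (cong (a ℕ.* b ℕ.*_) (^-distrib-* a b t)) (lem a b (a ℕ.^ t) (b ℕ.^ t))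
  where
  lem : ∀ a b x y → a ℕ.* b ℕ.* (x ℕ.* y) ≡ a ℕ.* x ℕ.* (b ℕ.* y)
  lem = ℕ-Solver.solve-∀

∏-* : ∀ {t} (f g : Fin t → ℕ) → ∏ (λ i → f i ℕ.* g i) ≡ ∏ f ℕ.* ∏ g
∏-* {zero} f g = refl
∏-* {suc t} f g = trans (cong (f zero ℕ.* g zero ℕ.*_) (∏-* (λ i → f (suc i)) (λ i → g (suc i)))) (lem (f zero) (g zero) (∏ (λ i → f (suc i))) (∏ (λ i → g (suc i))))
  where
  lem : ∀ a b c d → a ℕ.* b ℕ.* (c ℕ.* d) ≡ a ℕ.* c ℕ.* (b ℕ.* d)
  lem = ℕ-Solver.solve-∀

∏-const : ∀ t c → ∏ {t} (λ _ → c) ≡ c ℕ.^ t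
∏-const zero c = refl
∏-const (suc t) c = cong (c ℕ.*_) (∏-const t c)

∏-mono : ∀ {t} {f g : Fin t → ℕ} → (∀ i → f i ℕ.≤ g i) → ∏ f ℕ.≤ ∏ g
∏-mono {zero} le = ℕₚ.≤-refl
∏-mono {suc t} le = ℕₚ.*-mono-≤ (le zero) (∏-mono (λ i → le (suc i)))

∏-pos : ∀ {t} {f : Fin t → ℕ} → (∀ i → 0 ℕ.< f i) → 0 ℕ.< ∏ f
∏-pos {zero} _ = ℕ.s≤s ℕ.z≤n
∏-pos {suc t} 0<f = ℕₚ.*-mono-≤ (0<f zero) (∏-pos (λ i → 0<f (suc i)))

abstract
  -- 32 and 36 come from `h²≤`; 64 = 4 · 8 · 2 clears the ¼ in the witness value and collects K = 8
  -- and s = 2 of weak duality, once per factor.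
  K₁ : ℕ
  K₁ = 32 ℕ.* (36 ℕ.* 36) ℕ.* (64 ℕ.* 64)

  K₁≡ : K₁ ≡ 32 ℕ.* (36 ℕ.* 36) ℕ.* (64 ℕ.* 64)
  K₁≡ = refl

  32≤K₁ : 32 ℕ.≤ K₁
  32≤K₁ = ℕₚ.≤-trans (ℕₚ.m≤m*n 32 (36 ℕ.* 36)) (ℕₚ.m≤m*n (32 ℕ.* (36 ℕ.* 36)) (64 ℕ.* 64))

  -- Sized by two demands: 4 · 2 · K₁ c₁² for the lower bound (`C₁-lower`) and 64 · 4 · c₁² = 8 · 32
  -- · c₁² for the upper one (`C₁-upper`), which 32 ≤ K₁ covers.
  C₁ : ℕ
  C₁ = 8 ℕ.* K₁ ℕ.* (c₁ ℕ.* c₁)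

  C₁≡ : C₁ ≡ 8 ℕ.* K₁ ℕ.* (c₁ ℕ.* c₁)
  C₁≡ = refl

module Estimates (k : ℕ) {n : Fin (suc k) → ℕ} (𝓕ᵢ : ∀ i → SetSystem (n i)) (1<m : ∀ i → 1 ℕ.< card (𝓕ᵢ i)) where

  t : ℕ
  t = suc k

  S : ∀ i → Summary (𝓕ᵢ i)
  S i = summary (𝓕ᵢ i) (1<m i)

  S₀ : Summary (⨂ 𝓕ᵢ)
  S₀ = summary (⨂ 𝓕ᵢ) (⨂-card k 𝓕ᵢ 1<m)

  ℓ : Fin t → ℕ
  ℓ i = suc (Summary.L (S i))

  ℓ₀ h₀ Λ D : ℕ
  ℓ₀ = suc (Summary.L S₀)
  h₀ = herdisc (⨂ 𝓕ᵢ)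
  Λ = ∏ ℓ
  D = ∏ (λ i → herdisc (𝓕ᵢ i))

  -- The factorizations of the factors are tensored and the walk is run once, on the product; this
  -- is why its logarithm ℓ₀ occurs only to the first power in the square.
  upper : h₀ ℕ.* h₀ ℕ.≤ 32 ℕ.* ℓ₀ ℕ.* ((c₁ ℕ.^ t ℕ.* (Λ ℕ.* D)) ℕ.* (c₁ ℕ.^ t ℕ.* (Λ ℕ.* D)))
  upper = subst (λ G → h₀ ℕ.* h₀ ℕ.≤ 32 ℕ.* ℓ₀ ℕ.* (G ℕ.* G)) ∏≡ (factorization⇒herdisc (⨂ 𝓕ᵢ) {∏ g} {Summary.L S₀} (∏-pos 0<g) (Summary.card≤ S₀) (⨂-factorization k 𝓕ᵢ g (λ i → F i)))
    where
    g : Fin t → ℕ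
    g i = c₁ ℕ.* (ℓ i ℕ.* herdisc (𝓕ᵢ i))
    F : ∀ i → Factorization (mat (𝓕ᵢ i)) (ι (g i))
    F i = Summary.factorization (S i)
    0<g : ∀ i → 0 ℕ.< g i
    0<g i = ℕₚ.*-mono-≤ 0<c₁ (ℕₚ.*-mono-≤ {1} {ℓ i} (ℕ.s≤s ℕ.z≤n) (Summary.0<h (S i)))
    ∏≡ : ∏ g ≡ c₁ ℕ.^ t ℕ.* (Λ ℕ.* D)
    ∏≡ = trans (∏-* (λ _ → c₁) (λ i → ℓ i ℕ.* herdisc (𝓕ᵢ i))) (cong₂ ℕ._*_ (∏-const t c₁) (∏-* ℓ (λ i → herdisc (𝓕ᵢ i))))

  M : Fin t → ℕ
  M i = Summary.M (S i)

  -- Weak duality on the product: the tensored witnesses of the factors against the factorization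
  -- that the small herdisc of the product provides.
  ∏M≤ : ∏ M ℕ.≤ 64 ℕ.^ t ℕ.* (c₁ ℕ.* (ℓ₀ ℕ.* h₀))
  ∏M≤ = ι-cancel (≤-trans (≤-reflexive (sym clear)) (≤-trans (*-monoˡ (ι 4 ^ℚ t) (^ℚ-nonNeg (0≤ι 4) t)
      (certificate≤ (0≤ι (c₁ ℕ.* (ℓ₀ ℕ.* h₀))) (1≤8^ t) (^ℚ-nonNeg (0≤ι 2) t) F₀ (⨂-certificate k 𝓕ᵢ M (λ i → Summary.witness (S i)))))
      (≤-reflexive collect)))
    where
    F₀ : Factorization (mat (⨂ 𝓕ᵢ)) (ι (c₁ ℕ.* (ℓ₀ ℕ.* h₀)))
    F₀ = Summary.factorization S₀
    1≤8^ : ∀ t → 1ℚ ≤ ι 8 ^ℚ t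
    1≤8^ t = ≤-trans (1≤ι (ℕₚ.m^n>0 8 t)) (≤-reflexive (ι-^ 8 t))
    γ = ι (c₁ ℕ.* (ℓ₀ ℕ.* h₀))
    1^ : ∀ t → 1ℚ ^ℚ t ≡ 1ℚ
    1^ zero = refl
    1^ (suc t) = trans (*-identityˡ (1ℚ ^ℚ t)) (1^ t)
    clear : ι 4 ^ℚ t * (¼ ^ℚ t * ι (∏ M)) ≡ ι (∏ M)
    clear = trans (sym (*-assoc (ι 4 ^ℚ t) (¼ ^ℚ t) (ι (∏ M)))) (trans (cong (_* ι (∏ M)) (trans (sym (^ℚ-distrib-* (ι 4) ¼ t)) (1^ t))) (*-identityˡ (ι (∏ M))))
    lem : ∀ a b d g → a * (b * d * g) ≡ a * b * d * g
    lem = solve-∀ ℚ-ring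
    collect : ι 4 ^ℚ t * (ι 8 ^ℚ t * ι 2 ^ℚ t * γ) ≡ ι (64 ℕ.^ t ℕ.* (c₁ ℕ.* (ℓ₀ ℕ.* h₀)))
    collect = trans (lem (ι 4 ^ℚ t) (ι 8 ^ℚ t) (ι 2 ^ℚ t) γ) (trans (cong (_* γ) (trans (cong (_* ι 2 ^ℚ t) (sym (^ℚ-distrib-* (ι 4) (ι 8) t))) (sym (^ℚ-distrib-* (ι 4 * ι 8) (ι 2) t))))
      (trans (cong (_* γ) (sym (ι-^ 64 t))) (sym (ι-* (64 ℕ.^ t) (c₁ ℕ.* (ℓ₀ ℕ.* h₀))))))

  merge-bounds : ∀ a b s K′ g → K′ ≡ a ℕ.* (b ℕ.* b) ℕ.* (s ℕ.* s) →
            (∀ i → herdisc (𝓕ᵢ i) ℕ.* herdisc (𝓕ᵢ i) ℕ.≤ a ℕ.* ℓ i ℕ.* ((b ℕ.* M i) ℕ.* (b ℕ.* M i))) →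
            ∏ M ℕ.≤ s ℕ.^ t ℕ.* g → D ℕ.* D ℕ.≤ K′ ℕ.^ t ℕ.* Λ ℕ.* (g ℕ.* g)
  merge-bounds a b s K′ g K′≡ h²≤ ∏M≤ = ℕₚ.≤-trans (ℕₚ.≤-reflexive (sym (∏-* (λ i → herdisc (𝓕ᵢ i)) (λ i → herdisc (𝓕ᵢ i))))) (ℕₚ.≤-trans (∏-mono h²≤)
    (ℕₚ.≤-trans (ℕₚ.≤-reflexive expand) (ℕₚ.≤-trans (ℕₚ.*-monoʳ-≤ (K₀ ℕ.^ t ℕ.* Λ) (ℕₚ.*-mono-≤ ∏M≤ ∏M≤)) (ℕₚ.≤-reflexive regroup))))
    where
    K₀ = a ℕ.* (b ℕ.* b)
    lem : ∀ a b l m → a ℕ.* l ℕ.* ((b ℕ.* m) ℕ.* (b ℕ.* m)) ≡ a ℕ.* (b ℕ.* b) ℕ.* (l ℕ.* (m ℕ.* m))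
    lem = ℕ-Solver.solve-∀
    ∏-cong : ∀ {t} {f g : Fin t → ℕ} → (∀ i → f i ≡ g i) → ∏ f ≡ ∏ g
    ∏-cong {zero} eq = refl
    ∏-cong {suc t} eq = cong₂ ℕ._*_ (eq zero) (∏-cong (λ i → eq (suc i)))
    expand : ∏ (λ i → a ℕ.* ℓ i ℕ.* ((b ℕ.* M i) ℕ.* (b ℕ.* M i))) ≡ K₀ ℕ.^ t ℕ.* Λ ℕ.* (∏ M ℕ.* ∏ M)
    expand = trans (∏-cong (λ i → lem a b (ℓ i) (M i))) (trans (∏-* (λ _ → K₀) (λ i → ℓ i ℕ.* (M i ℕ.* M i)))
      (trans (cong₂ ℕ._*_ (∏-const t K₀) (trans (∏-* ℓ (λ i → M i ℕ.* M i)) (cong (Λ ℕ.*_) (∏-* M M)))) (sym (ℕₚ.*-assoc (K₀ ℕ.^ t) Λ (∏ M ℕ.* ∏ M)))))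
    lem₂ : ∀ a l b g → a ℕ.* l ℕ.* ((b ℕ.* g) ℕ.* (b ℕ.* g)) ≡ a ℕ.* (b ℕ.* b) ℕ.* l ℕ.* (g ℕ.* g)
    lem₂ = ℕ-Solver.solve-∀
    regroup : K₀ ℕ.^ t ℕ.* Λ ℕ.* ((s ℕ.^ t ℕ.* g) ℕ.* (s ℕ.^ t ℕ.* g)) ≡ K′ ℕ.^ t ℕ.* Λ ℕ.* (g ℕ.* g)
    regroup = trans (lem₂ (K₀ ℕ.^ t) Λ (s ℕ.^ t) g) (cong (λ z → z ℕ.* Λ ℕ.* (g ℕ.* g))
      (trans (cong (K₀ ℕ.^ t ℕ.*_) (sym (^-distrib-* s s t))) (trans (sym (^-distrib-* K₀ (s ℕ.* s) t)) (cong (ℕ._^ t) (sym K′≡)))))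

  lower : D ℕ.* D ℕ.≤ K₁ ℕ.^ t ℕ.* Λ ℕ.* ((c₁ ℕ.* (ℓ₀ ℕ.* h₀)) ℕ.* (c₁ ℕ.* (ℓ₀ ℕ.* h₀)))
  lower = merge-bounds 32 36 64 K₁ (c₁ ℕ.* (ℓ₀ ℕ.* h₀)) K₁≡ (λ i → Summary.h²≤ (S i)) ∏M≤

a≤a^suc : ∀ a k → 0 ℕ.< a → a ℕ.≤ a ℕ.^ suc k
a≤a^suc (suc a) k _ = ℕₚ.≤-trans (ℕₚ.≤-reflexive (sym (ℕₚ.*-identityʳ (suc a)))) (ℕₚ.*-monoʳ-≤ (suc a) (ℕₚ.m^n>0 (suc a) k))

C₁-upper : ∀ k → 64 ℕ.* (4 ℕ.^ suc k ℕ.* (c₁ ℕ.^ suc k ℕ.* c₁ ℕ.^ suc k)) ℕ.≤ C₁ ℕ.^ suc k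
C₁-upper k = ℕₚ.≤-trans (ℕₚ.*-monoˡ-≤ (4 ℕ.^ t ℕ.* (c₁ ℕ.^ t ℕ.* c₁ ℕ.^ t)) (a≤a^suc 64 k (ℕ.s≤s ℕ.z≤n)))
  (ℕₚ.≤-trans (ℕₚ.≤-reflexive (trans (cong (λ z → 64 ℕ.^ t ℕ.* (4 ℕ.^ t ℕ.* z)) (sym (^-distrib-* c₁ c₁ t))) (trans (cong (64 ℕ.^ t ℕ.*_) (sym (^-distrib-* 4 (c₁ ℕ.* c₁) t))) (sym (^-distrib-* 64 (4 ℕ.* (c₁ ℕ.* c₁)) t)))))
  (ℕₚ.^-monoˡ-≤ t (ℕₚ.≤-trans (ℕₚ.≤-reflexive (lem (c₁ ℕ.* c₁))) (ℕₚ.≤-trans (ℕₚ.*-monoˡ-≤ (c₁ ℕ.* c₁) (ℕₚ.*-monoʳ-≤ 8 32≤K₁)) (ℕₚ.≤-reflexive (sym C₁≡))))))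
  where
  t = suc k
  lem : ∀ x → 64 ℕ.* (4 ℕ.* x) ≡ 8 ℕ.* 32 ℕ.* x
  lem x = sym (ℕₚ.*-assoc 64 4 x)

C₁-lower : ∀ k → 4 ℕ.* (2 ℕ.^ suc k ℕ.* (K₁ ℕ.^ suc k ℕ.* (c₁ ℕ.* c₁))) ℕ.≤ C₁ ℕ.^ suc k
C₁-lower k = ℕₚ.≤-trans (ℕₚ.*-mono-≤ (a≤a^suc 4 k (ℕ.s≤s ℕ.z≤n)) (ℕₚ.*-monoʳ-≤ (2 ℕ.^ t) (ℕₚ.*-monoʳ-≤ (K₁ ℕ.^ t) (a≤a^suc (c₁ ℕ.* c₁) k (ℕₚ.*-mono-≤ 0<c₁ 0<c₁)))))
  (ℕₚ.≤-reflexive (trans (cong (λ z → 4 ℕ.^ t ℕ.* (2 ℕ.^ t ℕ.* z)) (sym (^-distrib-* K₁ (c₁ ℕ.* c₁) t))) (trans (cong (4 ℕ.^ t ℕ.*_) (sym (^-distrib-* 2 (K₁ ℕ.* (c₁ ℕ.* c₁)) t)))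
    (trans (sym (^-distrib-* 4 (2 ℕ.* (K₁ ℕ.* (c₁ ℕ.* c₁))) t)) (cong (ℕ._^ t) (trans (lem K₁ (c₁ ℕ.* c₁)) (sym C₁≡)))))))
  where
  t = suc k
  lem : ∀ a b → 4 ℕ.* (2 ℕ.* (a ℕ.* b)) ≡ 8 ℕ.* a ℕ.* b
  lem = ℕ-Solver.solve-∀

0<C₁ : 0 ℕ.< C₁
0<C₁ = subst (0 ℕ.<_) (sym C₁≡) (ℕₚ.*-mono-≤ (ℕₚ.*-mono-≤ {1} {8} (ℕ.s≤s ℕ.z≤n) (ℕₚ.≤-trans (ℕ.s≤s ℕ.z≤n) 32≤K₁)) (ℕₚ.*-mono-≤ 0<c₁ 0<c₁))

-- Bounds for cuts

ι≡/1 : ∀ n → (ℤ.+ n) ℚ./ 1 ≡ ι n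
ι≡/1 zero = refl
ι≡/1 (suc n) = trans (toℚᵘ-injective (ℚᵘₚ.≃-trans (toℚᵘ-fromℚᵘ (mkℚᵘ (ℤ.+ suc n) 0)) (ℚᵘₚ.≃-sym (ℚᵘₚ.≃-trans (toℚᵘ-homo-+ 1ℚ ((ℤ.+ n) ℚ./ 1))
    (ℚᵘₚ.≃-trans (ℚᵘₚ.+-congʳ (toℚᵘ 1ℚ) (toℚᵘ-fromℚᵘ (mkℚᵘ (ℤ.+ n) 0))) (*≡* (lem (ℤ.+ n))))))))
  (cong (1ℚ +_) (ι≡/1 n))
  where
  lem : ∀ z → (ℤ.+ 1 ℤ.* ℤ.+ 1 ℤ.+ z ℤ.* ℤ.+ 1) ℤ.* ℤ.+ 1 ≡ (ℤ.+ 1 ℤ.+ z) ℤ.* ℤ.+ 1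
  lem = ℤ-Solver.solve-∀

fromℕ-upper : ∀ n {q} → Upper (fromℕ n) q → ι n < q
fromℕ-upper n {q} lt = subst (_< q) (ι≡/1 n) lt

fromℕ-lower : ∀ n {q} → Lower (fromℕ n) q → q < ι n
fromℕ-lower n {q} lt = subst (q <_) (ι≡/1 n) lt

ι≤ : ∀ a q → 0ℚ ≤ q → a ℕ.* ↧ₙ q ℕ.≤ ℤ.∣ ↥ q ∣ → ι a ≤ q
ι≤ a q@(mkℚ (ℤ.+ n) d _) _ le = subst (_≤ q) (ι≡/1 a) (toℚᵘ-cancel-≤ (ℚᵘₚ.≤-respˡ-≃ (ℚᵘₚ.≃-sym (toℚᵘ-fromℚᵘ (mkℚᵘ (ℤ.+ a) 0)))
  (ℚᵘ.*≤* (subst₂ ℤ._≤_ (ℤₚ.pos-* a (suc d)) (sym (ℤₚ.*-identityʳ (ℤ.+ n))) (ℤ.+≤+ le)))))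
ι≤ a q@(mkℚ ℤ.-[1+ n ] d _) (*≤* ()) le

-- Each a with 2^a ≤ m satisfies a ≤ q. The bound is the average of the cases a = 1 and a = L.
log-upper : ∀ {m L q} → 1 ℕ.< m → 2 ℕ.^ L ℕ.< m → Upper (log m) q → ½ * ι (suc L) ≤ q
log-upper {m} {L} {q} 1<m lt (0≤q , mᵈ<2ⁿ) = ≤-trans (≤-reflexive (lem₁ (ι L))) (≤-trans (+-mono-≤ (*-monoˡ ½ (nonNegative⁻¹ ½) 1≤q) (*-monoˡ ½ (nonNegative⁻¹ ½) L≤q)) (≤-reflexive (lem₂ q)))
  where
  lem₁ : ∀ l → ½ * (1ℚ + l) ≡ ½ * 1ℚ + ½ * l
  lem₁ = solve-∀ ℚ-ring
  lem₂ : ∀ q → ½ * q + ½ * q ≡ q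
  lem₂ = solve-∀ ℚ-ring
  bound : ∀ a → 2 ℕ.^ a ℕ.≤ m → a ℕ.* ↧ₙ q ℕ.≤ ℤ.∣ ↥ q ∣
  bound a le with a ℕ.* ↧ₙ q ℕₚ.≤? ℤ.∣ ↥ q ∣
  ... | yes p = p
  ... | no ¬p = ⊥-elim (ℕₚ.<⇒≱ mᵈ<2ⁿ (ℕₚ.≤-trans (ℕₚ.^-monoʳ-≤ 2 (ℕₚ.<⇒≤ (ℕₚ.≰⇒> ¬p))) (ℕₚ.≤-trans (ℕₚ.≤-reflexive (sym (ℕₚ.^-*-assoc 2 a (↧ₙ q)))) (ℕₚ.^-monoˡ-≤ (↧ₙ q) le))))
  1≤q : 1ℚ ≤ q
  1≤q = ι≤ 1 q 0≤q (bound 1 1<m)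
  L≤q : ι L ≤ q
  L≤q = ι≤ L q 0≤q (bound L (ℕₚ.<⇒≤ lt))

^ᴿ-upper : ∀ x t {q} → 0ℚ ≤ x → Upper (fromℚ x ^ᴿ t) q → x ^ℚ t ≤ q
^ᴿ-upper x zero 0≤x up = <⇒≤ (fromℕ-upper 1 up)
^ᴿ-upper x (suc t) 0≤x (a , b , x<a , up , le) = ≤-trans (*-mono 0≤x (^ℚ-nonNeg 0≤x t) (<⇒≤ x<a) (^ᴿ-upper x t 0≤x up)) le

∏ᴿ-upper : ∀ {t} (m L : Fin t → ℕ) → (∀ i → 1 ℕ.< m i) → (∀ i → 2 ℕ.^ L i ℕ.< m i) → ∀ {q} →
           Upper (∏ᴿ (λ i → log (m i))) q → ½ ^ℚ t * ι (∏ (λ i → suc (L i))) ≤ q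
∏ᴿ-upper {zero} m L 1<m L< up = <⇒≤ (fromℕ-upper 1 up)
∏ᴿ-upper {suc t} m L 1<m L< (a , b , upa , upb , le) = ≤-trans (≤-reflexive (trans (cong (½ * ½ ^ℚ t *_) (ι-* (suc (L zero)) (∏ (λ i → suc (L (suc i)))))) (lem ½ (½ ^ℚ t) (ι (suc (L zero))) (ι (∏ (λ i → suc (L (suc i))))))))
    (≤-trans (*-mono (0≤* (nonNegative⁻¹ ½) (0≤ι (suc (L zero)))) (0≤* (^ℚ-nonNeg (nonNegative⁻¹ ½) t) (0≤ι (∏ (λ i → suc (L (suc i))))))
      (log-upper {m zero} {L zero} (1<m zero) (L< zero) upa) (∏ᴿ-upper (λ i → m (suc i)) (λ i → L (suc i)) (λ i → 1<m (suc i)) (λ i → L< (suc i)) upb)) le)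
  where
  lem : ∀ a b c d → a * b * (c * d) ≡ a * c * (b * d)
  lem = solve-∀ ℚ-ring

∏ᴿ√-upper : ∀ {t} (m L : Fin t → ℕ) → (∀ i → 1 ℕ.< m i) → (∀ i → 2 ℕ.^ L i ℕ.< m i) → ∀ {q} →
            Upper (∏ᴿ (λ i → √ (log (m i)))) q → 0ℚ ≤ q × ½ ^ℚ t * ι (∏ (λ i → suc (L i))) ≤ q * q
∏ᴿ√-upper {zero} m L 1<m L< {q} up = <⇒≤ (<-trans 0<1 1<q) , ≤-trans (*-mono 0≤1 0≤1 (<⇒≤ 1<q) (<⇒≤ 1<q)) ≤-refl
  where
  1<q : 1ℚ < q
  1<q = fromℕ-upper 1 up
∏ᴿ√-upper {suc t} m L 1<m L< {q} (a , b , (0<a , upa) , upb , le) = ≤-trans 0≤ab le ,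
    ≤-trans (≤-reflexive (trans (cong (½ * ½ ^ℚ t *_) (ι-* (suc (L zero)) (∏ (λ i → suc (L (suc i)))))) (lem ½ (½ ^ℚ t) (ι (suc (L zero))) (ι (∏ (λ i → suc (L (suc i))))))))
    (≤-trans (*-mono (0≤* (nonNegative⁻¹ ½) (0≤ι (suc (L zero)))) (0≤* (^ℚ-nonNeg (nonNegative⁻¹ ½) t) (0≤ι (∏ (λ i → suc (L (suc i))))))
      (log-upper {m zero} {L zero} (1<m zero) (L< zero) upa) (proj₂ rest)) (≤-trans (≤-reflexive (lem a a b b)) (*-mono 0≤ab 0≤ab le le)))
  where
  lem : ∀ a b c d → a * b * (c * d) ≡ a * c * (b * d)
  lem = solve-∀ ℚ-ring
  rest : 0ℚ ≤ b × ½ ^ℚ t * ι (∏ (λ i → suc (L (suc i)))) ≤ b * b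
  rest = ∏ᴿ√-upper (λ i → m (suc i)) (λ i → L (suc i)) (λ i → 1<m (suc i)) (λ i → L< (suc i)) upb
  0≤ab : 0ℚ ≤ a * b
  0≤ab = 0≤* (<⇒≤ 0<a) (proj₁ rest)

½^*2^ : ∀ t → ½ ^ℚ t * ι (2 ℕ.^ t) ≡ 1ℚ
½^*2^ t = trans (cong (½ ^ℚ t *_) (ι-^ 2 t)) (trans (sym (^ℚ-distrib-* ½ (ι 2) t)) (1^ t))
  where
  1^ : ∀ t → 1ℚ ^ℚ t ≡ 1ℚ
  1^ zero = refl
  1^ (suc t) = trans (*-identityˡ (1ℚ ^ℚ t)) (1^ t)

-- The two inequalities between cuts

module Final (k : ℕ) {n : Fin (suc k) → ℕ} (𝓕ᵢ : ∀ i → SetSystem (n i)) (1<m : ∀ i → 1 ℕ.< card (𝓕ᵢ i)) where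
  open Estimates k 𝓕ᵢ 1<m

  p : ℚ
  p = ½ ^ℚ t

  0≤p : 0ℚ ≤ p
  0≤p = ^ℚ-nonNeg (nonNegative⁻¹ ½) t

  κ : ℚ
  κ = ι C₁ ^ℚ t

  1≤κ : 1ℚ ≤ κ
  1≤κ = ≤-trans (1≤ι (ℕₚ.m^n>0 C₁ {{ℕ.>-nonZero 0<C₁}} t)) (≤-reflexive (ι-^ C₁ t))

  0≤κ : 0ℚ ≤ κ
  0≤κ = ≤-trans 0≤1 1≤κ

  -- The estimates are compared in squares, where C^(2t) is available although `C₁` is sized for C^t
  -- to suffice.
  κ≤κ² : κ ≤ κ * κ
  κ≤κ² = ≤-trans (≤-reflexive (sym (*-identityˡ κ))) (*-monoʳ κ 0≤κ 1≤κ)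

  1<m₀ : 1 ℕ.< card (⨂ 𝓕ᵢ)
  1<m₀ = ⨂-card k 𝓕ᵢ 1<m

  -- A rational q separating the two sides carries rational upper approximations d, e, s, b of the
  -- four factors with d e s b ≤ q < h₀. Squaring is needed because only s² is comparable with a
  -- logarithm.
  upper-bound : ¬ (fromℕ D *ᴿ fromℚ (ι C₁) ^ᴿ t *ᴿ √ (log (card (⨂ 𝓕ᵢ))) *ᴿ ∏ᴿ (λ i → log (card (𝓕ᵢ i))) <ᴿ fromℕ h₀)
  upper-bound (q , (x , b , (y , s , (d , e , D<d , up-e , de≤y) , (0<s , up-s) , ys≤x) , up-b , xb≤q) , q<h) =
    <⇒≱ (fromℕ-lower h₀ q<h) (≤-trans (sq-cancel-≤ 0≤P (≤-trans h²≤ P²≥)) (≤-trans (*-monoʳ b 0≤b (≤-trans (*-monoʳ s 0≤s de≤y) ys≤x)) xb≤q))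
    where
    0≤s = <⇒≤ 0<s
    d≥ : ι D ≤ d
    d≥ = <⇒≤ (fromℕ-upper D D<d)
    e≥ : κ ≤ e
    e≥ = ^ᴿ-upper (ι C₁) t (0≤ι C₁) up-e
    s²≥ : ½ * ι ℓ₀ ≤ s * s
    s²≥ = log-upper {card (⨂ 𝓕ᵢ)} {Summary.L S₀} 1<m₀ (Summary.card> S₀) up-s
    b≥ : p * ι Λ ≤ b
    b≥ = ∏ᴿ-upper (λ i → card (𝓕ᵢ i)) (λ i → Summary.L (S i)) 1<m (λ i → Summary.card> (S i)) up-b
    0≤d = ≤-trans (0≤ι D) d≥
    0≤e = ≤-trans 0≤κ e≥
    0≤pΛ = 0≤* 0≤p (0≤ι Λ)
    0≤b = ≤-trans 0≤pΛ b≥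
    P = d * e * s * b
    0≤P : 0ℚ ≤ P
    0≤P = 0≤* (0≤* (0≤* 0≤d 0≤e) 0≤s) 0≤b
    W = ι D * κ * (p * ι Λ)
    0≤W : 0ℚ ≤ W
    0≤W = 0≤* (0≤* (0≤ι D) 0≤κ) 0≤pΛ
    W≤ : W ≤ d * e * b
    W≤ = *-mono (0≤* (0≤ι D) 0≤κ) 0≤pΛ (*-mono (0≤ι D) 0≤κ d≥ e≥) b≥
    lem₁ : ∀ d e s b → s * s * ((d * e * b) * (d * e * b)) ≡ d * e * s * b * (d * e * s * b)
    lem₁ = solve-∀ ℚ-ring
    P²≥ : ½ * ι ℓ₀ * (W * W) ≤ P * P
    P²≥ = ≤-trans (*-mono (0≤* (nonNegative⁻¹ ½) (0≤ι ℓ₀)) (0≤sq W) s²≥ (*-mono 0≤W 0≤W W≤ W≤)) (≤-reflexive (lem₁ d e s b))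
    cᵗ = ι (c₁ ℕ.^ t)
    -- The factor 4^t in the constant repays the ½ lost in replacing each log m_i by its integer
    -- substitute, squared.
    four : p * p * ι (4 ℕ.^ t) ≡ 1ℚ
    four = trans (cong (p * p *_) (trans (cong ι (^-distrib-* 2 2 t)) (ι-* (2 ℕ.^ t) (2 ℕ.^ t)))) (trans (lem₂ p (ι (2 ℕ.^ t))) (trans (cong₂ _*_ (½^*2^ t) (½^*2^ t)) (*-identityˡ 1ℚ)))
      where
      lem₂ : ∀ p u → p * p * (u * u) ≡ p * u * (p * u)
      lem₂ = solve-∀ ℚ-ring
    const : ι 64 * (ι (4 ℕ.^ t) * (cᵗ * cᵗ)) ≤ κ
    const = ≤-trans (≤-reflexive (sym (trans (ι-* 64 (4 ℕ.^ t ℕ.* (c₁ ℕ.^ t ℕ.* c₁ ℕ.^ t))) (cong (ι 64 *_) (trans (ι-* (4 ℕ.^ t) (c₁ ℕ.^ t ℕ.* c₁ ℕ.^ t)) (cong (ι (4 ℕ.^ t) *_) (ι-* (c₁ ℕ.^ t) (c₁ ℕ.^ t))))))))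
      (≤-trans (ι-mono (C₁-upper k)) (≤-reflexive (ι-^ C₁ t)))
    V = cᵗ * (ι Λ * ι D)
    lem₃ : ∀ l x g d → ι 32 * l * ((x * (g * d)) * (x * (g * d))) * 1ℚ ≡ ½ * l * ((g * d) * (g * d)) * (ι 64 * (x * x) * 1ℚ)
    lem₃ = solve-∀ ℚ-ring
    lem₄ : ∀ p u x → ι 64 * (x * x) * (p * p * u) ≡ p * p * (ι 64 * (u * (x * x)))
    lem₄ = solve-∀ ℚ-ring
    lem₅ : ∀ l g d p κ → ½ * l * ((g * d) * (g * d)) * (p * p * (κ * κ)) ≡ ½ * l * ((d * κ * (p * g)) * (d * κ * (p * g)))
    lem₅ = solve-∀ ℚ-ring
    h²≤ : ι h₀ * ι h₀ ≤ ½ * ι ℓ₀ * (W * W)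
    h²≤ = ≤-trans (≤-reflexive (sym (ι-* h₀ h₀))) (≤-trans (ι-mono upper)
      (≤-trans (≤-reflexive (trans (ι-* (32 ℕ.* ℓ₀) ((c₁ ℕ.^ t ℕ.* (Λ ℕ.* D)) ℕ.* (c₁ ℕ.^ t ℕ.* (Λ ℕ.* D)))) (trans (cong₂ _*_ (ι-* 32 ℓ₀) (trans (ι-* (c₁ ℕ.^ t ℕ.* (Λ ℕ.* D)) (c₁ ℕ.^ t ℕ.* (Λ ℕ.* D))) (cong₂ _*_ ιV ιV)))
          (trans (sym (*-identityʳ (ι 32 * ι ℓ₀ * (V * V)))) (trans (lem₃ (ι ℓ₀) cᵗ (ι Λ) (ι D)) (cong (λ z → ½ * ι ℓ₀ * ((ι Λ * ι D) * (ι Λ * ι D)) * z)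
            (trans (cong (ι 64 * (cᵗ * cᵗ) *_) (sym four)) (lem₄ p (ι (4 ℕ.^ t)) cᵗ))))))))
      (≤-trans (*-monoˡ (½ * ι ℓ₀ * ((ι Λ * ι D) * (ι Λ * ι D))) (0≤* (0≤* (nonNegative⁻¹ ½) (0≤ι ℓ₀)) (0≤sq (ι Λ * ι D))) (*-monoˡ (p * p) (0≤sq p) (≤-trans const κ≤κ²)))
        (≤-reflexive (lem₅ (ι ℓ₀) (ι Λ) (ι D) p κ)))))
      where
      ιV : ι (c₁ ℕ.^ t ℕ.* (Λ ℕ.* D)) ≡ V
      ιV = trans (ι-* (c₁ ℕ.^ t) (Λ ℕ.* D)) (cong (cᵗ *_) (ι-* Λ D))

  -- Below the quotient lies a b with a < D and b u < 1 for an upper approximation u of the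
  -- denominator. If h₀ < a b, then D ≤ h₀ P ≤ a b u ≤ a, a contradiction; D ≤ h₀ P is again shown
  -- in squares.
  lower-bound : ¬ (fromℕ h₀ <ᴿ fromℕ D /ᴿ (fromℚ (ι C₁) ^ᴿ t *ᴿ log (card (⨂ 𝓕ᵢ)) *ᴿ ∏ᴿ (λ i → √ (log (card (𝓕ᵢ i))))))
  lower-bound (q , h<q , inj₁ q<0) = <⇒≱ (<-trans (fromℕ-upper h₀ h<q) q<0) (0≤ι h₀)
  lower-bound (q , h<q , inj₂ (a , b , 0≤a , 0≤b , a<D , (u , (x , v , (e , l , up-e , up-l , el≤x) , up-v , xv≤u) , bu<1) , q≤ab)) =
    <⇒≱ (fromℕ-lower D a<D) (≤-trans (sq-cancel-≤ 0≤hP (≤-trans D²≤ hP²≥)) (≤-trans (*-mono (0≤ι h₀) 0≤P (≤-trans (<⇒≤ (fromℕ-upper h₀ h<q)) q≤ab) P≤u)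
      (≤-trans (≤-reflexive (*-assoc a b u)) (≤-≡-trans (*-monoˡ a 0≤a (<⇒≤ bu<1)) (*-identityʳ a)))))
    where
    e≥ : κ ≤ e
    e≥ = ^ᴿ-upper (ι C₁) t (0≤ι C₁) up-e
    l≥ : ½ * ι ℓ₀ ≤ l
    l≥ = log-upper {card (⨂ 𝓕ᵢ)} {Summary.L S₀} 1<m₀ (Summary.card> S₀) up-l
    v≥ : 0ℚ ≤ v × p * ι Λ ≤ v * v
    v≥ = ∏ᴿ√-upper (λ i → card (𝓕ᵢ i)) (λ i → Summary.L (S i)) 1<m (λ i → Summary.card> (S i)) up-v
    0≤e = ≤-trans 0≤κ e≥
    0≤½ℓ = 0≤* (nonNegative⁻¹ ½) (0≤ι ℓ₀)
    0≤l = ≤-trans 0≤½ℓ l≥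
    P = e * l * v
    0≤P : 0ℚ ≤ P
    0≤P = 0≤* (0≤* 0≤e 0≤l) (proj₁ v≥)
    P≤u : P ≤ u
    P≤u = ≤-trans (*-monoʳ v (proj₁ v≥) el≤x) xv≤u
    0≤hP = 0≤* (0≤ι h₀) 0≤P
    W = κ * (½ * ι ℓ₀)
    0≤W : 0ℚ ≤ W
    0≤W = 0≤* 0≤κ 0≤½ℓ
    W≤ : W ≤ e * l
    W≤ = *-mono 0≤κ 0≤½ℓ e≥ l≥
    lem₁ : ∀ h e l v → h * h * ((e * l) * (e * l) * (v * v)) ≡ h * (e * l * v) * (h * (e * l * v))
    lem₁ = solve-∀ ℚ-ring
    hP²≥ : ι h₀ * ι h₀ * (W * W * (p * ι Λ)) ≤ ι h₀ * P * (ι h₀ * P)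
    hP²≥ = ≤-trans (*-monoˡ (ι h₀ * ι h₀) (0≤sq (ι h₀)) (*-mono (0≤sq W) (0≤* 0≤p (0≤ι Λ)) (*-mono 0≤W 0≤W W≤ W≤) (proj₂ v≥))) (≤-reflexive (lem₁ (ι h₀) e l v))
    Kᵗ = ι (K₁ ℕ.^ t)
    const : ι 4 * (ι (2 ℕ.^ t) * (Kᵗ * (ι c₁ * ι c₁))) ≤ κ
    const = ≤-trans (≤-reflexive (sym (trans (ι-* 4 (2 ℕ.^ t ℕ.* (K₁ ℕ.^ t ℕ.* (c₁ ℕ.* c₁)))) (cong (ι 4 *_) (trans (ι-* (2 ℕ.^ t) (K₁ ℕ.^ t ℕ.* (c₁ ℕ.* c₁))) (cong (ι (2 ℕ.^ t) *_) (trans (ι-* (K₁ ℕ.^ t) (c₁ ℕ.* c₁)) (cong (Kᵗ *_) (ι-* c₁ c₁)))))))))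
      (≤-trans (ι-mono (C₁-lower k)) (≤-reflexive (ι-^ C₁ t)))
    V = ι c₁ * (ι ℓ₀ * ι h₀)
    lem₂ : ∀ A g x l h → A * g * ((x * (l * h)) * (x * (l * h))) * 1ℚ ≡ h * h * (l * l * g * (A * (x * x) * 1ℚ))
    lem₂ = solve-∀ ℚ-ring
    lem₃ : ∀ A x p u → A * (x * x) * (p * u) ≡ p * (½ * ½) * (ι 4 * (u * (A * (x * x))))
    lem₃ = solve-∀ ℚ-ring
    lem₄ : ∀ h l g p κ → h * h * (l * l * g * (p * (½ * ½) * (κ * κ))) ≡ h * h * (κ * (½ * l) * (κ * (½ * l)) * (p * g))
    lem₄ = solve-∀ ℚ-ring
    D²≤ : ι D * ι D ≤ ι h₀ * ι h₀ * (W * W * (p * ι Λ))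
    D²≤ = ≤-trans (≤-reflexive (sym (ι-* D D))) (≤-trans (ι-mono lower)
      (≤-trans (≤-reflexive (trans (ι-* (K₁ ℕ.^ t ℕ.* Λ) _) (trans (cong₂ _*_ (ι-* (K₁ ℕ.^ t) Λ) (trans (ι-* (c₁ ℕ.* (ℓ₀ ℕ.* h₀)) (c₁ ℕ.* (ℓ₀ ℕ.* h₀))) (cong₂ _*_ ιV ιV)))
          (trans (sym (*-identityʳ (Kᵗ * ι Λ * (V * V)))) (trans (lem₂ Kᵗ (ι Λ) (ι c₁) (ι ℓ₀) (ι h₀)) (cong (λ z → ι h₀ * ι h₀ * (ι ℓ₀ * ι ℓ₀ * ι Λ * z))
            (trans (cong (Kᵗ * (ι c₁ * ι c₁) *_) (sym (½^*2^ t))) (lem₃ Kᵗ (ι c₁) p (ι (2 ℕ.^ t))))))))))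
      (≤-trans (*-monoˡ (ι h₀ * ι h₀) (0≤sq (ι h₀)) (*-monoˡ (ι ℓ₀ * ι ℓ₀ * ι Λ) (0≤* (0≤sq (ι ℓ₀)) (0≤ι Λ)) (*-monoˡ (p * (½ * ½)) (0≤* 0≤p 0≤¼) (≤-trans const κ≤κ²))))
        (≤-reflexive (lem₄ (ι h₀) (ι ℓ₀) (ι Λ) p κ)))))
      where
      ιV : ι (c₁ ℕ.* (ℓ₀ ℕ.* h₀)) ≡ V
      ιV = trans (ι-* c₁ (ℓ₀ ℕ.* h₀)) (cong (ι c₁ *_) (ι-* ℓ₀ h₀))

theorem5p3 : ∃[ C ] 0ℚ ℚ.< C × (∀ (k : ℕ) → let t = suc k in (n : Fin t → ℕ) (𝓕ᵢ : ∀ i → SetSystem (n i)) → (∀ i → 1 ℕ.< card (𝓕ᵢ i)) →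
    let 𝓕 = ⨂ 𝓕ᵢ
        m = λ i → card (𝓕ᵢ i)
        D = fromℕ (∏ (λ i → herdisc (𝓕ᵢ i)))
        Cᵗ = fromℚ C ^ᴿ t
    in  D /ᴿ (Cᵗ *ᴿ log (card 𝓕) *ᴿ ∏ᴿ (λ i → √ (log (m i)))) ≤ᴿ fromℕ (herdisc 𝓕)
      × fromℕ (herdisc 𝓕) ≤ᴿ D *ᴿ Cᵗ *ᴿ √ (log (card 𝓕)) *ᴿ ∏ᴿ (λ i → log (m i)))
theorem5p3 = ι C₁ , 0<ι 0<C₁ , λ k n 𝓕ᵢ 1<m → Final.lower-bound k 𝓕ᵢ 1<m , Final.upper-bound k 𝓕ᵢ 1<m
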